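{- For $0<|q|<1$, \begin{align*} \overline{r}_0(2)+\overline{r}_3(2)&=\tfrac{4}{9}\rho(q)-\tfrac{16}{9}\omega(q)+M(q),\\ \overline{r}_1(2)-\overline{r}_3(2)&=2\omega(q),\\ \overline{r}_2(2)+\overline{r}_3(2)&=-\tfrac{2}{9}\rho(q)-\tfrac{10}{9}\omega(q)+M(q), \end{align*} where $M(q)=\dfrac{4J_{6}^{12}}{3J_{1,6}^6J_{2}^4J_{3,6}^3}$.
   Context: An overpartition of a non-negative integer $n$ is a partition of $n$ in which the first occurrence of each distinct part may be overlined; the empty overpartition of $0$ is counted and has rank $0$. The rank of an overpartition is its largest part minus its number of parts. $\overline N(s,6,n)$ is the number of overpartitions of $n$ with rank congruent to $s$ modulo $6$, and $\overline r_s(d)=\sum_{n\ge0}\overline N(s,6,3n+d)q^n$. Notation: $(a;q)_n=\prod_{i=0}^{n-1}(1-aq^i)$, $(a;q)_\infty=\prod_{n\ge0}(1-aq^n)$, $j(z;q)=(z;q)_\infty(q/z;q)_\infty(q;q)_\infty$, $J_{a,m}=j(q^a;q^m)$, $J_m=(q^m;q^m)_\infty$. The third order mock theta functions are $\omega(q)=\sum_{n\ge0}\frac{q^{2n(n+1)}}{(q;q^2)_{n+1}^2}$ and $\rho(q)=\sum_{n\ge0}\frac{q^{2n(n+1)}(q;q^2)_{n+1}}{(q^3;q^6)_{n+1}}$. -}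

module Defs where

open import Data.Nat as ℕ using (ℕ; zero; suc; _∸_; _≤?_)
open import Data.Integer as ℤ using (ℤ; +_; _%ℕ_)
open import Data.Rational using (ℚ; _/_; 0ℚ; 1ℚ; _+_; _*_; -_; _-_)
open import Data.Bool using (Bool; true; false; if_then_else_)
open import Data.List as List using (List; []; _∷_; _++_; concatMap; length; filter; upTo)
open import Data.Product using (_×_; _,_)
open import Relation.Nullary.Decidable using (⌊_⌋)

-- Formal power series in q with rational coefficients:
-- a series is its coefficient function  n ↦ [q^n] f.

PS : Set
PS = ℕ → ℚ

sumTo : ℕ → (ℕ → ℚ) → ℚ
sumTo zero    f = f zero
sumTo (suc n) f = sumTo n f + f (suc n)

constPS : ℚ → PS
constPS c zero    = c
constPS c (suc n) = 0ℚ

onePS : PS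
onePS = constPS 1ℚ

mono : ℕ → PS
mono e n = if ⌊ e ℕ.≟ n ⌋ then 1ℚ else 0ℚ

_⊕_ : PS → PS → PS
(f ⊕ g) n = f n + g n

_⊖_ : PS → PS → PS
(f ⊖ g) n = f n - g n

_·_ : ℚ → PS → PS
(c · f) n = c * f n

infixl 6 _⊕_ _⊖_
infixl 7 _⊛_ _·_
infixr 8 _^^_

_⊛_ : PS → PS → PS
(f ⊛ g) n = sumTo n (λ k → f k * g (n ∸ k))

_^^_ : PS → ℕ → PS
f ^^ zero  = onePS
f ^^ suc j = f ⊛ (f ^^ j)

-- Multiplicative inverse of a series f with constant term 1:
-- 1/f = Σ_{j≥0} (1 - f)^j ; since (1-f)^j has order ≥ j, the
-- coefficient of q^n only involves j ≤ n.
inv : PS → PS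
inv f n = sumTo n (λ j → ((onePS ⊖ f) ^^ j) n)

poch : ℕ → ℕ → ℕ → PS
poch s m zero    = onePS
poch s m (suc n) = poch s m n ⊛ (onePS ⊖ mono (s ℕ.+ m ℕ.* n))

-- (q^s ; q^m)_∞ for s ≥ 1, m ≥ 1: the factors with index i > n
-- are ≡ 1 mod q^{n+1}, so [q^n] (q^s;q^m)_∞ = [q^n] (q^s;q^m)_{n+1}.
pochInf : ℕ → ℕ → PS
pochInf s m n = poch s m (suc n) n

J : ℕ → ℕ → PS
J a m = pochInf a m ⊛ pochInf (m ∸ a) m ⊛ pochInf m m

Jm : ℕ → PS
Jm m = pochInf m m

-- Third order mock theta functions.  The n-th summand has order
-- 2k(k+1) > k for k ≥ 1, so only summands k ≤ n contribute to [q^n].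

ωTerm : ℕ → PS
ωTerm k = mono (2 ℕ.* k ℕ.* (k ℕ.+ 1)) ⊛ inv (poch 1 2 (suc k) ^^ 2)

omega : PS
omega n = sumTo n (λ k → ωTerm k n)

ρTerm : ℕ → PS
ρTerm k = mono (2 ℕ.* k ℕ.* (k ℕ.+ 1)) ⊛ poch 1 2 (suc k) ⊛ inv (poch 3 6 (suc k))

rho : PS
rho n = sumTo n (λ k → ρTerm k n)

Mq : PS
Mq = (+ 4 / 3) · (Jm 6 ^^ 12 ⊛ inv (J 1 6 ^^ 6 ⊛ Jm 2 ^^ 4 ⊛ J 3 6 ^^ 3))

-- Overpartitions.
-- An overpartition is encoded as the list of its distinct parts in
-- strictly decreasing order, each distinct part p given as a triple
-- (p , k , b): p ≥ 1 occurs with multiplicity k ≥ 1, and b says whether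
-- its first occurrence is overlined.

Block : Set
Block = ℕ × ℕ × Bool

overpartsBounded : ℕ → ℕ → List (List Block)
overpartsBounded n zero    = if ⌊ n ℕ.≟ 0 ⌋ then ([] ∷ []) else []
overpartsBounded n (suc p) =
  overpartsBounded n p ++
  concatMap (λ k →
     if ⌊ suc k ℕ.* suc p ≤? n ⌋
       then concatMap (λ b →
              List.map (λ rest → (suc p , suc k , b) ∷ rest)
                       (overpartsBounded (n ∸ suc k ℕ.* suc p) p))
              (false ∷ true ∷ [])
       else [])
    (upTo n)

-- all overpartitions of n (parts of an overpartition of n are ≤ n)
overpartitions : ℕ → List (List Block)
overpartitions n = overpartsBounded n n

largestPart : List Block → ℕ
largestPart []              = 0
largestPart ((p , _ , _) ∷ _) = p

numParts : List Block → ℕ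
numParts []                 = 0
numParts ((_ , k , _) ∷ bs) = k ℕ.+ numParts bs

rank : List Block → ℤ
rank λ' = + largestPart λ' ℤ.- + numParts λ'

Nbar6 : ℕ → ℕ → ℕ
Nbar6 s n = length (filter (λ λ' → (rank λ' %ℕ 6) ℕ.≟ s) (overpartitions n))

rbar : ℕ → ℕ → PS
rbar s d n = + Nbar6 s (3 ℕ.* n ℕ.+ d) / 1

{-# OPTIONS --safe #-}

-- The generating functions D(p, k) of overpartitions in a p × k box satisfy a q-Delannoy recurrence and its transpose, so
-- D(p, k) = D(k, p).  For H_m = Σ_{rank λ ≥ m} q^|λ| and Z_m = H_m + H_{m+1} this gives Z_m = q^{m+1} (2P̄ − Z_{m+2}) (m ≥ 1),
-- where P̄ generates all overpartitions.  With w_i = (−1)^i q^{i²+i} the sums Σ_i w_i (Z_{C−2i} − Z_{C+2+2i}) then telescope: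
-- they equal w_b (1 + q^{2b+1})/(1 − q^{2b+1}) for C = 2b and vanish for odd C.  Sorted by rank mod 6 they express
-- (q^6; q^6)_∞ times differences of the rank generating functions as Lambert series.  The coefficients of q^{3n+2} of these
-- series match Watson's Lambert series for ω and ρ (a Bailey pair, summed over Durfee rectangles), directly for ω and after
-- exchanging the two divisors for ρ.  The remaining relation is Σ p̄(3n+2) q^n = 3M(q): it follows from φ(−q) P̄(q) = 1 by
-- trisecting φ(−q) and multiplying over the cube roots of unity.
module Submission where

open import Defs
open import Algebra.Bundles using (CommutativeRing)
import Algebra.Solver.Ring.AlmostCommutativeRing as ACR
open import Algebra.Structures using (IsCommutativeRing)
open import Data.Bool using (if_then_else_; Bool; true; false)
open import Data.Empty using (⊥)
open import Data.Integer as ℤ using (ℤ; +_; -[1+_]; _%ℕ_)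
import Data.Integer.DivMod as ℤ÷
import Data.Integer.Properties as ℤₚ
import Data.Integer.Tactic.RingSolver as ℤS
open import Data.List as List using (List; []; _∷_; _++_; concatMap; upTo; applyUpTo; filter; length)
open import Data.Maybe using (Maybe; just; nothing)
open import Data.Nat as ℕ using (ℕ; zero; suc; _∸_; _<_; _≤_; z≤n; s≤s; _≤?_)
import Data.Nat.DivMod as ℕ÷
import Data.Nat.Properties as ℕₚ
open import Data.Nat.Tactic.RingSolver using (solve-∀)
open import Data.Product using (_,_; _×_)
open import Data.Rational as ℚ using (ℚ; 0ℚ; 1ℚ; _/_)
import Data.Rational.Properties as ℚₚ
import Data.Rational.Solver as ℚS
import Data.Rational.Unnormalised as ℚᵘ
import Data.Rational.Unnormalised.Properties as ℚᵘₚ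
open import Data.Unit using (⊤; tt)
open import Function using (_∘_; id)
open import Level using (0ℓ)
open import Relation.Binary.PropositionalEquality as ≡ using (_≡_; _≢_)
open import Relation.Nullary using (yes; no; ⌊_⌋)
open import Relation.Nullary.Decidable using (toWitness)
open import Relation.Nullary.Negation using (contradiction)
open import Relation.Unary using (Decidable; Pred)

-- The recurrence links Z_m to Z_(m+2) and carries `P̄` along, so no residue class mod 6 closes up
-- under it. The weights are forced by w_(i+1) = -q^(2i+2) w_i: then the recurrence returns each
-- half of the sum over i as q^(C+1) times itself plus a term common to both halves. In the
-- difference that term, and `P̄` with it, drops out, and a linear equation for the sum remains. Its
-- right-hand side stems from the empty overpartition alone, which disturbs the recurrence at Z_0
-- and, after reflection, at Z_(-2); odd C never meets these indices. As i moves C - 2i in steps of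
-- 2, the residue of i mod 3 decides the class mod 6, and N_m = N_(-m) cancels the classes with i ≡
-- 1. Four series meet only three relations, which determine the combinations in the theorem rather
-- than single series. The exchanged Lambert series splits into those of ρ and ω by 3(1 + u + u² +
-- u³) = (1 - u - u² + u³) + 2(1 + u)(1 + u + u²). Every infinite sum is handled modulo q^N for
-- arbitrary N, where it is finite.

-- Ring solving with integer coefficients, and finite sums

module RingKit (R : CommutativeRing 0ℓ 0ℓ) where
  open CommutativeRing R public
    hiding (zero; _-_)
  open import Algebra.Properties.Ring ring public
    using (-‿distribˡ-*; -‿distribʳ-*; -‿involutive; -0#≈0#)
  open import Algebra.Properties.AbelianGroup +-abelianGroup public
    using () renaming (⁻¹-∙-comm to -+-comm)
  open import Algebra.Properties.Semiring.Mult.TCOptimised semiring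
    using (1+×; ×-homo-+; ×1-homo-*) renaming (_×_ to _×ₙ_)
  open import Relation.Binary.Reasoning.Setoid setoid public

  -- Integer coefficients have decidable equality, so `solve` can normalise over rings such as power
  -- series, whose own equality is not decidable.
  ι : ℤ → Carrier
  ι (+ n)    = n ×ₙ 1#
  ι -[1+ n ] = - (suc n ×ₙ 1#)

  private
    cancelˡ : ∀ a x y → (a + x) + - (a + y) ≈ x + - y
    cancelˡ a x y = begin
      (a + x) + - (a + y)     ≈⟨ +-cong (+-comm a x) (sym (-+-comm a y)) ⟩
      (x + a) + (- a + - y)   ≈⟨ +-assoc x a _ ⟩
      x + (a + (- a + - y))   ≈⟨ +-congˡ (sym (+-assoc a (- a) (- y))) ⟩
      x + ((a + - a) + - y)   ≈⟨ +-congˡ (+-congʳ (-‿inverseʳ a)) ⟩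
      x + (0# + - y)          ≈⟨ +-congˡ (+-identityˡ _) ⟩
      x + - y                 ∎

    ι-⊖ : ∀ m n → ι (m ℤ.⊖ n) ≈ (m ×ₙ 1#) + - (n ×ₙ 1#)
    ι-⊖ m zero = trans (sym (+-identityʳ _)) (+-congˡ (sym -0#≈0#))
    ι-⊖ zero (suc n) = sym (+-identityˡ _)
    ι-⊖ (suc m) (suc n) = begin
      ι (suc m ℤ.⊖ suc n)              ≈⟨ reflexive (≡.cong ι (ℤₚ.[1+m]⊖[1+n]≡m⊖n m n)) ⟩
      ι (m ℤ.⊖ n)                      ≈⟨ ι-⊖ m n ⟩
      (m ×ₙ 1#) + - (n ×ₙ 1#)            ≈⟨ sym (cancelˡ 1# _ _) ⟩
      (1# + m ×ₙ 1#) + - (1# + n ×ₙ 1#)  ≈⟨ sym (+-cong (1+× m 1#) (-‿cong (1+× n 1#))) ⟩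
      (suc m ×ₙ 1#) + - (suc n ×ₙ 1#)    ∎

    ι-+ : ∀ i j → ι (i ℤ.+ j) ≈ ι i + ι j
    ι-+ (+ m) (+ n) = ×-homo-+ 1# m n
    ι-+ (+ m) -[1+ n ] = ι-⊖ m (suc n)
    ι-+ -[1+ m ] (+ n) = trans (ι-⊖ n (suc m)) (+-comm _ _)
    ι-+ -[1+ m ] -[1+ n ] = begin
      - (suc (suc (m ℕ.+ n)) ×ₙ 1#)        ≈⟨ -‿cong (reflexive (≡.cong (_×ₙ 1#) (≡.sym (ℕₚ.+-suc (suc m) n)))) ⟩
      - ((suc m ℕ.+ suc n) ×ₙ 1#)          ≈⟨ -‿cong (×-homo-+ 1# (suc m) (suc n)) ⟩
      - (suc m ×ₙ 1# + suc n ×ₙ 1#)         ≈⟨ sym (-+-comm _ _) ⟩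
      - (suc m ×ₙ 1#) + - (suc n ×ₙ 1#)     ∎

    ι-neg : ∀ i → ι (ℤ.- i) ≈ - ι i
    ι-neg (+ zero)  = sym -0#≈0#
    ι-neg (+ suc n) = refl
    ι-neg -[1+ n ]  = sym (-‿involutive _)

    ι-pos* : ∀ m n → ι (+ m ℤ.* + n) ≈ ι (+ m) * ι (+ n)
    ι-pos* m n = trans (reflexive (≡.cong ι (≡.sym (ℤₚ.pos-* m n)))) (×1-homo-* m n)

    ι-*⁺ : ∀ m j → ι (+ m ℤ.* j) ≈ ι (+ m) * ι j
    ι-*⁺ m (+ n) = ι-pos* m n
    ι-*⁺ m -[1+ n ] = begin
      ι (+ m ℤ.* -[1+ n ])         ≈⟨ reflexive (≡.cong ι (≡.sym (ℤₚ.neg-distribʳ-* (+ m) (+ suc n)))) ⟩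
      ι (ℤ.- (+ m ℤ.* + suc n))    ≈⟨ ι-neg (+ m ℤ.* + suc n) ⟩
      - ι (+ m ℤ.* + suc n)        ≈⟨ -‿cong (ι-pos* m (suc n)) ⟩
      - (ι (+ m) * ι (+ suc n))    ≈⟨ -‿distribʳ-* _ _ ⟩
      ι (+ m) * ι -[1+ n ]         ∎

    ι-* : ∀ i j → ι (i ℤ.* j) ≈ ι i * ι j
    ι-* (+ m) j = ι-*⁺ m j
    ι-* -[1+ m ] j = begin
      ι (-[1+ m ] ℤ.* j)           ≈⟨ reflexive (≡.cong ι (≡.sym (ℤₚ.neg-distribˡ-* (+ suc m) j))) ⟩
      ι (ℤ.- (+ suc m ℤ.* j))      ≈⟨ ι-neg (+ suc m ℤ.* j) ⟩
      - ι (+ suc m ℤ.* j)          ≈⟨ -‿cong (ι-*⁺ (suc m) j) ⟩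
      - (ι (+ suc m) * ι j)        ≈⟨ -‿distribˡ-* _ _ ⟩
      ι -[1+ m ] * ι j             ∎

    ℤ-raw = CommutativeRing.rawRing ℤₚ.+-*-commutativeRing

    ι-morphism : ℤ-raw ACR.-Raw-AlmostCommutative⟶ ACR.fromCommutativeRing R
    ι-morphism = record
      { ⟦_⟧ = ι ; +-homo = ι-+ ; *-homo = ι-* ; -‿homo = ι-neg
      ; 0-homo = refl ; 1-homo = refl }

    ι-≟ : ∀ i j → Maybe (ι i ≈ ι j)
    ι-≟ i j with i ℤ.≟ j
    ... | yes e = just (reflexive (≡.cong ι e))
    ... | no  _ = nothing

  open import Algebra.Solver.Ring ℤ-raw (ACR.fromCommutativeRing R) ι-morphism ι-≟ public
    using (solve; _:+_; _:*_; _:-_; :-_; con; _:=_; Polynomial)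

  :1 :0 : ∀ {n} → Polynomial n
  :1 = con (+ 1)
  :0 = con (+ 0)

  -- Unfolds in step with `_^ₛ_` on series, so that powers of series can be passed to `solve` as
  -- polynomials.
  pw : ∀ {n} → ℕ → Polynomial n → Polynomial n
  pw zero    p = :1
  pw (suc k) p = p :* pw k p

  ∑ : ℕ → (ℕ → Carrier) → Carrier
  ∑ zero    f = 0#
  ∑ (suc n) f = ∑ n f + f n

  ∑-cong : ∀ n {f g} → (∀ i → i ℕ.< n → f i ≈ g i) → ∑ n f ≈ ∑ n g
  ∑-cong zero    e = refl
  ∑-cong (suc n) e = +-cong (∑-cong n (λ i i<n → e i (ℕₚ.m<n⇒m<1+n i<n))) (e n ℕₚ.≤-refl)

  ∑-cong′ : ∀ n {f g} → (∀ i → f i ≈ g i) → ∑ n f ≈ ∑ n g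
  ∑-cong′ n e = ∑-cong n (λ i _ → e i)

  ∑-0 : ∀ n {f} → (∀ i → i ℕ.< n → f i ≈ 0#) → ∑ n f ≈ 0#
  ∑-0 zero    e = refl
  ∑-0 (suc n) e = trans (+-cong (∑-0 n (λ i i<n → e i (ℕₚ.m<n⇒m<1+n i<n))) (e n ℕₚ.≤-refl)) (+-identityˡ 0#)

  ∑-+ : ∀ n f g → ∑ n (λ i → f i + g i) ≈ ∑ n f + ∑ n g
  ∑-+ zero    f g = sym (+-identityˡ 0#)
  ∑-+ (suc n) f g = trans (+-congʳ (∑-+ n f g))
    (solve 4 (λ a b c d → (a :+ b) :+ (c :+ d) := (a :+ c) :+ (b :+ d)) refl _ _ _ _)

  ∑-neg : ∀ n f → ∑ n (λ i → - f i) ≈ - ∑ n f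
  ∑-neg zero    f = sym -0#≈0#
  ∑-neg (suc n) f = trans (+-congʳ (∑-neg n f)) (-+-comm _ _)

  ∑-*ˡ : ∀ n c f → ∑ n (λ i → c * f i) ≈ c * ∑ n f
  ∑-*ˡ zero    c f = sym (zeroʳ c)
  ∑-*ˡ (suc n) c f = trans (+-congʳ (∑-*ˡ n c f)) (sym (distribˡ c _ _))

  ∑-*ʳ : ∀ n c f → ∑ n (λ i → f i * c) ≈ ∑ n f * c
  ∑-*ʳ n c f = trans (∑-cong′ n (λ i → *-comm (f i) c)) (trans (∑-*ˡ n c f) (*-comm c _))

  ∑-head : ∀ n f → ∑ (suc n) f ≈ f 0 + ∑ n (λ i → f (suc i))
  ∑-head zero    f = trans (+-identityˡ _) (sym (+-identityʳ _))
  ∑-head (suc n) f = trans (+-congʳ (∑-head n f)) (+-assoc _ _ _)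

  ∑-split : ∀ m n f → ∑ (m ℕ.+ n) f ≈ ∑ m f + ∑ n (λ i → f (m ℕ.+ i))
  ∑-split m zero    f = trans (reflexive (≡.cong (λ k → ∑ k f) (ℕₚ.+-identityʳ m))) (sym (+-identityʳ _))
  ∑-split m (suc n) f = trans (reflexive (≡.cong (λ k → ∑ k f) (ℕₚ.+-suc m n)))
    (trans (+-congʳ (∑-split m n f)) (+-assoc _ _ _))

  ∑-extend : ∀ {m n} f → m ℕ.≤ n → (∀ i → m ℕ.≤ i → f i ≈ 0#) → ∑ n f ≈ ∑ m f
  ∑-extend {m} {n} f m≤n z = begin
    ∑ n f                                 ≈⟨ reflexive (≡.cong (λ k → ∑ k f) (≡.sym (ℕₚ.m+[n∸m]≡n m≤n))) ⟩
    ∑ (m ℕ.+ (n ∸ m)) f                   ≈⟨ ∑-split m (n ∸ m) f ⟩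
    ∑ m f + ∑ (n ∸ m) (λ i → f (m ℕ.+ i)) ≈⟨ +-congˡ (∑-0 (n ∸ m) (λ i _ → z _ (ℕₚ.m≤m+n m i))) ⟩
    ∑ m f + 0#                            ≈⟨ +-identityʳ _ ⟩
    ∑ m f                                 ∎

  ∑-rev : ∀ n f → ∑ n f ≈ ∑ n (λ i → f (n ∸ suc i))
  ∑-rev zero    f = refl
  ∑-rev (suc n) f = trans (+-congʳ (∑-rev n f))
    (trans (+-comm _ _) (sym (∑-head n (λ i → f (n ∸ i)))))

  ∑-swap : ∀ m n (f : ℕ → ℕ → Carrier) → ∑ m (λ i → ∑ n (λ j → f i j)) ≈ ∑ n (λ j → ∑ m (λ i → f i j))
  ∑-swap zero    n f = sym (∑-0 n (λ _ _ → refl))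
  ∑-swap (suc m) n f = trans (+-congʳ (∑-swap m n f)) (sym (∑-+ n _ _))

  ∑-triangle : ∀ N (F : ℕ → ℕ → Carrier) → ∑ N (λ n → ∑ (suc n) (λ r → F n r)) ≈ ∑ N (λ r → ∑ (N ∸ r) (λ k → F (r ℕ.+ k) r))
  ∑-triangle zero    F = refl
  ∑-triangle (suc N) F = begin
    ∑ N (λ n → ∑ (suc n) (F n)) + ∑ (suc N) (F N)
      ≈⟨ +-congʳ (∑-triangle N F) ⟩
    ∑ N (λ r → ∑ (N ∸ r) (λ k → F (r ℕ.+ k) r)) + ∑ (suc N) (F N)
      -- Row r = N is empty because N ∸ N = 0; adding it gives both sums the range `suc N`.
      ≈⟨ +-congʳ (sym (trans (+-congˡ (reflexive (≡.cong (λ m → ∑ m (λ k → F (N ℕ.+ k) N)) (ℕₚ.n∸n≡0 N)))) (+-identityʳ _))) ⟩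
    ∑ (suc N) (λ r → ∑ (N ∸ r) (λ k → F (r ℕ.+ k) r)) + ∑ (suc N) (F N)
      ≈⟨ sym (∑-+ (suc N) _ _) ⟩
    ∑ (suc N) (λ r → ∑ (N ∸ r) (λ k → F (r ℕ.+ k) r) + F N r)
      ≈⟨ ∑-cong (suc N) step ⟩
    ∑ (suc N) (λ r → ∑ (suc N ∸ r) (λ k → F (r ℕ.+ k) r)) ∎
    where
    step : ∀ r → r ℕ.< suc N →
           ∑ (N ∸ r) (λ k → F (r ℕ.+ k) r) + F N r ≈ ∑ (suc N ∸ r) (λ k → F (r ℕ.+ k) r)
    step r (ℕ.s≤s r≤N) = trans
      (+-congˡ (reflexive (≡.cong (λ m → F m r) (≡.sym (ℕₚ.m+[n∸m]≡n r≤N)))))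
      (reflexive (≡.cong (λ m → ∑ m (λ k → F (r ℕ.+ k) r)) (≡.sym (ℕₚ.+-∸-assoc 1 r≤N))))

  ∑-square : ∀ N (F : ℕ → ℕ → Carrier) → ∑ N (λ i → ∑ N (F i)) ≈
             ∑ N (λ i → ∑ (suc i) (λ a → F a i)) + ∑ N (λ a → ∑ a (λ i → F a i))
  ∑-square zero    F = sym (+-identityˡ 0#)
  ∑-square (suc N) F = begin
    ∑ N (λ i → ∑ N (F i) + F i N) + (∑ N (F N) + F N N)
      ≈⟨ +-congʳ (∑-+ N _ _) ⟩
    (∑ N (λ i → ∑ N (F i)) + ∑ N (λ i → F i N)) + (∑ N (F N) + F N N)
      ≈⟨ +-congʳ (+-congʳ (∑-square N F)) ⟩
    _ ≈⟨ solve 5 (λ a b c d e → ((a :+ b) :+ c) :+ (d :+ e) := (a :+ (c :+ e)) :+ (b :+ d)) refl _ _ _ _ _ ⟩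
    _ ∎

  -- A quadrant cut along its diagonal. Vanishing beyond N in either argument allows both parts to
  -- be indexed by the distance from the diagonal, without triangular ranges.
  ∑-diagonal : ∀ N (F : ℕ → ℕ → Carrier) → (∀ a i → N ℕ.≤ a → F a i ≈ 0#) → (∀ a i → N ℕ.≤ i → F a i ≈ 0#) →
               ∑ N (λ a → ∑ N (λ i → F a i)) ≈
               ∑ N (λ a → ∑ N (λ r → F a (a ℕ.+ r))) + ∑ N (λ i → ∑ N (λ t → F (suc i ℕ.+ t) i))
  ∑-diagonal N F z₁ z₂ = trans (∑-square N F) (+-cong upper lower)
    where
    upper : ∑ N (λ i → ∑ (suc i) (λ a → F a i)) ≈ ∑ N (λ a → ∑ N (λ r → F a (a ℕ.+ r)))
    upper = trans (∑-triangle N (λ i a → F a i)) (∑-cong′ N (λ a → sym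
      (∑-extend (λ r → F a (a ℕ.+ r)) (ℕₚ.m∸n≤m N a) (λ r h → z₂ a _ (ℕₚ.≤-trans (ℕₚ.m≤n+m∸n N a) (ℕₚ.+-monoʳ-≤ a h))))))
    lower : ∑ N (λ a → ∑ a (λ i → F a i)) ≈ ∑ N (λ i → ∑ N (λ t → F (suc i ℕ.+ t) i))
    lower = begin
      ∑ N (λ a → ∑ a (λ i → F a i))
        ≈⟨ sym (∑-extend _ (ℕₚ.n≤1+n N) (λ a h → ∑-0 a (λ i _ → z₁ a i h))) ⟩
      ∑ (suc N) (λ a → ∑ a (λ i → F a i))
        ≈⟨ trans (∑-head N _) (+-identityˡ _) ⟩
      ∑ N (λ a → ∑ (suc a) (λ i → F (suc a) i))
        ≈⟨ ∑-triangle N (λ a i → F (suc a) i) ⟩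
      ∑ N (λ i → ∑ (N ∸ i) (λ t → F (suc i ℕ.+ t) i))
        ≈⟨ ∑-cong′ N (λ i → sym (∑-extend (λ t → F (suc i ℕ.+ t) i) (ℕₚ.m∸n≤m N i)
             (λ t h → z₁ _ i (ℕₚ.≤-trans (ℕₚ.m≤n+m∸n N i) (ℕₚ.≤-trans (ℕₚ.+-monoʳ-≤ i h) (ℕₚ.n≤1+n _)))))) ⟩
      ∑ N (λ i → ∑ N (λ t → F (suc i ℕ.+ t) i)) ∎

  ∑-single : ∀ n {k} f → k ℕ.< n → (∀ i → i ≡.≢ k → f i ≈ 0#) → ∑ n f ≈ f k
  ∑-single (suc n) {k} f k<1+n z with k ℕ.≟ n
  ... | yes ≡.refl = trans (+-congʳ (∑-0 n (λ i i<n → z i (ℕₚ.<⇒≢ i<n)))) (+-identityˡ _)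
  ... | no k≢n = trans
    (+-cong (∑-single n f (ℕₚ.≤∧≢⇒< (ℕₚ.≤-pred k<1+n) k≢n) z) (z n (λ e → k≢n (≡.sym e))))
    (+-identityʳ _)

  ∑-3 : ∀ M (f : ℕ → Carrier) → ∑ (M ℕ.* 3) f ≈ ∑ M (λ a → f (a ℕ.* 3) + f (1 ℕ.+ a ℕ.* 3) + f (2 ℕ.+ a ℕ.* 3))
  ∑-3 zero    f = refl
  ∑-3 (suc M) f = trans (+-congʳ (+-congʳ (+-congʳ (∑-3 M f))))
    (solve 4 (λ a b c d → a :+ b :+ c :+ d := a :+ (b :+ c :+ d)) refl _ _ _ _)

  ∑-2 : ∀ M (f : ℕ → Carrier) → ∑ (M ℕ.* 2) f ≈ ∑ M (λ a → f (a ℕ.* 2) + f (1 ℕ.+ a ℕ.* 2))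
  ∑-2 zero    f = refl
  ∑-2 (suc M) f = trans (+-congʳ (+-congʳ (∑-2 M f))) (+-assoc _ _ _)

-- Power series as a commutative ring, modulo q^N or exactly

module PowerSeries where

  module ℚK = RingKit ℚₚ.+-*-commutativeRing

  -- Equality of series is taken modulo q^N (fin N) or exactly (∞).
  data Prec : Set where
    fin : ℕ → Prec
    ∞   : Prec

  In : Prec → ℕ → Set
  In (fin N) n = n < N
  In ∞       n = ⊤

  In-down : ∀ π {m n} → m ≤ n → In π n → In π m
  In-down (fin N) m≤n n<N = ℕₚ.≤-<-trans m≤n n<N
  In-down ∞       _   _   = tt

  infix 4 _≈[_]_
  record _≈[_]_ (f : PS) (π : Prec) (g : PS) : Set where
    constructor mk
    field at : ∀ n → In π n → f n ≡ g n
  open _≈[_]_ public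

  exact : ∀ {f g} π → f ≈[ ∞ ] g → f ≈[ π ] g
  exact π e = mk (λ n _ → at e n tt)

  limit : ∀ {f g} → (∀ N → f ≈[ fin N ] g) → f ≈[ ∞ ] g
  limit e = mk (λ n _ → at (e (suc n)) n ℕₚ.≤-refl)

  coarsen : ∀ {f g M N} → M ≤ N → f ≈[ fin N ] g → f ≈[ fin M ] g
  coarsen M≤N e = mk (λ n n<M → at e n (ℕₚ.<-≤-trans n<M M≤N))

  zeroPS : PS
  zeroPS _ = 0ℚ

  negPS : PS → PS
  negPS f n = ℚ.- f n

  sumTo≡∑ : ∀ n f → sumTo n f ≡ ℚK.∑ (suc n) f
  sumTo≡∑ zero    f = ≡.sym (ℚₚ.+-identityˡ _)
  sumTo≡∑ (suc n) f = ≡.cong (ℚ._+ f (suc n)) (sumTo≡∑ n f)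

  ⊛-coeff : ∀ f g n → (f ⊛ g) n ≡ ℚK.∑ (suc n) (λ k → f k ℚ.* g (n ∸ k))
  ⊛-coeff f g n = sumTo≡∑ n _

  private
    ⊛-cong : ∀ π {f f′ g g′} → f ≈[ π ] f′ → g ≈[ π ] g′ → f ⊛ g ≈[ π ] f′ ⊛ g′
    ⊛-cong π {f} {f′} {g} {g′} e e′ = mk (λ n n∈ → begin
      (f ⊛ g) n                                 ≡⟨ ⊛-coeff f g n ⟩
      ℚK.∑ (suc n) (λ k → f k ℚ.* g (n ∸ k))    ≡⟨ ℚK.∑-cong (suc n) (λ k k≤n → ≡.cong₂ ℚ._*_
                                                     (at e k (In-down π (ℕₚ.≤-pred k≤n) n∈))
                                                     (at e′ (n ∸ k) (In-down π (ℕₚ.m∸n≤m n k) n∈))) ⟩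
      ℚK.∑ (suc n) (λ k → f′ k ℚ.* g′ (n ∸ k))  ≡⟨ ⊛-coeff f′ g′ n ⟨
      (f′ ⊛ g′) n                               ∎)
      where open ≡.≡-Reasoning

    ⊛-comm : ∀ f g n → (f ⊛ g) n ≡ (g ⊛ f) n
    ⊛-comm f g n = begin
      (f ⊛ g) n                                             ≡⟨ ⊛-coeff f g n ⟩
      ℚK.∑ (suc n) (λ k → f k ℚ.* g (n ∸ k))                ≡⟨ ℚK.∑-rev (suc n) _ ⟩
      ℚK.∑ (suc n) (λ k → f (n ∸ k) ℚ.* g (n ∸ (n ∸ k)))
        ≡⟨ ℚK.∑-cong (suc n) (λ k k≤n → ≡.trans
             (≡.cong (λ m → f (n ∸ k) ℚ.* g m) (ℕₚ.m∸[m∸n]≡n (ℕₚ.≤-pred k≤n))) (ℚₚ.*-comm _ (g k))) ⟩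
      ℚK.∑ (suc n) (λ k → g k ℚ.* f (n ∸ k))                ≡⟨ ⊛-coeff g f n ⟨
      (g ⊛ f) n                                             ∎
      where open ≡.≡-Reasoning

    ⊛-assoc : ∀ f g h n → ((f ⊛ g) ⊛ h) n ≡ (f ⊛ (g ⊛ h)) n
    ⊛-assoc f g h n = begin
      ((f ⊛ g) ⊛ h) n
        ≡⟨ ⊛-coeff (f ⊛ g) h n ⟩
      ℚK.∑ (suc n) (λ k → (f ⊛ g) k ℚ.* h (n ∸ k))
        ≡⟨ ℚK.∑-cong′ (suc n) (λ k → ≡.trans (≡.cong (ℚ._* h (n ∸ k)) (⊛-coeff f g k))
             (≡.sym (ℚK.∑-*ʳ (suc k) (h (n ∸ k)) _))) ⟩
      ℚK.∑ (suc n) (λ k → ℚK.∑ (suc k) (λ i → f i ℚ.* g (k ∸ i) ℚ.* h (n ∸ k)))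
        ≡⟨ ℚK.∑-triangle (suc n) (λ k i → f i ℚ.* g (k ∸ i) ℚ.* h (n ∸ k)) ⟩
      ℚK.∑ (suc n) (λ i → ℚK.∑ (suc n ∸ i) (λ j → f i ℚ.* g (i ℕ.+ j ∸ i) ℚ.* h (n ∸ (i ℕ.+ j))))
        ≡⟨ ℚK.∑-cong (suc n) inner ⟩
      ℚK.∑ (suc n) (λ i → f i ℚ.* (g ⊛ h) (n ∸ i))
        ≡⟨ ⊛-coeff f (g ⊛ h) n ⟨
      (f ⊛ (g ⊛ h)) n ∎
      where
      open ≡.≡-Reasoning
      inner : ∀ i → i < suc n →
        ℚK.∑ (suc n ∸ i) (λ j → f i ℚ.* g (i ℕ.+ j ∸ i) ℚ.* h (n ∸ (i ℕ.+ j))) ≡ f i ℚ.* (g ⊛ h) (n ∸ i)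
      inner i (s≤s i≤n) = begin
        ℚK.∑ (suc n ∸ i) (λ j → f i ℚ.* g (i ℕ.+ j ∸ i) ℚ.* h (n ∸ (i ℕ.+ j)))
          ≡⟨ ≡.cong (λ m → ℚK.∑ m (λ j → f i ℚ.* g (i ℕ.+ j ∸ i) ℚ.* h (n ∸ (i ℕ.+ j)))) (ℕₚ.+-∸-assoc 1 i≤n) ⟩
        ℚK.∑ (suc (n ∸ i)) (λ j → f i ℚ.* g (i ℕ.+ j ∸ i) ℚ.* h (n ∸ (i ℕ.+ j)))
          ≡⟨ ℚK.∑-cong′ (suc (n ∸ i)) (λ j → ≡.trans
               (≡.cong₂ (λ a b → f i ℚ.* g a ℚ.* h b) (ℕₚ.m+n∸m≡n i j) (≡.sym (ℕₚ.∸-+-assoc n i j)))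
               (ℚₚ.*-assoc (f i) _ _)) ⟩
        ℚK.∑ (suc (n ∸ i)) (λ j → f i ℚ.* (g j ℚ.* h (n ∸ i ∸ j)))
          ≡⟨ ℚK.∑-*ˡ (suc (n ∸ i)) (f i) _ ⟩
        f i ℚ.* ℚK.∑ (suc (n ∸ i)) (λ j → g j ℚ.* h (n ∸ i ∸ j))
          ≡⟨ ≡.cong (f i ℚ.*_) (⊛-coeff g h (n ∸ i)) ⟨
        f i ℚ.* (g ⊛ h) (n ∸ i) ∎

    ⊛-distribˡ : ∀ f g h n → (f ⊛ (g ⊕ h)) n ≡ (f ⊛ g ⊕ f ⊛ h) n
    ⊛-distribˡ f g h n = begin
      (f ⊛ (g ⊕ h)) n
        ≡⟨ ⊛-coeff f (g ⊕ h) n ⟩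
      ℚK.∑ (suc n) (λ k → f k ℚ.* (g (n ∸ k) ℚ.+ h (n ∸ k)))
        ≡⟨ ℚK.∑-cong′ (suc n) (λ k → ℚₚ.*-distribˡ-+ (f k) _ _) ⟩
      ℚK.∑ (suc n) (λ k → f k ℚ.* g (n ∸ k) ℚ.+ f k ℚ.* h (n ∸ k))
        ≡⟨ ℚK.∑-+ (suc n) _ _ ⟩
      ℚK.∑ (suc n) (λ k → f k ℚ.* g (n ∸ k)) ℚ.+ ℚK.∑ (suc n) (λ k → f k ℚ.* h (n ∸ k))
        ≡⟨ ≡.cong₂ ℚ._+_ (⊛-coeff f g n) (⊛-coeff f h n) ⟨
      (f ⊛ g ⊕ f ⊛ h) n ∎
      where open ≡.≡-Reasoning

  const-coeff-pos : ∀ c k → k ≢ 0 → constPS c k ≡ 0ℚ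
  const-coeff-pos c zero    h = contradiction ≡.refl h
  const-coeff-pos c (suc k) h = ≡.refl

  const-⊛ : ∀ c f n → (constPS c ⊛ f) n ≡ c ℚ.* f n
  const-⊛ c f n = ≡.trans (⊛-coeff (constPS c) f n)
    (ℚK.∑-single (suc n) _ (s≤s z≤n) (λ k h → ≡.trans
      (≡.cong (ℚ._* f (n ∸ k)) (const-coeff-pos c k h)) (ℚₚ.*-zeroˡ (f (n ∸ k)))))

  private
    ⊛-identityˡ : ∀ f n → (onePS ⊛ f) n ≡ f n
    ⊛-identityˡ f n = ≡.trans (const-⊛ 1ℚ f n) (ℚₚ.*-identityˡ _)

  -- Opaque copies of the operations: unification would otherwise unfold them pointwise.
  opaque
    infixl 6 _⊞_
    infixl 7 _⊠_
    infix  9 q^_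
    infix  8 ⊟_
    _⊞_ _⊠_ : PS → PS → PS
    _⊞_ = _⊕_
    _⊠_ = _⊛_

    ⊟_ : PS → PS
    ⊟_ = negPS

    0ₛ 1ₛ : PS
    0ₛ = zeroPS
    1ₛ = onePS

    q^_ : ℕ → PS
    q^_ = mono

    ⊠-def : ∀ f g → f ⊛ g ≡ f ⊠ g
    ⊠-def f g = ≡.refl

    ⊖-def : ∀ f g → f ⊖ g ≡ f ⊞ (⊟ g)
    ⊖-def f g = ≡.refl

    1-def : onePS ≡ 1ₛ
    1-def = ≡.refl

    q-def : ∀ e → mono e ≡ q^ e
    q-def e = ≡.refl

    ⊞-at : ∀ f g n → (f ⊞ g) n ≡ f n ℚ.+ g n
    ⊞-at f g n = ≡.refl

    ⊟-at : ∀ f n → (⊟ f) n ≡ ℚ.- f n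
    ⊟-at f n = ≡.refl

    0-at : ∀ n → 0ₛ n ≡ 0ℚ
    0-at n = ≡.refl

    ⊠-0 : ∀ f g → (f ⊠ g) 0 ≡ f 0 ℚ.* g 0
    ⊠-0 f g = ≡.refl

    1-0 : 1ₛ 0 ≡ 1ℚ
    1-0 = ≡.refl

    ⊠-coeff : ∀ f g n → (f ⊠ g) n ≡ ℚK.∑ (suc n) (λ k → f k ℚ.* g (n ∸ k))
    ⊠-coeff = ⊛-coeff

    private
      isCR : ∀ π → IsCommutativeRing (λ f g → f ≈[ π ] g) _⊞_ _⊠_ ⊟_ 0ₛ 1ₛ
      isCR π = record
        { isRing = record
          { +-isAbelianGroup = record
            { isGroup = record
              { isMonoid = record
                { isSemigroup = record
                  { isMagma = record
                    { isEquivalence = record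
                      { refl = mk (λ _ _ → ≡.refl) ; sym = λ e → mk (λ n n∈ → ≡.sym (at e n n∈))
                      ; trans = λ e e′ → mk (λ n n∈ → ≡.trans (at e n n∈) (at e′ n n∈)) }
                    ; ∙-cong = λ e e′ → mk (λ n n∈ → ≡.cong₂ ℚ._+_ (at e n n∈) (at e′ n n∈)) }
                  ; assoc = λ f g h → mk (λ n _ → ℚₚ.+-assoc (f n) (g n) (h n)) }
                ; identity = (λ f → mk (λ n _ → ℚₚ.+-identityˡ (f n))) , (λ f → mk (λ n _ → ℚₚ.+-identityʳ (f n))) }
              ; inverse = (λ f → mk (λ n _ → ℚₚ.+-inverseˡ (f n))) , (λ f → mk (λ n _ → ℚₚ.+-inverseʳ (f n)))
              ; ⁻¹-cong = λ e → mk (λ n n∈ → ≡.cong ℚ.-_ (at e n n∈)) }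
            ; comm = λ f g → mk (λ n _ → ℚₚ.+-comm (f n) (g n)) }
          ; *-cong = ⊛-cong π
          ; *-assoc = λ f g h → mk (λ n _ → ⊛-assoc f g h n)
          ; *-identity = (λ f → mk (λ n _ → ⊛-identityˡ f n))
                       , (λ f → mk (λ n _ → ≡.trans (⊛-comm f onePS n) (⊛-identityˡ f n)))
          ; distrib = (λ f g h → mk (λ n _ → ⊛-distribˡ f g h n))
                    , (λ f g h → mk (λ n _ → ≡.trans (⊛-comm (g ⊕ h) f n) (≡.trans (⊛-distribˡ f g h n)
                         (≡.cong₂ ℚ._+_ (⊛-comm f g n) (⊛-comm f h n)))))
          }
        ; *-comm = λ f g → mk (λ n _ → ⊛-comm f g n)
        }

  PS-commutativeRing : Prec → CommutativeRing 0ℓ 0ℓ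
  PS-commutativeRing π = record { isCommutativeRing = isCR π }

  opaque
    unfolding _⊞_

    q-≡ : ∀ e → (q^ e) e ≡ 1ℚ
    q-≡ e with e ℕ.≟ e
    ... | yes _ = ≡.refl
    ... | no h  = contradiction ≡.refl h

    q-≢ : ∀ {e n} → e ≢ n → (q^ e) n ≡ 0ℚ
    q-≢ {e} {n} h with e ℕ.≟ n
    ... | yes p = contradiction p h
    ... | no _  = ≡.refl

    q-⊠-< : ∀ e f {n} → n < e → (q^ e ⊠ f) n ≡ 0ℚ
    q-⊠-< e f {n} n<e = ≡.trans (⊠-coeff (q^ e) f n) (ℚK.∑-0 (suc n) (λ k k≤n → ≡.trans
      (≡.cong (ℚ._* f (n ∸ k)) (q-≢ (λ p → ℕₚ.<⇒≱ n<e (≡.subst (_≤ n) (≡.sym p) (ℕₚ.≤-pred k≤n)))))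
      (ℚₚ.*-zeroˡ (f (n ∸ k)))))

    q-⊠-+ : ∀ e f n → (q^ e ⊠ f) (e ℕ.+ n) ≡ f n
    q-⊠-+ e f n = begin
      (q^ e ⊠ f) (e ℕ.+ n)       ≡⟨ ⊠-coeff (q^ e) f (e ℕ.+ n) ⟩
      ℚK.∑ (suc (e ℕ.+ n)) (λ k → (q^ e) k ℚ.* f (e ℕ.+ n ∸ k))
        ≡⟨ ℚK.∑-single (suc (e ℕ.+ n)) {e} _ (s≤s (ℕₚ.m≤m+n e n)) (λ k h → ≡.trans
            (≡.cong (ℚ._* f (e ℕ.+ n ∸ k)) (q-≢ (λ p → h (≡.sym p)))) (ℚₚ.*-zeroˡ (f (e ℕ.+ n ∸ k)))) ⟩
      (q^ e) e ℚ.* f (e ℕ.+ n ∸ e) ≡⟨ ≡.cong₂ ℚ._*_ (q-≡ e) (≡.cong f (ℕₚ.m+n∸m≡n e n)) ⟩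
      1ℚ ℚ.* f n                   ≡⟨ ℚₚ.*-identityˡ (f n) ⟩
      f n                          ∎
      where open ≡.≡-Reasoning

  opaque
    unfolding _⊞_
    q-0-at : ∀ n → (q^ 0) n ≡ 1ₛ n
    q-0-at zero    = ≡.refl
    q-0-at (suc n) = ≡.refl

  module Series (π : Prec) where
    open RingKit (PS-commutativeRing π) public

    ≡⇒≈ : ∀ {f g} → f ≡ g → f ≈ g
    ≡⇒≈ ≡.refl = refl

    pointwise : ∀ {f g} → (∀ n → f n ≡ g n) → f ≈ g
    pointwise e = mk (λ n _ → e n)

    q-cong : ∀ {a b} → a ≡ b → q^ a ≈ q^ b
    q-cong e = ≡⇒≈ (≡.cong q^_ e)

    q-+ : ∀ a b → q^ (a ℕ.+ b) ≈ q^ a ⊠ q^ b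
    q-+ a b = pointwise λ n → ≡.sym (go n)
      where
      go : ∀ n → (q^ a ⊠ q^ b) n ≡ (q^ (a ℕ.+ b)) n
      go n with a ℕ.≤? n
      ... | no a≰n = ≡.trans (q-⊠-< a (q^ b) (ℕₚ.≰⇒> a≰n))
        (≡.sym (q-≢ {a ℕ.+ b} (λ p → a≰n (≡.subst (a ≤_) p (ℕₚ.m≤m+n a b)))))
      ... | yes a≤n with ℕₚ.m+[n∸m]≡n a≤n
      ... | eq = ≡.subst (λ m → (q^ a ⊠ q^ b) m ≡ (q^ (a ℕ.+ b)) m) eq
        (≡.trans (q-⊠-+ a (q^ b) (n ∸ a)) (cancel (n ∸ a)))
        where
        cancel : ∀ k → (q^ b) k ≡ (q^ (a ℕ.+ b)) (a ℕ.+ k)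
        cancel k with b ℕ.≟ k
        ... | yes ≡.refl = ≡.trans (q-≡ b) (≡.sym (q-≡ (a ℕ.+ b)))
        ... | no b≢k     = ≡.trans (q-≢ b≢k) (≡.sym (q-≢ (λ p → b≢k (ℕₚ.+-cancelˡ-≡ a b k p))))

    q-split : ∀ {c} a b → c ≡ a ℕ.+ b → q^ c ≈ q^ a ⊠ q^ b
    q-split a b e = trans (q-cong e) (q-+ a b)

    q-0 : q^ 0 ≈ 1ₛ
    q-0 = pointwise q-0-at

  module Mod (N : ℕ) where
    open Series (fin N) public

    q-big : ∀ {e} → N ≤ e → q^ e ≈ 0ₛ
    q-big N≤e = mk (λ n n<N → ≡.trans (q-≢ (ℕₚ.>⇒≢ (ℕₚ.<-≤-trans n<N N≤e))) (≡.sym (0-at n)))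

    q-big-* : ∀ {e} f → N ≤ e → q^ e ⊠ f ≈ 0ₛ
    q-big-* f N≤e = trans (*-congʳ {x = f} (q-big N≤e)) (zeroˡ f)

    ∑-coeff : ∀ M F n → ∑ M F n ≡ ℚK.∑ M (λ k → F k n)
    ∑-coeff zero    F n = 0-at n
    ∑-coeff (suc M) F n = ≡.trans (⊞-at _ (F M) n) (≡.cong (ℚ._+ F M n) (∑-coeff M F n))

  -- The source of all convergence arguments: a recurrence whose right-hand side carries a positive
  -- power of q is a contraction.
  gain-* : ∀ {f g} e {m} → f ≈[ fin m ] g → q^ e ⊠ f ≈[ fin (e ℕ.+ m) ] q^ e ⊠ g
  gain-* {f} {g} e {m} h = mk go
    where
    go : ∀ n → n < e ℕ.+ m → (q^ e ⊠ f) n ≡ (q^ e ⊠ g) n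
    go n n<e+m with e ℕ.≤? n
    ... | no e≰n = ≡.trans (q-⊠-< e f (ℕₚ.≰⇒> e≰n)) (≡.sym (q-⊠-< e g (ℕₚ.≰⇒> e≰n)))
    ... | yes e≤n with n ∸ e | ℕₚ.m+[n∸m]≡n e≤n
    ... | k | ≡.refl = ≡.trans (q-⊠-+ e f k) (≡.trans (at h k (ℕₚ.+-cancelˡ-< e k m n<e+m)) (≡.sym (q-⊠-+ e g k)))

  -- Inductions on the precision advance one step at a time, so a single unit of the gain suffices.
  gain : ∀ {f g} N e → f ≈[ fin N ] g → q^ suc e ⊠ f ≈[ fin (suc N) ] q^ suc e ⊠ g
  gain N e h = coarsen (s≤s (ℕₚ.m≤n+m N e)) (gain-* (suc e) h)

-- Inverses, infinite sums and infinite products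

module Inverses where
  open PowerSeries

  -- As g has no constant term, coefficient n of the product involves only coefficients of h with
  -- index below n.
  order-⊠ : ∀ {g h} j → g 0 ≡ 0ℚ → h ≈[ fin j ] 0ₛ → g ⊠ h ≈[ fin (suc j) ] 0ₛ
  order-⊠ {g} {h} j g0 e = mk (λ n n≤j → ≡.trans (⊠-coeff g h n) (≡.trans (ℚK.∑-0 (suc n) (term n n≤j)) (≡.sym (0-at n))))
    where
    term : ∀ n → n < suc j → ∀ k → k < suc n → g k ℚ.* h (n ∸ k) ≡ 0ℚ
    term n n≤j zero    _ = ≡.trans (≡.cong (ℚ._* h n) g0) (ℚₚ.*-zeroˡ (h n))
    term n n≤j (suc k) (s≤s k<n) = ≡.trans
      (≡.cong (g (suc k) ℚ.*_) (≡.trans (at e (n ∸ suc k)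
        (ℕₚ.<-≤-trans (ℕₚ.∸-monoʳ-< {n} (s≤s (z≤n {k})) k<n) (ℕₚ.≤-pred n≤j))) (0-at _)))
      (ℚₚ.*-zeroʳ (g (suc k)))

  unit-⊠ : ∀ {f g} → f 0 ≡ 1ℚ → g 0 ≡ 1ℚ → (f ⊠ g) 0 ≡ 1ℚ
  unit-⊠ {f} {g} e e′ = ≡.trans (⊠-0 f g) (≡.cong₂ ℚ._*_ e e′)

  unit-1-q : ∀ e → (1ₛ ⊞ ⊟ q^ suc e) 0 ≡ 1ℚ
  unit-1-q e = ≡.trans (⊞-at 1ₛ _ 0) (≡.cong₂ ℚ._+_ 1-0 (≡.trans (⊟-at _ 0) (≡.cong ℚ.-_ (q-≢ {suc e} (λ ())))))

  -- Diagonal truncation: coefficient n sees only the summands k ≤ n. For `Vanishing` families this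
  -- is the infinite sum, and it is the form in which `omega` and `rho` are given.
  Σ∞ : (ℕ → PS) → PS
  Σ∞ F n = sumTo n (λ k → F k n)

  Vanishing : (ℕ → PS) → Set
  Vanishing F = ∀ k → F k ≈[ fin k ] 0ₛ

  module _ (N : ℕ) where
    open Mod N

    -- Any cut-off M ≥ N is allowed, so the two sides of an identity may be truncated at different
    -- lengths.
    Σ∞≈∑ : ∀ {F} M → N ≤ M → Vanishing F → Σ∞ F ≈ ∑ M F
    Σ∞≈∑ {F} M N≤M v = mk (λ n n<N → ≡.trans (sumTo≡∑ n _) (≡.sym (≡.trans (∑-coeff M F n)
      (ℚK.∑-extend (λ k → F k n) (ℕₚ.≤-trans n<N N≤M) (λ k n<k → ≡.trans (at (v k) n n<k) (0-at n))))))

  infixr 8 _^ₛ_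
  _^ₛ_ : PS → ℕ → PS
  f ^ₛ zero  = 1ₛ
  f ^ₛ suc j = f ⊠ (f ^ₛ j)

  ^^-def : ∀ f j → f ^^ j ≡ f ^ₛ j
  ^^-def f zero    = 1-def
  ^^-def f (suc j) = ≡.trans (⊠-def f (f ^^ j)) (≡.cong (f ⊠_) (^^-def f j))

  module _ (π : Prec) where
    open Series π

    geometric-sum : ∀ g M → (1ₛ + - g) * ∑ M (g ^ₛ_) ≈ 1ₛ + - (g ^ₛ M)
    geometric-sum g zero    = trans (zeroʳ _) (sym (-‿inverseʳ 1ₛ))
    geometric-sum g (suc M) = begin
      (1ₛ + - g) * (∑ M (g ^ₛ_) + g ^ₛ M)
        ≈⟨ solve 3 (λ x s y → (:1 :+ :- x) :* (s :+ y) := (:1 :+ :- x) :* s :+ (y :+ :- (x :* y))) refl g _ _ ⟩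
      (1ₛ + - g) * ∑ M (g ^ₛ_) + (g ^ₛ M + - (g ^ₛ suc M))
        ≈⟨ +-congʳ (geometric-sum g M) ⟩
      (1ₛ + - (g ^ₛ M)) + (g ^ₛ M + - (g ^ₛ suc M))
        ≈⟨ solve 3 (λ o y z → (o :+ :- y) :+ (y :+ :- z) := o :+ :- z) refl _ _ _ ⟩
      1ₛ + - (g ^ₛ suc M) ∎

  private
    pow-vanishing : ∀ {g} → g 0 ≡ 0ℚ → Vanishing (g ^ₛ_)
    pow-vanishing g0 zero    = mk (λ _ ())
    pow-vanishing g0 (suc k) = order-⊠ k g0 (pow-vanishing g0 k)

  -- With g = 1 - f, `inv f` is the geometric series in g; modulo q^N it may be stopped at N, and
  -- the remainder g^N vanishes because g has no constant term.
  ⊠-inv : ∀ {f} → f 0 ≡ 1ℚ → f ⊠ inv f ≈[ ∞ ] 1ₛ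
  ⊠-inv {f} f0 = limit go
    where
    g = 1ₛ ⊞ ⊟ f
    g≡ : onePS ⊖ f ≡ g
    g≡ = ≡.trans (⊖-def onePS f) (≡.cong (_⊞ ⊟ f) 1-def)
    g0 : g 0 ≡ 0ℚ
    g0 = ≡.trans (⊞-at 1ₛ _ 0) (≡.cong₂ ℚ._+_ 1-0 (≡.trans (⊟-at f 0) (≡.cong ℚ.-_ f0)))
    go : ∀ N → f ⊠ inv f ≈[ fin N ] 1ₛ
    go N = begin
      f * inv f                 ≈⟨ *-cong (solve 1 (λ x → x := :1 :+ :- (:1 :+ :- x)) refl f)
                                     (pointwise λ n → ≡.trans (≡.cong (λ h → sumTo n (λ j → (h ^^ j) n)) g≡)
                                       (≡.trans (sumTo≡∑ n _) (≡.trans (ℚK.∑-cong′ (suc n) (λ j → ≡.cong (λ h → h n) (^^-def g j)))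
                                         (≡.sym (sumTo≡∑ n _))))) ⟩
      (1ₛ + - g) * Σ∞ (g ^ₛ_)   ≈⟨ *-congˡ (Σ∞≈∑ N N ℕₚ.≤-refl (pow-vanishing g0)) ⟩
      (1ₛ + - g) * ∑ N (g ^ₛ_)  ≈⟨ geometric-sum (fin N) g N ⟩
      1ₛ + - (g ^ₛ N)           ≈⟨ +-congˡ (-‿cong (pow-vanishing g0 N)) ⟩
      1ₛ + - 0ₛ                 ≈⟨ trans (+-congˡ -0#≈0#) (+-identityʳ 1ₛ) ⟩
      1ₛ                        ∎
      where open Mod N

  module Units (π : Prec) where
    open Series π

    inv-r : ∀ {f} → f 0 ≡ 1ℚ → f * inv f ≈ 1ₛ
    inv-r f0 = exact π (⊠-inv f0)

    inv-l : ∀ {f} → f 0 ≡ 1ℚ → inv f * f ≈ 1ₛ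
    inv-l {f} f0 = trans (*-comm (inv f) f) (inv-r f0)

    cancel-unit : ∀ f {g h} → f 0 ≡ 1ℚ → f * g ≈ f * h → g ≈ h
    cancel-unit f {g} {h} f0 e = begin
      g               ≈⟨ expand g ⟩
      inv f * (f * g) ≈⟨ *-congˡ e ⟩
      inv f * (f * h) ≈⟨ expand h ⟨
      h               ∎
      where
      expand : ∀ x → x ≈ inv f * (f * x)
      expand x = sym (trans (sym (*-assoc (inv f) f x)) (trans (*-congʳ (inv-l f0)) (*-identityˡ x)))

    inv-unique : ∀ f {g h} → f 0 ≡ 1ℚ → f * g ≈ h → g ≈ h * inv f
    inv-unique f {g} {h} f0 e = cancel-unit f f0 (trans e (sym (begin
      f * (h * inv f) ≈⟨ solve 3 (λ a b c → a :* (b :* c) := b :* (a :* c)) refl f h (inv f) ⟩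
      h * (f * inv f) ≈⟨ *-congˡ (inv-r f0) ⟩
      h * 1ₛ       ≈⟨ *-identityʳ h ⟩
      h               ∎)))

  poch-0 : ∀ s m → poch s m 0 ≡ 1ₛ
  poch-0 s m = 1-def

  poch-suc : ∀ s m n → poch s m (suc n) ≡ poch s m n ⊠ (1ₛ ⊞ ⊟ q^ (s ℕ.+ m ℕ.* n))
  poch-suc s m n = ≡.trans (⊠-def _ _) (≡.cong (poch s m n ⊠_)
    (≡.trans (⊖-def _ _) (≡.cong₂ (λ a b → a ⊞ ⊟ b) 1-def (q-def _))))

  poch-unit : ∀ s m n → poch (suc s) m n 0 ≡ 1ℚ
  poch-unit s m zero    = ≡.refl
  poch-unit s m (suc n) = ≡.cong₂ ℚ._*_ (poch-unit s m n) ≡.refl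

  module _ (N : ℕ) where
    open Mod N
    -- The factors of index K and beyond have exponents at least N and are 1 modulo q^N.
    poch-stable : ∀ s m {K L} → 1 ≤ s → 1 ≤ m → N ≤ K → K ≤ L → poch s m L ≈ poch s m K
    poch-stable s (suc m) {K} {L} 1≤s 1≤m N≤K K≤L = ≡.subst (λ x → poch s (suc m) x ≈ poch s (suc m) K) (ℕₚ.m+[n∸m]≡n K≤L) (go (L ∸ K))
      where
      go : ∀ d → poch s (suc m) (K ℕ.+ d) ≈ poch s (suc m) K
      go zero    = ≡⇒≈ (≡.cong (poch s (suc m)) (ℕₚ.+-identityʳ K))
      go (suc d) = begin
        poch s (suc m) (K ℕ.+ suc d)
          ≈⟨ ≡⇒≈ (≡.cong (poch s (suc m)) (ℕₚ.+-suc K d)) ⟩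
        poch s (suc m) (suc (K ℕ.+ d))
          ≈⟨ ≡⇒≈ (poch-suc s (suc m) (K ℕ.+ d)) ⟩
        poch s (suc m) (K ℕ.+ d) * (1ₛ + - q^ (s ℕ.+ suc m ℕ.* (K ℕ.+ d)))
          ≈⟨ *-congˡ (+-congˡ (-‿cong (q-big big))) ⟩
        poch s (suc m) (K ℕ.+ d) * (1ₛ + - 0ₛ)
          ≈⟨ solve 1 (λ x → x :* (:1 :+ :- :0) := x) refl _ ⟩
        poch s (suc m) (K ℕ.+ d)  ≈⟨ go d ⟩
        poch s (suc m) K          ∎
        where
        big : N ≤ s ℕ.+ suc m ℕ.* (K ℕ.+ d)
        big = ℕₚ.≤-trans N≤K (ℕₚ.≤-trans (ℕₚ.m≤m+n K d) (ℕₚ.≤-trans (ℕₚ.m≤m+n (K ℕ.+ d) (m ℕ.* (K ℕ.+ d))) (ℕₚ.m≤n+m _ s)))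

  pochInf≈ : ∀ N s m {K} → 1 ≤ s → 1 ≤ m → N ≤ K → pochInf s m ≈[ fin N ] poch s m K
  pochInf≈ N s m {K} 1≤s 1≤m N≤K = mk (λ n n<N → ≡.sym (at (poch-stable (suc n) s m 1≤s 1≤m ℕₚ.≤-refl (ℕₚ.≤-trans n<N N≤K)) n ℕₚ.≤-refl))

  pochInf-unit : ∀ s m → pochInf (suc s) m 0 ≡ 1ℚ
  pochInf-unit s m = ≡.refl

  module _ (N : ℕ) where
    open Mod N
    open Units (fin N)

    q-^ : ∀ d r → (q^ d) ^ₛ r ≈ q^ (d ℕ.* r)
    q-^ d zero    = sym (trans (q-cong (ℕₚ.*-zeroʳ d)) q-0)
    q-^ d (suc r) = trans (*-congˡ (q-^ d r)) (sym (q-split d (d ℕ.* r) (ℕₚ.*-suc d r)))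

    inv-geometric : ∀ d → inv (1ₛ + - q^ suc d) ≈ ∑ N (λ r → q^ (suc d ℕ.* r))
    inv-geometric d = sym (trans (inv-unique (1ₛ + - q^ suc d) (unit-1-q d) (begin
      (1ₛ + - q^ suc d) * ∑ N (λ r → q^ (suc d ℕ.* r))
        ≈⟨ *-congˡ (∑-cong′ N (λ r → sym (q-^ (suc d) r))) ⟩
      (1ₛ + - q^ suc d) * ∑ N ((q^ suc d) ^ₛ_)
        ≈⟨ geometric-sum (fin N) (q^ suc d) N ⟩
      1ₛ + - ((q^ suc d) ^ₛ N)
        ≈⟨ +-congˡ (-‿cong (trans (q-^ (suc d) N) (q-big (ℕₚ.m≤m+n N (d ℕ.* N))))) ⟩
      1ₛ + - 0ₛ
        ≈⟨ solve 0 (:1 :+ :- :0 := :1) refl ⟩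
      1ₛ ∎)) (*-identityˡ _))

-- The Jacobi triple product in finite and infinite form

module TripleProducts where
  open PowerSeries
  open Inverses

  sg : ℕ → PS
  sg zero    = 1ₛ
  sg (suc k) = ⊟ sg k

  -- (−1)^k q^{M k(k−1)/2 + c k}
  θ : ℕ → ℕ → ℕ → PS
  θ M c zero    = 1ₛ
  θ M c (suc k) = ⊟ (q^ (M ℕ.* k ℕ.+ c) ⊠ θ M c k)

  module θ-Properties (π : Prec) where
    open Series π

    -- The exponent is characterised by its recurrence, so each use can supply a polynomial of its
    -- own and no halving of k(k - 1) is needed.
    θ-explicit : ∀ {M c} (E : ℕ → ℕ) → E 0 ≡ 0 → (∀ k → E (suc k) ≡ (M ℕ.* k ℕ.+ c) ℕ.+ E k) →
                 ∀ k → θ M c k ≈ sg k * q^ (E k)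
    θ-explicit E e0 es zero    = sym (trans (*-identityˡ _) (trans (q-cong e0) q-0))
    θ-explicit {M} {c} E e0 es (suc k) = begin
      - (q^ (M ℕ.* k ℕ.+ c) * θ M c k)          ≈⟨ -‿cong (*-congˡ (θ-explicit E e0 es k)) ⟩
      - (q^ (M ℕ.* k ℕ.+ c) * (sg k * q^ E k))  ≈⟨ solve 3 (λ a s b → :- (a :* (s :* b)) := (:- s) :* (a :* b)) refl _ _ _ ⟩
      - sg k * (q^ (M ℕ.* k ℕ.+ c) * q^ E k)    ≈⟨ *-congˡ (q-split _ _ (es k)) ⟨
      - sg k * q^ E (suc k)                     ∎

  θ-exponent : ℕ → ℕ → ℕ → ℕ
  θ-exponent M c zero    = 0
  θ-exponent M c (suc k) = (M ℕ.* k ℕ.+ c) ℕ.+ θ-exponent M c k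

  k≤θ-exponent : ∀ M {c} k → 1 ≤ c → k ≤ θ-exponent M c k
  k≤θ-exponent M zero    h = z≤n
  k≤θ-exponent M (suc k) h = ℕₚ.+-mono-≤ (ℕₚ.≤-trans h (ℕₚ.m≤n+m _ (M ℕ.* k))) (k≤θ-exponent M k h)

  -- For c ≥ 1 the term `θ M c k` is divisible by q^k, which makes up for k missing units of
  -- precision.
  θ-order : ∀ M {c} k {m} {f g} → 1 ≤ c → f ≈[ fin m ] g → θ M c k ⊠ f ≈[ fin (k ℕ.+ m) ] θ M c k ⊠ g
  θ-order M {c} k {m} {f} {g} 1≤c h = begin
    θ M c k * f       ≈⟨ *-congʳ e ⟩
    (sg k * q^ E) * f ≈⟨ *-assoc _ _ _ ⟩
    sg k * (q^ E * f) ≈⟨ *-congˡ (coarsen (ℕₚ.+-monoˡ-≤ m (k≤θ-exponent M k 1≤c)) (gain-* E h)) ⟩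
    sg k * (q^ E * g) ≈⟨ *-assoc _ _ _ ⟨
    (sg k * q^ E) * g ≈⟨ *-congʳ e ⟨
    θ M c k * g       ∎
    where
    open Mod (k ℕ.+ m)
    E = θ-exponent M c k
    e : θ M c k ≈ sg k * q^ E
    e = θ-Properties.θ-explicit (fin (k ℕ.+ m)) (θ-exponent M c) ≡.refl (λ _ → ≡.refl) k

  θ-vanish : ∀ M {c} → 1 ≤ c → Vanishing (θ M c)
  θ-vanish M {c} 1≤c k = begin
    θ M c k      ≈⟨ *-identityʳ _ ⟨
    θ M c k * 1ₛ ≈⟨ coarsen (ℕₚ.m≤m+n k 0) (θ-order M k {0} 1≤c (mk (λ _ ()))) ⟩
    θ M c k * 0ₛ ≈⟨ zeroʳ _ ⟩
    0ₛ           ∎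
    where open Mod k

  module FiniteTripleProduct (M′ : ℕ) (π : Prec) where
    open Series π
    open Units π

    M : ℕ
    M = suc M′

    P iP : ℕ → PS
    P n  = poch M M n
    iP n = inv (P n)

    1-p^ : ℕ → PS
    1-p^ n = 1ₛ + - q^ (M ℕ.* n)

    P-suc : ∀ n → P (suc n) ≈ P n * 1-p^ (suc n)
    P-suc n = trans (≡⇒≈ (poch-suc M M n)) (*-congˡ (+-congˡ (-‿cong (q-cong (≡.sym (ℕₚ.*-suc M n))))))

    P*iP : ∀ n → P n * iP n ≈ 1ₛ
    P*iP n = inv-r {P n} (poch-unit M′ M n)

    iP-suc : ∀ n → 1-p^ (suc n) * iP (suc n) ≈ iP n
    iP-suc n = cancel-unit (P n) (poch-unit M′ M n) (begin
      P n * (1-p^ (suc n) * iP (suc n)) ≈⟨ *-assoc _ _ _ ⟨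
      (P n * 1-p^ (suc n)) * iP (suc n) ≈⟨ *-congʳ (P-suc n) ⟨
      P (suc n) * iP (suc n)            ≈⟨ P*iP (suc n) ⟩
      1ₛ                                ≈⟨ P*iP n ⟨
      P n * iP n                        ∎)

    1-p^0 : 1-p^ 0 ≈ 0ₛ
    1-p^0 = trans (+-congˡ (-‿cong (trans (q-cong (ℕₚ.*-zeroʳ M)) q-0))) (-‿inverseʳ 1ₛ)

    -- `H ϑ N * P N` is Σ_i ϑ_i times the Gaussian binomial of N over i in p = q^M; keeping `P N`
    -- outside avoids Gaussian binomials altogether.
    H : (ℕ → PS) → ℕ → PS
    H ϑ N = ∑ (suc N) (λ i → ϑ i * (iP i * iP (N ∸ i)))

    -- 1 − p^{N+1} = (1 − p^{N+1−i}) + p^{N+1−i}(1 − p^i) removes one factor from either end.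
    H-suc : ∀ ϑ y N → (∀ i → i ≤ N → q^ (M ℕ.* (N ∸ i)) * ϑ (suc i) ≈ - (y * ϑ i)) →
            1-p^ (suc N) * H ϑ (suc N) ≈ (1ₛ + - y) * H ϑ N
    H-suc ϑ y N rec = begin
      1-p^ (suc N) * H ϑ (suc N)
        ≈⟨ ∑-*ˡ (suc (suc N)) _ _ ⟨
      ∑ (suc (suc N)) (λ i → 1-p^ (suc N) * (ϑ i * (iP i * iP (suc N ∸ i))))
        ≈⟨ ∑-cong (suc (suc N)) (λ i i≤ → trans (*-congʳ (split i (ℕₚ.≤-pred i≤)))
             (solve 6 (λ a b c t x z → (a :+ b :* c) :* (t :* (x :* z)) := t :* (x :* (a :* z)) :+ (b :* t) :* ((c :* x) :* z))
                refl (1-p^ (suc N ∸ i)) (q^ (M ℕ.* (suc N ∸ i))) (1-p^ i) (ϑ i) (iP i) (iP (suc N ∸ i)))) ⟩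
      ∑ (suc (suc N)) (λ i → ϑ i * (iP i * (1-p^ (suc N ∸ i) * iP (suc N ∸ i)))
                           + (q^ (M ℕ.* (suc N ∸ i)) * ϑ i) * ((1-p^ i * iP i) * iP (suc N ∸ i)))
        ≈⟨ ∑-+ (suc (suc N)) _ _ ⟩
      _ ≈⟨ +-cong upper lower ⟩
      H ϑ N + ∑ (suc N) (λ i → (q^ (M ℕ.* (N ∸ i)) * ϑ (suc i)) * (iP i * iP (N ∸ i)))
        ≈⟨ +-congˡ (trans (∑-cong (suc N) (λ i i≤N → trans (*-congʳ (rec i (ℕₚ.≤-pred i≤N)))
             (solve 3 (λ a b c → (:- (a :* b)) :* c := (:- a) :* (b :* c)) refl y (ϑ i) _))) (∑-*ˡ (suc N) (- y) _)) ⟩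
      H ϑ N + - y * H ϑ N
        ≈⟨ solve 2 (λ a h → h :+ (:- a) :* h := (:1 :+ :- a) :* h) refl y (H ϑ N) ⟩
      (1ₛ + - y) * H ϑ N ∎
      where
      split : ∀ i → i ≤ suc N → 1-p^ (suc N) ≈ 1-p^ (suc N ∸ i) + q^ (M ℕ.* (suc N ∸ i)) * 1-p^ i
      split i i≤ = trans (+-congˡ (-‿cong (q-split (M ℕ.* (suc N ∸ i)) (M ℕ.* i)
          (≡.trans (≡.cong (M ℕ.*_) (≡.sym (ℕₚ.m∸n+n≡m i≤))) (ℕₚ.*-distribˡ-+ M (suc N ∸ i) i)))))
        (solve 2 (λ a b → :1 :+ :- (a :* b) := (:1 :+ :- a) :+ a :* (:1 :+ :- b)) refl _ _)
      upper : ∑ (suc (suc N)) (λ i → ϑ i * (iP i * (1-p^ (suc N ∸ i) * iP (suc N ∸ i)))) ≈ H ϑ N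
      upper = trans (+-cong
        (∑-cong (suc N) (λ i i≤N → *-congˡ (*-congˡ (trans
          (≡⇒≈ (≡.cong (λ m → 1-p^ m * iP m) (ℕₚ.+-∸-assoc 1 (ℕₚ.≤-pred i≤N)))) (iP-suc (N ∸ i))))))
        (trans (*-congˡ (*-congˡ (*-congʳ (trans (≡⇒≈ (≡.cong 1-p^ (ℕₚ.n∸n≡0 N))) 1-p^0))))
          (solve 3 (λ a b c → a :* (b :* (:0 :* c)) := :0) refl _ _ _)))
        (+-identityʳ _)
      lower : ∑ (suc (suc N)) (λ i → (q^ (M ℕ.* (suc N ∸ i)) * ϑ i) * ((1-p^ i * iP i) * iP (suc N ∸ i)))
            ≈ ∑ (suc N) (λ i → (q^ (M ℕ.* (N ∸ i)) * ϑ (suc i)) * (iP i * iP (N ∸ i)))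
      lower = trans (∑-head (suc N) _) (trans (+-cong
        (trans (*-congˡ (*-congʳ (*-congʳ 1-p^0))) (solve 3 (λ a b c → a :* ((:0 :* b) :* c) := :0) refl _ _ _))
        (∑-cong′ (suc N) (λ i → *-congˡ (*-congʳ (iP-suc i)))))
        (+-identityˡ _))

    module _ (c d : ℕ) (c+d : c ℕ.+ d ≡ M) where

      -- The finite q-binomial theorem. The y of `H-suc` is q^(c + MN), so each step of the
      -- induction supplies exactly the next factor of the product.
      one-sided : ∀ N → H (θ M c) N * P N ≈ poch c M N
      one-sided zero = begin
        (0ₛ + 1ₛ * (iP 0 * iP 0)) * P 0 ≈⟨ solve 2 (λ a b → (:0 :+ :1 :* (a :* a)) :* b := a :* (b :* a)) refl (iP 0) (P 0) ⟩
        iP 0 * (P 0 * iP 0)             ≈⟨ *-cong iP0 (P*iP 0) ⟩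
        1ₛ * 1ₛ                         ≈⟨ *-identityˡ _ ⟩
        1ₛ                              ≈⟨ ≡⇒≈ (poch-0 c M) ⟨
        poch c M 0                      ∎
        where
        iP0 : iP 0 ≈ 1ₛ
        iP0 = trans (sym (trans (*-congʳ (≡⇒≈ (poch-0 M M))) (*-identityˡ _))) (P*iP 0)
      one-sided (suc N) = begin
        H (θ M c) (suc N) * P (suc N)                 ≈⟨ *-congˡ (P-suc N) ⟩
        H (θ M c) (suc N) * (P N * 1-p^ (suc N))      ≈⟨ solve 3 (λ a b c → a :* (b :* c) := (c :* a) :* b) refl _ _ _ ⟩
        (1-p^ (suc N) * H (θ M c) (suc N)) * P N      ≈⟨ *-congʳ (H-suc (θ M c) (q^ (c ℕ.+ M ℕ.* N)) N rec) ⟩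
        ((1ₛ + - q^ (c ℕ.+ M ℕ.* N)) * H (θ M c) N) * P N  ≈⟨ solve 3 (λ a b c → (a :* b) :* c := (b :* c) :* a) refl _ _ _ ⟩
        (H (θ M c) N * P N) * (1ₛ + - q^ (c ℕ.+ M ℕ.* N))  ≈⟨ *-congʳ (one-sided N) ⟩
        poch c M N * (1ₛ + - q^ (c ℕ.+ M ℕ.* N))      ≈⟨ ≡⇒≈ (poch-suc c M N) ⟨
        poch c M (suc N)                              ∎
        where
        rec : ∀ i → i ≤ N → q^ (M ℕ.* (N ∸ i)) * θ M c (suc i) ≈ - (q^ (c ℕ.+ M ℕ.* N) * θ M c i)
        rec i i≤N = trans (solve 3 (λ a b t → a :* (:- (b :* t)) := :- ((a :* b) :* t)) refl _ _ _)
          (-‿cong (*-congʳ (sym (q-split (M ℕ.* (N ∸ i)) (M ℕ.* i ℕ.+ c)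
            (≡.trans (≡.cong (λ n → c ℕ.+ M ℕ.* n) (≡.sym (ℕₚ.m∸n+n≡m i≤N))) (lem M c (N ∸ i) i))))))
          where
          lem : ∀ M c a b → c ℕ.+ M ℕ.* (a ℕ.+ b) ≡ M ℕ.* a ℕ.+ (M ℕ.* b ℕ.+ c)
          lem = solve-∀

      -- ϑ a is the bilateral theta sequence θ_a, θ_{a−1}, …, θ_0, θ_{−1}, …
      ϑ : ℕ → ℕ → PS
      ϑ zero    i       = θ M d i
      ϑ (suc a) zero    = θ M c (suc a)
      ϑ (suc a) (suc i) = ϑ a i

      ϑ-left : ∀ a k → ϑ (k ℕ.+ a) k ≈ θ M c a
      ϑ-left zero    zero    = refl
      ϑ-left (suc a) zero    = refl
      ϑ-left a       (suc k) = ϑ-left a k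

      ϑ-right : ∀ a k → ϑ a (a ℕ.+ k) ≈ θ M d k
      ϑ-right zero    k = refl
      ϑ-right (suc a) k = ϑ-right a k

      -- Shifting the theta sequence by a replaces c by d = M - c in the constant of the recurrence:
      -- enlarging the right end of the window brings in the factor 1 - q^(d + Mb).
      ϑ-rec : ∀ a b i → i ≤ a ℕ.+ b → q^ (M ℕ.* (a ℕ.+ b ∸ i)) * ϑ a (suc i) ≈ - (q^ (d ℕ.+ M ℕ.* b) * ϑ a i)
      ϑ-rec zero b i i≤b = trans (solve 3 (λ a b t → a :* (:- (b :* t)) := :- ((a :* b) :* t)) refl _ _ _)
          (-‿cong (*-congʳ (sym (q-split (M ℕ.* (b ∸ i)) (M ℕ.* i ℕ.+ d)
            (≡.trans (≡.cong (λ n → d ℕ.+ M ℕ.* n) (≡.sym (ℕₚ.m∸n+n≡m i≤b))) (lem M d (b ∸ i) i))))))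
          where
          lem : ∀ M c a b → c ℕ.+ M ℕ.* (a ℕ.+ b) ≡ M ℕ.* a ℕ.+ (M ℕ.* b ℕ.+ c)
          lem = solve-∀
      ϑ-rec (suc a) b zero _ = begin
        q^ (M ℕ.* suc (a ℕ.+ b)) * ϑ a 0       ≈⟨ *-cong (q-split (d ℕ.+ M ℕ.* b) (M ℕ.* a ℕ.+ c) expo) (ϑ-left a 0) ⟩
        (q^ (d ℕ.+ M ℕ.* b) * q^ (M ℕ.* a ℕ.+ c)) * θ M c a
          ≈⟨ solve 3 (λ x y t → (x :* y) :* t := :- (x :* :- (y :* t))) refl _ _ _ ⟩
        - (q^ (d ℕ.+ M ℕ.* b) * θ M c (suc a)) ∎
        where
        lem : ∀ M a b c d → (c ℕ.+ d) ℕ.+ M ℕ.* (a ℕ.+ b) ≡ d ℕ.+ M ℕ.* b ℕ.+ (M ℕ.* a ℕ.+ c)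
        lem = solve-∀
        expo : M ℕ.* suc (a ℕ.+ b) ≡ d ℕ.+ M ℕ.* b ℕ.+ (M ℕ.* a ℕ.+ c)
        expo = ≡.trans (ℕₚ.*-suc M (a ℕ.+ b)) (≡.trans (≡.cong (ℕ._+ M ℕ.* (a ℕ.+ b)) (≡.sym c+d)) (lem M a b c d))
      ϑ-rec (suc a) b (suc i) (s≤s i≤) = ϑ-rec a b i i≤

      -- Induction on b alone: at b = 0 the sum read backwards is the one-sided case.
      two-sided : ∀ a b → H (ϑ a) (a ℕ.+ b) * P (a ℕ.+ b) ≈ poch c M a * poch d M b
      two-sided a zero = begin
        H (ϑ a) (a ℕ.+ 0) * P (a ℕ.+ 0) ≈⟨ ≡⇒≈ (≡.cong (λ n → H (ϑ a) n * P n) (ℕₚ.+-identityʳ a)) ⟩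
        H (ϑ a) a * P a                 ≈⟨ *-congʳ reverse ⟩
        H (θ M c) a * P a               ≈⟨ one-sided a ⟩
        poch c M a                      ≈⟨ *-identityʳ _ ⟨
        poch c M a * 1ₛ                 ≈⟨ *-congˡ (≡⇒≈ (poch-0 d M)) ⟨
        poch c M a * poch d M 0         ∎
        where
        reverse : H (ϑ a) a ≈ H (θ M c) a
        reverse = trans (∑-rev (suc a) _) (∑-cong (suc a) (λ i i≤a → *-cong
          (trans (≡⇒≈ (≡.cong (λ m → ϑ m (a ∸ i)) (≡.sym (ℕₚ.m∸n+n≡m (ℕₚ.≤-pred i≤a))))) (ϑ-left i (a ∸ i)))
          (trans (*-congˡ (≡⇒≈ (≡.cong iP (ℕₚ.m∸[m∸n]≡n (ℕₚ.≤-pred i≤a))))) (*-comm _ _))))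
      two-sided a (suc b) = begin
        H (ϑ a) (a ℕ.+ suc b) * P (a ℕ.+ suc b)
          ≈⟨ ≡⇒≈ (≡.cong (λ n → H (ϑ a) n * P n) (ℕₚ.+-suc a b)) ⟩
        H (ϑ a) (suc N) * P (suc N)                  ≈⟨ *-congˡ (P-suc N) ⟩
        H (ϑ a) (suc N) * (P N * 1-p^ (suc N))       ≈⟨ solve 3 (λ a b c → a :* (b :* c) := (c :* a) :* b) refl _ _ _ ⟩
        (1-p^ (suc N) * H (ϑ a) (suc N)) * P N       ≈⟨ *-congʳ (H-suc (ϑ a) (q^ (d ℕ.+ M ℕ.* b)) N (ϑ-rec a b)) ⟩
        ((1ₛ + - q^ (d ℕ.+ M ℕ.* b)) * H (ϑ a) N) * P N  ≈⟨ solve 3 (λ a b c → (a :* b) :* c := (b :* c) :* a) refl _ _ _ ⟩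
        (H (ϑ a) N * P N) * (1ₛ + - q^ (d ℕ.+ M ℕ.* b))  ≈⟨ *-congʳ (two-sided a b) ⟩
        (poch c M a * poch d M b) * (1ₛ + - q^ (d ℕ.+ M ℕ.* b)) ≈⟨ *-assoc _ _ _ ⟩
        poch c M a * (poch d M b * (1ₛ + - q^ (d ℕ.+ M ℕ.* b))) ≈⟨ *-congˡ (≡⇒≈ (poch-suc d M b)) ⟨
        poch c M a * poch d M (suc b)                ∎
        where N = a ℕ.+ b

      -- The terms of index r and -(r + 1) of the bilateral theta series.
      η : ℕ → PS
      η r = θ M c r + θ M d (suc r)

      -- With n factors on one side and n + 1 on the other the sum has 2n + 2 terms, which fold into
      -- the pairs `η r` with nothing left over.
      finite-triple-product : ∀ n → ∑ (suc n) (λ r → η r * (iP (n ∸ r) * iP (suc n ℕ.+ r))) * P (n ℕ.+ suc n)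
                              ≈ poch c M n * poch d M (suc n)
      finite-triple-product n = trans (*-congʳ (sym fold)) (two-sided n (suc n))
        where
        t : ℕ → PS
        t i = ϑ n i * (iP i * iP (n ℕ.+ suc n ∸ i))
        e₁ : ∀ r → r ≤ n → n ℕ.+ suc n ∸ (n ∸ r) ≡ suc n ℕ.+ r
        e₁ r r≤n = ≡.trans (ℕₚ.+-∸-comm (suc n) (ℕₚ.m∸n≤m n r))
          (≡.trans (≡.cong (ℕ._+ suc n) (ℕₚ.m∸[m∸n]≡n r≤n)) (ℕₚ.+-comm r (suc n)))
        e₂ : ∀ r → n ℕ.+ suc n ∸ (suc n ℕ.+ r) ≡ n ∸ r
        e₂ r = ≡.trans (≡.cong (_∸ (suc n ℕ.+ r)) (ℕₚ.+-comm n (suc n))) (ℕₚ.[m+n]∸[m+o]≡n∸o (suc n) n r)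
        fold : H (ϑ n) (n ℕ.+ suc n) ≈ ∑ (suc n) (λ r → η r * (iP (n ∸ r) * iP (suc n ℕ.+ r)))
        fold = begin
          ∑ (suc n ℕ.+ suc n) t
            ≈⟨ ∑-split (suc n) (suc n) t ⟩
          ∑ (suc n) t + ∑ (suc n) (λ r → t (suc n ℕ.+ r))
            ≈⟨ +-congʳ (∑-rev (suc n) t) ⟩
          ∑ (suc n) (λ r → t (n ∸ r)) + ∑ (suc n) (λ r → t (suc n ℕ.+ r))
            ≈⟨ ∑-+ (suc n) _ _ ⟨
          ∑ (suc n) (λ r → t (n ∸ r) + t (suc n ℕ.+ r))
            ≈⟨ ∑-cong (suc n) (λ r r≤n → trans (+-cong
                 (*-cong (trans (≡⇒≈ (≡.cong (λ m → ϑ m (n ∸ r)) (≡.sym (ℕₚ.m∸n+n≡m (ℕₚ.≤-pred r≤n))))) (ϑ-left r (n ∸ r)))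
                         (*-congˡ (≡⇒≈ (≡.cong iP (e₁ r (ℕₚ.≤-pred r≤n))))))
                 (*-cong (trans (≡⇒≈ (≡.cong (ϑ n) (≡.sym (ℕₚ.+-suc n r)))) (ϑ-right n (suc r)))
                         (trans (*-congˡ (≡⇒≈ (≡.cong iP (e₂ r)))) (*-comm _ _))))
                 (sym (distribʳ _ _ _))) ⟩
          ∑ (suc n) (λ r → η r * (iP (n ∸ r) * iP (suc n ℕ.+ r))) ∎

  inv-cong : ∀ {π f g} → f 0 ≡ 1ℚ → g 0 ≡ 1ℚ → f ≈[ π ] g → inv f ≈[ π ] inv g
  inv-cong {π} {f} {g} f0 g0 e = cancel-unit f f0 (trans (inv-r f0) (sym (trans (*-congʳ e) (inv-r g0))))
    where
    open Series π
    open Units π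

  inv-poch-stable : ∀ N M {K L} → N ≤ K → N ≤ L → inv (poch (suc M) (suc M) K) ≈[ fin N ] inv (poch (suc M) (suc M) L)
  inv-poch-stable N M {K} {L} N≤K N≤L = trans (to N≤K) (sym (to N≤L))
    where
    open Mod N
    to : ∀ {K} → N ≤ K → inv (poch (suc M) (suc M) K) ≈ inv (poch (suc M) (suc M) N)
    to {K} N≤K = inv-cong (poch-unit M _ K) (poch-unit M _ N) (poch-stable N (suc M) (suc M) (s≤s z≤n) (s≤s z≤n) ℕₚ.≤-refl N≤K)

  module TripleProduct (M′ c′ d′ : ℕ) (c+d : suc c′ ℕ.+ suc d′ ≡ suc M′) where

    private
      M = suc M′
      c = suc c′
      d = suc d′

    η : ℕ → PS
    η r = θ M c r ⊞ θ M d (suc r)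

    η-vanishing : Vanishing η
    η-vanishing r = trans (+-cong (θ-vanish M (s≤s z≤n) r) (coarsen (ℕₚ.n≤1+n r) (θ-vanish M (s≤s z≤n) (suc r)))) (+-identityˡ _)
      where open Mod r

    triple-product : Σ∞ η ≈[ ∞ ] pochInf c M ⊠ pochInf d M ⊠ pochInf M M
    triple-product = limit go
      where
      go : ∀ N → Σ∞ η ≈[ fin N ] pochInf c M ⊠ pochInf d M ⊠ pochInf M M
      go N = begin
        Σ∞ η
          ≈⟨ Σ∞≈∑ N (suc N) (ℕₚ.n≤1+n N) η-vanishing ⟩
        ∑ (suc N) η
          ≈⟨ trans (*-congˡ (trans (*-cong (P*iP N) (P*iP N)) (*-identityˡ _))) (*-identityʳ _) ⟨
        ∑ (suc N) η * ((P N * iP N) * (P N * iP N))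
          ≈⟨ solve 3 (λ a x y → a :* ((x :* y) :* (x :* y)) := ((a :* (y :* y)) :* x) :* x) refl _ _ _ ⟩
        ((∑ (suc N) η * (iP N * iP N)) * P N) * P N
          ≈⟨ *-congʳ (*-cong (sym (∑-*ʳ (suc N) _ _)) (sym P-limit)) ⟩
        (∑ (suc N) (λ r → η r * (iP N * iP N)) * P (N ℕ.+ suc N)) * P N
          ≈⟨ *-congʳ (*-congʳ (∑-cong (suc N) (λ r r≤N → sym (trans (distribʳ _ _ _)
               (trans (+-cong (term r r (ℕₚ.≤-pred r≤N) (ℕₚ.≤-refl) (s≤s z≤n))
                              (term (suc r) r (ℕₚ.≤-pred r≤N) (ℕₚ.n≤1+n r) (s≤s z≤n)))
               (sym (distribʳ _ _ _))))))) ⟩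
        (∑ (suc N) (λ r → η r * (iP (N ∸ r) * iP (suc N ℕ.+ r))) * P (N ℕ.+ suc N)) * P N
          ≈⟨ *-congʳ (finite-triple-product c d c+d N) ⟩
        (poch c M N * poch d M (suc N)) * P N
          ≈⟨ *-cong (*-cong (sym (pochInf≈ N c M (s≤s z≤n) (s≤s z≤n) ℕₚ.≤-refl)) (sym (pochInf≈ N d M (s≤s z≤n) (s≤s z≤n) (ℕₚ.n≤1+n N))))
               (sym (pochInf≈ N M M (s≤s z≤n) (s≤s z≤n) ℕₚ.≤-refl)) ⟩
        pochInf c M * pochInf d M * pochInf M M ∎
        where
        open Mod N
        open FiniteTripleProduct M′ (fin N) hiding (M; η)
        P-limit : P (N ℕ.+ suc N) ≈ P N
        P-limit = poch-stable N M M (s≤s z≤n) (s≤s z≤n) ℕₚ.≤-refl (ℕₚ.m≤m+n N (suc N))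
        -- `iP (N ∸ r)` agrees with `iP N` only modulo q^(N - r); the theta term of index k ≥ r
        -- supplies the other r units.
        term : ∀ {e} k r → r ≤ N → r ≤ k → 1 ≤ e → θ M e k * (iP (N ∸ r) * iP (suc N ℕ.+ r)) ≈ θ M e k * (iP N * iP N)
        term k r r≤N r≤k 1≤e = coarsen (ℕₚ.≤-trans (ℕₚ.m≤n+m∸n N r) (ℕₚ.+-monoˡ-≤ (N ∸ r) r≤k))
          (θ-order M k {N ∸ r} 1≤e (K.*-cong
            (inv-poch-stable (N ∸ r) M′ ℕₚ.≤-refl (ℕₚ.m∸n≤m N r))
            (inv-poch-stable (N ∸ r) M′ (ℕₚ.≤-trans (ℕₚ.m∸n≤m N r) (ℕₚ.≤-trans (ℕₚ.n≤1+n N) (ℕₚ.m≤m+n (suc N) r))) (ℕₚ.m∸n≤m N r))))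
          where module K = Mod (N ∸ r)

-- Durfee rectangles and Bailey pairs in base q²

module BaileyPairs where
  open PowerSeries
  open Inverses
  open TripleProducts

  module _ (N : ℕ) where
    open Mod N
    open Units (fin N)
    open FiniteTripleProduct 1 (fin N)

    -- Σ_k Q^{k² + Ck} / (Q)_k (Q)_{k+C}, with Q = q²
    durfee : ℕ → PS
    durfee C = ∑ N (λ k → q^ (2 ℕ.* (k ℕ.* k ℕ.+ C ℕ.* k)) * (iP k * iP (k ℕ.+ C)))

    private
      -- Over the common denominator (Q)_k (Q)_(k+C+1) the numerator 1 - Q^(k+C+1) - Q^k is (1 -
      -- Q^k) - Q^(k+C+1); the bracket cancels the last factor of (Q)_k and shifts k by one.
      durfee-step : ∀ C → durfee C + - durfee (suc C) ≈ - (q^ (2 ℕ.* suc C) * (durfee (suc C) + - durfee (suc (suc C))))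
      durfee-step C = begin
        durfee C + - durfee (suc C)
          ≈⟨ trans (+-congˡ (sym (∑-neg N _))) (sym (∑-+ N _ _)) ⟩
        ∑ N (λ k → q^ (e C k) * (iP k * iP (k ℕ.+ C)) + - (q^ (e (suc C) k) * (iP k * iP (k ℕ.+ suc C))))
          ≈⟨ ∑-cong′ N step ⟩
        ∑ N (λ k → t k + - (q^ (2 ℕ.* suc C) * (q^ (e (suc C) k) * (iP k * iP (k ℕ.+ suc C)))))
          ≈⟨ trans (∑-+ N _ _) (+-congˡ (trans (∑-neg N _) (-‿cong (∑-*ˡ N _ _)))) ⟩
        ∑ N t + - (q^ (2 ℕ.* suc C) * durfee (suc C))
          ≈⟨ +-congʳ shift ⟩
        q^ (2 ℕ.* suc C) * durfee (suc (suc C)) + - (q^ (2 ℕ.* suc C) * durfee (suc C))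
          ≈⟨ solve 3 (λ a x y → a :* y :+ :- (a :* x) := :- (a :* (x :+ :- y))) refl _ _ _ ⟩
        - (q^ (2 ℕ.* suc C) * (durfee (suc C) + - durfee (suc (suc C)))) ∎
        where
        e : ℕ → ℕ → ℕ
        e C k = 2 ℕ.* (k ℕ.* k ℕ.+ C ℕ.* k)
        t : ℕ → PS
        t k = q^ (e C k) * ((1-p^ k * iP k) * iP (k ℕ.+ suc C))
        e-suc : ∀ k C → 2 ℕ.* (k ℕ.* k ℕ.+ (1 ℕ.+ C) ℕ.* k) ≡ 2 ℕ.* (k ℕ.* k ℕ.+ C ℕ.* k) ℕ.+ 2 ℕ.* k
        e-suc = solve-∀
        step : ∀ k → q^ (e C k) * (iP k * iP (k ℕ.+ C)) + - (q^ (e (suc C) k) * (iP k * iP (k ℕ.+ suc C)))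
                   ≈ t k + - (q^ (2 ℕ.* suc C) * (q^ (e (suc C) k) * (iP k * iP (k ℕ.+ suc C))))
        step k = trans
          (+-cong (*-congˡ (*-congˡ (trans (sym (iP-suc (k ℕ.+ C)))
               (*-cong (+-congˡ (-‿cong (q-split (2 ℕ.* k) (2 ℕ.* suc C)
                  (≡.trans (≡.cong (2 ℕ.*_) (≡.sym (ℕₚ.+-suc k C))) (ℕₚ.*-distribˡ-+ 2 k (suc C))))))
                 (≡⇒≈ (≡.cong iP (≡.sym (ℕₚ.+-suc k C))))))))
            (-‿cong (*-congʳ (q-split (e C k) (2 ℕ.* k) (e-suc k C)))))
          (trans
            (solve 5 (λ E K C x y → E :* (x :* ((:1 :+ :- (K :* C)) :* y)) :+ :- ((E :* K) :* (x :* y))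
               := E :* (((:1 :+ :- K) :* x) :* y) :+ :- (C :* ((E :* K) :* (x :* y)))) refl
               (q^ (e C k)) (q^ (2 ℕ.* k)) (q^ (2 ℕ.* suc C)) (iP k) (iP (k ℕ.+ suc C)))
            (+-congˡ (-‿cong (*-congˡ (*-congʳ (sym (q-split (e C k) (2 ℕ.* k) (e-suc k C))))))))
        expo : ∀ k C → 2 ℕ.* ((1 ℕ.+ k) ℕ.* (1 ℕ.+ k) ℕ.+ C ℕ.* (1 ℕ.+ k)) ≡ 2 ℕ.* (1 ℕ.+ C) ℕ.+ 2 ℕ.* (k ℕ.* k ℕ.+ (1 ℕ.+ (1 ℕ.+ C)) ℕ.* k)
        expo = solve-∀
        big : ∀ k → k ≤ e C k
        big zero    = z≤n
        big (suc k) = ℕₚ.≤-trans (ℕₚ.m≤m*n (suc k) (suc k)) (ℕₚ.≤-trans (ℕₚ.m≤m+n _ (C ℕ.* suc k)) (ℕₚ.m≤m+n _ _))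
        shift : ∑ N t ≈ q^ (2 ℕ.* suc C) * durfee (suc (suc C))
        shift = begin
          ∑ N t
            ≈⟨ ∑-extend t (ℕₚ.n≤1+n N) (λ k h → q-big-* _ (ℕₚ.≤-trans h (big k))) ⟨
          ∑ (suc N) t
            ≈⟨ trans (∑-head N t) (trans (+-congʳ (trans (*-congˡ (*-congʳ (*-congʳ 1-p^0)))
                 (solve 3 (λ a x y → a :* ((:0 :* x) :* y) := :0) refl _ _ _))) (+-identityˡ _)) ⟩
          ∑ N (λ k → t (suc k))
            ≈⟨ ∑-cong′ N (λ k → trans (*-cong (q-split (2 ℕ.* suc C) (e (suc (suc C)) k) (expo k C))
                  (*-cong (iP-suc k) (≡⇒≈ (≡.cong iP (≡.sym (ℕₚ.+-suc k (suc C))))))) (*-assoc _ _ _)) ⟩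
          ∑ N (λ k → q^ (2 ℕ.* suc C) * (q^ (e (suc (suc C)) k) * (iP k * iP (k ℕ.+ suc (suc C)))))
            ≈⟨ ∑-*ˡ N _ _ ⟩
          q^ (2 ℕ.* suc C) * durfee (suc (suc C)) ∎

      -- Iterating `durfee-step` collects positive powers of q, so consecutive differences vanish to
      -- every order up to N.
      durfee-diff : ∀ j → j ≤ N → ∀ C → durfee C + - durfee (suc C) ≈[ fin j ] 0ₛ
      durfee-diff zero    _   C = mk (λ _ ())
      durfee-diff (suc j) j<N C = K.trans (coarsen j<N (durfee-step C)) (K.trans
        (K.-‿cong (K.trans (gain j _ (durfee-diff j (ℕₚ.<⇒≤ j<N) (suc C))) (K.zeroʳ _))) K.-0#≈0#)
        where module K = Mod (suc j)

    -- As the sum does not depend on C, C may be raised beyond N, where only the summand k = 0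
    -- survives. Combinatorially, every partition has a largest k × (k + C) rectangle.
    durfee-rectangle : ∀ C → durfee C ≈ iP N
    durfee-rectangle C = trans (far N) (limit′ (C ℕ.+ N) (ℕₚ.m≤n+m N C))
      where
      next : ∀ C → durfee C ≈ durfee (suc C)
      next C = begin
        durfee C ≈⟨ solve 2 (λ x y → x := (x :+ :- y) :+ y) refl _ _ ⟩
        (durfee C + - durfee (suc C)) + durfee (suc C) ≈⟨ +-congʳ (durfee-diff N ℕₚ.≤-refl C) ⟩
        0ₛ + durfee (suc C) ≈⟨ +-identityˡ _ ⟩
        durfee (suc C) ∎
      far : ∀ j → durfee C ≈ durfee (C ℕ.+ j)
      far zero    = ≡⇒≈ (≡.cong durfee (≡.sym (ℕₚ.+-identityʳ C)))
      far (suc j) = trans (far j) (trans (next (C ℕ.+ j)) (≡⇒≈ (≡.cong durfee (≡.sym (ℕₚ.+-suc C j)))))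
      iP0 : iP 0 ≈ 1ₛ
      iP0 = trans (sym (trans (*-congʳ (≡⇒≈ (poch-0 M M))) (*-identityˡ _))) (P*iP 0)
      limit′ : ∀ C → N ≤ C → durfee C ≈ iP N
      limit′ C N≤C = begin
        durfee C ≈⟨ ∑-extend f (ℕₚ.n≤1+n N) tail ⟨
        ∑ (suc N) f ≈⟨ ∑-head N f ⟩
        f 0 + ∑ N (λ k → f (suc k)) ≈⟨ +-congˡ (∑-0 N (λ k _ → q-big-* _ (ℕₚ.≤-trans N≤C (ℕₚ.≤-trans (ℕₚ.m≤m*n C (suc k))
               (ℕₚ.≤-trans (ℕₚ.m≤n+m _ (suc k ℕ.* suc k)) (ℕₚ.m≤m+n _ _)))))) ⟩
        f 0 + 0ₛ ≈⟨ +-identityʳ _ ⟩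
        f 0 ≈⟨ *-cong (trans (q-cong (≡.cong (2 ℕ.*_) (ℕₚ.*-zeroʳ C))) q-0) (*-cong iP0 (inv-poch-stable N 1 N≤C ℕₚ.≤-refl)) ⟩
        1ₛ * (1ₛ * iP N) ≈⟨ solve 1 (λ x → :1 :* (:1 :* x) := x) refl _ ⟩
        iP N ∎
        where
        f : ℕ → PS
        f k = q^ (2 ℕ.* (k ℕ.* k ℕ.+ C ℕ.* k)) * (iP k * iP (k ℕ.+ C))
        tail : ∀ k → N ≤ k → f k ≈ 0ₛ
        tail zero    h = q-big-* _ (ℕₚ.≤-trans h z≤n)
        tail (suc k) h = q-big-* _ (ℕₚ.≤-trans h (ℕₚ.≤-trans (ℕₚ.m≤m*n (suc k) (suc k))
               (ℕₚ.≤-trans (ℕₚ.m≤m+n _ (C ℕ.* suc k)) (ℕₚ.m≤m+n _ _))))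

    private
      -- (−1)^r q^{r²+r} (1 − q^{4r+2})
      α : ℕ → PS
      α r = θ 2 2 r * (1ₛ + - q^ (2 ℕ.* (suc r ℕ.+ r)))

      poch-zero : ∀ n → poch 0 2 (suc n) ≈ 0ₛ
      poch-zero zero = trans (≡⇒≈ (poch-suc 0 2 0)) (trans (*-congˡ (trans (+-congˡ (-‿cong q-0)) (-‿inverseʳ 1ₛ))) (zeroʳ _))
      poch-zero (suc n) = trans (≡⇒≈ (poch-suc 0 2 (suc n))) (trans (*-congʳ (poch-zero n)) (zeroˡ _))

      θ-shift : ∀ r → θ 2 2 r ≈ q^ (2 ℕ.* r) * θ 2 0 r
      θ-shift zero = sym (trans (*-congʳ q-0) (*-identityˡ _))
      θ-shift (suc r) = begin
        - (q^ (2 ℕ.* r ℕ.+ 2) * θ 2 2 r) ≈⟨ -‿cong (*-cong (q-cong (e r)) (θ-shift r)) ⟩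
        - (q^ (2 ℕ.* suc r) * (q^ (2 ℕ.* r) * θ 2 0 r)) ≈⟨ -‿cong (*-congˡ (*-congʳ (q-cong (≡.sym (ℕₚ.+-identityʳ _))))) ⟩
        - (q^ (2 ℕ.* suc r) * (q^ (2 ℕ.* r ℕ.+ 0) * θ 2 0 r)) ≈⟨ solve 2 (λ a b → :- (a :* b) := a :* (:- b)) refl _ _ ⟩
        q^ (2 ℕ.* suc r) * θ 2 0 (suc r) ∎
        where
        e : ∀ r → 2 ℕ.* r ℕ.+ 2 ≡ 2 ℕ.* (1 ℕ.+ r)
        e = solve-∀

      η-factor : ∀ r → θ 2 0 r + θ 2 2 (suc r) ≈ θ 2 0 r * (1ₛ + - q^ (2 ℕ.* (suc r ℕ.+ r)))
      η-factor r = begin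
        θ 2 0 r + - (q^ (2 ℕ.* r ℕ.+ 2) * θ 2 2 r)
          ≈⟨ +-congˡ (-‿cong (*-congˡ (θ-shift r))) ⟩
        θ 2 0 r + - (q^ (2 ℕ.* r ℕ.+ 2) * (q^ (2 ℕ.* r) * θ 2 0 r))
          ≈⟨ solve 3 (λ t a b → t :+ :- (a :* (b :* t)) := t :* (:1 :+ :- (a :* b))) refl _ _ _ ⟩
        θ 2 0 r * (1ₛ + - (q^ (2 ℕ.* r ℕ.+ 2) * q^ (2 ℕ.* r)))
          ≈⟨ *-congˡ (+-congˡ (-‿cong (sym (q-split _ _ (e r))))) ⟩
        θ 2 0 r * (1ₛ + - q^ (2 ℕ.* (suc r ℕ.+ r))) ∎
        where
        e : ∀ r → 2 ℕ.* (1 ℕ.+ r ℕ.+ r) ≡ (2 ℕ.* r ℕ.+ 2) ℕ.+ 2 ℕ.* r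
        e = solve-∀

      -- The finite triple product with c = 0: its product side contains the factor 1 - q^0. For
      -- index 0 the product would be empty, hence `suc n`.
      orthogonality : ∀ n → ∑ (suc (suc n)) (λ r → (q^ (2 ℕ.* (suc n ∸ r)) * α r) * (iP (suc n ∸ r) * iP (suc (suc n) ℕ.+ r))) ≈ 0ₛ
      orthogonality n = begin
        ∑ (suc (suc n)) (λ r → (q^ (2 ℕ.* (suc n ∸ r)) * α r) * X r)
          ≈⟨ ∑-cong (suc (suc n)) (λ r r≤ → trans (*-congʳ (coef r (ℕₚ.≤-pred r≤))) (*-assoc _ _ _)) ⟩
        ∑ (suc (suc n)) (λ r → q^ (2 ℕ.* suc n) * ((θ 2 0 r + θ 2 2 (suc r)) * X r))
          ≈⟨ ∑-*ˡ (suc (suc n)) _ _ ⟩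
        q^ (2 ℕ.* suc n) * ∑ (suc (suc n)) (λ r → (θ 2 0 r + θ 2 2 (suc r)) * X r)
          ≈⟨ *-congˡ zero-sum ⟩
        q^ (2 ℕ.* suc n) * 0ₛ ≈⟨ zeroʳ _ ⟩
        0ₛ ∎
        where
        X : ℕ → PS
        X r = iP (suc n ∸ r) * iP (suc (suc n) ℕ.+ r)
        coef : ∀ r → r ≤ suc n → q^ (2 ℕ.* (suc n ∸ r)) * α r ≈ q^ (2 ℕ.* suc n) * (θ 2 0 r + θ 2 2 (suc r))
        coef r r≤ = begin
          q^ (2 ℕ.* (suc n ∸ r)) * (θ 2 2 r * _)                  ≈⟨ *-congˡ (*-congʳ (θ-shift r)) ⟩
          q^ (2 ℕ.* (suc n ∸ r)) * ((q^ (2 ℕ.* r) * θ 2 0 r) * _) ≈⟨ solve 4 (λ a b c d → a :* ((b :* c) :* d) := (a :* b) :* (c :* d)) refl _ _ _ _ ⟩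
          (q^ (2 ℕ.* (suc n ∸ r)) * q^ (2 ℕ.* r)) * (θ 2 0 r * _)
            ≈⟨ *-cong (sym (q-split (2 ℕ.* (suc n ∸ r)) (2 ℕ.* r) (≡.trans (≡.cong (2 ℕ.*_) (≡.sym (ℕₚ.m∸n+n≡m r≤))) (ℕₚ.*-distribˡ-+ 2 (suc n ∸ r) r))))
                 (sym (η-factor r)) ⟩
          q^ (2 ℕ.* suc n) * (θ 2 0 r + θ 2 2 (suc r)) ∎
        zero-sum : ∑ (suc (suc n)) (λ r → (θ 2 0 r + θ 2 2 (suc r)) * X r) ≈ 0ₛ
        zero-sum = cancel-unit (P (suc n ℕ.+ suc (suc n))) (poch-unit 1 2 (suc n ℕ.+ suc (suc n)))
          (trans (*-comm _ _) (trans (finite-triple-product 0 2 ≡.refl (suc n))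
            (trans (trans (*-congʳ (poch-zero n)) (zeroˡ _)) (sym (zeroʳ _)))))

    -- The (unit-free) Bailey pair of the products ∏ 1/F_i.
    module Bailey (F iF β : ℕ → PS) (F*iF : ∀ n → F n * iF n ≈ 1ₛ)
      (β-0 : β 0 ≈ iF 0) (β-suc : ∀ n → β (suc n) ≈ β n * iF (suc n))
      (F-split : ∀ n r → r ≤ n → F n ≈ q^ (2 ℕ.* (n ∸ r)) * F r + 1-p^ (n ∸ r) * 1-p^ (suc n ℕ.+ r)) where

      private
        B : ℕ → PS
        B n = ∑ (suc n) (λ r → (α r * iF r) * (iP (n ∸ r) * iP (suc n ℕ.+ r)))

        -- `F-split` gives two parts: in one, F_r cancels against iF_r and the sum vanishes by
        -- `orthogonality`; in the other, both denominators lose a factor, which leaves `B n`.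
        F*B : ∀ n → F (suc n) * B (suc n) ≈ B n
        F*B n = begin
          F n′ * B n′ ≈⟨ ∑-*ˡ (suc n′) _ _ ⟨
          ∑ (suc n′) (λ r → F n′ * ((α r * iF r) * (iP (n′ ∸ r) * iP (suc n′ ℕ.+ r))))
            ≈⟨ ∑-cong (suc n′) (λ r r≤ → trans (*-congʳ (F-split n′ r (ℕₚ.≤-pred r≤))) (trans
                 (solve 8 (λ x f a b α i y z → (x :* f :+ a :* b) :* ((α :* i) :* (y :* z)) :=
                     ((x :* α) :* (y :* z)) :* (f :* i) :+ (α :* i) :* ((a :* y) :* (b :* z))) refl
                     (q^ (2 ℕ.* (n′ ∸ r))) (F r) (1-p^ (n′ ∸ r)) (1-p^ (suc n′ ℕ.+ r)) (α r) (iF r) (iP (n′ ∸ r)) (iP (suc n′ ℕ.+ r)))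
                 (+-cong (trans (*-congˡ (F*iF r)) (*-identityʳ _)) (*-congˡ (*-congˡ (iP-suc (n′ ℕ.+ r))))))) ⟩
          ∑ (suc n′) (λ r → (q^ (2 ℕ.* (n′ ∸ r)) * α r) * (iP (n′ ∸ r) * iP (suc n′ ℕ.+ r))
                          + (α r * iF r) * ((1-p^ (n′ ∸ r) * iP (n′ ∸ r)) * iP (n′ ℕ.+ r)))
            ≈⟨ trans (∑-+ (suc n′) _ _) (trans (+-congʳ (orthogonality n)) (+-identityˡ _)) ⟩
          ∑ (suc n′) (λ r → (α r * iF r) * ((1-p^ (n′ ∸ r) * iP (n′ ∸ r)) * iP (n′ ℕ.+ r)))
            ≈⟨ trans (+-congˡ (trans (*-congˡ (*-congʳ (*-congʳ (trans (≡⇒≈ (≡.cong 1-p^ (ℕₚ.n∸n≡0 n′))) 1-p^0))))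
                 (solve 3 (λ a x y → a :* ((:0 :* x) :* y) := :0) refl _ _ _))) (+-identityʳ _) ⟩
          ∑ n′ (λ r → (α r * iF r) * ((1-p^ (n′ ∸ r) * iP (n′ ∸ r)) * iP (n′ ℕ.+ r)))
            ≈⟨ ∑-cong n′ (λ r r≤ → *-congˡ (*-congʳ (trans (≡⇒≈ (≡.cong (λ m → 1-p^ m * iP m) (ℕₚ.+-∸-assoc 1 (ℕₚ.≤-pred r≤)))) (iP-suc (n ∸ r))))) ⟩
          B n ∎
          where n′ = suc n

        β≈B : ∀ n → β n ≈ B n
        β≈B zero = trans β-0 (sym (begin
          0ₛ + (1ₛ * (1ₛ + - q^ 2) * iF 0) * (iP 0 * iP 1)
            ≈⟨ solve 4 (λ a i x y → :0 :+ (:1 :* a :* i) :* (x :* y) := (i :* x) :* (a :* y)) refl _ _ _ _ ⟩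
          (iF 0 * iP 0) * (1-p^ 1 * iP 1) ≈⟨ *-congˡ (iP-suc 0) ⟩
          (iF 0 * iP 0) * iP 0            ≈⟨ *-cong (*-congˡ iP0) iP0 ⟩
          (iF 0 * 1ₛ) * 1ₛ                ≈⟨ solve 1 (λ x → (x :* :1) :* :1 := x) refl _ ⟩
          iF 0 ∎))
          where
          iP0 : iP 0 ≈ 1ₛ
          iP0 = trans (sym (trans (*-congʳ (≡⇒≈ (poch-0 M M))) (*-identityˡ _))) (P*iP 0)
        β≈B (suc n) = begin
          β (suc n)                              ≈⟨ β-suc n ⟩
          β n * iF (suc n)                       ≈⟨ *-congʳ (trans (β≈B n) (sym (F*B n))) ⟩
          (F (suc n) * B (suc n)) * iF (suc n)   ≈⟨ solve 3 (λ a b c → (a :* b) :* c := b :* (a :* c)) refl _ _ _ ⟩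
          B (suc n) * (F (suc n) * iF (suc n))   ≈⟨ trans (*-congˡ (F*iF (suc n))) (*-identityʳ _) ⟩
          B (suc n) ∎

      -- Insert the pair, interchange the sums, and sum over n by Durfee rectangles.
      bailey-sum : ∑ N (λ n → q^ (2 ℕ.* n ℕ.* (n ℕ.+ 1)) * β n) * P N
                 ≈ ∑ N (λ r → (α r * iF r) * q^ (2 ℕ.* r ℕ.* (r ℕ.+ 1)))
      bailey-sum = begin
        ∑ N (λ n → q^ (e n) * β n) * P N
          ≈⟨ *-congʳ (∑-cong′ N (λ n → trans (*-congˡ (β≈B n)) (sym (∑-*ˡ (suc n) _ _)))) ⟩
        ∑ N (λ n → ∑ (suc n) (λ r → q^ (e n) * ((α r * iF r) * (iP (n ∸ r) * iP (suc n ℕ.+ r))))) * P N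
          ≈⟨ *-congʳ (∑-triangle N (λ n r → q^ (e n) * ((α r * iF r) * (iP (n ∸ r) * iP (suc n ℕ.+ r))))) ⟩
        ∑ N (λ r → ∑ (N ∸ r) (λ k → G r k)) * P N
          ≈⟨ *-congʳ (∑-cong′ N (λ r → sym (∑-extend (G r) (ℕₚ.m∸n≤m N r) (tail r)))) ⟩
        ∑ N (λ r → ∑ N (λ k → G r k)) * P N
          ≈⟨ *-congʳ (∑-cong′ N (λ r → trans (∑-cong′ N (inner r)) (∑-*ˡ N _ _))) ⟩
        ∑ N (λ r → ((α r * iF r) * q^ (e r)) * durfee (suc (r ℕ.+ r))) * P N
          ≈⟨ *-congʳ (trans (∑-cong′ N (λ r → *-congˡ (durfee-rectangle _))) (∑-*ʳ N _ _)) ⟩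
        (∑ N (λ r → (α r * iF r) * q^ (e r)) * iP N) * P N
          ≈⟨ trans (*-assoc _ _ _) (trans (*-congˡ (trans (*-comm _ _) (P*iP N))) (*-identityʳ _)) ⟩
        ∑ N (λ r → (α r * iF r) * q^ (e r)) ∎
        where
        e : ℕ → ℕ
        e n = 2 ℕ.* n ℕ.* (n ℕ.+ 1)
        G : ℕ → ℕ → PS
        G r k = q^ (e (r ℕ.+ k)) * ((α r * iF r) * (iP (r ℕ.+ k ∸ r) * iP (suc (r ℕ.+ k) ℕ.+ r)))
        big : ∀ n → n ≤ e n
        big n = ℕₚ.≤-trans (ℕₚ.≤-trans (ℕₚ.m≤m+n n _) (ℕₚ.m≤m*n (2 ℕ.* n) (suc n)))
                  (ℕₚ.≤-reflexive (≡.cong (2 ℕ.* n ℕ.*_) (ℕₚ.+-comm 1 n)))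
        tail : ∀ r k → N ∸ r ≤ k → G r k ≈ 0ₛ
        tail r k h = q-big-* _ (ℕₚ.≤-trans (ℕₚ.≤-trans (ℕₚ.m≤n+m∸n N r) (ℕₚ.+-monoʳ-≤ r h)) (big (r ℕ.+ k)))
        -- The exponent beyond 2r(r + 1) is 2(k² + (2r + 1)k), so the inner sum is the rectangle sum
        -- with C = 2r + 1, independent of r after `durfee-rectangle`.
        e-split : ∀ r k → 2 ℕ.* (r ℕ.+ k) ℕ.* (r ℕ.+ k ℕ.+ 1) ≡ 2 ℕ.* r ℕ.* (r ℕ.+ 1) ℕ.+ 2 ℕ.* (k ℕ.* k ℕ.+ (1 ℕ.+ (r ℕ.+ r)) ℕ.* k)
        e-split = solve-∀
        idx : ∀ r k → 1 ℕ.+ (r ℕ.+ k) ℕ.+ r ≡ k ℕ.+ (1 ℕ.+ (r ℕ.+ r))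
        idx = solve-∀
        inner : ∀ r k → G r k ≈ ((α r * iF r) * q^ (e r)) * (q^ (2 ℕ.* (k ℕ.* k ℕ.+ suc (r ℕ.+ r) ℕ.* k)) * (iP k * iP (k ℕ.+ suc (r ℕ.+ r))))
        inner r k = trans (*-cong (q-split _ _ (e-split r k)) (*-congˡ (*-cong (≡⇒≈ (≡.cong iP (ℕₚ.m+n∸m≡n r k))) (≡⇒≈ (≡.cong iP (idx r k))))))
          (solve 4 (λ a b x y → (a :* b) :* (x :* y) := (x :* a) :* (b :* y)) refl _ _ _ _)

-- Lambert series of ω and ρ

module MockTheta where
  open PowerSeries
  open Inverses
  open TripleProducts
  open BaileyPairs

  Vanishing-*ʳ : ∀ {F} (G : ℕ → PS) → Vanishing F → Vanishing (λ k → F k ⊠ G k)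
  Vanishing-*ʳ {F} G v k = trans (*-congʳ (v k)) (zeroˡ (G k))
    where open Mod k

  Vanishing-*ˡ : ∀ {F} (G : ℕ → PS) → Vanishing F → Vanishing (λ k → G k ⊠ F k)
  Vanishing-*ˡ {F} G v k = trans (*-congˡ (v k)) (zeroʳ (G k))
    where open Mod k

  Vanishing-q : ∀ (e : ℕ → ℕ) → (∀ k → k ≤ e k) → Vanishing (λ k → q^ (e k))
  Vanishing-q e h k = q-big (h k)
    where open Mod k

  module LambertKernels (π : Prec) where
    open Series π
    open Units π

    inv-* : ∀ {f g} → f 0 ≡ 1ℚ → g 0 ≡ 1ℚ → inv (f * g) ≈ inv f * inv g
    inv-* {f} {g} f0 g0 = cancel-unit (f * g) (unit-⊠ {f} {g} f0 g0) (trans (inv-r (unit-⊠ {f} {g} f0 g0))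
      (sym (trans (solve 4 (λ a b c d → (a :* b) :* (c :* d) := (a :* c) :* (b :* d)) refl f g (inv f) (inv g))
        (trans (*-cong (inv-r f0) (inv-r g0)) (*-identityˡ _)))))

    u : ℕ → PS
    u r = q^ (1 ℕ.+ 2 ℕ.* r)

    1/1-u 1/1-u³ : ℕ → PS
    1/1-u  r = inv (1ₛ + - u r)
    1/1-u³ r = inv (1ₛ + - q^ (3 ℕ.+ 6 ℕ.* r))

    u³ : ∀ r → q^ (3 ℕ.+ 6 ℕ.* r) ≈ u r * (u r * u r)
    u³ r = trans (q-split (1 ℕ.+ 2 ℕ.* r) ((1 ℕ.+ 2 ℕ.* r) ℕ.+ (1 ℕ.+ 2 ℕ.* r)) (e r)) (*-congˡ (q-+ _ _))
      where
      e : ∀ r → 3 ℕ.+ 6 ℕ.* r ≡ (1 ℕ.+ 2 ℕ.* r) ℕ.+ ((1 ℕ.+ 2 ℕ.* r) ℕ.+ (1 ℕ.+ 2 ℕ.* r))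
      e = solve-∀

    ωKernel ρKernel : ℕ → PS
    ωKernel r = (1ₛ + u r) * 1/1-u r
    ρKernel r = (1ₛ + - u r + - (u r * u r) + u r * (u r * u r)) * 1/1-u³ r

    1-u-unit : ∀ r → (1ₛ + - u r) 0 ≡ 1ℚ
    1-u-unit r = unit-1-q (2 ℕ.* r)

    1-u³-unit : ∀ r → (1ₛ + - q^ (3 ℕ.+ 6 ℕ.* r)) 0 ≡ 1ℚ
    1-u³-unit r = unit-1-q (2 ℕ.+ 6 ℕ.* r)

    1/1-u≈ : ∀ r → 1/1-u r ≈ (1ₛ + u r + u r * u r) * 1/1-u³ r
    1/1-u≈ r = cancel-unit (1ₛ + - u r) (1-u-unit r) (trans (inv-r (1-u-unit r)) (sym (begin
      (1ₛ + - u r) * ((1ₛ + u r + u r * u r) * 1/1-u³ r)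
        ≈⟨ solve 2 (λ x w → (:1 :+ :- x) :* ((:1 :+ x :+ x :* x) :* w) := (:1 :+ :- (x :* (x :* x))) :* w) refl (u r) _ ⟩
      (1ₛ + - (u r * (u r * u r))) * 1/1-u³ r ≈⟨ *-congʳ (+-congˡ (-‿cong (sym (u³ r)))) ⟩
      (1ₛ + - q^ (3 ℕ.+ 6 ℕ.* r)) * 1/1-u³ r  ≈⟨ inv-r (1-u³-unit r) ⟩
      1ₛ ∎)))

  module _ (N : ℕ) where
    open Mod N
    open Units (fin N)
    open LambertKernels (fin N)
    open FiniteTripleProduct 1 (fin N) using (P; 1-p^)

    private
      -- Valid for every c. The choice c = 2 gives F = (1 - u)², needed for ω; c = -1 gives F = 1 +
      -- u + u² = (1 - u³)/(1 - u), needed for ρ.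
      quadratic-split : ∀ c n r → r ≤ n →
        1ₛ + - (c * u n) + u n * u n
          ≈ q^ (2 ℕ.* (n ∸ r)) * (1ₛ + - (c * u r) + u r * u r) + 1-p^ (n ∸ r) * 1-p^ (suc n ℕ.+ r)
      quadratic-split c n r r≤n = begin
        1ₛ + - (c * u n) + u n * u n
          ≈⟨ +-cong (+-congˡ (-‿cong (*-congˡ un))) (*-cong un un) ⟩
        1ₛ + - (c * (x * u r)) + (x * u r) * (x * u r)
          ≈⟨ solve 3 (λ c x v → :1 :+ :- (c :* (x :* v)) :+ (x :* v) :* (x :* v)
               := x :* (:1 :+ :- (c :* v) :+ v :* v) :+ (:1 :+ :- x) :* (:1 :+ :- (x :* (v :* v)))) refl c x (u r) ⟩
        x * (1ₛ + - (c * u r) + u r * u r) + (1ₛ + - x) * (1ₛ + - (x * (u r * u r)))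
          ≈⟨ +-congˡ (*-congˡ (+-congˡ (-‿cong (sym (trans (q-split (2 ℕ.* (n ∸ r)) _ e₂) (*-congˡ (q-+ _ _))))))) ⟩
        x * (1ₛ + - (c * u r) + u r * u r) + 1-p^ (n ∸ r) * 1-p^ (suc n ℕ.+ r) ∎
        where
        x = q^ (2 ℕ.* (n ∸ r))
        l₁ : ∀ k r → 1 ℕ.+ 2 ℕ.* (k ℕ.+ r) ≡ 2 ℕ.* k ℕ.+ (1 ℕ.+ 2 ℕ.* r)
        l₁ = solve-∀
        un : u n ≈ x * u r
        un = q-split (2 ℕ.* (n ∸ r)) (1 ℕ.+ 2 ℕ.* r) (≡.trans (≡.cong (λ m → 1 ℕ.+ 2 ℕ.* m) (≡.sym (ℕₚ.m∸n+n≡m r≤n))) (l₁ (n ∸ r) r))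
        l₂ : ∀ k r → 2 ℕ.* (1 ℕ.+ (k ℕ.+ r) ℕ.+ r) ≡ 2 ℕ.* k ℕ.+ ((1 ℕ.+ 2 ℕ.* r) ℕ.+ (1 ℕ.+ 2 ℕ.* r))
        l₂ = solve-∀
        e₂ : 2 ℕ.* (suc n ℕ.+ r) ≡ 2 ℕ.* (n ∸ r) ℕ.+ ((1 ℕ.+ 2 ℕ.* r) ℕ.+ (1 ℕ.+ 2 ℕ.* r))
        e₂ = ≡.trans (≡.cong (λ m → 2 ℕ.* (suc m ℕ.+ r)) (≡.sym (ℕₚ.m∸n+n≡m r≤n))) (l₂ (n ∸ r) r)

      e : ℕ → ℕ
      e n = 2 ℕ.* n ℕ.* (n ℕ.+ 1)

      e-big : ∀ n → n ≤ e n
      e-big n = ℕₚ.≤-trans (ℕₚ.≤-trans (ℕₚ.m≤m+n n _) (ℕₚ.m≤m*n (2 ℕ.* n) (suc n)))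
                (ℕₚ.≤-reflexive (≡.cong (2 ℕ.* n ℕ.*_) (ℕₚ.+-comm 1 n)))

      -- The factor 1 - q^(4r+2) of the Bailey pair is 1 - u², which turns 1/F_r into the kernel;
      -- the exponents r² + r and 2r(r + 1) add up to 3r(r + 1).
      prefactor : ∀ r i k → (1ₛ + - (u r * u r)) * i ≈ k →
        (θ 2 2 r * (1ₛ + - q^ (2 ℕ.* (suc r ℕ.+ r))) * i) * q^ (e r) ≈ θ 6 6 r * k
      prefactor r i k h = begin
        (θ 2 2 r * (1ₛ + - q^ (2 ℕ.* (suc r ℕ.+ r))) * i) * q^ (e r)
          ≈⟨ *-congʳ (*-congʳ (*-cong (θ-explicit (λ r → r ℕ.* r ℕ.+ r) ≡.refl s₂ r)
               (+-congˡ (-‿cong (q-split (1 ℕ.+ 2 ℕ.* r) (1 ℕ.+ 2 ℕ.* r) (uu r)))))) ⟩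
        ((sg r * q^ (r ℕ.* r ℕ.+ r)) * (1ₛ + - (u r * u r)) * i) * q^ (e r)
          ≈⟨ solve 5 (λ s a b i c → ((s :* a) :* b :* i) :* c := (s :* (a :* c)) :* (b :* i)) refl _ _ _ _ _ ⟩
        (sg r * (q^ (r ℕ.* r ℕ.+ r) * q^ (e r))) * ((1ₛ + - (u r * u r)) * i)
          ≈⟨ *-cong (trans (*-congˡ (sym (q-split _ _ (e₃ r)))) (sym (θ-explicit (λ r → 3 ℕ.* (r ℕ.* r ℕ.+ r)) ≡.refl s₆ r))) h ⟩
        θ 6 6 r * k ∎
        where
        open θ-Properties (fin N)
        s₂ : ∀ r → (1 ℕ.+ r) ℕ.* (1 ℕ.+ r) ℕ.+ (1 ℕ.+ r) ≡ (2 ℕ.* r ℕ.+ 2) ℕ.+ (r ℕ.* r ℕ.+ r)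
        s₂ = solve-∀
        s₆ : ∀ r → 3 ℕ.* ((1 ℕ.+ r) ℕ.* (1 ℕ.+ r) ℕ.+ (1 ℕ.+ r)) ≡ (6 ℕ.* r ℕ.+ 6) ℕ.+ 3 ℕ.* (r ℕ.* r ℕ.+ r)
        s₆ = solve-∀
        uu : ∀ r → 2 ℕ.* ((1 ℕ.+ r) ℕ.+ r) ≡ (1 ℕ.+ 2 ℕ.* r) ℕ.+ (1 ℕ.+ 2 ℕ.* r)
        uu = solve-∀
        e₃ : ∀ r → 3 ℕ.* (r ℕ.* r ℕ.+ r) ≡ (r ℕ.* r ℕ.+ r) ℕ.+ 2 ℕ.* r ℕ.* (r ℕ.+ 1)
        e₃ = solve-∀

    omega-lambert-mod : omega * Jm 2 ≈ Σ∞ (λ r → θ 6 6 r * ωKernel r)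
    omega-lambert-mod = begin
      omega * Jm 2
        ≈⟨ *-cong (trans (Σ∞≈∑ N N ℕₚ.≤-refl van) (∑-cong′ N term)) (pochInf≈ N 2 2 (s≤s z≤n) (s≤s z≤n) ℕₚ.≤-refl) ⟩
      ∑ N (λ n → q^ (e n) * β n) * P N
        ≈⟨ bailey-sum ⟩
      ∑ N (λ r → (θ 2 2 r * (1ₛ + - q^ (2 ℕ.* (suc r ℕ.+ r))) * iF r) * q^ (e r))
        ≈⟨ ∑-cong′ N (λ r → prefactor r _ _ (kernel r)) ⟩
      ∑ N (λ r → θ 6 6 r * ωKernel r)
        ≈⟨ Σ∞≈∑ N N ℕₚ.≤-refl (Vanishing-*ʳ ωKernel (θ-vanish 6 (s≤s z≤n))) ⟨
      Σ∞ (λ r → θ 6 6 r * ωKernel r) ∎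
      where
      F iF β : ℕ → PS
      F r  = 1ₛ + - ((1ₛ + 1ₛ) * u r) + u r * u r
      iF r = 1/1-u r * 1/1-u r
      β n  = inv (poch 1 2 (suc n) ^ₛ 2)
      F*iF : ∀ r → F r * iF r ≈ 1ₛ
      F*iF r = trans (solve 2 (λ v w → (:1 :+ :- ((:1 :+ :1) :* v) :+ v :* v) :* (w :* w) := ((:1 :+ :- v) :* w) :* ((:1 :+ :- v) :* w)) refl (u r) (1/1-u r))
        (trans (*-cong (inv-r (1-u-unit r)) (inv-r (1-u-unit r))) (*-identityˡ _))
      kernel : ∀ r → (1ₛ + - (u r * u r)) * iF r ≈ ωKernel r
      kernel r = trans (solve 2 (λ v w → (:1 :+ :- (v :* v)) :* (w :* w) := ((:1 :+ v) :* w) :* ((:1 :+ :- v) :* w)) refl (u r) (1/1-u r))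
        (trans (*-congˡ (inv-r (1-u-unit r))) (*-identityʳ _))
      β≈ : ∀ n → β n ≈ inv (poch 1 2 (suc n)) * inv (poch 1 2 (suc n))
      β≈ n = trans (inv-cong (unit-⊠ {p} {p ⊠ 1ₛ} p0 (unit-⊠ {p} p0 1-0)) (unit-⊠ {p} {p} p0 p0) (*-congˡ (*-identityʳ p))) (inv-* {p} {p} p0 p0)
        where
        p = poch 1 2 (suc n)
        p0 = poch-unit 0 2 (suc n)
      p-suc : ∀ n → inv (poch 1 2 (suc n)) ≈ inv (poch 1 2 n) * 1/1-u n
      p-suc n = trans (≡⇒≈ (≡.cong inv (poch-suc 1 2 n))) (inv-* {poch 1 2 n} (poch-unit 0 2 n) (1-u-unit n))
      inv-poch-0 : inv (poch 1 2 0) ≈ 1ₛ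
      inv-poch-0 = trans (sym (trans (*-congʳ (≡⇒≈ (poch-0 1 2))) (*-identityˡ _))) (inv-r {poch 1 2 0} ≡.refl)
      open Bailey N F iF β F*iF
        (trans (β≈ 0) (trans (*-cong (p-suc 0) (p-suc 0)) (trans (*-cong (*-congʳ inv-poch-0) (*-congʳ inv-poch-0)) (solve 1 (λ x → (:1 :* x) :* (:1 :* x) := x :* x) refl _))))
        (λ n → trans (β≈ (suc n)) (trans (*-cong (p-suc (suc n)) (p-suc (suc n))) (trans
           (solve 2 (λ a b → (a :* b) :* (a :* b) := (a :* a) :* (b :* b)) refl _ _) (*-congʳ (sym (β≈ n))))))
        (quadratic-split (1ₛ + 1ₛ))
      term≡ : ∀ n → ωTerm n ≡ q^ (e n) ⊠ β n
      term≡ n = ≡.trans (⊠-def _ _) (≡.cong₂ _⊠_ (q-def _) (≡.cong inv (^^-def _ 2)))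
      term : ∀ n → ωTerm n ≈ q^ (e n) * β n
      term n = ≡⇒≈ (term≡ n)
      van : Vanishing ωTerm
      van k = ≡.subst (λ f → f ≈[ fin k ] 0ₛ) (≡.sym (term≡ k)) (Vanishing-*ʳ β (Vanishing-q e e-big) k)

    rho-lambert-mod : rho * Jm 2 ≈ Σ∞ (λ r → θ 6 6 r * ρKernel r)
    rho-lambert-mod = begin
      rho * Jm 2
        ≈⟨ *-cong (trans (Σ∞≈∑ N N ℕₚ.≤-refl van) (∑-cong′ N term)) (pochInf≈ N 2 2 (s≤s z≤n) (s≤s z≤n) ℕₚ.≤-refl) ⟩
      ∑ N (λ n → q^ (e n) * β n) * P N
        ≈⟨ bailey-sum ⟩
      ∑ N (λ r → (θ 2 2 r * (1ₛ + - q^ (2 ℕ.* (suc r ℕ.+ r))) * iF r) * q^ (e r))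
        ≈⟨ ∑-cong′ N (λ r → prefactor r _ _ (kernel r)) ⟩
      ∑ N (λ r → θ 6 6 r * ρKernel r)
        ≈⟨ Σ∞≈∑ N N ℕₚ.≤-refl (Vanishing-*ʳ ρKernel (θ-vanish 6 (s≤s z≤n))) ⟨
      Σ∞ (λ r → θ 6 6 r * ρKernel r) ∎
      where
      F iF β : ℕ → PS
      F r  = 1ₛ + - (- 1ₛ * u r) + u r * u r
      iF r = (1ₛ + - u r) * 1/1-u³ r
      β n  = poch 1 2 (suc n) * inv (poch 3 6 (suc n))
      F*iF : ∀ r → F r * iF r ≈ 1ₛ
      F*iF r = trans (solve 2 (λ v w → (:1 :+ :- ((:- :1) :* v) :+ v :* v) :* ((:1 :+ :- v) :* w) := (:1 :+ :- (v :* (v :* v))) :* w) refl (u r) (1/1-u³ r))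
        (trans (*-congʳ (+-congˡ (-‿cong (sym (u³ r))))) (inv-r (1-u³-unit r)))
      kernel : ∀ r → (1ₛ + - (u r * u r)) * iF r ≈ ρKernel r
      kernel r = solve 2 (λ v w → (:1 :+ :- (v :* v)) :* ((:1 :+ :- v) :* w) := (:1 :+ :- v :+ :- (v :* v) :+ v :* (v :* v)) :* w) refl (u r) (1/1-u³ r)
      p-suc : ∀ n → inv (poch 3 6 (suc n)) ≈ inv (poch 3 6 n) * 1/1-u³ n
      p-suc n = trans (≡⇒≈ (≡.cong inv (poch-suc 3 6 n))) (inv-* {poch 3 6 n} (poch-unit 2 6 n) (1-u³-unit n))
      inv-poch-0 : inv (poch 3 6 0) ≈ 1ₛ
      inv-poch-0 = trans (sym (trans (*-congʳ (≡⇒≈ (poch-0 3 6))) (*-identityˡ _))) (inv-r {poch 3 6 0} ≡.refl)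
      open Bailey N F iF β F*iF
        (trans (*-cong (trans (≡⇒≈ (poch-suc 1 2 0)) (*-congʳ (≡⇒≈ (poch-0 1 2)))) (trans (p-suc 0) (*-congʳ inv-poch-0)))
           (solve 2 (λ a b → (:1 :* a) :* (:1 :* b) := a :* b) refl _ _))
        (λ n → trans (*-cong (≡⇒≈ (poch-suc 1 2 (suc n))) (p-suc (suc n)))
           (solve 4 (λ a b c d → (a :* b) :* (c :* d) := (a :* c) :* (b :* d)) refl _ _ _ _))
        (quadratic-split (- 1ₛ))
      term≡ : ∀ n → ρTerm n ≡ q^ (e n) ⊠ poch 1 2 (suc n) ⊠ inv (poch 3 6 (suc n))
      term≡ n = ≡.trans (⊠-def _ _) (≡.cong (_⊠ inv (poch 3 6 (suc n))) (≡.trans (⊠-def _ _) (≡.cong (_⊠ poch 1 2 (suc n)) (q-def _))))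
      term : ∀ n → ρTerm n ≈ q^ (e n) * β n
      term n = trans (≡⇒≈ (term≡ n)) (*-assoc _ _ _)
      van : Vanishing ρTerm
      van k = ≡.subst (λ f → f ≈[ fin k ] 0ₛ) (≡.sym (term≡ k)) (Vanishing-*ʳ (λ n → inv (poch 3 6 (suc n))) (Vanishing-*ʳ (λ n → poch 1 2 (suc n)) (Vanishing-q e e-big)) k)

  module K∞ = LambertKernels ∞

  omega-lambert : omega ⊠ Jm 2 ≈[ ∞ ] Σ∞ (λ r → θ 6 6 r ⊠ K∞.ωKernel r)
  omega-lambert = limit omega-lambert-mod

-- Overpartitions in a box and their q-Delannoy recurrence

module Overpartitions where
  open PowerSeries

  private variable
    A B : Set

  Σℓ : (A → ℚ) → List A → ℚ
  Σℓ h []       = 0ℚ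
  Σℓ h (x ∷ xs) = h x ℚ.+ Σℓ h xs

  Σℓ-++ : ∀ (h : A → ℚ) xs ys → Σℓ h (xs ++ ys) ≡ Σℓ h xs ℚ.+ Σℓ h ys
  Σℓ-++ h []       ys = ≡.sym (ℚₚ.+-identityˡ _)
  Σℓ-++ h (x ∷ xs) ys = ≡.trans (≡.cong (h x ℚ.+_) (Σℓ-++ h xs ys)) (≡.sym (ℚₚ.+-assoc (h x) (Σℓ h xs) (Σℓ h ys)))

  Σℓ-map : ∀ (h : B → ℚ) (f : A → B) xs → Σℓ h (List.map f xs) ≡ Σℓ (h ∘ f) xs
  Σℓ-map h f []       = ≡.refl
  Σℓ-map h f (x ∷ xs) = ≡.cong (h (f x) ℚ.+_) (Σℓ-map h f xs)

  Σℓ-concatMap : ∀ (h : B → ℚ) (f : A → List B) xs → Σℓ h (concatMap f xs) ≡ Σℓ (λ x → Σℓ h (f x)) xs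
  Σℓ-concatMap h f []       = ≡.refl
  Σℓ-concatMap h f (x ∷ xs) = ≡.trans (Σℓ-++ h (f x) _) (≡.cong (Σℓ h (f x) ℚ.+_) (Σℓ-concatMap h f xs))

  Σℓ-cong : ∀ {h h′ : A → ℚ} → (∀ x → h x ≡ h′ x) → ∀ xs → Σℓ h xs ≡ Σℓ h′ xs
  Σℓ-cong e []       = ≡.refl
  Σℓ-cong e (x ∷ xs) = ≡.cong₂ ℚ._+_ (e x) (Σℓ-cong e xs)

  Σℓ-applyUpTo : ∀ (h : A → ℚ) f n → Σℓ h (applyUpTo f n) ≡ ℚK.∑ n (h ∘ f)
  Σℓ-applyUpTo h f zero    = ≡.refl
  Σℓ-applyUpTo h f (suc n) = ≡.trans (≡.cong (h (f 0) ℚ.+_) (Σℓ-applyUpTo h (f ∘ suc) n)) (≡.sym (ℚK.∑-head n (h ∘ f)))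

  -- Σ h(λ) q^|λ| over the overpartitions λ with parts ≤ p
  weighted : ℕ → (List Block → ℚ) → PS
  weighted p h n = Σℓ h (overpartsBounded n p)

  q-⊠-∸ : ∀ e f {n} → e ≤ n → (q^ e ⊠ f) n ≡ f (n ∸ e)
  q-⊠-∸ e f {n} e≤n = ≡.subst (λ m → (q^ e ⊠ f) m ≡ f (n ∸ e)) (ℕₚ.m+[n∸m]≡n e≤n) (q-⊠-+ e f (n ∸ e))

  module _ (p : ℕ) (h : List Block → ℚ) where
    private
      tails : ℕ → PS
      tails k = weighted p (λ rest → h ((suc p , suc k , false) ∷ rest)) ⊞ weighted p (λ rest → h ((suc p , suc k , true) ∷ rest))

    weighted-list : ∀ n → weighted (suc p) h n ≡ weighted p h n ℚ.+ ℚK.∑ n (λ k → (q^ (suc k ℕ.* suc p) ⊠ tails k) n)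
    weighted-list n = ≡.trans (Σℓ-++ h (overpartsBounded n p) _) (≡.cong (weighted p h n ℚ.+_)
      (≡.trans (Σℓ-concatMap h _ (upTo n)) (≡.trans (Σℓ-applyUpTo _ id n) (ℚK.∑-cong′ n block))))
      where
      block : ∀ k → Σℓ h (if ⌊ suc k ℕ.* suc p ≤? n ⌋
         then concatMap (λ b → List.map (λ rest → (suc p , suc k , b) ∷ rest) (overpartsBounded (n ∸ suc k ℕ.* suc p) p)) (false ∷ true ∷ [])
         else []) ≡ (q^ (suc k ℕ.* suc p) ⊠ tails k) n
      block k with suc k ℕ.* suc p ≤? n
      ... | no  h≰ = ≡.sym (q-⊠-< _ _ (ℕₚ.≰⇒> h≰))
      ... | yes h≤ = begin
        Σℓ h (concatMap f (false ∷ true ∷ []))        ≡⟨ Σℓ-concatMap h f (false ∷ true ∷ []) ⟩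
        Σℓ h (f false) ℚ.+ (Σℓ h (f true) ℚ.+ 0ℚ)     ≡⟨ ≡.cong₂ ℚ._+_ (Σℓ-map h _ L) (≡.trans (ℚₚ.+-identityʳ _) (Σℓ-map h _ L)) ⟩
        _                                             ≡⟨ ⊞-at _ _ _ ⟨
        tails k (n ∸ suc k ℕ.* suc p)                 ≡⟨ q-⊠-∸ _ (tails k) h≤ ⟨
        (q^ (suc k ℕ.* suc p) ⊠ tails k) n            ∎
        where
        open ≡.≡-Reasoning
        L = overpartsBounded (n ∸ suc k ℕ.* suc p) p
        f : Bool → List (List Block)
        f b = List.map (λ rest → (suc p , suc k , b) ∷ rest) L

    weighted-suc : ∀ N → let open Mod N in
      weighted (suc p) h ≈ weighted p h + ∑ N (λ k → q^ (suc k ℕ.* suc p) * tails k)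
    weighted-suc N = mk λ n n<N → ≡.trans (weighted-list n) (≡.trans (≡.cong (weighted p h n ℚ.+_)
        (≡.trans (≡.sym (ℚK.∑-extend _ (ℕₚ.<⇒≤ n<N) (λ k n≤k → q-⊠-< _ _ (ℕₚ.≤-trans (s≤s n≤k) (ℕₚ.m≤m*n (suc k) (suc p))))))
          (≡.sym (∑-coeff N _ n))))
        (≡.sym (⊞-at _ _ n)))
      where open Mod N

  byParts : ℕ → (ℕ → ℚ) → PS
  byParts p g = weighted p (g ∘ numParts)

  -- Delete one copy of the part p + 1. With two or more copies the overline survives on the rest;
  -- with a single copy the two choices of overline leave the same overpartition. So those with
  -- parts ≤ p occur once more than the others.
  byParts-suc : ∀ p g N → let open Mod N in
    byParts (suc p) g ≈ byParts p g + q^ suc p * (byParts (suc p) (g ∘ suc) + byParts p (g ∘ suc))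
  byParts-suc p g N = begin
    byParts (suc p) g
      ≈⟨ weighted-suc p (g ∘ numParts) N ⟩
    byParts p g + ∑ N f
      ≈⟨ +-congˡ (trans (sym (∑-extend f (ℕₚ.n≤1+n N) (λ k h → q-big-* _ (ℕₚ.≤-trans h (ℕₚ.≤-trans (ℕₚ.n≤1+n k) (ℕₚ.m≤m*n (suc k) (suc p)))))))
           (trans (∑-head N f) (+-cong (*-congʳ (q-cong (ℕₚ.*-identityˡ (suc p))))
             (trans (∑-cong′ N (λ k → trans (*-congʳ (q-+ (suc p) (suc k ℕ.* suc p))) (*-assoc _ _ _))) (∑-*ˡ N _ _))))) ⟩
    byParts p g + (q^ suc p * (byParts p (g ∘ suc) + byParts p (g ∘ suc)) + q^ suc p * S)
      ≈⟨ solve 4 (λ g x a s → g :+ (x :* (a :+ a) :+ x :* s) := g :+ x :* ((a :+ s) :+ a)) refl (byParts p g) (q^ suc p) (byParts p (g ∘ suc)) S ⟩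
    byParts p g + q^ suc p * ((byParts p (g ∘ suc) + S) + byParts p (g ∘ suc))
      ≈⟨ +-congˡ (*-congˡ (+-congʳ (sym (weighted-suc p (g ∘ suc ∘ numParts) N)))) ⟩
    byParts p g + q^ suc p * (byParts (suc p) (g ∘ suc) + byParts p (g ∘ suc)) ∎
    where
    open Mod N
    f : ℕ → PS
    f k = q^ (suc k ℕ.* suc p) * (byParts p (λ m → g (suc k ℕ.+ m)) + byParts p (λ m → g (suc k ℕ.+ m)))
    S : PS
    S = ∑ N (λ k → q^ (suc k ℕ.* suc p) * (byParts p (λ m → g (suc (suc k ℕ.+ m))) + byParts p (λ m → g (suc (suc k ℕ.+ m)))))

  byParts-0 : ∀ g n → byParts 0 g n ≡ constPS (g 0) n
  byParts-0 g zero    = ℚₚ.+-identityʳ (g 0)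
  byParts-0 g (suc n) = ≡.refl

  byParts-cong : ∀ p {g g′} → (∀ m → g m ≡ g′ m) → ∀ n → byParts p g n ≡ byParts p g′ n
  byParts-cong p e n = Σℓ-cong (λ x → e (numParts x)) (overpartsBounded n p)

  -- Having K parts costs size at least K; in the induction every part removed by `byParts-suc` pays
  -- a positive power of q.
  byParts-vanishing : ∀ p K g → (∀ m → m < K → g m ≡ 0ℚ) → byParts p g ≈[ fin K ] 0ₛ
  byParts-vanishing p       zero    g z = mk (λ _ ())
  byParts-vanishing zero    (suc K) g z = mk λ n _ → ≡.trans (byParts-0 g n) (≡.trans (lem n) (≡.sym (0-at n)))
    where
    lem : ∀ n → constPS (g 0) n ≡ 0ℚ
    lem zero    = z 0 (s≤s z≤n)
    lem (suc n) = ≡.refl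
  byParts-vanishing (suc p) (suc K) g z = begin
    byParts (suc p) g
      ≈⟨ byParts-suc p g (suc K) ⟩
    byParts p g + q^ suc p * (byParts (suc p) (g ∘ suc) + byParts p (g ∘ suc))
      ≈⟨ +-cong (byParts-vanishing p (suc K) g z) (gain K p (K.trans (K.+-cong
           (byParts-vanishing (suc p) K (g ∘ suc) (λ m h → z (suc m) (s≤s h)))
           (byParts-vanishing p K (g ∘ suc) (λ m h → z (suc m) (s≤s h)))) (K.+-identityˡ _))) ⟩
    0ₛ + q^ suc p * 0ₛ ≈⟨ solve 1 (λ x → :0 :+ x :* :0 := :0) refl _ ⟩
    0ₛ ∎
    where
    open Mod (suc K)
    module K = Mod K

  -- ind m k = [m ≤ k]
  ind : ℕ → ℕ → ℚ
  ind zero    k       = 1ℚ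
  ind (suc m) zero    = 0ℚ
  ind (suc m) (suc k) = ind m k

  ind-≤ : ∀ {m k} → m ≤ k → ind m k ≡ 1ℚ
  ind-≤ z≤n     = ≡.refl
  ind-≤ (s≤s h) = ind-≤ h

  ind-> : ∀ {m k} → k < m → ind m k ≡ 0ℚ
  ind-> {suc m} {zero}  _       = ≡.refl
  ind-> {suc m} {suc k} (s≤s h) = ind-> h

  -- the generating function of the overpartitions with at most k parts, each at most p
  opaque
    D : ℕ → ℕ → PS
    D p k = byParts p (λ m → ind m k)

    D-def : ∀ p k → byParts p (λ m → ind m k) ≡ D p k
    D-def p k = ≡.refl

  -- D satisfies a q-analogue of the Delannoy recurrence; that it also satisfies the transposed one gives D p k = D k p.
  module Delannoy (N : ℕ) where
    open Mod N

    private
      zero-weight : ∀ p → byParts p (λ _ → 0ℚ) ≈ 0ₛ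
      zero-weight p = byParts-vanishing p N (λ _ → 0ℚ) (λ _ _ → ≡.refl)

    opaque
      unfolding D

      D-suc-suc : ∀ p k → D (suc p) (suc k) ≈ D p (suc k) + q^ suc p * (D (suc p) k + D p k)
      D-suc-suc p k = byParts-suc p (λ m → ind m (suc k)) N

      D-0ˡ : ∀ k → D 0 k ≈ 1ₛ
      D-0ˡ k = pointwise (λ n → ≡.trans (byParts-0 (λ m → ind m k) n) (≡.cong (λ f → f n) 1-def))

      D-0ʳ : ∀ p → D p 0 ≈ 1ₛ
      D-0ʳ zero    = D-0ˡ 0
      D-0ʳ (suc p) = begin
        D (suc p) 0 ≈⟨ byParts-suc p (λ m → ind m 0) N ⟩
        D p 0 + q^ suc p * (byParts (suc p) (λ _ → 0ℚ) + byParts p (λ _ → 0ℚ))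
          ≈⟨ +-cong (D-0ʳ p) (*-congˡ (+-cong (zero-weight (suc p)) (zero-weight p))) ⟩
        1ₛ + q^ suc p * (0ₛ + 0ₛ) ≈⟨ solve 1 (λ x → :1 :+ x :* (:0 :+ :0) := :1) refl _ ⟩
        1ₛ ∎

    private
      q1+ : ∀ k → q^ suc k ≈ q^ 1 * q^ k
      q1+ k = q-+ 1 k

    -- Expanding the corner once by the known recurrence and then by this one, inductively,
    -- expresses it through six neighbours, and the result is symmetric under exchange of the two
    -- directions.
    D-suc-sucʳ : ∀ p k → D (suc p) (suc k) ≈ D (suc p) k + q^ suc k * (D p (suc k) + D p k)
    D-suc-sucʳ zero zero = begin
      D 1 1                               ≈⟨ D-suc-suc 0 0 ⟩
      D 0 1 + q^ 1 * (D 1 0 + D 0 0)      ≈⟨ +-cong (trans (D-0ˡ 1) (sym (D-0ʳ 1))) (*-congˡ (+-congʳ (trans (D-0ʳ 1) (sym (D-0ˡ 1))))) ⟩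
      D 1 0 + q^ 1 * (D 0 1 + D 0 0)      ∎
    D-suc-sucʳ zero (suc k) = begin
      D 1 (suc (suc k))
        ≈⟨ trans (D-suc-suc 0 (suc k)) (+-cong (D-0ˡ _) (*-congˡ (+-cong (D-suc-sucʳ zero k) (D-0ˡ _)))) ⟩
      1ₛ + q^ 1 * ((D 1 k + q^ suc k * (D 0 (suc k) + D 0 k)) + 1ₛ)
        ≈⟨ +-congˡ (*-congˡ (+-congʳ (+-congˡ (*-congˡ (+-cong (D-0ˡ _) (D-0ˡ _)))))) ⟩
      1ₛ + q^ 1 * ((D 1 k + q^ suc k * (1ₛ + 1ₛ)) + 1ₛ)
        ≈⟨ solve 3 (λ x d y → :1 :+ x :* ((d :+ y :* (:1 :+ :1)) :+ :1) := (:1 :+ x :* (d :+ :1)) :+ (x :* y) :* (:1 :+ :1)) refl _ _ _ ⟩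
      (1ₛ + q^ 1 * (D 1 k + 1ₛ)) + (q^ 1 * q^ suc k) * (1ₛ + 1ₛ)
        ≈⟨ +-cong (trans (+-cong (sym (D-0ˡ _)) (*-congˡ (+-congˡ (sym (D-0ˡ _))))) (sym (D-suc-suc 0 k)))
                  (*-cong (sym (q1+ (suc k))) (+-cong (sym (D-0ˡ _)) (sym (D-0ˡ _)))) ⟩
      D 1 (suc k) + q^ suc (suc k) * (D 0 (suc (suc k)) + D 0 (suc k)) ∎
    D-suc-sucʳ (suc p) zero = begin
      D (2 ℕ.+ p) 1
        ≈⟨ trans (D-suc-suc (suc p) 0) (+-congˡ (*-cong (q1+ (suc p)) (+-cong (D-0ʳ _) (D-0ʳ _)))) ⟩
      D (suc p) 1 + (q^ 1 * q^ suc p) * (1ₛ + 1ₛ)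
        ≈⟨ +-congʳ (trans (D-suc-sucʳ p zero) (+-cong (D-0ʳ _) (*-congˡ (+-congˡ (D-0ʳ _))))) ⟩
      (1ₛ + q^ 1 * (D p 1 + 1ₛ)) + (q^ 1 * q^ suc p) * (1ₛ + 1ₛ)
        ≈⟨ solve 3 (λ x d y → (:1 :+ x :* (d :+ :1)) :+ (x :* y) :* (:1 :+ :1) := :1 :+ x :* ((d :+ y :* (:1 :+ :1)) :+ :1)) refl _ _ _ ⟩
      1ₛ + q^ 1 * ((D p 1 + q^ suc p * (1ₛ + 1ₛ)) + 1ₛ)
        ≈⟨ +-cong (sym (D-0ʳ _)) (*-congˡ (+-cong (trans (+-congˡ (*-congˡ (+-cong (sym (D-0ʳ _)) (sym (D-0ʳ _))))) (sym (D-suc-suc p 0))) (sym (D-0ʳ _)))) ⟩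
      D (2 ℕ.+ p) 0 + q^ 1 * (D (suc p) 1 + D (suc p) 0) ∎
    D-suc-sucʳ (suc p) (suc k) = begin
      D (2 ℕ.+ p) (2 ℕ.+ k)
        ≈⟨ D-suc-suc (suc p) (suc k) ⟩
      D (suc p) (2 ℕ.+ k) + q^ (2 ℕ.+ p) * (D (2 ℕ.+ p) (suc k) + D (suc p) (suc k))
        ≈⟨ +-cong (D-suc-sucʳ p (suc k)) (*-cong (q1+ (suc p)) (+-cong (D-suc-sucʳ (suc p) k) (D-suc-sucʳ p k))) ⟩
      (c + q^ (2 ℕ.+ k) * (a + b)) + (q^ 1 * X) * ((z + Y * (c + d)) + (d + Y * (b + e)))
        ≈⟨ +-congʳ (+-congˡ (*-congʳ (q1+ (suc k)))) ⟩
      (c + (q^ 1 * Y) * (a + b)) + (q^ 1 * X) * ((z + Y * (c + d)) + (d + Y * (b + e)))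
        ≈⟨ solve 9 (λ a b c d e z q X Y →
             (c :+ (q :* Y) :* (a :+ b)) :+ (q :* X) :* ((z :+ Y :* (c :+ d)) :+ (d :+ Y :* (b :+ e)))
             := (c :+ (q :* X) :* (z :+ d)) :+ (q :* Y) :* ((a :+ X :* (c :+ b)) :+ (b :+ X :* (d :+ e))))
             refl a b c d e z (q^ 1) X Y ⟩
      (c + (q^ 1 * X) * (z + d)) + (q^ 1 * Y) * ((a + X * (c + b)) + (b + X * (d + e)))
        ≈⟨ +-cong (trans (+-congˡ (*-congʳ (sym (q1+ (suc p))))) (sym (D-suc-suc (suc p) k)))
             (*-cong (sym (q1+ (suc k))) (+-cong (sym (D-suc-suc p (suc k))) (sym (D-suc-suc p k)))) ⟩
      D (2 ℕ.+ p) (suc k) + q^ (2 ℕ.+ k) * (D (suc p) (2 ℕ.+ k) + D (suc p) (suc k)) ∎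
      where
      a = D p (2 ℕ.+ k) ; b = D p (suc k) ; c = D (suc p) (suc k) ; d = D (suc p) k ; e = D p k
      z = D (2 ℕ.+ p) k ; X = q^ suc p ; Y = q^ suc k

    D-sym : ∀ p k → D p k ≈ D k p
    D-sym zero    k       = trans (D-0ˡ k) (sym (D-0ʳ k))
    D-sym (suc p) zero    = trans (D-0ʳ (suc p)) (sym (D-0ˡ (suc p)))
    D-sym (suc p) (suc k) = trans (D-suc-suc p k) (trans
      (+-cong (D-sym p (suc k)) (*-congˡ (+-cong (D-sym (suc p) k) (D-sym p k))))
      (sym (D-suc-sucʳ k p)))

-- Generating functions by rank and the recurrence for Z_m

module RankSeries where
  open PowerSeries
  open Overpartitions


  private variable
    A : Set

  Σℓ-+ : ∀ (h h′ : A → ℚ) xs → Σℓ (λ x → h x ℚ.+ h′ x) xs ≡ Σℓ h xs ℚ.+ Σℓ h′ xs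
  Σℓ-+ h h′ []       = ≡.refl
  Σℓ-+ h h′ (x ∷ xs) = ≡.trans (≡.cong (h x ℚ.+ h′ x ℚ.+_) (Σℓ-+ h h′ xs))
    (ℚK.solve 4 (λ a b c d → (a ℚK.:+ b) ℚK.:+ (c ℚK.:+ d) ℚK.:= (a ℚK.:+ c) ℚK.:+ (b ℚK.:+ d)) ≡.refl (h x) (h′ x) (Σℓ h xs) (Σℓ h′ xs))

  Σℓ-∑ : ∀ L (h : ℕ → A → ℚ) xs → Σℓ (λ x → ℚK.∑ L (λ l → h l x)) xs ≡ ℚK.∑ L (λ l → Σℓ (h l) xs)
  Σℓ-∑ zero    h xs = zeros xs
    where
    zeros : ∀ xs → Σℓ (λ _ → 0ℚ) xs ≡ 0ℚ
    zeros []       = ≡.refl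
    zeros (x ∷ xs) = ≡.trans (ℚₚ.+-identityˡ _) (zeros xs)
  Σℓ-∑ (suc L) h xs = ≡.trans (Σℓ-+ _ (h L) xs) (≡.cong (ℚ._+ Σℓ (h L) xs) (Σℓ-∑ L h xs))

  Weight : Set
  Weight = ℕ → ℕ → ℚ

  byRank : ℕ → Weight → PS
  byRank p G = weighted p (λ x → G (largestPart x) (numParts x))

  -- Σ G(largest part, number of parts) q^|λ| over all overpartitions λ
  RF : Weight → PS
  RF G n = byRank n G n

  RF-ext : ∀ {G G′} → (∀ p k → G p k ≡ G′ p k) → ∀ n → RF G n ≡ RF G′ n
  RF-ext e n = Σℓ-cong (λ x → e (largestPart x) (numParts x)) (overpartitions n)

  RF-+ : ∀ G G′ n → RF (λ p k → G p k ℚ.+ G′ p k) n ≡ RF G n ℚ.+ RF G′ n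
  RF-+ G G′ n = Σℓ-+ _ _ (overpartitions n)

  RF-∑ : ∀ L (G : ℕ → Weight) n → RF (λ p k → ℚK.∑ L (λ l → G l p k)) n ≡ ℚK.∑ L (λ l → RF (G l) n)
  RF-∑ L G n = Σℓ-∑ L _ (overpartitions n)

  byParts-+ : ∀ p g g′ n → byParts p (λ m → g m ℚ.+ g′ m) n ≡ byParts p g n ℚ.+ byParts p g′ n
  byParts-+ p g g′ n = Σℓ-+ _ _ (overpartsBounded n p)

  byParts-local : ∀ p {g g′} N → (∀ m → m < N → g m ≡ g′ m) → byParts p g ≈[ fin N ] byParts p g′
  byParts-local p {g} {g′} N e = mk λ n n<N → begin
    byParts p g n
      ≡⟨ byParts-cong p (λ m → ≡.sym (lem (g m) (g′ m))) n ⟩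
    byParts p (λ m → g′ m ℚ.+ (g m ℚ.- g′ m)) n
      ≡⟨ byParts-+ p g′ (λ m → g m ℚ.- g′ m) n ⟩
    byParts p g′ n ℚ.+ byParts p (λ m → g m ℚ.- g′ m) n
      ≡⟨ ≡.cong (byParts p g′ n ℚ.+_) (≡.trans (at (byParts-vanishing p N _ (λ m h →
           ≡.trans (≡.cong (ℚ._- g′ m) (e m h)) (ℚₚ.+-inverseʳ (g′ m)))) n n<N) (0-at n)) ⟩
    byParts p g′ n ℚ.+ 0ℚ ≡⟨ ℚₚ.+-identityʳ _ ⟩
    byParts p g′ n ∎
    where
    open ≡.≡-Reasoning
    lem : ∀ a b → b ℚ.+ (a ℚ.- b) ≡ a
    lem = ℚK.solve 2 (λ a b → b ℚK.:+ (a ℚK.:- b) ℚK.:= a) ≡.refl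

  module RankSums (N : ℕ) where
    open Mod N
    open Delannoy N public

    ∑-telescope : ∀ n (f : ℕ → PS) → ∑ n (λ j → f (suc j) + - f j) ≈ f n + - f 0
    ∑-telescope zero    f = sym (-‿inverseʳ (f 0))
    ∑-telescope (suc n) f = trans (+-congʳ (∑-telescope n f))
      (solve 3 (λ a b c → (a :+ :- b) :+ (c :+ :- a) := c :+ :- b) refl (f n) (f 0) (f (suc n)))

    byRank-suc : ∀ p G → byRank (suc p) G ≈ byRank p G + (byParts (suc p) (G (suc p)) + - byParts p (G (suc p)))
    byRank-suc p G = trans (weighted-suc p _ N) (+-congˡ (sym (trans (+-congʳ (weighted-suc p (G (suc p) ∘ numParts) N))
      (solve 2 (λ a t → (a :+ t) :+ :- a := t) refl (byParts p (G (suc p))) _))))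

    RF-stable : ∀ G → RF G ≈ byRank N G
    RF-stable G = mk λ n n<N → go n (N ∸ n) n<N (ℕₚ.m+[n∸m]≡n (ℕₚ.<⇒≤ n<N))
      where
      step : ∀ p n → n ≤ p → byRank (suc p) G n ≡ byRank p G n
      step p n n≤p = ≡.trans (weighted-list p _ n) (≡.trans (≡.cong (byRank p G n ℚ.+_) (ℚK.∑-0 n (λ k _ →
        q-⊠-< _ _ (ℕₚ.≤-trans (s≤s n≤p) (ℕₚ.m≤m+n (suc p) (k ℕ.* suc p)))))) (ℚₚ.+-identityʳ _))
      up : ∀ n d → byRank n G n ≡ byRank (n ℕ.+ d) G n
      up n zero    = ≡.cong (λ p → byRank p G n) (≡.sym (ℕₚ.+-identityʳ n))
      up n (suc d) = ≡.trans (up n d) (≡.trans (≡.sym (step (n ℕ.+ d) n (ℕₚ.m≤m+n n d)))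
        (≡.cong (λ p → byRank p G n) (≡.sym (ℕₚ.+-suc n d))))
      go : ∀ n d → n < N → n ℕ.+ d ≡ N → RF G n ≡ byRank N G n
      go n d _ e = ≡.subst (λ p → RF G n ≡ byRank p G n) e (up n d)

    -- Sorting by the largest part j + 1 freezes the first argument of G, and a difference of two
    -- `byParts` keeps exactly the overpartitions with that largest part.
    RF-sum : ∀ G → RF G ≈ byParts 0 (G 0) + ∑ N (λ j → byParts (suc j) (G (suc j)) + - byParts j (G (suc j)))
    RF-sum G = trans (RF-stable G) (go N)
      where
      base : ∀ n → byRank 0 G n ≡ byParts 0 (G 0) n
      base zero    = ≡.refl
      base (suc n) = ≡.refl
      go : ∀ p → byRank p G ≈ byParts 0 (G 0) + ∑ p (λ j → byParts (suc j) (G (suc j)) + - byParts j (G (suc j)))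
      go zero    = trans (pointwise base) (sym (+-identityʳ _))
      go (suc p) = trans (byRank-suc p G) (trans (+-congʳ (go p)) (+-assoc _ _ _))

    RF-local : ∀ {G G′} → (∀ p k → p ≤ N → k < N → G p k ≡ G′ p k) → RF G ≈ RF G′
    RF-local {G} {G′} e = trans (RF-sum G) (trans (+-cong (byParts-local 0 N (λ m → e 0 m z≤n))
      (∑-cong N (λ j j<N → +-cong (byParts-local (suc j) N (λ m → e (suc j) m j<N))
        (-‿cong (byParts-local j N (λ m → e (suc j) m j<N)))))) (sym (RF-sum G′)))

  -- Rank ≥ m and rank ≥ -m respectively; m is added to the smaller or the larger side so that no
  -- truncated subtraction occurs.
  H⁺ H⁻ : ℕ → PS
  H⁺ m = RF (λ p k → ind (k ℕ.+ m) p)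
  H⁻ m = RF (λ p k → ind k (p ℕ.+ m))

  P̄ : PS
  P̄ = RF (λ _ _ → 1ℚ)

  module RankRecurrences (N : ℕ) where
    open Mod N
    open RankSums N

    -- Largest part exactly j + 1 and at most t parts.
    E : ℕ → ℕ → PS
    E j t = D (suc j) t + - D j t

    E-0 : ∀ j → E j 0 ≈ 0ₛ
    E-0 j = trans (+-cong (D-0ʳ (suc j)) (-‿cong (D-0ʳ j))) (-‿inverseʳ 1ₛ)

    E-suc : ∀ j t → E j (suc t) ≈ q^ suc j * (D (suc j) t + D j t)
    E-suc j t = trans (+-congʳ (D-suc-suc j t)) (solve 2 (λ a b → (a :+ b) :+ :- a := b) refl _ _)

    E-big : ∀ j t → N ≤ suc j → E j t ≈ 0ₛ
    E-big j zero    h = E-0 j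
    E-big j (suc t) h = trans (E-suc j t) (q-big-* _ h)

    H⁻-sum : ∀ m → H⁻ m ≈ 1ₛ + ∑ N (λ j → E j (suc (j ℕ.+ m)))
    H⁻-sum m = trans (RF-sum (λ p k → ind k (p ℕ.+ m))) (+-cong
      (trans (≡⇒≈ (D-def 0 m)) (D-0ˡ m))
      (∑-cong′ N (λ j → +-cong (≡⇒≈ (D-def (suc j) (suc (j ℕ.+ m)))) (-‿cong (≡⇒≈ (D-def j (suc (j ℕ.+ m))))))))

    H⁺0≡H⁻0 : H⁺ 0 ≈ H⁻ 0
    H⁺0≡H⁻0 = pointwise (RF-ext (λ p k → ≡.cong₂ ind (ℕₚ.+-identityʳ k) (≡.sym (ℕₚ.+-identityʳ p))))

    ind-cancel : ∀ μ k t → ind (k ℕ.+ μ) (μ ℕ.+ t) ≡ ind k t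
    ind-cancel μ k t = ≡.trans (≡.cong (λ x → ind x (μ ℕ.+ t)) (ℕₚ.+-comm k μ)) (go μ)
      where
      go : ∀ μ → ind (μ ℕ.+ k) (μ ℕ.+ t) ≡ ind k t
      go zero    = ≡.refl
      go (suc μ) = go μ

    -- A largest part of at most μ cannot reach rank μ + 1, and for largest part μ + t + 1 the rank
    -- condition says that there are at most t parts.
    H⁺-sum : ∀ μ → H⁺ (suc μ) ≈ ∑ N (λ t → E (μ ℕ.+ t) t)
    H⁺-sum μ = begin
      H⁺ (suc μ)
        ≈⟨ RF-sum (λ p k → ind (k ℕ.+ suc μ) p) ⟩
      byParts 0 (λ k → ind (k ℕ.+ suc μ) 0) + ∑ N T
        ≈⟨ +-cong (byParts-vanishing 0 N _ (λ k _ → ind-> (ℕₚ.≤-trans (s≤s z≤n) (ℕₚ.m≤n+m (suc μ) k))))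
             (sym (∑-extend T (ℕₚ.m≤n+m N μ) (λ j h → T-multiple j (ℕₚ.≤-trans h (ℕₚ.n≤1+n j))))) ⟩
      0ₛ + ∑ (μ ℕ.+ N) T
        ≈⟨ trans (+-identityˡ _) (∑-split μ N T) ⟩
      ∑ μ T + ∑ N (λ t → T (μ ℕ.+ t))
        ≈⟨ +-cong (∑-0 μ low) (∑-cong′ N high) ⟩
      0ₛ + ∑ N (λ t → E (μ ℕ.+ t) t)
        ≈⟨ +-identityˡ _ ⟩
      ∑ N (λ t → E (μ ℕ.+ t) t) ∎
      where
      g : ℕ → ℕ → ℚ
      g j k = ind (k ℕ.+ suc μ) (suc j)
      T : ℕ → PS
      T j = byParts (suc j) (g j) + - byParts j (g j)
      T-multiple : ∀ j → N ≤ suc j → T j ≈ 0ₛ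
      T-multiple j h = trans (+-congʳ (trans (byParts-suc j (g j) N) (+-congˡ (q-big-* _ h))))
        (solve 1 (λ a → (a :+ :0) :+ :- a := :0) refl (byParts j (g j)))
      low : ∀ j → j < μ → T j ≈ 0ₛ
      low j j<μ = trans (+-cong (z (suc j)) (-‿cong (z j))) (-‿inverseʳ 0ₛ)
        where
        z : ∀ p → byParts p (g j) ≈ 0ₛ
        z p = byParts-vanishing p N (g j) (λ k _ → ind-> (ℕₚ.≤-trans (s≤s j<μ) (ℕₚ.m≤n+m (suc μ) k)))
      high : ∀ t → T (μ ℕ.+ t) ≈ E (μ ℕ.+ t) t
      high t = +-cong (to (suc (μ ℕ.+ t))) (-‿cong (to (μ ℕ.+ t)))
        where
        to : ∀ p → byParts p (g (μ ℕ.+ t)) ≈ D p t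
        to p = trans (pointwise (byParts-cong p (λ k → ≡.trans (≡.cong (λ x → ind x (suc (μ ℕ.+ t))) (ℕₚ.+-suc k μ)) (ind-cancel μ k t))))
          (≡⇒≈ (D-def p t))

    -- Modulo q^N any box with both sides at least N holds everything; this shape is the last term
    -- of the telescoping sum in `H-complement`.
    total : ∀ m → P̄ ≈ D N (N ℕ.+ m)
    total m = begin
      P̄ ≈⟨ RF-sum (λ _ _ → 1ℚ) ⟩
      byParts 0 (λ _ → 1ℚ) + ∑ N (λ j → byParts (suc j) (λ _ → 1ℚ) + - byParts j (λ _ → 1ℚ))
        ≈⟨ +-congˡ (∑-telescope N (λ j → byParts j (λ _ → 1ℚ))) ⟩
      byParts 0 (λ _ → 1ℚ) + (byParts N (λ _ → 1ℚ) + - byParts 0 (λ _ → 1ℚ))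
        ≈⟨ solve 2 (λ a b → a :+ (b :+ :- a) := b) refl (byParts 0 (λ _ → 1ℚ)) (byParts N (λ _ → 1ℚ)) ⟩
      byParts N (λ _ → 1ℚ)
        ≈⟨ byParts-local N N (λ k k<N → ≡.sym (ind-≤ (ℕₚ.≤-trans (ℕₚ.<⇒≤ k<N) (ℕₚ.m≤m+n N m)))) ⟩
      byParts N (λ k → ind k (N ℕ.+ m))
        ≈⟨ ≡⇒≈ (D-def N (N ℕ.+ m)) ⟩
      D N (N ℕ.+ m) ∎

    -- This is the symmetry of the rank under conjugation. After `D-sym` the two sums interleave and
    -- telescope along D(j, j + m).
    H-complement : ∀ m → H⁻ m + H⁺ (suc m) ≈ P̄
    H-complement m = begin
      H⁻ m + H⁺ (suc m)
        ≈⟨ +-cong (H⁻-sum m) (H⁺-sum m) ⟩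
      (1ₛ + ∑ N (λ j → E j (suc (j ℕ.+ m)))) + ∑ N (λ t → E (m ℕ.+ t) t)
        ≈⟨ trans (+-assoc _ _ _) (+-cong (sym (D-0ˡ m)) (sym (∑-+ N _ _))) ⟩
      D 0 m + ∑ N (λ j → E j (suc (j ℕ.+ m)) + E (m ℕ.+ j) j)
        ≈⟨ +-congˡ (∑-cong′ N step) ⟩
      D 0 m + ∑ N (λ j → D (suc j) (suc j ℕ.+ m) + - D j (j ℕ.+ m))
        ≈⟨ +-congˡ (∑-telescope N (λ j → D j (j ℕ.+ m))) ⟩
      D 0 m + (D N (N ℕ.+ m) + - D 0 m)
        ≈⟨ solve 2 (λ a b → a :+ (b :+ :- a) := b) refl _ _ ⟩
      D N (N ℕ.+ m) ≈⟨ total m ⟨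
      P̄ ∎
      where
      step : ∀ j → E j (suc (j ℕ.+ m)) + E (m ℕ.+ j) j ≈ D (suc j) (suc j ℕ.+ m) + - D j (j ℕ.+ m)
      step j = trans (+-congˡ (+-cong
          (trans (≡⇒≈ (≡.cong (λ x → D (suc x) j) (ℕₚ.+-comm m j))) (D-sym _ _))
          (-‿cong (trans (≡⇒≈ (≡.cong (λ x → D x j) (ℕₚ.+-comm m j))) (D-sym _ _)))))
        (solve 3 (λ a b c → (a :+ :- b) :+ (b :+ :- c) := a :+ :- c) refl _ _ _)

    -- The non-empty overpartitions of rank ≥ m: by `E-suc` the summand has largest part m + s + 1
    -- and at most s + 1 parts. Unlike `H⁺-sum` it treats m = 0 on the same footing.
    W : ℕ → PS
    W m = ∑ N (λ s → q^ suc (m ℕ.+ s) * (D (suc (m ℕ.+ s)) s + D (m ℕ.+ s) s))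

    H⁺-0 : H⁺ 0 ≈ 1ₛ + W 0
    H⁺-0 = trans H⁺0≡H⁻0 (trans (H⁻-sum 0) (+-congˡ (∑-cong′ N (λ j → trans
      (≡⇒≈ (≡.cong (λ x → E j (suc x)) (ℕₚ.+-identityʳ j))) (E-suc j j)))))

    H⁺-suc : ∀ m → H⁺ (suc m) ≈ W (suc m)
    H⁺-suc m = begin
      H⁺ (suc m)                                 ≈⟨ H⁺-sum m ⟩
      ∑ N (λ t → E (m ℕ.+ t) t)                  ≈⟨ ∑-extend _ (ℕₚ.n≤1+n N) (λ t h → E-big _ t (ℕₚ.≤-trans h (ℕₚ.≤-trans (ℕₚ.m≤n+m t m) (ℕₚ.n≤1+n _)))) ⟨
      ∑ (suc N) (λ t → E (m ℕ.+ t) t)            ≈⟨ ∑-head N _ ⟩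
      E (m ℕ.+ 0) 0 + ∑ N (λ s → E (m ℕ.+ suc s) (suc s))
        ≈⟨ trans (+-congʳ (E-0 _)) (+-identityˡ _) ⟩
      ∑ N (λ s → E (m ℕ.+ suc s) (suc s))
        ≈⟨ ∑-cong′ N (λ s → trans (≡⇒≈ (≡.cong (λ x → E x (suc s)) (ℕₚ.+-suc m s))) (E-suc _ s)) ⟩
      W (suc m) ∎

    -- Expand both `H⁻`. After transposition the terms s ≥ 1 of `W m` are the summands `a` and the
    -- terms of `W (suc m)` are the summands `b`; the two constants 1 account for s = 0.
    W-recurrence : ∀ m → W m + W (suc m) ≈ q^ suc m * (H⁻ (suc m) + H⁻ (suc (suc m)))
    W-recurrence m = sym (begin
      q^ suc m * (H⁻ (suc m) + H⁻ (suc (suc m)))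
        ≈⟨ *-congˡ (+-cong (expand (suc m)) (expand (suc (suc m)))) ⟩
      q^ suc m * ((1ₛ + (∑ N (a (suc m)) + ∑ N (b (suc m)))) + (1ₛ + (∑ N (a (suc (suc m))) + ∑ N (b (suc (suc m))))))
        ≈⟨ solve 5 (λ x a b c d → x :* ((:1 :+ (a :+ b)) :+ (:1 :+ (c :+ d))) := (x :* (:1 :+ :1) :+ x :* (a :+ c)) :+ x :* (b :+ d)) refl _ _ _ _ _ ⟩
      (q^ suc m * (1ₛ + 1ₛ) + q^ suc m * (∑ N (a (suc m)) + ∑ N (a (suc (suc m))))) + q^ suc m * (∑ N (b (suc m)) + ∑ N (b (suc (suc m))))
        ≈⟨ +-cong first second ⟩
      W m + W (suc m) ∎)
      where
      a b : ℕ → ℕ → PS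
      a x j = q^ suc j * D (suc j) (j ℕ.+ x)
      b x j = q^ suc j * D j (j ℕ.+ x)
      expand : ∀ x → H⁻ x ≈ 1ₛ + (∑ N (a x) + ∑ N (b x))
      expand x = trans (H⁻-sum x) (+-congˡ (trans (∑-cong′ N (λ j → trans (E-suc j (j ℕ.+ x)) (distribˡ _ _ _))) (∑-+ N _ _)))
      f : ℕ → PS
      f s = q^ suc (m ℕ.+ s) * (D (suc (m ℕ.+ s)) s + D (m ℕ.+ s) s)
      e₁ : ∀ m j → 1 ℕ.+ (m ℕ.+ (1 ℕ.+ j)) ≡ (1 ℕ.+ m) ℕ.+ (1 ℕ.+ j)
      e₁ = solve-∀
      e₂ : ∀ m j → 1 ℕ.+ (m ℕ.+ (1 ℕ.+ j)) ≡ j ℕ.+ (1 ℕ.+ (1 ℕ.+ m))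
      e₂ = solve-∀
      e₃ : ∀ m j → m ℕ.+ (1 ℕ.+ j) ≡ j ℕ.+ (1 ℕ.+ m)
      e₃ = solve-∀
      first : q^ suc m * (1ₛ + 1ₛ) + q^ suc m * (∑ N (a (suc m)) + ∑ N (a (suc (suc m)))) ≈ W m
      first = sym (begin
        ∑ N f ≈⟨ ∑-extend f (ℕₚ.n≤1+n N) (λ s h → q-big-* _ (ℕₚ.≤-trans h (ℕₚ.≤-trans (ℕₚ.m≤n+m s m) (ℕₚ.n≤1+n _)))) ⟨
        ∑ (suc N) f ≈⟨ ∑-head N f ⟩
        f 0 + ∑ N (λ j → f (suc j))
          ≈⟨ +-cong (*-cong (q-cong (≡.cong suc (ℕₚ.+-identityʳ m))) (+-cong (D-0ʳ _) (D-0ʳ _)))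
               (trans (∑-cong′ N (λ j → trans (*-cong (q-split _ _ (e₁ m j)) (+-cong
                   (trans (≡⇒≈ (≡.cong (λ x → D x (suc j)) (e₂ m j))) (D-sym _ _))
                   (trans (≡⇒≈ (≡.cong (λ x → D x (suc j)) (e₃ m j))) (D-sym _ _))))
                 (solve 4 (λ x y c d → (x :* y) :* (c :+ d) := x :* ((y :* d) :+ (y :* c))) refl _ _ _ _)))
                 (trans (∑-*ˡ N _ _) (*-congˡ (∑-+ N _ _)))) ⟩
        q^ suc m * (1ₛ + 1ₛ) + q^ suc m * (∑ N (a (suc m)) + ∑ N (a (suc (suc m)))) ∎)
      e₄ : ∀ m j → 1 ℕ.+ ((1 ℕ.+ m) ℕ.+ j) ≡ (1 ℕ.+ m) ℕ.+ (1 ℕ.+ j)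
      e₄ = solve-∀
      e₅ : ∀ m j → 1 ℕ.+ ((1 ℕ.+ m) ℕ.+ j) ≡ j ℕ.+ (1 ℕ.+ (1 ℕ.+ m))
      e₅ = solve-∀
      e₆ : ∀ m j → (1 ℕ.+ m) ℕ.+ j ≡ j ℕ.+ (1 ℕ.+ m)
      e₆ = solve-∀
      second : q^ suc m * (∑ N (b (suc m)) + ∑ N (b (suc (suc m)))) ≈ W (suc m)
      second = sym (trans (∑-cong′ N (λ j → trans (*-cong (q-split _ _ (e₄ m j)) (+-cong
                   (trans (≡⇒≈ (≡.cong (λ x → D x j) (e₅ m j))) (D-sym _ _))
                   (trans (≡⇒≈ (≡.cong (λ x → D x j) (e₆ m j))) (D-sym _ _))))
                 (solve 4 (λ x y c d → (x :* y) :* (c :+ d) := x :* ((y :* d) :+ (y :* c))) refl _ _ _ _)))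
                 (trans (∑-*ˡ N _ _) (*-congˡ (∑-+ N _ _))))

-- Ranks modulo 6 and the sequences N_m and Z_m over the integers

module RankResidues where
  open PowerSeries
  open Overpartitions
  open RankSeries


  δ : ℕ → ℕ → ℚ
  δ zero    zero    = 1ℚ
  δ zero    (suc j) = 0ℚ
  δ (suc a) zero    = 0ℚ
  δ (suc a) (suc j) = δ a j

  δ-ind : ∀ a j → ind j a ℚ.+ ℚ.- ind (suc j) a ≡ δ a j
  δ-ind zero    zero    = ≡.refl
  δ-ind zero    (suc j) = ≡.refl
  δ-ind (suc a) zero    = ≡.refl
  δ-ind (suc a) (suc j) = δ-ind a j

  δ-ind′ : ∀ a j → ind (suc a) (suc j) ℚ.+ ℚ.- ind (suc a) j ≡ δ a j
  δ-ind′ zero    zero    = ≡.refl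
  δ-ind′ zero    (suc j) = ≡.refl
  δ-ind′ (suc a) zero    = ≡.refl
  δ-ind′ (suc a) (suc j) = δ-ind′ a j

  δ-≢ : ∀ {a j} → a ≢ j → δ a j ≡ 0ℚ
  δ-≢ {zero}  {zero}  h = contradiction ≡.refl h
  δ-≢ {zero}  {suc j} h = ≡.refl
  δ-≢ {suc a} {zero}  h = ≡.refl
  δ-≢ {suc a} {suc j} h = δ-≢ (λ e → h (≡.cong suc e))

  δ-refl : ∀ a → δ a a ≡ 1ℚ
  δ-refl zero    = ≡.refl
  δ-refl (suc a) = δ-refl a

  [6+a]%6 : ∀ a → (6 ℕ.+ a) ℕ.% 6 ≡ a ℕ.% 6
  [6+a]%6 a = ≡.trans (≡.cong (ℕ._% 6) (ℕₚ.+-comm 6 a)) (ℕ÷.[m+n]%n≡m%n a 6)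

  residue-sum : ∀ L a s → s < 6 → a < 6 ℕ.* L → ℚK.∑ L (λ l → δ a (s ℕ.+ 6 ℕ.* l)) ≡ δ (a ℕ.% 6) s
  residue-sum zero    a s s<6 ()
  residue-sum (suc L) a s s<6 a< with a ℕ.<? 6
  ... | yes a<6 = ≡.trans (ℚK.∑-head L (λ l → δ a (s ℕ.+ 6 ℕ.* l))) (≡.trans (≡.cong₂ ℚ._+_
      (≡.cong₂ δ (≡.sym (ℕ÷.m<n⇒m%n≡m a<6)) (ℕₚ.+-identityʳ s))
      (ℚK.∑-0 L (λ l _ → δ-≢ (ℕₚ.<⇒≢ (ℕₚ.<-≤-trans a<6 (ℕₚ.≤-trans (ℕₚ.m≤m*n 6 (suc l)) (ℕₚ.m≤n+m _ s)))))))
      (ℚₚ.+-identityʳ _))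
  ... | no a≮6 with a ∸ 6 | ℕₚ.m+[n∸m]≡n (ℕₚ.≮⇒≥ a≮6)
  ... | a′ | ≡.refl = ≡.trans (ℚK.∑-head L (λ l → δ (6 ℕ.+ a′) (s ℕ.+ 6 ℕ.* l))) (≡.trans (≡.cong₂ ℚ._+_
      (δ-≢ (ℕₚ.>⇒≢ (ℕₚ.<-≤-trans (≡.subst (_< 6) (≡.sym (ℕₚ.+-identityʳ s)) s<6) (ℕₚ.m≤m+n 6 a′))))
      (≡.trans (ℚK.∑-cong′ L (λ l → ≡.cong (δ (6 ℕ.+ a′)) (e s l))) (residue-sum L a′ s s<6 bound)))
      (≡.trans (ℚₚ.+-identityˡ _) (≡.cong (λ r → δ r s) (≡.sym ([6+a]%6 a′)))))
    where
    e : ∀ s l → s ℕ.+ 6 ℕ.* (1 ℕ.+ l) ≡ 6 ℕ.+ (s ℕ.+ 6 ℕ.* l)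
    e = solve-∀
    bound : a′ < 6 ℕ.* L
    bound = ℕₚ.+-cancelˡ-< 6 a′ (6 ℕ.* L) (≡.subst (6 ℕ.+ a′ <_) (ℕₚ.*-suc 6 L) a<)

  neg-%ℕ : ∀ a → -[1+ a ] %ℕ 6 ≡ 5 ∸ a ℕ.% 6
  neg-%ℕ 0 = ≡.refl
  neg-%ℕ 1 = ≡.refl
  neg-%ℕ 2 = ≡.refl
  neg-%ℕ 3 = ≡.refl
  neg-%ℕ 4 = ≡.refl
  neg-%ℕ 5 = ≡.refl
  neg-%ℕ (suc (suc (suc (suc (suc (suc a)))))) = ≡.trans (shift a)
    (≡.trans (neg-%ℕ a) (≡.cong (5 ∸_) (≡.sym ([6+a]%6 a))))
    where
    g : ℕ → ℕ
    g zero    = 0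
    g (suc r) = 6 ∸ suc r
    unfold : ∀ a → -[1+ a ] %ℕ 6 ≡ g (suc a ℕ.% 6)
    unfold a with suc a ℕ.% 6
    ... | zero  = ≡.refl
    ... | suc r = ≡.refl
    shift : ∀ a → -[1+ 6 ℕ.+ a ] %ℕ 6 ≡ -[1+ a ] %ℕ 6
    shift a = ≡.trans (unfold (6 ℕ.+ a)) (≡.trans (≡.cong g ([6+a]%6 (suc a))) (≡.sym (unfold a)))

  δ-flip : ∀ {r} → r < 6 → ∀ {s} → s < 6 → δ (5 ∸ r) s ≡ δ r (5 ∸ s)
  δ-flip = toWitness {a? = ℕₚ.allUpTo? (λ r → ℕₚ.allUpTo? (λ s → δ (5 ∸ r) s ℚ.≟ δ r (5 ∸ s)) 6) 6} tt

  -- Indicators of rank j and of rank -(j + 1).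
  Nw⁺ Nw⁻ : ℕ → Weight
  Nw⁺ j p k = ind (k ℕ.+ j) p ℚ.+ ℚ.- ind (k ℕ.+ suc j) p
  Nw⁻ j p k = ind k (p ℕ.+ suc j) ℚ.+ ℚ.- ind k (p ℕ.+ j)

  ind-cancelˡ : ∀ μ k t → ind (μ ℕ.+ k) (μ ℕ.+ t) ≡ ind k t
  ind-cancelˡ zero    k t = ≡.refl
  ind-cancelˡ (suc μ) k t = ind-cancelˡ μ k t

  -- The negative ranks congruent to s are -(j + 1) with j = (5 - s) + 6l, whence the second family.
  -- The bounds on p and k put every rank that occurs inside the window of length 6L.
  rank-weight : ∀ L s p k → s < 6 → p < 6 ℕ.* L → k < 6 ℕ.* L →
    δ ((+ p ℤ.- + k) %ℕ 6) s ≡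
    ℚK.∑ L (λ l → Nw⁺ (s ℕ.+ 6 ℕ.* l) p k) ℚ.+ ℚK.∑ L (λ l → Nw⁻ ((5 ∸ s) ℕ.+ 6 ℕ.* l) p k)
  rank-weight L s p k s<6 p< k< with k ℕ.≤? p
  ... | yes k≤p with p ∸ k | ℕₚ.m+[n∸m]≡n k≤p
  ... | a | ≡.refl = begin
    δ ((+ (k ℕ.+ a) ℤ.- + k) %ℕ 6) s
      ≡⟨ ≡.cong (λ ρ → δ (ρ %ℕ 6) s) rank≡ ⟩
    δ (a ℕ.% 6) s
      ≡⟨ residue-sum L a s s<6 (ℕₚ.≤-<-trans (ℕₚ.m≤n+m a k) p<) ⟨
    ℚK.∑ L (λ l → δ a (s ℕ.+ 6 ℕ.* l))
      ≡⟨ ℚK.∑-cong′ L (λ l → ≡.trans (≡.cong₂ (λ x y → x ℚ.+ ℚ.- y) (ind-cancelˡ k _ a) (ind-cancelˡ k _ a)) (δ-ind a _)) ⟨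
    ℚK.∑ L (λ l → Nw⁺ (s ℕ.+ 6 ℕ.* l) (k ℕ.+ a) k)
      ≡⟨ ℚₚ.+-identityʳ _ ⟨
    ℚK.∑ L (λ l → Nw⁺ (s ℕ.+ 6 ℕ.* l) (k ℕ.+ a) k) ℚ.+ 0ℚ
      ≡⟨ ≡.cong (ℚK.∑ L (λ l → Nw⁺ (s ℕ.+ 6 ℕ.* l) (k ℕ.+ a) k) ℚ.+_) (ℚK.∑-0 L (λ l _ → ≡.cong₂ (λ x y → x ℚ.+ ℚ.- y)
           (ind-≤ (≤′ _)) (ind-≤ (≤′ _)))) ⟨
    _ ∎
    where
    open ≡.≡-Reasoning
    rank≡ : + (k ℕ.+ a) ℤ.- + k ≡ + a
    rank≡ = ≡.trans (ℤₚ.m-n≡m⊖n (k ℕ.+ a) k) (≡.trans (≡.cong ((k ℕ.+ a) ℤ.⊖_) (≡.sym (ℕₚ.+-identityʳ k))) (ℤₚ.+-cancelˡ-⊖ k a 0))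
    ≤′ : ∀ x → k ≤ k ℕ.+ a ℕ.+ x
    ≤′ x = ℕₚ.≤-trans (ℕₚ.m≤m+n k a) (ℕₚ.m≤m+n _ x)
  rank-weight L s p k s<6 p< k< | no k≰p with k ∸ suc p | ℕₚ.m+[n∸m]≡n (ℕₚ.≰⇒> k≰p)
  ... | a | eq with ≡.trans (≡.sym eq) (≡.sym (ℕₚ.+-suc p a))
  ... | ≡.refl = begin
    δ ((+ p ℤ.- + (p ℕ.+ suc a)) %ℕ 6) s
      ≡⟨ ≡.cong (λ ρ → δ (ρ %ℕ 6) s) rank≡ ⟩
    δ (-[1+ a ] %ℕ 6) s
      ≡⟨ ≡.cong (λ r → δ r s) (neg-%ℕ a) ⟩
    δ (5 ∸ a ℕ.% 6) s
      ≡⟨ δ-flip (ℕ÷.m%n<n a 6) s<6 ⟩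
    δ (a ℕ.% 6) (5 ∸ s)
      ≡⟨ residue-sum L a (5 ∸ s) (s≤s (ℕₚ.m∸n≤m 5 s)) (ℕₚ.≤-<-trans (ℕₚ.≤-trans (ℕₚ.n≤1+n a) (ℕₚ.m≤n+m (suc a) p)) k<) ⟨
    ℚK.∑ L (λ l → δ a ((5 ∸ s) ℕ.+ 6 ℕ.* l))
      ≡⟨ ℚK.∑-cong′ L (λ l → ≡.trans (≡.cong₂ (λ x y → x ℚ.+ ℚ.- y) (ind-cancelˡ p (suc a) _) (ind-cancelˡ p (suc a) _)) (δ-ind′ a _)) ⟨
    ℚK.∑ L (λ l → Nw⁻ ((5 ∸ s) ℕ.+ 6 ℕ.* l) p (p ℕ.+ suc a))
      ≡⟨ ℚₚ.+-identityˡ _ ⟨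
    0ℚ ℚ.+ ℚK.∑ L (λ l → Nw⁻ ((5 ∸ s) ℕ.+ 6 ℕ.* l) p (p ℕ.+ suc a))
      ≡⟨ ≡.cong (ℚ._+ ℚK.∑ L (λ l → Nw⁻ ((5 ∸ s) ℕ.+ 6 ℕ.* l) p (p ℕ.+ suc a))) (ℚK.∑-0 L (λ l _ → ≡.cong₂ (λ x y → x ℚ.+ ℚ.- y)
           (ind-> (<′ _)) (ind-> (<′ _)))) ⟨
    _ ∎
    where
    open ≡.≡-Reasoning
    rank≡ : + p ℤ.- + (p ℕ.+ suc a) ≡ -[1+ a ]
    rank≡ = ≡.trans (ℤₚ.m-n≡m⊖n p (p ℕ.+ suc a)) (≡.trans (≡.cong (ℤ._⊖ (p ℕ.+ suc a)) (≡.sym (ℕₚ.+-identityʳ p))) (ℤₚ.+-cancelˡ-⊖ p 0 (suc a)))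
    <′ : ∀ x → p < p ℕ.+ suc a ℕ.+ x
    <′ x = ℕₚ.≤-trans (ℕₚ.m<m+n p (s≤s z≤n)) (ℕₚ.m≤m+n _ x)

  suc/1 : ∀ k → + suc k / 1 ≡ 1ℚ ℚ.+ + k / 1
  suc/1 k = ℚₚ.toℚᵘ-injective (ℚᵘₚ.≃-trans (ℚₚ.toℚᵘ-fromℚᵘ (ℚᵘ.mkℚᵘ (+ suc k) 0))
    (ℚᵘₚ.≃-trans (ℚᵘ.*≡* lem) (ℚᵘₚ.≃-sym (ℚᵘₚ.≃-trans (ℚₚ.toℚᵘ-homo-+ 1ℚ (+ k / 1))
      (ℚᵘₚ.+-congʳ (ℚᵘ.mkℚᵘ (+ 1) 0) (ℚₚ.toℚᵘ-fromℚᵘ (ℚᵘ.mkℚᵘ (+ k) 0)))))))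
    where
    lem : + suc k ℤ.* + 1 ≡ (+ 1 ℤ.* + 1 ℤ.+ + k ℤ.* + 1) ℤ.* + 1
    lem = ≡.cong (ℤ._* + 1) (≡.cong (λ x → + 1 ℤ.+ x) (≡.sym (ℤₚ.*-identityʳ (+ k))))

  length-filter : ∀ {A : Set} {P : Pred A 0ℓ} (P? : Decidable P) (h : A → ℚ) →
    (∀ x → P x → h x ≡ 1ℚ) → (∀ x → (P x → ⊥) → h x ≡ 0ℚ) →
    ∀ xs → + length (filter P? xs) / 1 ≡ Σℓ h xs
  length-filter P? h y n []       = ≡.refl
  length-filter P? h y n (x ∷ xs) with P? x
  ... | yes px = ≡.trans (suc/1 (length (filter P? xs))) (≡.cong₂ ℚ._+_ (≡.sym (y x px)) (length-filter P? h y n xs))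
  ... | no ¬px = ≡.trans (length-filter P? h y n xs) (≡.sym (≡.trans (≡.cong (ℚ._+ Σℓ h xs) (n x ¬px)) (ℚₚ.+-identityˡ _)))

  rb : ℕ → PS
  rb s n = + Nbar6 s n / 1

  rb≡RF : ∀ s n → rb s n ≡ RF (λ p k → δ ((+ p ℤ.- + k) %ℕ 6) s) n
  rb≡RF s n = length-filter (λ x → rank x %ℕ 6 ℕ.≟ s) _
    (λ x e → ≡.trans (≡.cong (λ r → δ r s) e) (δ-refl s)) (λ x → δ-≢) (overpartitions n)

  -- N_i for rank exactly i and Z_i = H_i + H_(i+1), where H_(-m) is encoded as `H⁻ m`.
  Nz Zz : ℤ → PS
  Nz (+ j)    = H⁺ j ⊞ ⊟ H⁺ (suc j)
  Nz -[1+ j ] = H⁻ (suc j) ⊞ ⊟ H⁻ j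
  Zz (+ m)    = H⁺ m ⊞ H⁺ (suc m)
  Zz -[1+ m ] = H⁻ (suc m) ⊞ H⁻ m

  RF-- : ∀ G G′ n → RF (λ p k → G p k ℚ.+ ℚ.- G′ p k) n ≡ (RF G ⊞ ⊟ RF G′) n
  RF-- G G′ n = ≡.sym (begin
    (RF G ⊞ ⊟ RF G′) n         ≡⟨ ≡.trans (⊞-at _ _ n) (≡.cong (RF G n ℚ.+_) (⊟-at _ n)) ⟩
    RF G n ℚ.+ ℚ.- RF G′ n     ≡⟨ ≡.cong (ℚ._+ ℚ.- RF G′ n) (≡.trans (RF-ext (λ p k → ≡.sym (lem (G p k) (G′ p k))) n) (RF-+ (λ p k → G p k ℚ.+ ℚ.- G′ p k) G′ n)) ⟩
    (RF (λ p k → G p k ℚ.+ ℚ.- G′ p k) n ℚ.+ RF G′ n) ℚ.+ ℚ.- RF G′ n ≡⟨ lem′ _ _ ⟩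
    RF (λ p k → G p k ℚ.+ ℚ.- G′ p k) n ∎)
    where
    open ≡.≡-Reasoning
    lem : ∀ a b → (a ℚ.+ ℚ.- b) ℚ.+ b ≡ a
    lem = ℚK.solve 2 (λ a b → (a ℚK.:+ ℚK.:- b) ℚK.:+ b ℚK.:= a) ≡.refl
    lem′ : ∀ a b → (a ℚ.+ b) ℚ.+ ℚ.- b ≡ a
    lem′ = ℚK.solve 2 (λ a b → (a ℚK.:+ b) ℚK.:+ ℚK.:- b ℚK.:= a) ≡.refl

  module ResidueSums (N : ℕ) where
    open Mod N
    open RankSums N
    open RankRecurrences N

    rb-sum : ∀ L s → s < 6 → N < 6 ℕ.* L →
      rb s ≈ ∑ L (λ l → Nz (+ (s ℕ.+ 6 ℕ.* l))) + ∑ L (λ l → Nz -[1+ (5 ∸ s) ℕ.+ 6 ℕ.* l ])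
    rb-sum L s s<6 N< = trans (pointwise (rb≡RF s)) (trans
      (RF-local (λ p k p≤N k<N → rank-weight L s p k s<6 (ℕₚ.≤-<-trans p≤N N<) (ℕₚ.<-trans k<N N<)))
      (pointwise λ n → ≡.trans (RF-+ (λ p k → ℚK.∑ L (λ l → A l p k)) (λ p k → ℚK.∑ L (λ l → B l p k)) n) (≡.trans
        (≡.cong₂ ℚ._+_
          (≡.trans (RF-∑ L A n) (ℚK.∑-cong′ L (λ l → RF-- (λ p k → ind (k ℕ.+ a l) p) (λ p k → ind (k ℕ.+ suc (a l)) p) n)))
          (≡.trans (RF-∑ L B n) (ℚK.∑-cong′ L (λ l → RF-- (λ p k → ind k (p ℕ.+ suc (b l))) (λ p k → ind k (p ℕ.+ b l)) n))))
        (≡.sym (≡.trans (⊞-at _ _ n) (≡.cong₂ ℚ._+_ (∑-coeff L (λ l → Nz (+ a l)) n) (∑-coeff L (λ l → Nz -[1+ b l ]) n)))))))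
      where
      a b : ℕ → ℕ
      a l = s ℕ.+ 6 ℕ.* l
      b l = (5 ∸ s) ℕ.+ 6 ℕ.* l
      A B : ℕ → Weight
      A l = Nw⁺ (a l)
      B l = Nw⁻ (b l)

    Nz-even : ∀ j → Nz -[1+ j ] ≈ Nz (+ suc j)
    Nz-even j = trans (+-cong (c (suc j)) (-‿cong (c j)))
      (solve 3 (λ p x y → (p :+ :- x) :+ :- (p :+ :- y) := y :+ :- x) refl P̄ _ _)
      where
      c : ∀ m → H⁻ m ≈ P̄ + - H⁺ (suc m)
      c m = trans (solve 2 (λ a b → a := (a :+ b) :+ :- b) refl (H⁻ m) (H⁺ (suc m))) (+-congʳ (H-complement m))

    Nz-neg : ∀ i → Nz (ℤ.- i) ≈ Nz i
    Nz-neg (+ zero)  = refl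
    Nz-neg (+ suc n) = Nz-even n
    Nz-neg -[1+ n ]  = sym (Nz-even n)

    H⁺-big : ∀ m → N ≤ suc m → H⁺ (suc m) ≈ 0ₛ
    H⁺-big m h = trans (H⁺-suc m) (∑-0 N (λ s _ → q-big-* _ (ℕₚ.≤-trans h (ℕₚ.≤-trans (ℕₚ.m≤m+n (suc m) s) (ℕₚ.n≤1+n _)))))

    Nz-big⁺ : ∀ j → N ≤ suc j → Nz (+ suc j) ≈ 0ₛ
    Nz-big⁺ j h = trans (+-cong (H⁺-big j h) (-‿cong (H⁺-big (suc j) (ℕₚ.≤-trans h (ℕₚ.n≤1+n _))))) (-‿inverseʳ 0ₛ)

    Nz-big : ∀ i → N ≤ ℤ.∣ i ∣ → 1 ≤ ℤ.∣ i ∣ → Nz i ≈ 0ₛ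
    Nz-big (+ suc j) h _ = Nz-big⁺ j h
    Nz-big -[1+ j ]  h _ = trans (Nz-even j) (Nz-big⁺ j h)

    Zz-diff : ∀ i → Zz i + - Zz (ℤ.suc i) ≈ Nz i + Nz (ℤ.suc i)
    Zz-diff (+ m) = solve 3 (λ a b c → (a :+ b) :+ :- (b :+ c) := (a :+ :- b) :+ (b :+ :- c)) refl _ _ _
    -- At i = -1 the two encodings `H⁻ 0` and `H⁺ 0` of rank ≥ 0 meet.
    Zz-diff -[1+ zero ] = trans (+-congˡ (-‿cong (+-congʳ H⁺0≡H⁻0)))
      (trans (solve 3 (λ a b c → (a :+ b) :+ :- (b :+ c) := (a :+ :- b) :+ (b :+ :- c)) refl (H⁻ 1) (H⁻ 0) (H⁺ 1))
        (+-congˡ (+-congʳ (sym H⁺0≡H⁻0))))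
    Zz-diff -[1+ suc m ] = solve 3 (λ a b c → (a :+ b) :+ :- (b :+ c) := (a :+ :- b) :+ (b :+ :- c)) refl _ _ _

    2P̄ : PS
    2P̄ = P̄ + P̄

    Zz-reflect : ∀ m → Zz -[1+ m ] ≈ 2P̄ + - Zz (+ suc m)
    Zz-reflect m = trans (solve 4 (λ a b c d → a :+ c := ((c :+ d) :+ (a :+ b)) :+ :- (d :+ b)) refl (H⁻ (suc m)) (H⁺ (suc (suc m))) (H⁻ m) (H⁺ (suc m)))
      (+-congʳ (+-cong (H-complement m) (H-complement (suc m))))

    Zz-0 : Zz (+ 0) ≈ P̄
    Zz-0 = trans (+-congʳ H⁺0≡H⁻0) (H-complement 0)

    private
      complement : ∀ m → H⁻ (suc m) + H⁻ (suc (suc m)) ≈ 2P̄ + - Zz (+ (2 ℕ.+ m))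
      complement m = trans (solve 4 (λ a b c d → a :+ c := ((a :+ b) :+ (c :+ d)) :+ :- (b :+ d)) refl (H⁻ (suc m)) (H⁺ (suc (suc m))) (H⁻ (suc (suc m))) (H⁺ (suc (suc (suc m)))))
        (+-congʳ (+-cong (H-complement (suc m)) (H-complement (suc (suc m)))))

    Zz-rec : ∀ m → Zz (+ suc m) ≈ q^ (2 ℕ.+ m) * (2P̄ + - Zz (+ (3 ℕ.+ m)))
    Zz-rec m = trans (+-cong (H⁺-suc m) (H⁺-suc (suc m))) (trans (W-recurrence (suc m)) (*-congˡ (complement (suc m))))

    -- The extra 1 is the empty overpartition, which has rank 0 and is absent from `W 0`.
    Zz-rec-0 : Zz (+ 0) ≈ 1ₛ + q^ 1 * (2P̄ + - Zz (+ 2))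
    Zz-rec-0 = trans (+-cong H⁺-0 (H⁺-suc 0)) (trans (+-assoc _ _ _) (+-congˡ (trans (W-recurrence 0) (*-congˡ (complement 0)))))

-- Theta-weighted sums of Z_m in closed form

module ThetaSums where
  open PowerSeries
  open Inverses
  open TripleProducts
  open MockTheta using (module LambertKernels)
  open RankResidues

  dbl : ℕ → ℕ
  dbl zero    = 0
  dbl (suc b) = suc (suc (dbl b))

  dbl≡ : ∀ b → dbl b ≡ 2 ℕ.* b
  dbl≡ zero    = ≡.refl
  dbl≡ (suc b) = ≡.trans (≡.cong (λ x → suc (suc x)) (dbl≡ b)) (≡.sym (ℕₚ.*-suc 2 b))

  -- C − 2i
  minus2 : ℕ → ℕ → ℤ
  minus2 C             zero    = + C
  minus2 zero          (suc i) = -[1+ suc (2 ℕ.* i) ]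
  minus2 (suc zero)    (suc i) = -[1+ 2 ℕ.* i ]
  minus2 (suc (suc C)) (suc i) = minus2 C i

  w : ℕ → PS
  w = θ 2 2

  dₛ : ℕ → ℕ → PS
  dₛ zero    zero    = 1ₛ
  dₛ zero    (suc j) = 0ₛ
  dₛ (suc a) zero    = 0ₛ
  dₛ (suc a) (suc j) = dₛ a j

  module SSums (N : ℕ) where
    open Mod N
    open Units (fin N)
    open ResidueSums N

    private
      -- The defect of Z_m = q^(m+1) (2P̄ - Z_(m+2)) at m = C - 2i - 2, times q^(2i+2). Reflection
      -- carries the recurrence over to negative m; it fails only at m = 0, by the 1 of `Zz-rec-0`,
      -- and at m = -2, by -q^(-1), the reflected form of the same 1.
      corr : ℕ → ℕ → PS
      corr zero                zero    = - q^ 1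
      corr zero                (suc i) = 0ₛ
      corr (suc zero)          i       = 0ₛ
      corr (suc (suc zero))    zero    = q^ 2
      corr (suc (suc (suc C))) zero    = 0ₛ
      corr (suc (suc C))       (suc i) = q^ 2 * corr C i

      reflect₂ : ∀ m → 2P̄ + - Zz -[1+ m ] ≈ Zz (+ suc m)
      reflect₂ m = trans (+-congˡ (-‿cong (Zz-reflect m))) (solve 2 (λ a b → a :+ :- (a :+ :- b) := b) refl _ _)

      left-rec : ∀ C i → q^ (2 ℕ.* i ℕ.+ 2) * Zz (minus2 C (suc i)) ≈ q^ suc C * (2P̄ + - Zz (minus2 C i)) + corr C i
      left-rec zero zero = begin
        q^ 2 * Zz -[1+ 1 ]     ≈⟨ *-cong (q-+ 1 1) (Zz-reflect 1) ⟩
        (q^ 1 * q^ 1) * X      ≈⟨ solve 2 (λ q x → (q :* q) :* x := q :* (:1 :+ q :* x) :+ :- q) refl _ _ ⟩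
        -- Since Z_0 = P̄, the expression 2P̄ - Z_0 is Z_0 itself, to which `Zz-rec-0` applies.
        q^ 1 * (1ₛ + q^ 1 * X) + - q^ 1 ≈⟨ +-congʳ (*-congˡ (sym (trans (+-cong (trans (+-cong (sym Zz-0) (sym Zz-0)) (+-congʳ refl)) refl)
             (trans (solve 1 (λ z → (z :+ z) :+ :- z := z) refl (Zz (+ 0))) Zz-rec-0)))) ⟩
        q^ 1 * (2P̄ + - Zz (+ 0)) + - q^ 1 ∎
        where X = 2P̄ + - Zz (+ 2)
      left-rec zero (suc i) = begin
        q^ (2 ℕ.* suc i ℕ.+ 2) * Zz -[1+ suc (2 ℕ.* suc i) ]
          ≈⟨ *-cong (q-split 1 (3 ℕ.+ 2 ℕ.* i) (e₁ i)) (trans (Zz-reflect _) (+-congˡ (-‿cong (≡⇒≈ (≡.cong (λ x → Zz (+ x)) (e₂ i)))))) ⟩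
        (q^ 1 * q^ (3 ℕ.+ 2 ℕ.* i)) * (2P̄ + - Zz (+ (4 ℕ.+ 2 ℕ.* i)))
          ≈⟨ *-assoc _ _ _ ⟩
        q^ 1 * (q^ (3 ℕ.+ 2 ℕ.* i) * (2P̄ + - Zz (+ (4 ℕ.+ 2 ℕ.* i))))
          ≈⟨ *-congˡ (sym (trans (reflect₂ _) (Zz-rec (suc (2 ℕ.* i))))) ⟩
        q^ 1 * (2P̄ + - Zz -[1+ suc (2 ℕ.* i) ])
          ≈⟨ +-identityʳ _ ⟨
        q^ 1 * (2P̄ + - Zz -[1+ suc (2 ℕ.* i) ]) + 0ₛ ∎
        where
        e₁ : ∀ i → 2 ℕ.* (1 ℕ.+ i) ℕ.+ 2 ≡ 1 ℕ.+ (3 ℕ.+ 2 ℕ.* i)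
        e₁ = solve-∀
        e₂ : ∀ i → 2 ℕ.+ 2 ℕ.* (1 ℕ.+ i) ≡ 4 ℕ.+ 2 ℕ.* i
        e₂ = solve-∀
      left-rec (suc zero) zero = trans (*-congˡ (Zz-reflect 0)) (sym (+-identityʳ _))
      left-rec (suc zero) (suc i) = begin
        q^ (2 ℕ.* suc i ℕ.+ 2) * Zz -[1+ 2 ℕ.* suc i ]
          ≈⟨ *-cong (q-split 2 (2 ℕ.+ 2 ℕ.* i) (e₁ i)) (trans (Zz-reflect _) (+-congˡ (-‿cong (≡⇒≈ (≡.cong (λ x → Zz (+ x)) (e₂ i)))))) ⟩
        (q^ 2 * q^ (2 ℕ.+ 2 ℕ.* i)) * (2P̄ + - Zz (+ (3 ℕ.+ 2 ℕ.* i)))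
          ≈⟨ *-assoc _ _ _ ⟩
        q^ 2 * (q^ (2 ℕ.+ 2 ℕ.* i) * (2P̄ + - Zz (+ (3 ℕ.+ 2 ℕ.* i))))
          ≈⟨ *-congˡ (sym (trans (reflect₂ _) (Zz-rec (2 ℕ.* i)))) ⟩
        q^ 2 * (2P̄ + - Zz -[1+ 2 ℕ.* i ])
          ≈⟨ +-identityʳ _ ⟨
        q^ 2 * (2P̄ + - Zz -[1+ 2 ℕ.* i ]) + 0ₛ ∎
        where
        e₁ : ∀ i → 2 ℕ.* (1 ℕ.+ i) ℕ.+ 2 ≡ 2 ℕ.+ (2 ℕ.+ 2 ℕ.* i)
        e₁ = solve-∀
        e₂ : ∀ i → 1 ℕ.+ 2 ℕ.* (1 ℕ.+ i) ≡ 3 ℕ.+ 2 ℕ.* i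
        e₂ = solve-∀
      left-rec (suc (suc zero)) zero = begin
        q^ 2 * Zz (+ 0) ≈⟨ *-congˡ Zz-rec-0 ⟩
        q^ 2 * (1ₛ + q^ 1 * (2P̄ + - Zz (+ 2))) ≈⟨ solve 3 (λ a b x → a :* (:1 :+ b :* x) := (a :* b) :* x :+ a) refl _ _ _ ⟩
        (q^ 2 * q^ 1) * (2P̄ + - Zz (+ 2)) + q^ 2 ≈⟨ +-congʳ (*-congʳ (sym (q-+ 2 1))) ⟩
        q^ 3 * (2P̄ + - Zz (+ 2)) + q^ 2 ∎
      left-rec (suc (suc (suc C))) zero = begin
        q^ 2 * Zz (+ suc C) ≈⟨ *-congˡ (Zz-rec C) ⟩
        q^ 2 * (q^ (2 ℕ.+ C) * (2P̄ + - Zz (+ (3 ℕ.+ C)))) ≈⟨ *-assoc _ _ _ ⟨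
        (q^ 2 * q^ (2 ℕ.+ C)) * (2P̄ + - Zz (+ (3 ℕ.+ C))) ≈⟨ *-congʳ (q-+ 2 (2 ℕ.+ C)) ⟨
        q^ (4 ℕ.+ C) * (2P̄ + - Zz (+ (3 ℕ.+ C))) ≈⟨ +-identityʳ _ ⟨
        q^ (4 ℕ.+ C) * (2P̄ + - Zz (+ (3 ℕ.+ C))) + 0ₛ ∎
      left-rec (suc (suc C)) (suc i) = begin
        q^ (2 ℕ.* suc i ℕ.+ 2) * Zz (minus2 C (suc i))
          ≈⟨ *-congʳ (q-split 2 (2 ℕ.* i ℕ.+ 2) (e₁ i)) ⟩
        (q^ 2 * q^ (2 ℕ.* i ℕ.+ 2)) * Zz (minus2 C (suc i))
          ≈⟨ trans (*-assoc _ _ _) (*-congˡ (left-rec C i)) ⟩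
        q^ 2 * (q^ suc C * (2P̄ + - Zz (minus2 C i)) + corr C i)
          ≈⟨ solve 4 (λ a b x c → a :* (b :* x :+ c) := (a :* b) :* x :+ a :* c) refl _ _ _ _ ⟩
        (q^ 2 * q^ suc C) * (2P̄ + - Zz (minus2 C i)) + q^ 2 * corr C i
          ≈⟨ +-cong (*-congʳ (sym (q-+ 2 (suc C)))) (sym (corr-step C)) ⟩
        q^ (3 ℕ.+ C) * (2P̄ + - Zz (minus2 C i)) + corr (suc (suc C)) (suc i) ∎
        where
        e₁ : ∀ i → 2 ℕ.* (1 ℕ.+ i) ℕ.+ 2 ≡ 2 ℕ.+ (2 ℕ.* i ℕ.+ 2)
        e₁ = solve-∀
        corr-step : ∀ C → corr (suc (suc C)) (suc i) ≈ q^ 2 * corr C i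
        corr-step zero    = refl
        corr-step (suc C) = refl

      c₀ : ℕ → PS
      c₀ zero    = 1ₛ
      c₀ (suc C) = 0ₛ

      left-start : ∀ C → Zz (+ C) ≈ q^ suc C * (2P̄ + - Zz (+ (2 ℕ.+ C))) + c₀ C
      left-start zero    = trans Zz-rec-0 (+-comm _ _)
      left-start (suc C) = trans (Zz-rec C) (sym (+-identityʳ _))

      w-big : ∀ {f} → w N * f ≈ 0ₛ
      w-big {f} = trans (*-congʳ (θ-vanish 2 (s≤s z≤n) N)) (zeroˡ f)

      w-shift : ∀ (f : ℕ → PS) → ∑ N (λ i → w i * f i) ≈ f 0 + ∑ N (λ i → w (suc i) * f (suc i))
      w-shift f = begin
        ∑ N (λ i → w i * f i)           ≈⟨ trans (+-congˡ w-big) (+-identityʳ _) ⟨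
        ∑ (suc N) (λ i → w i * f i)     ≈⟨ trans (∑-head N _) (+-congʳ (*-identityˡ _)) ⟩
        f 0 + ∑ N (λ i → w (suc i) * f (suc i)) ∎

    l r : ℕ → ℕ → PS
    l C i = Zz (minus2 C i)
    r C i = Zz (+ (2 ℕ.+ C ℕ.+ 2 ℕ.* i))

    S : ℕ → PS
    S C = ∑ N (λ i → w i * (l C i + - r C i))

    private
      S-split : ∀ C → S C ≈ ∑ N (λ i → w i * l C i) + - ∑ N (λ i → w i * r C i)
      S-split C = trans (∑-cong′ N (λ i → solve 3 (λ w a b → w :* (a :+ :- b) := w :* a :+ :- (w :* b)) refl _ _ _))
        (trans (∑-+ N _ _) (+-congˡ (∑-neg N _)))

      -- From w_(i+1) = -q^(2i+2) w_i the recurrence moves each half by one index and reproduces it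
      -- with the factor q^(C+1). The terms with 2P̄ and the boundary term `G 0` agree in both
      -- halves and cancel.
      S-equation : ∀ C → S C ≈ q^ suc C * S C + (c₀ C + - ∑ N (λ i → w i * corr C i))
      S-equation C = begin
        S C
          ≈⟨ S-split C ⟩
        A + - B
          ≈⟨ +-cong left (-‿cong right) ⟩
        ((x * G 0 + c₀ C) + - (x * (y + - A) + κ)) + - - (x * ((y + - B) + - G 0))
          ≈⟨ solve 7 (λ x g c y a b k → ((x :* g :+ c) :+ :- (x :* (y :+ :- a) :+ k)) :+ :- :- (x :* ((y :+ :- b) :+ :- g))
               := x :* (a :+ :- b) :+ (c :+ :- k)) refl x (G 0) (c₀ C) y A B κ ⟩
        x * (A + - B) + (c₀ C + - κ)
          ≈⟨ +-congʳ (*-congˡ (sym (S-split C))) ⟩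
        x * S C + (c₀ C + - κ) ∎
        where
        x = q^ suc C
        A = ∑ N (λ i → w i * l C i)
        B = ∑ N (λ i → w i * r C i)
        y = ∑ N (λ i → w i * 2P̄)
        κ = ∑ N (λ i → w i * corr C i)
        G : ℕ → PS
        G i = 2P̄ + - r C i
        minus : ∀ (f : ℕ → PS) → ∑ N (λ i → w i * (2P̄ + - f i)) ≈ y + - ∑ N (λ i → w i * f i)
        minus f = trans (∑-cong′ N (λ i → solve 3 (λ w a b → w :* (a :+ :- b) := w :* a :+ :- (w :* b)) refl _ _ _))
          (trans (∑-+ N _ _) (+-congˡ (∑-neg N _)))
        left : A ≈ (x * G 0 + c₀ C) + - (x * (y + - A) + κ)
        left = begin
          A ≈⟨ w-shift (l C) ⟩
          l C 0 + ∑ N (λ i → w (suc i) * l C (suc i))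
            ≈⟨ +-cong (trans (left-start C) (+-congʳ (*-congˡ (+-congˡ (-‿cong (≡⇒≈ (≡.cong (λ z → Zz (+ z)) (≡.sym (ℕₚ.+-identityʳ (2 ℕ.+ C))))))))))
                 (trans (∑-cong′ N (λ i → trans (solve 3 (λ a b c → (:- (a :* b)) :* c := :- (b :* (a :* c))) refl _ _ _)
                   (-‿cong (trans (*-congˡ (left-rec C i)) (solve 4 (λ w x a c → w :* (x :* a :+ c) := x :* (w :* a) :+ w :* c) refl _ _ _ _)))))
                   (trans (∑-neg N _) (-‿cong (trans (∑-+ N _ _) (+-congʳ (trans (∑-*ˡ N _ _) (*-congˡ (minus (l C))))))))) ⟩
          (x * G 0 + c₀ C) + - (x * (y + - A) + κ) ∎
        right : B ≈ - (x * ((y + - B) + - G 0))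
        right = begin
          B ≈⟨ ∑-cong′ N (λ i → trans (*-congˡ (trans (Zz-rec (1 ℕ.+ C ℕ.+ 2 ℕ.* i))
                 (*-cong (q-split (suc C) (2 ℕ.* i ℕ.+ 2) (e₁ C i)) (+-congˡ (-‿cong (≡⇒≈ (≡.cong (λ z → Zz (+ z)) (e₂ C i))))))))
                 (solve 4 (λ w x a g → w :* ((x :* a) :* g) := (:- x) :* ((:- (a :* w)) :* g)) refl _ _ _ _)) ⟩
          ∑ N (λ i → - x * (w (suc i) * G (suc i)))
            ≈⟨ ∑-*ˡ N _ _ ⟩
          - x * ∑ N (λ i → w (suc i) * G (suc i))
            ≈⟨ *-congˡ (trans (solve 2 (λ g s → s := (g :+ s) :+ :- g) refl (G 0) _) (+-congʳ (trans (sym (w-shift G)) (minus (r C))))) ⟩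
          - x * ((y + - B) + - G 0)
            ≈⟨ solve 2 (λ a b → (:- a) :* b := :- (a :* b)) refl _ _ ⟩
          - (x * ((y + - B) + - G 0)) ∎
          where
          e₁ : ∀ C i → 2 ℕ.+ (1 ℕ.+ C ℕ.+ 2 ℕ.* i) ≡ (1 ℕ.+ C) ℕ.+ (2 ℕ.* i ℕ.+ 2)
          e₁ = solve-∀
          e₂ : ∀ C i → 3 ℕ.+ (1 ℕ.+ C ℕ.+ 2 ℕ.* i) ≡ 2 ℕ.+ C ℕ.+ 2 ℕ.* (1 ℕ.+ i)
          e₂ = solve-∀

      S-solve : ∀ C k → c₀ C + - ∑ N (λ i → w i * corr C i) ≈ k → S C ≈ k * inv (1ₛ + - q^ suc C)
      S-solve C k h = inv-unique (1ₛ + - q^ suc C) (unit-1-q C) (begin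
        (1ₛ + - q^ suc C) * S C ≈⟨ solve 2 (λ x s → (:1 :+ :- x) :* s := s :+ :- (x :* s)) refl _ _ ⟩
        S C + - (q^ suc C * S C) ≈⟨ +-congʳ (S-equation C) ⟩
        (q^ suc C * S C + (c₀ C + - ∑ N (λ i → w i * corr C i))) + - (q^ suc C * S C) ≈⟨ solve 2 (λ a b → (a :+ b) :+ :- a := b) refl _ _ ⟩
        c₀ C + - ∑ N (λ i → w i * corr C i) ≈⟨ h ⟩
        k ∎)

      -- For C = 2b the index m = 0 is met at i = b - 1 and m = -2 at i = b; the two deltas mark
      -- these positions.
      corr-even : ∀ b i → corr (dbl b) i ≈ dₛ b (suc i) * q^ dbl b + - (dₛ b i * q^ suc (dbl b))
      corr-even zero    zero    = solve 2 (λ a b → :- b := :0 :* a :+ :- (:1 :* b)) refl (q^ 0) (q^ 1)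
      corr-even zero    (suc i) = solve 2 (λ a b → :0 := :0 :* a :+ :- (:0 :* b)) refl (q^ 0) (q^ 1)
      corr-even (suc zero) zero = solve 2 (λ a b → a := :1 :* a :+ :- (:0 :* b)) refl (q^ 2) (q^ 3)
      corr-even (suc (suc b)) zero = solve 2 (λ a b → :0 := :0 :* a :+ :- (:0 :* b)) refl (q^ (4 ℕ.+ dbl b)) (q^ (5 ℕ.+ dbl b))
      corr-even (suc b) (suc i) = trans (step b) (trans (*-congˡ (corr-even b i))
        (trans (solve 5 (λ z a x b y → z :* (a :* x :+ :- (b :* y)) := a :* (z :* x) :+ :- (b :* (z :* y))) refl _ _ _ _ _)
          (+-cong (*-congˡ (sym (q-+ 2 (dbl b)))) (-‿cong (*-congˡ (sym (q-+ 2 (suc (dbl b)))))))))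
        where
        step : ∀ b → corr (suc (suc (dbl b))) (suc i) ≈ q^ 2 * corr (dbl b) i
        step zero    = refl
        step (suc b) = refl

      corr-odd : ∀ b i → corr (suc (dbl b)) i ≈ 0ₛ
      corr-odd zero    i       = refl
      corr-odd (suc b) zero    = refl
      corr-odd (suc b) (suc i) = trans (*-congˡ (corr-odd b i)) (zeroʳ _)

      dₛ-refl : ∀ a → dₛ a a ≈ 1ₛ
      dₛ-refl zero    = refl
      dₛ-refl (suc a) = dₛ-refl a

      dₛ-≢ : ∀ a j → j ≢ a → dₛ a j ≈ 0ₛ
      dₛ-≢ zero    zero    h = contradiction ≡.refl h
      dₛ-≢ zero    (suc j) h = refl
      dₛ-≢ (suc a) zero    h = refl
      dₛ-≢ (suc a) (suc j) h = dₛ-≢ a j (λ e → h (≡.cong suc e))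

      w-pick : ∀ b x → ∑ N (λ i → w i * (dₛ b i * x)) ≈ w b * x
      w-pick b x with b ℕ.<? N
      ... | yes b<N = trans (∑-single N _ b<N (λ i h → trans (*-congˡ (trans (*-congʳ (dₛ-≢ b i h)) (zeroˡ x))) (zeroʳ _)))
            (*-congˡ (trans (*-congʳ (dₛ-refl b)) (*-identityˡ x)))
      ... | no b≮N = trans (∑-0 N (λ i i<N → trans (*-congˡ (trans (*-congʳ (dₛ-≢ b i (λ e → b≮N (≡.subst (_< N) e i<N)))) (zeroˡ x))) (zeroʳ _)))
            (sym (trans (*-congʳ (coarsen (ℕₚ.≮⇒≥ b≮N) (θ-vanish 2 (s≤s z≤n) b))) (zeroˡ x)))

      -- The correction at i = b - 1 becomes w_b by w_b = -q^(2b) w_(b-1). For b = 0 that position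
      -- does not exist and `c₀` takes its place.
      κ-even : ∀ b → c₀ (dbl b) + - ∑ N (λ i → w i * corr (dbl b) i) ≈ w b * (1ₛ + q^ suc (dbl b))
      κ-even b = trans (+-congˡ (-‿cong (trans (∑-cong′ N (λ i → trans (*-congˡ (corr-even b i))
          (solve 3 (λ w a b → w :* (a :+ :- b) := w :* a :+ :- (w :* b)) refl _ _ _)))
          (trans (∑-+ N _ _) (+-congˡ (trans (∑-neg N _) (-‿cong (w-pick b _))))))))
        (trans (+-congˡ (-‿cong (+-congʳ (first b)))) (final b))
        where
        first : ∀ b → ∑ N (λ i → w i * (dₛ b (suc i) * q^ dbl b)) ≈ c₀ (dbl b) + - w b
        first zero    = trans (∑-0 N (λ i _ → trans (*-congˡ (zeroˡ _)) (zeroʳ _))) (sym (-‿inverseʳ 1ₛ))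
        first (suc b) = trans (w-pick b _) (trans (*-congˡ (q-cong (≡.trans (≡.cong (2 ℕ.+_) (dbl≡ b)) (ℕₚ.+-comm 2 (2 ℕ.* b)))))
          (solve 2 (λ w x → w :* x := :0 :+ :- :- (x :* w)) refl _ _))
        final : ∀ b → c₀ (dbl b) + - ((c₀ (dbl b) + - w b) + - (w b * q^ suc (dbl b))) ≈ w b * (1ₛ + q^ suc (dbl b))
        final b = solve 3 (λ c w x → c :+ :- ((c :+ :- w) :+ :- (w :* x)) := w :* (:1 :+ x)) refl _ _ _

    open LambertKernels (fin N) using (ωKernel)

    S-even : ∀ b → S (dbl b) ≈ w b * ωKernel b
    S-even b = trans (S-solve (dbl b) _ (κ-even b)) (trans (*-assoc _ _ _)
      (*-congˡ (≡⇒≈ (≡.cong (λ e → (1ₛ ⊞ q^ e) ⊠ inv (1ₛ ⊞ ⊟ q^ e)) (≡.cong suc (dbl≡ b))))))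

    S-odd : ∀ b → S (suc (dbl b)) ≈ 0ₛ
    S-odd b = trans (S-solve (suc (dbl b)) 0ₛ (trans (+-identityˡ _) (trans (-‿cong (∑-0 N (λ i _ → trans (*-congˡ (corr-odd b i)) (zeroʳ _)))) -0#≈0#))) (zeroˡ _)

-- Differences of rank generating functions as Lambert series

module RankDifferences where
  open PowerSeries
  open Inverses
  open TripleProducts
  open MockTheta using (Vanishing-*ʳ; module LambertKernels; module K∞)
  open RankResidues
  open ThetaSums

  minus2≡ : ∀ C i → minus2 C i ≡ + C ℤ.- + (2 ℕ.* i)
  minus2≡ C             zero    = ≡.sym (ℤₚ.+-identityʳ (+ C))
  minus2≡ zero          (suc i) = ≡.cong -[1+_] (≡.sym (ℕₚ.+-suc i (i ℕ.+ 0)))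
  minus2≡ (suc zero)    (suc i) = ≡.trans (neg i) (lem (+ i))
    where
    neg : ∀ i → -[1+ 2 ℕ.* i ] ≡ ℤ.- (+ 1 ℤ.+ (+ i ℤ.+ (+ i ℤ.+ + 0)))
    neg i = ≡.refl
    lem : ∀ x → ℤ.- (+ 1 ℤ.+ (x ℤ.+ (x ℤ.+ + 0))) ≡ + 1 ℤ.- ((+ 1 ℤ.+ x) ℤ.+ ((+ 1 ℤ.+ x) ℤ.+ + 0))
    lem = ℤS.solve-∀
  minus2≡ (suc (suc C)) (suc i) = ≡.trans (minus2≡ C i) (lem (+ C) (+ i))
    where
    lem : ∀ c x → c ℤ.- (x ℤ.+ (x ℤ.+ + 0)) ≡ (+ 2 ℤ.+ c) ℤ.- ((+ 1 ℤ.+ x) ℤ.+ ((+ 1 ℤ.+ x) ℤ.+ + 0))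
    lem = ℤS.solve-∀

  module Bilaterals (N : ℕ) where
    open Mod N
    open ResidueSums N
    open SSums N
    open LambertKernels (fin N) using (ωKernel)

    -- 6L = 12N + 18 leaves room for all arguments t - 6a with |t| ≤ 6 and a ≤ N + 1; `room` checks
    -- this.
    L : ℕ
    L = 2 ℕ.* N ℕ.+ 3

    -- Σ_{m ≡ x mod 6} N_m, over a window wide enough modulo q^N
    BL : ℤ → PS
    BL x = ∑ L (λ l → Nz (x ℤ.+ + (6 ℕ.* l))) + ∑ L (λ l → Nz (x ℤ.- + (6 ℕ.* suc l)))

    Nz-≡ : ∀ {i j} → i ≡ j → Nz i ≈ Nz j
    Nz-≡ e = ≡⇒≈ (≡.cong Nz e)

    Zz-≡ : ∀ {i j} → i ≡ j → Zz i ≈ Zz j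
    Zz-≡ e = ≡⇒≈ (≡.cong Zz e)

    private
      p m : ℤ → ℕ → PS
      p x l = Nz (x ℤ.+ + (6 ℕ.* l))
      m x l = Nz (x ℤ.- + (6 ℕ.* l))

      -- Both the shift by 6 and the reflection of `BL` lead to this window. It differs from that of
      -- `BL` only in far terms, which vanish modulo q^N.
      swapped : ℤ → PS
      swapped x = ∑ L (m x) + ∑ L (λ l → p x (suc l))

      far⁺ : ∀ x → ℤ.∣ x ∣ ℕ.+ suc N ≤ 6 ℕ.* L → p x L ≈ 0ₛ
      far⁺ x h = Nz-big (x ℤ.+ + (6 ℕ.* L)) (ℕₚ.≤-trans (ℕₚ.n≤1+n N) b) (ℕₚ.≤-trans (s≤s z≤n) b)
        where
        y = x ℤ.+ + (6 ℕ.* L)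
        lem : ∀ x k → k ≡ (x ℤ.+ k) ℤ.- x
        lem = ℤS.solve-∀
        b : suc N ≤ ℤ.∣ y ∣
        b = ℕₚ.+-cancelˡ-≤ ℤ.∣ x ∣ _ _ (ℕₚ.≤-trans h (ℕₚ.≤-trans (ℕₚ.≤-reflexive (≡.cong ℤ.∣_∣ (lem x (+ (6 ℕ.* L)))))
              (ℕₚ.≤-trans (ℤₚ.∣i-j∣≤∣i∣+∣j∣ y x) (ℕₚ.≤-reflexive (ℕₚ.+-comm ℤ.∣ y ∣ ℤ.∣ x ∣)))))

      far⁻ : ∀ x → ℤ.∣ x ∣ ℕ.+ suc N ≤ 6 ℕ.* L → m x L ≈ 0ₛ
      far⁻ x h = Nz-big (x ℤ.- + (6 ℕ.* L)) (ℕₚ.≤-trans (ℕₚ.n≤1+n N) b) (ℕₚ.≤-trans (s≤s z≤n) b)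
        where
        y = x ℤ.- + (6 ℕ.* L)
        lem : ∀ x k → k ≡ x ℤ.- (x ℤ.- k)
        lem = ℤS.solve-∀
        b : suc N ≤ ℤ.∣ y ∣
        b = ℕₚ.+-cancelˡ-≤ ℤ.∣ x ∣ _ _ (ℕₚ.≤-trans h (ℕₚ.≤-trans (ℕₚ.≤-reflexive (≡.cong ℤ.∣_∣ (lem x (+ (6 ℕ.* L)))))
              (ℤₚ.∣i-j∣≤∣i∣+∣j∣ x y)))

      swapped≈BL : ∀ x → ℤ.∣ x ∣ ℕ.+ suc N ≤ 6 ℕ.* L → swapped x ≈ BL x
      swapped≈BL x h = begin
        ∑ L (m x) + ∑ L (λ l → p x (suc l))
          ≈⟨ +-cong (pad (m x) (far⁻ x h)) (unpad (p x) (far⁺ x h)) ⟩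
        (m x 0 + ∑ L (λ l → m x (suc l))) + (∑ L (p x) + - p x 0)
          ≈⟨ +-congʳ (+-congʳ (Nz-≡ (ends x))) ⟩
        (p x 0 + ∑ L (λ l → m x (suc l))) + (∑ L (p x) + - p x 0)
          ≈⟨ solve 3 (λ a b c → (a :+ b) :+ (c :+ :- a) := c :+ b) refl _ _ _ ⟩
        BL x ∎
        where
        ends : ∀ x → x ℤ.- + 0 ≡ x ℤ.+ + 0
        ends = ℤS.solve-∀
        pad : ∀ f → f L ≈ 0ₛ → ∑ L f ≈ f 0 + ∑ L (λ l → f (suc l))
        pad f z = trans (sym (trans (+-congˡ z) (+-identityʳ _))) (∑-head L f)
        unpad : ∀ f → f L ≈ 0ₛ → ∑ L (λ l → f (suc l)) ≈ ∑ L f + - f 0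
        unpad f z = trans (solve 2 (λ a b → b := (a :+ b) :+ :- a) refl (f 0) _) (+-congʳ (sym (pad f z)))

    BL-shift : ∀ x → ℤ.∣ x ∣ ℕ.+ suc N ≤ 6 ℕ.* L → BL (x ℤ.+ + 6) ≈ BL x
    BL-shift x h = trans (trans (+-cong (∑-cong′ L (λ l → Nz-≡ (e₁ l))) (∑-cong′ L (λ l → Nz-≡ (e₂ l)))) (+-comm _ _)) (swapped≈BL x h)
      where
      l₁ : ∀ x y → (x ℤ.+ + 6) ℤ.+ y ≡ x ℤ.+ (+ 6 ℤ.+ y)
      l₁ = ℤS.solve-∀
      e₁ : ∀ l → (x ℤ.+ + 6) ℤ.+ + (6 ℕ.* l) ≡ x ℤ.+ + (6 ℕ.* suc l)
      e₁ l = ≡.trans (l₁ x (+ (6 ℕ.* l))) (≡.cong (λ k → x ℤ.+ + k) (≡.sym (ℕₚ.*-suc 6 l)))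
      l₂ : ∀ x y → (x ℤ.+ + 6) ℤ.- (+ 6 ℤ.+ y) ≡ x ℤ.- y
      l₂ = ℤS.solve-∀
      e₂ : ∀ l → (x ℤ.+ + 6) ℤ.- + (6 ℕ.* suc l) ≡ x ℤ.- + (6 ℕ.* l)
      e₂ l = ≡.trans (≡.cong (λ k → (x ℤ.+ + 6) ℤ.- + k) (ℕₚ.*-suc 6 l)) (l₂ x (+ (6 ℕ.* l)))

    BL-even : ∀ x → ℤ.∣ x ∣ ℕ.+ suc N ≤ 6 ℕ.* L → BL (ℤ.- x) ≈ BL x
    BL-even x h = trans (+-cong (∑-cong′ L (λ l → trans (Nz-≡ (l₁ x (+ (6 ℕ.* l)))) (Nz-neg (x ℤ.- + (6 ℕ.* l)))))
                                (∑-cong′ L (λ l → trans (Nz-≡ (l₂ x (+ (6 ℕ.* suc l)))) (Nz-neg (x ℤ.+ + (6 ℕ.* suc l)))))) (swapped≈BL x h)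
      where
      l₁ : ∀ x y → ℤ.- x ℤ.+ y ≡ ℤ.- (x ℤ.- y)
      l₁ = ℤS.solve-∀
      l₂ : ∀ x y → ℤ.- x ℤ.- y ≡ ℤ.- (x ℤ.+ y)
      l₂ = ℤS.solve-∀

    private
      room : ∀ t a → ℤ.∣ t ∣ ≤ 6 → a ≤ suc N → ℤ.∣ t ℤ.- + (6 ℕ.* a) ∣ ℕ.+ suc N ≤ 6 ℕ.* L
      room t a t≤ a≤ = ℕₚ.≤-trans (ℕₚ.+-monoˡ-≤ (suc N) (ℕₚ.≤-trans (ℤₚ.∣i-j∣≤∣i∣+∣j∣ t (+ (6 ℕ.* a))) (ℕₚ.+-mono-≤ t≤ (ℕₚ.*-monoʳ-≤ 6 a≤))))
        (ℕₚ.≤-trans (ℕₚ.m≤m+n _ (5 ℕ.+ 5 ℕ.* N)) (ℕₚ.≤-reflexive (e N)))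
        where
        e : ∀ N → 6 ℕ.+ 6 ℕ.* (1 ℕ.+ N) ℕ.+ (1 ℕ.+ N) ℕ.+ (5 ℕ.+ 5 ℕ.* N) ≡ 6 ℕ.* (2 ℕ.* N ℕ.+ 3)
        e = solve-∀

    BL-down : ∀ t a → ℤ.∣ t ∣ ≤ 6 → a ≤ suc N → BL (t ℤ.- + (6 ℕ.* a)) ≈ BL t
    BL-down t zero    _  _  = ≡⇒≈ (≡.cong BL (ℤₚ.+-identityʳ t))
    BL-down t (suc a) t≤ a< = trans (sym (BL-shift (t ℤ.- + (6 ℕ.* suc a)) (room t (suc a) t≤ a<)))
      (trans (≡⇒≈ (≡.cong BL e)) (BL-down t a t≤ (ℕₚ.<⇒≤ a<)))
      where
      l₂ : ∀ x y → (x ℤ.- (+ 6 ℤ.+ y)) ℤ.+ + 6 ≡ x ℤ.- y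
      l₂ = ℤS.solve-∀
      e : (t ℤ.- + (6 ℕ.* suc a)) ℤ.+ + 6 ≡ t ℤ.- + (6 ℕ.* a)
      e = ≡.trans (≡.cong (λ k → (t ℤ.- + k) ℤ.+ + 6) (ℕₚ.*-suc 6 a)) (l₂ t (+ (6 ℕ.* a)))

    private
      small : ∀ t → ℤ.∣ t ∣ ≤ 6 → ℤ.∣ t ∣ ℕ.+ suc N ≤ 6 ℕ.* L
      small t t≤ = ≡.subst (λ x → ℤ.∣ x ∣ ℕ.+ suc N ≤ 6 ℕ.* L) (ℤₚ.+-identityʳ t) (room t 0 t≤ z≤n)

    -- The hypothesis matches the downward half of the window with the ranks -(j + 1) of `rb-sum`.
    -- It is left to each numeral s, for which 5 ∸ s computes and the ring solver applies.
    BL-rb : ∀ s → s < 6 → (∀ y → + s ℤ.- (+ 6 ℤ.+ y) ≡ ℤ.- (+ 1 ℤ.+ (+ (5 ∸ s) ℤ.+ y))) → BL (+ s) ≈ rb s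
    BL-rb s s<6 e = sym (trans (rb-sum L s s<6 N<) (+-congˡ (∑-cong′ L (λ l → Nz-≡ (≡.sym
      (≡.trans (≡.cong (λ k → + s ℤ.- + k) (ℕₚ.*-suc 6 l)) (e (+ (6 ℕ.* l)))))))))
      where
      N< : N < 6 ℕ.* L
      N< = small (+ 0) z≤n

    BL0 : BL (+ 0) ≈ rb 0
    BL0 = BL-rb 0 (s≤s z≤n) ℤS.solve-∀
    BL1 : BL (+ 1) ≈ rb 1
    BL1 = BL-rb 1 (s≤s (s≤s z≤n)) ℤS.solve-∀
    BL2 : BL (+ 2) ≈ rb 2
    BL2 = BL-rb 2 (s≤s (s≤s (s≤s z≤n))) ℤS.solve-∀
    BL3 : BL (+ 3) ≈ rb 3
    BL3 = BL-rb 3 (s≤s (s≤s (s≤s (s≤s z≤n)))) ℤS.solve-∀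
    BL-1 : BL -[1+ 0 ] ≈ rb 1
    BL-1 = trans (BL-even (+ 1) (small (+ 1) (s≤s z≤n))) BL1
    BL-2 : BL -[1+ 1 ] ≈ rb 2
    BL-2 = trans (BL-even (+ 2) (small (+ 2) (s≤s (s≤s z≤n)))) BL2
    BL-3 : BL -[1+ 2 ] ≈ rb 3
    BL-3 = trans (BL-even (+ 3) (small (+ 3) (s≤s (s≤s (s≤s z≤n))))) BL3
    BL4 : BL (+ 4) ≈ rb 2
    BL4 = trans (BL-shift -[1+ 1 ] (small -[1+ 1 ] (s≤s (s≤s z≤n)))) BL-2
    BL5 : BL (+ 5) ≈ rb 1
    BL5 = trans (BL-shift -[1+ 0 ] (small -[1+ 0 ] (s≤s z≤n))) BL-1
    BL-4 : BL -[1+ 3 ] ≈ rb 2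
    BL-4 = trans (BL-even (+ 4) (small (+ 4) (s≤s (s≤s (s≤s (s≤s z≤n)))))) BL4

    rb-4 : rb 4 ≈ rb 2
    rb-4 = trans (sym (BL-rb 4 (s≤s (s≤s (s≤s (s≤s (s≤s z≤n))))) ℤS.solve-∀)) BL4

    rb-5 : rb 5 ≈ rb 1
    rb-5 = trans (sym (BL-rb 5 (s≤s (s≤s (s≤s (s≤s (s≤s (s≤s z≤n)))))) ℤS.solve-∀)) BL5

    private
      w-terms : ∀ (F : ℕ → PS) → ∑ N (λ i → w i * F i) ≈ ∑ (N ℕ.* 3) (λ i → w i * F i)
      w-terms F = sym (∑-extend _ (ℕₚ.m≤m*n N 3) (λ i h → trans (*-congʳ (coarsen h (θ-vanish 2 (s≤s z≤n) i))) (zeroˡ (F i))))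

      at3 : ∀ t j a → ℤ.∣ t ℤ.- + (2 ℕ.* j) ∣ ≤ 6 → a ≤ N → BL (t ℤ.- + (2 ℕ.* (j ℕ.+ a ℕ.* 3))) ≈ BL (t ℤ.- + (2 ℕ.* j))
      at3 t j a h a≤ = trans (≡⇒≈ (≡.cong BL e)) (BL-down (t ℤ.- + (2 ℕ.* j)) a h (ℕₚ.≤-trans a≤ (ℕₚ.n≤1+n N)))
        where
        ℕe : ∀ j a → 2 ℕ.* (j ℕ.+ a ℕ.* 3) ≡ 2 ℕ.* j ℕ.+ 6 ℕ.* a
        ℕe = solve-∀
        lem : ∀ t x y → t ℤ.- (x ℤ.+ y) ≡ (t ℤ.- x) ℤ.- y
        lem = ℤS.solve-∀
        e : t ℤ.- + (2 ℕ.* (j ℕ.+ a ℕ.* 3)) ≡ (t ℤ.- + (2 ℕ.* j)) ℤ.- + (6 ℕ.* a)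
        e = ≡.trans (≡.cong (λ k → t ℤ.- + k) (ℕe j a)) (lem t (+ (2 ℕ.* j)) (+ (6 ℕ.* a)))

      -- Two consecutive differences Z_x - Z_(x+1) = N_x + N_(x+1) share the middle N, which
      -- cancels.
      second-difference : ∀ x → (Zz (ℤ.suc x) + Zz (ℤ.suc x)) + - Zz x + - Zz (ℤ.suc (ℤ.suc x)) ≈ Nz (ℤ.suc (ℤ.suc x)) + - Nz x
      second-difference x = begin
        (Zz (ℤ.suc x) + Zz (ℤ.suc x)) + - Zz x + - Zz (ℤ.suc (ℤ.suc x))
          ≈⟨ solve 3 (λ a b c → (b :+ b) :+ :- a :+ :- c := (b :+ :- c) :+ :- (a :+ :- b)) refl _ _ _ ⟩
        (Zz (ℤ.suc x) + - Zz (ℤ.suc (ℤ.suc x))) + - (Zz x + - Zz (ℤ.suc x))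
          ≈⟨ +-cong (Zz-diff (ℤ.suc x)) (-‿cong (Zz-diff x)) ⟩
        (Nz (ℤ.suc x) + Nz (ℤ.suc (ℤ.suc x))) + - (Nz x + Nz (ℤ.suc x))
          ≈⟨ solve 3 (λ a b c → (b :+ c) :+ :- (a :+ b) := c :+ :- a) refl _ _ _ ⟩
        Nz (ℤ.suc (ℤ.suc x)) + - Nz x ∎

      suc³ suc⁴ : ℤ → ℤ
      suc³ x = ℤ.suc (ℤ.suc (ℤ.suc x))
      suc⁴ x = ℤ.suc (suc³ x)

      outer-difference : ∀ x → Zz x + - Zz (ℤ.suc x) + - Zz (suc³ x) + Zz (suc⁴ x) ≈ (Nz x + Nz (ℤ.suc x)) + - (Nz (suc³ x) + Nz (suc⁴ x))
      outer-difference x = trans (solve 4 (λ a b c d → a :+ :- b :+ :- c :+ d := (a :+ :- b) :+ :- (c :+ :- d)) refl _ _ _ _)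
        (+-cong (Zz-diff x) (-‿cong (Zz-diff (suc³ x))))

      six : ℕ → ℕ
      six l = 6 ℕ.* l

      shiftᶻ : ∀ c y z → (c ℤ.+ y) ℤ.- z ≡ (c ℤ.- z) ℤ.+ y
      shiftᶻ = ℤS.solve-∀

      leftᶻ : ∀ c l i → minus2 (c ℕ.+ six l) i ≡ (+ c ℤ.- + (2 ℕ.* i)) ℤ.+ + six l
      leftᶻ c l i = ≡.trans (minus2≡ (c ℕ.+ six l) i) (shiftᶻ (+ c) (+ six l) (+ (2 ℕ.* i)))

      sucᶻ : ∀ c l i → ℤ.suc (minus2 (c ℕ.+ six l) i) ≡ minus2 (suc c ℕ.+ six l) i
      sucᶻ c l i = ≡.trans (≡.cong ℤ.suc (leftᶻ c l i)) (≡.trans (lem (+ c) (+ (2 ℕ.* i)) (+ six l)) (≡.sym (leftᶻ (suc c) l i)))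
        where
        lem : ∀ c z y → + 1 ℤ.+ ((c ℤ.- z) ℤ.+ y) ≡ ((+ 1 ℤ.+ c) ℤ.- z) ℤ.+ y
        lem = ℤS.solve-∀

      -- The right half of `S` runs over positive indices only; evenness of N turns them into the
      -- negative members of the class of c - 2i.
      mirror : ∀ c c′ l i → (∀ (y : ℤ) → c ℤ.- (+ 6 ℤ.+ y) ≡ ℤ.- (+ c′ ℤ.+ y)) →
               Nz (+ (c′ ℕ.+ six l ℕ.+ 2 ℕ.* i)) ≈ Nz ((c ℤ.- + (2 ℕ.* i)) ℤ.- + (6 ℕ.* suc l))
      mirror c c′ l i h = trans (sym (Nz-neg (+ (c′ ℕ.+ six l ℕ.+ 2 ℕ.* i)))) (Nz-≡ (≡.sym (≡.trans
        (≡.cong (λ k → (c ℤ.- + (2 ℕ.* i)) ℤ.- + k) (ℕₚ.*-suc 6 l))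
        (≡.trans (lem c (+ (2 ℕ.* i)) (+ six l)) (≡.trans (≡.cong (ℤ._- + (2 ℕ.* i)) (h (+ six l))) (lem′ (+ c′) (+ six l) (+ (2 ℕ.* i))))))))
        where
        lem : ∀ c z y → (c ℤ.- z) ℤ.- (+ 6 ℤ.+ y) ≡ (c ℤ.- (+ 6 ℤ.+ y)) ℤ.- z
        lem = ℤS.solve-∀
        lem′ : ∀ c y z → ℤ.- (c ℤ.+ y) ℤ.- z ≡ ℤ.- ((c ℤ.+ y) ℤ.+ z)
        lem′ = ℤS.solve-∀

    private
      g : ℕ → ℕ → PS
      g C i = l C i + - r C i

    S≡ : ∀ {C C′} → C ≡ C′ → S C ≈ S C′
    S≡ e = ≡⇒≈ (≡.cong S e)

    private
      odd-zero : ∀ C b → C ≡ suc (2 ℕ.* b) → S C ≈ 0ₛ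
      odd-zero C b e = trans (S≡ (≡.trans e (≡.cong suc (≡.sym (dbl≡ b))))) (S-odd b)

      even-value : ∀ C b → C ≡ 2 ℕ.* b → S C ≈ w b * ωKernel b
      even-value C b e = trans (S≡ (≡.trans e (≡.sym (dbl≡ b)))) (S-even b)

    private
      -- Summed over l, the left halves fill the upward parts of the two windows and the mirrored
      -- right halves the downward parts.
      weight₁ : ∀ i → ∑ L (λ l → ((g (2 ℕ.+ six l) i + g (2 ℕ.+ six l) i) + - g (1 ℕ.+ six l) i + - g (3 ℕ.+ six l) i))
                    ≈ BL (+ 3 ℤ.- + (2 ℕ.* i)) + - BL (+ 1 ℤ.- + (2 ℕ.* i))
      weight₁ i = begin
        _ ≈⟨ ∑-cong′ L (λ k → trans
               (solve 6 (λ a b c a′ b′ c′ → ((b :+ :- b′) :+ (b :+ :- b′)) :+ :- (a :+ :- a′) :+ :- (c :+ :- c′)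
                 := ((b :+ b) :+ :- a :+ :- c) :+ :- ((b′ :+ b′) :+ :- a′ :+ :- c′)) refl
                 (l (1 ℕ.+ six k) i) _ _ (r (1 ℕ.+ six k) i) _ _)
               (+-cong (left k) (-‿cong (right k)))) ⟩
        ∑ L (λ l → (A₃ l + - A₁ l) + - (B₁ l + - B₃ l))
          ≈⟨ ∑-cong′ L (λ l → solve 4 (λ a b c d → (a :+ :- b) :+ :- (c :+ :- d) := (a :+ d) :+ :- (b :+ c)) refl (A₃ l) (A₁ l) (B₁ l) (B₃ l)) ⟩
        ∑ L (λ l → (A₃ l + B₃ l) + - (A₁ l + B₁ l))
          ≈⟨ trans (∑-+ L _ _) (+-cong (∑-+ L A₃ B₃) (trans (∑-neg L _) (-‿cong (∑-+ L A₁ B₁)))) ⟩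
        BL (+ 3 ℤ.- + (2 ℕ.* i)) + - BL (+ 1 ℤ.- + (2 ℕ.* i)) ∎
        where
        A₁ A₃ B₁ B₃ : ℕ → PS
        A₁ l = Nz ((+ 1 ℤ.- + (2 ℕ.* i)) ℤ.+ + (6 ℕ.* l))
        A₃ l = Nz ((+ 3 ℤ.- + (2 ℕ.* i)) ℤ.+ + (6 ℕ.* l))
        B₁ l = Nz ((+ 1 ℤ.- + (2 ℕ.* i)) ℤ.- + (6 ℕ.* suc l))
        B₃ l = Nz ((+ 3 ℤ.- + (2 ℕ.* i)) ℤ.- + (6 ℕ.* suc l))
        left : ∀ k → (l (2 ℕ.+ six k) i + l (2 ℕ.+ six k) i) + - l (1 ℕ.+ six k) i + - l (3 ℕ.+ six k) i ≈ A₃ k + - A₁ k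
        left k = begin
          _ ≈⟨ +-cong (+-congʳ (+-cong e₂ e₂)) (-‿cong e₃) ⟩
          (Zz (ℤ.suc x) + Zz (ℤ.suc x)) + - Zz x + - Zz (ℤ.suc (ℤ.suc x)) ≈⟨ second-difference x ⟩
          Nz (ℤ.suc (ℤ.suc x)) + - Nz x
            ≈⟨ +-cong (Nz-≡ (≡.trans (≡.cong ℤ.suc (sucᶻ 1 k i)) (≡.trans (sucᶻ 2 k i) (leftᶻ 3 k i)))) (-‿cong (Nz-≡ (leftᶻ 1 k i))) ⟩
          A₃ k + - A₁ k ∎
          where
          x = minus2 (1 ℕ.+ six k) i
          e₂ : l (2 ℕ.+ six k) i ≈ Zz (ℤ.suc x)
          e₂ = Zz-≡ (≡.sym (sucᶻ 1 k i))
          e₃ : l (3 ℕ.+ six k) i ≈ Zz (ℤ.suc (ℤ.suc x))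
          e₃ = Zz-≡ (≡.sym (≡.trans (≡.cong ℤ.suc (sucᶻ 1 k i)) (sucᶻ 2 k i)))
        right : ∀ k → (r (2 ℕ.+ six k) i + r (2 ℕ.+ six k) i) + - r (1 ℕ.+ six k) i + - r (3 ℕ.+ six k) i ≈ B₁ k + - B₃ k
        right k = trans (second-difference (+ (3 ℕ.+ six k ℕ.+ 2 ℕ.* i)))
          (+-cong (mirror (+ 1) 5 k i ℤS.solve-∀) (-‿cong (mirror (+ 3) 3 k i ℤS.solve-∀)))

      weight₀ : ∀ i → ∑ L (λ l → g (six l) i + - g (1 ℕ.+ six l) i + - g (3 ℕ.+ six l) i + g (4 ℕ.+ six l) i)
                    ≈ (BL (+ 0 ℤ.- + (2 ℕ.* i)) + BL (+ 1 ℤ.- + (2 ℕ.* i))) + - (BL (+ 3 ℤ.- + (2 ℕ.* i)) + BL (+ 4 ℤ.- + (2 ℕ.* i)))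
      weight₀ i = begin
        _ ≈⟨ ∑-cong′ L (λ k → trans
               (solve 8 (λ a b c d a′ b′ c′ d′ → (a :+ :- a′) :+ :- (b :+ :- b′) :+ :- (c :+ :- c′) :+ (d :+ :- d′)
                 := (a :+ :- b :+ :- c :+ d) :+ :- (a′ :+ :- b′ :+ :- c′ :+ d′)) refl
                 (l (six k) i) _ _ _ (r (six k) i) _ _ _)
               (+-cong (left k) (-‿cong (right k)))) ⟩
        ∑ L (λ k → ((A 0 k + A 1 k) + - (A 3 k + A 4 k)) + - ((B 4 k + B 3 k) + - (B 1 k + B 0 k)))
          ≈⟨ ∑-cong′ L (λ k → solve 8 (λ a b c d a′ b′ c′ d′ → ((a :+ b) :+ :- (c :+ d)) :+ :- ((d′ :+ c′) :+ :- (b′ :+ a′))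
               := ((a :+ a′) :+ (b :+ b′)) :+ :- ((c :+ c′) :+ (d :+ d′))) refl (A 0 k) (A 1 k) (A 3 k) (A 4 k) (B 0 k) (B 1 k) (B 3 k) (B 4 k)) ⟩
        ∑ L (λ k → ((A 0 k + B 0 k) + (A 1 k + B 1 k)) + - ((A 3 k + B 3 k) + (A 4 k + B 4 k)))
          ≈⟨ trans (∑-+ L _ _) (+-cong (trans (∑-+ L _ _) (+-cong (∑-+ L (A 0) (B 0)) (∑-+ L (A 1) (B 1))))
               (trans (∑-neg L _) (-‿cong (trans (∑-+ L _ _) (+-cong (∑-+ L (A 3) (B 3)) (∑-+ L (A 4) (B 4))))))) ⟩
        _ ∎
        where
        A B : ℕ → ℕ → PS
        A c k = Nz ((+ c ℤ.- + (2 ℕ.* i)) ℤ.+ + (6 ℕ.* k))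
        B c k = Nz ((+ c ℤ.- + (2 ℕ.* i)) ℤ.- + (6 ℕ.* suc k))
        left : ∀ k → l (six k) i + - l (1 ℕ.+ six k) i + - l (3 ℕ.+ six k) i + l (4 ℕ.+ six k) i ≈ (A 0 k + A 1 k) + - (A 3 k + A 4 k)
        left k = begin
          _ ≈⟨ +-cong (+-cong (+-congˡ (-‿cong (Zz-≡ (≡.sym s₁)))) (-‿cong (Zz-≡ (≡.sym s₃)))) (Zz-≡ (≡.sym s₄)) ⟩
          Zz x + - Zz (ℤ.suc x) + - Zz (suc³ x) + Zz (suc⁴ x) ≈⟨ outer-difference x ⟩
          (Nz x + Nz (ℤ.suc x)) + - (Nz (suc³ x) + Nz (suc⁴ x))
            ≈⟨ +-cong (+-cong (Nz-≡ (leftᶻ 0 k i)) (Nz-≡ (≡.trans s₁ (leftᶻ 1 k i))))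
                 (-‿cong (+-cong (Nz-≡ (≡.trans s₃ (leftᶻ 3 k i))) (Nz-≡ (≡.trans s₄ (leftᶻ 4 k i))))) ⟩
          (A 0 k + A 1 k) + - (A 3 k + A 4 k) ∎
          where
          x = minus2 (six k) i
          s₁ : ℤ.suc x ≡ minus2 (1 ℕ.+ six k) i
          s₁ = sucᶻ 0 k i
          s₃ : suc³ x ≡ minus2 (3 ℕ.+ six k) i
          s₃ = ≡.trans (≡.cong ℤ.suc (≡.trans (≡.cong ℤ.suc s₁) (sucᶻ 1 k i))) (sucᶻ 2 k i)
          s₄ : suc⁴ x ≡ minus2 (4 ℕ.+ six k) i
          s₄ = ≡.trans (≡.cong ℤ.suc s₃) (sucᶻ 3 k i)
        right : ∀ k → r (six k) i + - r (1 ℕ.+ six k) i + - r (3 ℕ.+ six k) i + r (4 ℕ.+ six k) i ≈ (B 4 k + B 3 k) + - (B 1 k + B 0 k)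
        right k = trans (outer-difference (+ (2 ℕ.+ six k ℕ.+ 2 ℕ.* i)))
          (+-cong (+-cong (mirror (+ 4) 2 k i ℤS.solve-∀) (mirror (+ 3) 3 k i ℤS.solve-∀))
            (-‿cong (+-cong (mirror (+ 1) 5 k i ℤS.solve-∀) (mirror (+ 0) 6 k i ℤS.solve-∀))))

    T s₁ s₀ s₂ : ℕ → PS
    T a = w (a ℕ.* 3) + - w (2 ℕ.+ a ℕ.* 3)
    s₀ l = w (l ℕ.* 3) * ωKernel (l ℕ.* 3)
    s₁ l = w (1 ℕ.+ l ℕ.* 3) * ωKernel (1 ℕ.+ l ℕ.* 3)
    s₂ l = w (2 ℕ.+ l ℕ.* 3) * ωKernel (2 ℕ.+ l ℕ.* 3)

    private
      collect : ∀ (h : ℕ → ℕ → PS) (X : ℕ → PS) → (∀ i → ∑ L (λ k → h k i) ≈ X i) →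
                ∑ L (λ k → ∑ N (λ i → w i * h k i)) ≈
                ∑ N (λ a → w (a ℕ.* 3) * X (a ℕ.* 3) + w (1 ℕ.+ a ℕ.* 3) * X (1 ℕ.+ a ℕ.* 3) + w (2 ℕ.+ a ℕ.* 3) * X (2 ℕ.+ a ℕ.* 3))
      collect h X e = trans (∑-swap L N _) (trans (∑-cong′ N (λ i → trans (∑-*ˡ L (w i) _) (*-congˡ (e i))))
        (trans (w-terms X) (∑-3 N (λ i → w i * X i))))

      S-eq-1 : ∀ b → 1 ℕ.+ 6 ℕ.* b ≡ 1 ℕ.+ 2 ℕ.* (b ℕ.* 3)
      S-eq-1 = solve-∀
      S-eq-2 : ∀ b → 2 ℕ.+ 6 ℕ.* b ≡ 2 ℕ.* (1 ℕ.+ b ℕ.* 3)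
      S-eq-2 = solve-∀
      S-eq-3 : ∀ b → 3 ℕ.+ 6 ℕ.* b ≡ 1 ℕ.+ 2 ℕ.* (1 ℕ.+ b ℕ.* 3)
      S-eq-3 = solve-∀
      S-eq-4 : ∀ b → 4 ℕ.+ 6 ℕ.* b ≡ 2 ℕ.* (2 ℕ.+ b ℕ.* 3)
      S-eq-4 = solve-∀
      S-eq-0 : ∀ b → 6 ℕ.* b ≡ 2 ℕ.* (b ℕ.* 3)
      S-eq-0 = solve-∀

    -- For i ≡ 1 mod 3 the classes are 1 and -1, which cancel. For i ≡ 0 and i ≡ 2 the same
    -- difference appears with opposite signs, hence the weight `T`. On the other side only the even
    -- index 6k + 2 has a non-zero `S`.
    rank-1-3-mod : ∑ N T * (rb 3 + - rb 1) ≈ ∑ L (λ k → s₁ k + s₁ k)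
    rank-1-3-mod = sym (begin
      ∑ L (λ k → s₁ k + s₁ k)
        ≈⟨ ∑-cong′ L (λ k → sym (trans (+-cong (+-cong (+-cong (even-value _ (1 ℕ.+ k ℕ.* 3) (S-eq-2 k)) (even-value _ (1 ℕ.+ k ℕ.* 3) (S-eq-2 k)))
              (-‿cong (odd-zero _ (k ℕ.* 3) (S-eq-1 k)))) (-‿cong (odd-zero _ (1 ℕ.+ k ℕ.* 3) (S-eq-3 k))))
              (solve 1 (λ a → a :+ :- :0 :+ :- :0 := a) refl _))) ⟩
      ∑ L (λ k → (S (2 ℕ.+ six k) + S (2 ℕ.+ six k)) + - S (1 ℕ.+ six k) + - S (3 ℕ.+ six k))
        ≈⟨ ∑-cong′ L (λ k → join (2 ℕ.+ six k) (1 ℕ.+ six k) (3 ℕ.+ six k)) ⟩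
      ∑ L (λ k → ∑ N (λ i → w i * ((g (2 ℕ.+ six k) i + g (2 ℕ.+ six k) i) + - g (1 ℕ.+ six k) i + - g (3 ℕ.+ six k) i)))
        ≈⟨ collect _ (λ i → BL (+ 3 ℤ.- + (2 ℕ.* i)) + - BL (+ 1 ℤ.- + (2 ℕ.* i))) weight₁ ⟩
      _ ≈⟨ ∑-cong N (λ a a<N → trans (+-cong (+-cong
             (*-congˡ (+-cong (trans (at3 (+ 3) 0 a (s≤s (s≤s (s≤s z≤n))) (ℕₚ.<⇒≤ a<N)) BL3) (-‿cong (trans (at3 (+ 1) 0 a (s≤s z≤n) (ℕₚ.<⇒≤ a<N)) BL1))))
             (*-congˡ (+-cong (trans (at3 (+ 3) 1 a (s≤s z≤n) (ℕₚ.<⇒≤ a<N)) BL1) (-‿cong (trans (at3 (+ 1) 1 a (s≤s z≤n) (ℕₚ.<⇒≤ a<N)) BL-1)))))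
             (*-congˡ (+-cong (trans (at3 (+ 3) 2 a (s≤s z≤n) (ℕₚ.<⇒≤ a<N)) BL-1) (-‿cong (trans (at3 (+ 1) 2 a (s≤s (s≤s (s≤s z≤n))) (ℕₚ.<⇒≤ a<N)) BL-3)))))
             (solve 5 (λ x y z p q → x :* (p :+ :- q) :+ y :* (q :+ :- q) :+ z :* (q :+ :- p) := (x :+ :- z) :* (p :+ :- q)) refl _ _ _ (rb 3) (rb 1))) ⟩
      ∑ N (λ a → T a * (rb 3 + - rb 1)) ≈⟨ ∑-*ʳ N _ T ⟩
      ∑ N T * (rb 3 + - rb 1) ∎)
      where
      join : ∀ a b c → (S a + S a) + - S b + - S c ≈ ∑ N (λ i → w i * ((g a i + g a i) + - g b i + - g c i))
      join a b c = sym (trans (∑-cong′ N (λ i → solve 4 (λ w x y z → w :* ((x :+ x) :+ :- y :+ :- z) := (w :* x :+ w :* x) :+ :- (w :* y) :+ :- (w :* z)) refl _ (g a i) (g b i) (g c i)))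
        (trans (∑-+ N _ _) (+-cong (trans (∑-+ N _ _) (+-cong (∑-+ N _ _) (∑-neg N _))) (∑-neg N _))))

    -- The offsets 0, 1, 3, 4 pick both even indices left over by `rank-1-3-mod`. Again i ≡ 1
    -- contributes nothing: the classes -2, -1 stand against 1, 2.
    rank-0123-mod : ∑ N T * (rb 0 + rb 1 + - rb 2 + - rb 3) ≈ ∑ L s₀ + ∑ L s₂
    rank-0123-mod = sym (begin
      ∑ L s₀ + ∑ L s₂
        ≈⟨ sym (∑-+ L s₀ s₂) ⟩
      ∑ L (λ k → s₀ k + s₂ k)
        ≈⟨ ∑-cong′ L (λ k → sym (trans (+-cong (+-cong (+-cong (even-value _ (k ℕ.* 3) (S-eq-0 k)) (-‿cong (odd-zero _ (k ℕ.* 3) (S-eq-1 k))))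
              (-‿cong (odd-zero _ (1 ℕ.+ k ℕ.* 3) (S-eq-3 k)))) (even-value _ (2 ℕ.+ k ℕ.* 3) (S-eq-4 k)))
              (solve 2 (λ a b → a :+ :- :0 :+ :- :0 :+ b := a :+ b) refl _ _))) ⟩
      ∑ L (λ k → S (six k) + - S (1 ℕ.+ six k) + - S (3 ℕ.+ six k) + S (4 ℕ.+ six k))
        ≈⟨ ∑-cong′ L (λ k → join (six k) (1 ℕ.+ six k) (3 ℕ.+ six k) (4 ℕ.+ six k)) ⟩
      ∑ L (λ k → ∑ N (λ i → w i * (g (six k) i + - g (1 ℕ.+ six k) i + - g (3 ℕ.+ six k) i + g (4 ℕ.+ six k) i)))
        ≈⟨ collect _ (λ i → (BL (+ 0 ℤ.- + (2 ℕ.* i)) + BL (+ 1 ℤ.- + (2 ℕ.* i))) + - (BL (+ 3 ℤ.- + (2 ℕ.* i)) + BL (+ 4 ℤ.- + (2 ℕ.* i)))) weight₀ ⟩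
      _ ≈⟨ ∑-cong N (λ a a<N → let a≤ = ℕₚ.<⇒≤ a<N in trans (+-cong (+-cong
             (*-congˡ (+-cong (+-cong (trans (at3 (+ 0) 0 a z≤n a≤) BL0) (trans (at3 (+ 1) 0 a (s≤s z≤n) a≤) BL1))
                (-‿cong (+-cong (trans (at3 (+ 3) 0 a (s≤s (s≤s (s≤s z≤n))) a≤) BL3) (trans (at3 (+ 4) 0 a (s≤s (s≤s (s≤s (s≤s z≤n)))) a≤) BL4)))))
             (*-congˡ (+-cong (+-cong (trans (at3 (+ 0) 1 a (s≤s (s≤s z≤n)) a≤) BL-2) (trans (at3 (+ 1) 1 a (s≤s z≤n) a≤) BL-1))
                (-‿cong (+-cong (trans (at3 (+ 3) 1 a (s≤s z≤n) a≤) BL1) (trans (at3 (+ 4) 1 a (s≤s (s≤s z≤n)) a≤) BL2))))))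
             (*-congˡ (+-cong (+-cong (trans (at3 (+ 0) 2 a (s≤s (s≤s (s≤s (s≤s z≤n)))) a≤) BL-4) (trans (at3 (+ 1) 2 a (s≤s (s≤s (s≤s z≤n))) a≤) BL-3))
                (-‿cong (+-cong (trans (at3 (+ 3) 2 a (s≤s z≤n) a≤) BL-1) (trans (at3 (+ 4) 2 a z≤n a≤) BL0))))))
             (solve 7 (λ x y z a b c d → x :* ((a :+ b) :+ :- (d :+ c)) :+ y :* ((c :+ b) :+ :- (b :+ c)) :+ z :* ((c :+ d) :+ :- (b :+ a))
                := (x :+ :- z) :* (a :+ b :+ :- c :+ :- d)) refl _ _ _ (rb 0) (rb 1) (rb 2) (rb 3))) ⟩
      ∑ N (λ a → T a * (rb 0 + rb 1 + - rb 2 + - rb 3)) ≈⟨ ∑-*ʳ N _ T ⟩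
      ∑ N T * (rb 0 + rb 1 + - rb 2 + - rb 3) ∎)
      where
      join : ∀ a b c d → S a + - S b + - S c + S d ≈ ∑ N (λ i → w i * (g a i + - g b i + - g c i + g d i))
      join a b c d = sym (trans (∑-cong′ N (λ i → solve 5 (λ w x y z v → w :* (x :+ :- y :+ :- z :+ v) := w :* x :+ :- (w :* y) :+ :- (w :* z) :+ w :* v) refl _ (g a i) (g b i) (g c i) (g d i)))
        (trans (∑-+ N _ _) (+-congʳ (trans (∑-+ N _ _) (+-cong (trans (∑-+ N _ _) (+-congˡ (∑-neg N _))) (∑-neg N _))))))

  T s₀ s₁ s₂ : ℕ → PS
  T a = w (a ℕ.* 3) ⊞ ⊟ w (2 ℕ.+ a ℕ.* 3)
  s₀ l = w (l ℕ.* 3) ⊠ K∞.ωKernel (l ℕ.* 3)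
  s₁ l = w (1 ℕ.+ l ℕ.* 3) ⊠ K∞.ωKernel (1 ℕ.+ l ℕ.* 3)
  s₂ l = w (2 ℕ.+ l ℕ.* 3) ⊠ K∞.ωKernel (2 ℕ.+ l ℕ.* 3)

  private
    w-sub : ∀ (e : ℕ → ℕ) → (∀ l → l ≤ e l) → Vanishing (λ l → w (e l))
    w-sub e h l = coarsen (h l) (θ-vanish 2 (s≤s z≤n) (e l))

    l≤l3 : ∀ j l → l ≤ j ℕ.+ l ℕ.* 3
    l≤l3 j l = ℕₚ.≤-trans (ℕₚ.m≤m*n l 3) (ℕₚ.m≤n+m _ j)

  T-vanishing : Vanishing T
  T-vanishing a = trans (+-cong (w-sub (ℕ._* 3) (l≤l3 0) a) (-‿cong (w-sub (λ l → 2 ℕ.+ l ℕ.* 3) (l≤l3 2) a))) (-‿inverseʳ 0ₛ)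
    where open Mod a

  s₀-vanishing : Vanishing s₀
  s₀-vanishing = Vanishing-*ʳ (λ l → K∞.ωKernel (l ℕ.* 3)) (w-sub (ℕ._* 3) (l≤l3 0))
  s₁-vanishing : Vanishing s₁
  s₁-vanishing = Vanishing-*ʳ (λ l → K∞.ωKernel (1 ℕ.+ l ℕ.* 3)) (w-sub (λ l → 1 ℕ.+ l ℕ.* 3) (l≤l3 1))
  s₂-vanishing : Vanishing s₂
  s₂-vanishing = Vanishing-*ʳ (λ l → K∞.ωKernel (2 ℕ.+ l ℕ.* 3)) (w-sub (λ l → 2 ℕ.+ l ℕ.* 3) (l≤l3 2))

  private
    N≤L : ∀ N → N ≤ 2 ℕ.* N ℕ.+ 3
    N≤L N = ℕₚ.≤-trans (ℕₚ.m≤m+n N _) (ℕₚ.m≤m+n _ 3)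

  rank-1-3 : Σ∞ T ⊠ (rb 3 ⊞ ⊟ rb 1) ≈[ ∞ ] Σ∞ s₁ ⊞ Σ∞ s₁
  rank-1-3 = limit λ N → let open Mod N in
    trans (*-congʳ (Σ∞≈∑ N N ℕₚ.≤-refl T-vanishing)) (trans (Bilaterals.rank-1-3-mod N)
      (trans (∑-+ (2 ℕ.* N ℕ.+ 3) s₁ s₁) (sym (+-cong (Σ∞≈∑ N _ (N≤L N) s₁-vanishing) (Σ∞≈∑ N _ (N≤L N) s₁-vanishing)))))

  rank-0123 : Σ∞ T ⊠ (rb 0 ⊞ rb 1 ⊞ ⊟ rb 2 ⊞ ⊟ rb 3) ≈[ ∞ ] Σ∞ s₀ ⊞ Σ∞ s₂
  rank-0123 = limit λ N → let open Mod N in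
    trans (*-congʳ (Σ∞≈∑ N N ℕₚ.≤-refl T-vanishing)) (trans (Bilaterals.rank-0123-mod N)
      (sym (+-cong (Σ∞≈∑ N _ (N≤L N) s₀-vanishing) (Σ∞≈∑ N _ (N≤L N) s₂-vanishing))))

-- Trisection of power series

module Trisection where
  open PowerSeries

  -- f(q) ↦ f(q³); comp i below extracts the coefficients of q^{3n+i}.
  up : PS → PS
  up g zero                = g 0
  up g (suc zero)          = 0ℚ
  up g (suc (suc zero))    = 0ℚ
  up g (suc (suc (suc n))) = up (g ∘ suc) n

  opaque
    comp : ℕ → PS → PS
    comp i f n = f (3 ℕ.* n ℕ.+ i)

    comp-at : ∀ i f n → f (3 ℕ.* n ℕ.+ i) ≡ comp i f n
    comp-at i f n = ≡.refl

  up-0 : ∀ g n → up g (n ℕ.* 3) ≡ g n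
  up-0 g zero    = ≡.refl
  up-0 g (suc n) = up-0 (g ∘ suc) n

  up-1 : ∀ g n → up g (1 ℕ.+ n ℕ.* 3) ≡ 0ℚ
  up-1 g zero    = ≡.refl
  up-1 g (suc n) = up-1 (g ∘ suc) n

  up-2 : ∀ g n → up g (2 ℕ.+ n ℕ.* 3) ≡ 0ℚ
  up-2 g zero    = ≡.refl
  up-2 g (suc n) = up-2 (g ∘ suc) n

  private
    swap3 : ∀ i n → 3 ℕ.* n ℕ.+ i ≡ i ℕ.+ n ℕ.* 3
    swap3 = solve-∀

  comp-≡ : ∀ i f n → comp i f n ≡ f (i ℕ.+ n ℕ.* 3)
  comp-≡ i f n = ≡.trans (≡.sym (comp-at i f n)) (≡.cong f (swap3 i n))

  data Third : ℕ → Set where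
    third₀ : Third 0
    third₁ : Third 1
    third₂ : Third 2

  private
    add-zero : ∀ {x y a : ℚ} → x ≡ a → y ≡ 0ℚ → x ℚ.+ y ≡ a
    add-zero {a = a} ≡.refl ≡.refl = ℚₚ.+-identityʳ a

    drop : ∀ {x y : ℚ} → x ≡ 0ℚ → x ℚ.* y ≡ 0ℚ
    drop {y = y} ≡.refl = ℚₚ.*-zeroˡ y

    sum3 : ∀ {i} → Third i → ∀ f (h : ℕ → ℚ) n → ℚK.∑ (suc (i ℕ.+ n ℕ.* 3)) (λ k → up f k ℚ.* h k) ≡ ℚK.∑ (suc n) (λ j → f j ℚ.* h (j ℕ.* 3))
    sum3 third₀ f h zero    = ≡.refl
    sum3 third₀ f h (suc n) = ≡.cong₂ ℚ._+_
      (add-zero (add-zero (sum3 third₀ f h n) (drop (up-1 f n))) (drop (up-2 f n)))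
      (≡.cong (ℚ._* h (suc n ℕ.* 3)) (up-0 (f ∘ suc) n))
    sum3 third₁ f h n = add-zero (sum3 third₀ f h n) (drop (up-1 f n))
    sum3 third₂ f h n = add-zero (sum3 third₁ f h n) (drop (up-2 f n))

  comp-up-⊠ : ∀ {i} → Third i → ∀ f h n → comp i (up f ⊠ h) n ≡ (f ⊠ comp i h) n
  comp-up-⊠ {i} t f h n = begin
    comp i (up f ⊠ h) n                                        ≡⟨ comp-≡ i (up f ⊠ h) n ⟩
    (up f ⊠ h) (i ℕ.+ n ℕ.* 3)                                 ≡⟨ ⊠-coeff (up f) h _ ⟩
    ℚK.∑ (suc (i ℕ.+ n ℕ.* 3)) (λ k → up f k ℚ.* h (i ℕ.+ n ℕ.* 3 ∸ k)) ≡⟨ sum3 t f (λ k → h (i ℕ.+ n ℕ.* 3 ∸ k)) n ⟩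
    ℚK.∑ (suc n) (λ j → f j ℚ.* h (i ℕ.+ n ℕ.* 3 ∸ j ℕ.* 3))
      ≡⟨ ℚK.∑-cong (suc n) (λ j j≤n → ≡.cong (f j ℚ.*_) (≡.trans (≡.cong h (idx j (ℕₚ.≤-pred j≤n))) (≡.sym (comp-≡ i h (n ∸ j))))) ⟩
    ℚK.∑ (suc n) (λ j → f j ℚ.* comp i h (n ∸ j))              ≡⟨ ⊠-coeff f (comp i h) n ⟨
    (f ⊠ comp i h) n                                           ∎
    where
    open ≡.≡-Reasoning
    idx : ∀ j → j ≤ n → i ℕ.+ n ℕ.* 3 ∸ j ℕ.* 3 ≡ i ℕ.+ (n ∸ j) ℕ.* 3
    idx j j≤n = ≡.trans (ℕₚ.+-∸-assoc i (ℕₚ.*-monoˡ-≤ 3 j≤n)) (≡.cong (i ℕ.+_) (≡.sym (ℕₚ.*-distribʳ-∸ 3 n j)))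

  comp-0-up : ∀ f n → comp 0 (up f) n ≡ f n
  comp-0-up f n = ≡.trans (comp-≡ 0 (up f) n) (up-0 f n)

  comp-1-up : ∀ f n → comp 1 (up f) n ≡ 0ₛ n
  comp-1-up f n = ≡.trans (comp-≡ 1 (up f) n) (≡.trans (up-1 f n) (≡.sym (0-at n)))

  comp-2-up : ∀ f n → comp 2 (up f) n ≡ 0ₛ n
  comp-2-up f n = ≡.trans (comp-≡ 2 (up f) n) (≡.trans (up-2 f n) (≡.sym (0-at n)))

  comp-ext : ∀ {f g} → (∀ {i} → Third i → ∀ n → comp i f n ≡ comp i g n) → ∀ n → f n ≡ g n
  comp-ext {f} {g} e n = ≡.subst (λ m → f m ≡ g m) (≡.sym (ℕ÷.m≡m%n+[m/n]*n n 3)) (at-third (n ℕ.% 3) (n ℕ./ 3) (ℕ÷.m%n<n n 3))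
    where
    from : ∀ {i} → Third i → ∀ n → f (i ℕ.+ n ℕ.* 3) ≡ g (i ℕ.+ n ℕ.* 3)
    from {i} t n = ≡.trans (≡.sym (comp-≡ i f n)) (≡.trans (e t n) (comp-≡ i g n))
    at-third : ∀ i m → i < 3 → f (i ℕ.+ m ℕ.* 3) ≡ g (i ℕ.+ m ℕ.* 3)
    at-third 0 m _ = from third₀ m
    at-third 1 m _ = from third₁ m
    at-third 2 m _ = from third₂ m
    at-third (suc (suc (suc i))) m (s≤s (s≤s (s≤s ())))

  comp-cong : ∀ {i N f g} → i < 3 → f ≈[ fin (3 ℕ.* N) ] g → comp i f ≈[ fin N ] comp i g
  comp-cong {i} {N} {f} {g} i<3 e = mk λ n n<N → ≡.trans (≡.sym (comp-at i f n)) (≡.trans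
    (at e _ (ℕₚ.<-≤-trans (ℕₚ.+-monoʳ-< (3 ℕ.* n) i<3) (ℕₚ.≤-trans (ℕₚ.≤-reflexive (≡.trans (ℕₚ.+-comm (3 ℕ.* n) 3) (≡.sym (ℕₚ.*-suc 3 n)))) (ℕₚ.*-monoʳ-≤ 3 n<N))))
    (comp-at i g n))

  comp-cong∞ : ∀ {i f g} → f ≈[ ∞ ] g → comp i f ≈[ ∞ ] comp i g
  comp-cong∞ {i} {f} {g} e = mk λ n _ → ≡.trans (≡.sym (comp-at i f n)) (≡.trans (at e _ tt) (comp-at i g n))

  comp-⊞ : ∀ i f g n → comp i (f ⊞ g) n ≡ (comp i f ⊞ comp i g) n
  comp-⊞ i f g n = ≡.trans (≡.sym (comp-at i (f ⊞ g) n)) (≡.trans (⊞-at f g _)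
    (≡.trans (≡.cong₂ ℚ._+_ (comp-at i f n) (comp-at i g n)) (≡.sym (⊞-at _ _ n))))

  comp-⊟ : ∀ i f n → comp i (⊟ f) n ≡ (⊟ comp i f) n
  comp-⊟ i f n = ≡.trans (≡.sym (comp-at i (⊟ f) n)) (≡.trans (⊟-at f _) (≡.trans (≡.cong ℚ.-_ (comp-at i f n)) (≡.sym (⊟-at _ n))))

  comp-0ₛ : ∀ i n → comp i 0ₛ n ≡ 0ₛ n
  comp-0ₛ i n = ≡.trans (≡.sym (comp-at i 0ₛ n)) (≡.trans (0-at _) (≡.sym (0-at n)))

  private
    q-⊠-idx : ∀ e f {m} n → m ≡ e ℕ.+ n → (q^ e ⊠ f) m ≡ f n
    q-⊠-idx e f n ≡.refl = q-⊠-+ e f n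

  comp-q-same : ∀ i f n → comp i (q^ i ⊠ f) n ≡ comp 0 f n
  comp-q-same i f n = ≡.trans (comp-≡ i _ n) (≡.trans (q-⊠-idx i f (n ℕ.* 3) ≡.refl) (≡.sym (comp-≡ 0 f n)))

  comp-2-q-1 : ∀ f n → comp 2 (q^ 1 ⊠ f) n ≡ comp 1 f n
  comp-2-q-1 f n = ≡.trans (comp-≡ 2 _ n) (≡.trans (q-⊠-idx 1 f (1 ℕ.+ n ℕ.* 3) ≡.refl) (≡.sym (comp-≡ 1 f n)))

  -- Residue i of q^e f is fed by residue j of f, one block earlier; since i < e, coefficient 0 has
  -- no source at all.
  comp-wrap : ∀ {i e j} f → i < e → e ℕ.+ j ≡ 3 ℕ.+ i → (∀ n → comp j f n ≡ 0ₛ n) → ∀ n → comp i (q^ e ⊠ f) n ≡ 0ₛ n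
  comp-wrap {i} {e} {j} f i<e e+j z zero = ≡.trans (comp-≡ i _ 0) (≡.trans (q-⊠-< e f (≡.subst (_< e) (≡.sym (ℕₚ.+-identityʳ i)) i<e)) (≡.sym (0-at 0)))
  comp-wrap {i} {e} {j} f i<e e+j z (suc n) = ≡.trans (comp-≡ i _ (suc n)) (≡.trans
    (q-⊠-idx e f (j ℕ.+ n ℕ.* 3) (≡.trans (lem i (n ℕ.* 3)) (≡.trans (≡.cong (ℕ._+ n ℕ.* 3) (≡.sym e+j)) (ℕₚ.+-assoc e j _))))
    (≡.trans (≡.sym (comp-≡ j f n)) (≡.trans (z n) (≡.trans (0-at n) (≡.sym (0-at (suc n)))))))
    where
    lem : ∀ i x → i ℕ.+ (3 ℕ.+ x) ≡ (3 ℕ.+ i) ℕ.+ x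
    lem = solve-∀

  open Series ∞

  up-cong-≡ : ∀ {f g} → (∀ n → f n ≡ g n) → ∀ n → up f n ≡ up g n
  up-cong-≡ e zero                = e 0
  up-cong-≡ e (suc zero)          = ≡.refl
  up-cong-≡ e (suc (suc zero))    = ≡.refl
  up-cong-≡ e (suc (suc (suc n))) = up-cong-≡ (λ m → e (suc m)) n

  up-cong : ∀ {f g} → f ≈ g → up f ≈ up g
  up-cong e = pointwise (up-cong-≡ (λ n → at e n tt))

  up-⊞ : ∀ f g → up (f ⊞ g) ≈ up f + up g
  up-⊞ f g = pointwise (comp-ext λ
    { third₀ n → ≡.trans (comp-0-up _ n) (≡.trans (⊞-at f g n) (≡.sym (≡.trans (comp-⊞ 0 _ _ n) (≡.trans (⊞-at _ _ n) (≡.cong₂ ℚ._+_ (comp-0-up f n) (comp-0-up g n))))))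
    ; third₁ n → zero₁ 1 n comp-1-up
    ; third₂ n → zero₁ 2 n comp-2-up })
    where
    zero₁ : ∀ i n → (∀ f n → comp i (up f) n ≡ 0ₛ n) → comp i (up (f ⊞ g)) n ≡ comp i (up f ⊞ up g) n
    zero₁ i n z = ≡.trans (z _ n) (≡.sym (≡.trans (comp-⊞ i _ _ n) (≡.trans (⊞-at _ _ n) (≡.trans (≡.cong₂ ℚ._+_ (≡.trans (z f n) (0-at n)) (≡.trans (z g n) (0-at n))) (≡.sym (0-at n))))))

  up-⊟ : ∀ f → up (⊟ f) ≈ - up f
  up-⊟ f = pointwise (comp-ext λ
    { third₀ n → ≡.trans (comp-0-up _ n) (≡.trans (⊟-at f n) (≡.sym (≡.trans (comp-⊟ 0 _ n) (≡.trans (⊟-at _ n) (≡.cong ℚ.-_ (comp-0-up f n))))))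
    ; third₁ n → z′ 1 n comp-1-up
    ; third₂ n → z′ 2 n comp-2-up })
    where
    z′ : ∀ i n → (∀ f n → comp i (up f) n ≡ 0ₛ n) → comp i (up (⊟ f)) n ≡ comp i (⊟ up f) n
    z′ i n z = ≡.trans (z _ n) (≡.sym (≡.trans (comp-⊟ i _ n) (≡.trans (⊟-at _ n) (≡.trans (≡.cong ℚ.-_ (≡.trans (z f n) (0-at n))) (≡.sym (0-at n))))))

  up-⊠ : ∀ f g → up (f ⊠ g) ≈ up f * up g
  up-⊠ f g = pointwise (comp-ext λ
    { third₀ n → ≡.trans (comp-0-up _ n) (≡.sym (≡.trans (comp-up-⊠ third₀ f (up g) n) (at (*-congˡ (pointwise (comp-0-up g))) n tt)))
    ; third₁ n → ≡.trans (comp-1-up _ n) (≡.sym (≡.trans (comp-up-⊠ third₁ f (up g) n) (at (trans (*-congˡ (pointwise (comp-1-up g))) (zeroʳ f)) n tt)))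
    ; third₂ n → ≡.trans (comp-2-up _ n) (≡.sym (≡.trans (comp-up-⊠ third₂ f (up g) n) (at (trans (*-congˡ (pointwise (comp-2-up g))) (zeroʳ f)) n tt))) })

  up-q : ∀ e → up (q^ e) ≈ q^ (3 ℕ.* e)
  up-q zero = pointwise go
    where
    z : ∀ n → up (λ m → (q^ 0) (suc m)) n ≡ 0ℚ
    z zero                = q-≢ {0} {1} (λ ())
    z (suc zero)          = ≡.refl
    z (suc (suc zero))    = ≡.refl
    z (suc (suc (suc n))) = ≡.trans (up-cong-≡ (λ m → ≡.trans (q-≢ {0} {suc (suc m)} (λ ())) (≡.sym (q-≢ {0} {suc m} (λ ())))) n) (z n)
    go : ∀ n → up (q^ 0) n ≡ (q^ 0) n
    go zero                = ≡.refl
    go (suc zero)          = ≡.sym (q-≢ {0} {1} (λ ()))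
    go (suc (suc zero))    = ≡.sym (q-≢ {0} {2} (λ ()))
    go (suc (suc (suc n))) = ≡.trans (z n) (≡.sym (q-≢ {0} {3 ℕ.+ n} (λ ())))
  up-q (suc e) = trans (pointwise shift) (trans (*-congˡ (up-q e)) (sym (q-split 3 (3 ℕ.* e) (ℕₚ.*-suc 3 e))))
    where
    unshift : ∀ m → (q^ suc e) (suc m) ≡ (q^ e) m
    unshift m with e ℕ.≟ m
    ... | yes ≡.refl = ≡.trans (q-≡ (suc e)) (≡.sym (q-≡ e))
    ... | no h = ≡.trans (q-≢ (λ p → h (ℕₚ.suc-injective p))) (≡.sym (q-≢ h))
    shift : ∀ n → up (q^ suc e) n ≡ (q^ 3 ⊠ up (q^ e)) n
    shift zero                = ≡.trans (q-≢ {suc e} {0} (λ ())) (≡.sym (q-⊠-< 3 _ (s≤s z≤n)))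
    shift (suc zero)          = ≡.sym (q-⊠-< 3 _ (s≤s (s≤s z≤n)))
    shift (suc (suc zero))    = ≡.sym (q-⊠-< 3 _ (s≤s (s≤s (s≤s z≤n))))
    shift (suc (suc (suc n))) = ≡.trans (up-cong-≡ unshift n) (≡.sym (q-⊠-+ 3 (up (q^ e)) n))

-- The product over the cube roots of unity

module CubicNorm where
  open PowerSeries
  open Inverses
  open Trisection

  open Series ∞

  triple : PS → PS → PS → PS
  triple x y z = up x + q^ 1 * up y + q^ 2 * up z

  private
    comp-triple : ∀ i {a b c d x y z} → (∀ n → comp i x n ≡ a n) → (∀ n → comp i y n ≡ b n) → (∀ n → comp i z n ≡ c n) →
                  a + b + c ≈ d → comp i (x + y + z) ≈ d
    comp-triple i ex ey ez h = trans (trans (pointwise (comp-⊞ i _ _))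
      (+-cong (trans (pointwise (comp-⊞ i _ _)) (+-cong (pointwise ex) (pointwise ey))) (pointwise ez))) h

  comp-triple-0 : ∀ x y z → comp 0 (triple x y z) ≈ x
  comp-triple-0 x y z = comp-triple 0 (comp-0-up _) (comp-wrap {0} {1} {2} _ (s≤s z≤n) ≡.refl (comp-2-up _))
    (comp-wrap {0} {2} {1} _ (s≤s z≤n) ≡.refl (comp-1-up _)) (solve 1 (λ a → a :+ :0 :+ :0 := a) refl x)

  comp-triple-1 : ∀ x y z → comp 1 (triple x y z) ≈ y
  comp-triple-1 x y z = comp-triple 1 (comp-1-up _) (λ n → ≡.trans (comp-q-same 1 _ n) (comp-0-up _ n))
    (comp-wrap {1} {2} {2} _ (s≤s (s≤s z≤n)) ≡.refl (comp-2-up _)) (solve 1 (λ a → :0 :+ a :+ :0 := a) refl y)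

  comp-triple-2 : ∀ x y z → comp 2 (triple x y z) ≈ z
  comp-triple-2 x y z = comp-triple 2 (comp-2-up _) (λ n → ≡.trans (comp-2-q-1 _ n) (comp-1-up _ n))
    (λ n → ≡.trans (comp-q-same 2 _ n) (comp-0-up _ n)) (solve 1 (λ a → :0 :+ :0 :+ a := a) refl z)

  record Comps (f x y z : PS) : Set where
    constructor comps
    field
      c₀ : comp 0 f ≈ x
      c₁ : comp 1 f ≈ y
      c₂ : comp 2 f ≈ z

  Comps-≈ : ∀ {f x y z} → f ≈ triple x y z → Comps f x y z
  Comps-≈ e = comps (trans (comp-cong∞ e) (comp-triple-0 _ _ _)) (trans (comp-cong∞ e) (comp-triple-1 _ _ _)) (trans (comp-cong∞ e) (comp-triple-2 _ _ _))

  decompose : ∀ f → f ≈ triple (comp 0 f) (comp 1 f) (comp 2 f)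
  decompose f = pointwise (comp-ext λ
    { third₀ n → ≡.sym (at (comp-triple-0 (comp 0 f) (comp 1 f) (comp 2 f)) n tt)
    ; third₁ n → ≡.sym (at (comp-triple-1 (comp 0 f) (comp 1 f) (comp 2 f)) n tt)
    ; third₂ n → ≡.sym (at (comp-triple-2 (comp 0 f) (comp 1 f) (comp 2 f)) n tt) })

  from-Comps : ∀ {f x y z} → Comps f x y z → f ≈ triple x y z
  from-Comps {f} (comps a b c) = trans (decompose f) (+-cong (+-cong (up-cong a) (*-congˡ (up-cong b))) (*-congˡ (up-cong c)))

  Comps-refl : ∀ f → Comps f (comp 0 f) (comp 1 f) (comp 2 f)
  Comps-refl f = comps refl refl refl

  -- Pairs of residues adding up to 3 or 4 wrap around with a factor q³, that is `up (q^ 1)`.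
  Comps-* : ∀ {f g x y z a b c} → Comps f x y z → Comps g a b c →
    Comps (f * g) (x * a + q^ 1 * (y * c + z * b)) (x * b + y * a + q^ 1 * (z * c)) (x * c + y * b + z * a)
  Comps-* {f} {g} {x} {y} {z} {a} {b} {c} F G = Comps-≈ (begin
    f * g ≈⟨ *-cong (from-Comps F) (from-Comps G) ⟩
    triple x y z * triple a b c
      ≈⟨ solve 8 (λ x y z a b c q r → (x :+ q :* y :+ r :* z) :* (a :+ q :* b :+ r :* c) :=
           (x :* a :+ (q :* r) :* (y :* c :+ z :* b)) :+ q :* (x :* b :+ y :* a) :+ (q :* q) :* (y :* b) :+ r :* (x :* c :+ z :* a) :+ (r :* r) :* (z :* c))
           refl (up x) (up y) (up z) (up a) (up b) (up c) (q^ 1) (q^ 2) ⟩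
    _ ≈⟨ +-cong (+-congʳ (+-cong (+-congʳ (+-congˡ (*-congʳ (trans (sym (q-+ 1 2)) (sym (up-q 1)))))) (*-congʳ (sym (q-+ 1 1))))) (*-congʳ q⁴) ⟩
    (up x * up a + up (q^ 1) * (up y * up c + up z * up b)) + q^ 1 * (up x * up b + up y * up a) + q^ 2 * (up y * up b)
      + q^ 2 * (up x * up c + up z * up a) + (q^ 1 * up (q^ 1)) * (up z * up c)
      ≈⟨ solve 9 (λ x y z a b c q r Q → (x :* a :+ Q :* (y :* c :+ z :* b)) :+ q :* (x :* b :+ y :* a) :+ r :* (y :* b) :+ r :* (x :* c :+ z :* a) :+ (q :* Q) :* (z :* c)
           := (x :* a :+ Q :* (y :* c :+ z :* b)) :+ q :* (x :* b :+ y :* a :+ Q :* (z :* c)) :+ r :* (x :* c :+ y :* b :+ z :* a))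
           refl (up x) (up y) (up z) (up a) (up b) (up c) (q^ 1) (q^ 2) (up (q^ 1)) ⟩
    (up x * up a + up (q^ 1) * (up y * up c + up z * up b)) + q^ 1 * (up x * up b + up y * up a + up (q^ 1) * (up z * up c))
      + q^ 2 * (up x * up c + up y * up b + up z * up a)
      ≈⟨ sym (+-cong (+-cong
           (trans (up-⊞ _ _) (+-cong (up-⊠ _ _) (trans (up-⊠ _ _) (*-congˡ (trans (up-⊞ _ _) (+-cong (up-⊠ _ _) (up-⊠ _ _)))))))
           (*-congˡ (trans (up-⊞ _ _) (+-cong (trans (up-⊞ _ _) (+-cong (up-⊠ _ _) (up-⊠ _ _))) (trans (up-⊠ _ _) (*-congˡ (up-⊠ _ _)))))))
           (*-congˡ (trans (up-⊞ _ _) (+-cong (trans (up-⊞ _ _) (+-cong (up-⊠ _ _) (up-⊠ _ _))) (up-⊠ _ _))))) ⟩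
    triple (x * a + q^ 1 * (y * c + z * b)) (x * b + y * a + q^ 1 * (z * c)) (x * c + y * b + z * a) ∎)
    where
    q⁴ : q^ 2 * q^ 2 ≈ q^ 1 * up (q^ 1)
    q⁴ = trans (sym (q-+ 2 2)) (trans (q-+ 1 3) (*-congˡ (sym (up-q 1))))

  -- ∏_{ω³=1} f(ω q^{1/3}), written out in the three components of f
  N3 : PS → PS → PS → PS
  N3 x y z = x * (x * x) + q^ 1 * (y * (y * y)) + (q^ 1 * q^ 1) * (z * (z * z)) + - ((1ₛ + 1ₛ + 1ₛ) * (q^ 1 * (x * (y * z))))

  norm : PS → PS
  norm f = N3 (comp 0 f) (comp 1 f) (comp 2 f)

  N3-cong : ∀ π {x y z a b c} → x ≈[ π ] a → y ≈[ π ] b → z ≈[ π ] c → N3 x y z ≈[ π ] N3 a b c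
  N3-cong π e f g = K.+-cong (K.+-cong (K.+-cong (K.*-cong e (K.*-cong e e)) (K.*-congˡ (K.*-cong f (K.*-cong f f))))
      (K.*-congˡ (K.*-cong g (K.*-cong g g)))) (K.-‿cong (K.*-congˡ (K.*-congˡ (K.*-cong e (K.*-cong f g)))))
    where module K = Series π

  -- Each component uses every third coefficient, so precision 3N shrinks to N.
  norm-cong : ∀ {N f g} → f ≈[ fin (3 ℕ.* N) ] g → norm f ≈[ fin N ] norm g
  norm-cong e = N3-cong _ (comp-cong (s≤s z≤n) e) (comp-cong (s≤s (s≤s z≤n)) e) (comp-cong (s≤s (s≤s (s≤s z≤n))) e)

  norm-cong∞ : ∀ {f g} → f ≈ g → norm f ≈ norm g
  norm-cong∞ e = N3-cong _ (comp-cong∞ e) (comp-cong∞ e) (comp-cong∞ e)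

  norm-Comps : ∀ {f x y z} → Comps f x y z → norm f ≈ N3 x y z
  norm-Comps (comps a b c) = N3-cong ∞ a b c

  up-1ₛ : up 1ₛ ≈ 1ₛ
  up-1ₛ = trans (pointwise (up-cong-≡ (λ n → ≡.sym (q-0-at n)))) (trans (up-q 0) q-0)

  up-0ₛ : up 0ₛ ≈ 0ₛ
  up-0ₛ = trans (pointwise (up-cong-≡ {0ₛ} {0ₛ ⊠ 0ₛ} (λ n → at (sym (zeroˡ 0ₛ)) n tt))) (trans (up-⊠ 0ₛ 0ₛ) (trans (*-congʳ up0) (zeroˡ _)))
    where
    up0 : up 0ₛ ≈ 0ₛ
    up0 = trans (solve 1 (λ a → a := (a :+ a) :+ :- a) refl (up 0ₛ)) (trans (+-congʳ (trans (sym (up-⊞ 0ₛ 0ₛ)) (pointwise (up-cong-≡ (λ n → at (+-identityˡ 0ₛ) n tt))))) (-‿inverseʳ _))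

  private
    cube : PS → PS
    cube a = a * (a * a)

    factor₁ : ∀ e → Comps (1ₛ + - q^ (3 ℕ.* e ℕ.+ 1)) 1ₛ (- q^ e) 0ₛ
    factor₁ e = Comps-≈ (begin
      1ₛ + - q^ (3 ℕ.* e ℕ.+ 1)
        ≈⟨ +-congˡ (-‿cong (trans (q-split 1 (3 ℕ.* e) (ℕₚ.+-comm _ 1)) (*-congˡ (sym (up-q e))))) ⟩
      1ₛ + - (q^ 1 * up (q^ e))
        ≈⟨ solve 4 (λ o q c r → o :+ :- (q :* c) := o :+ q :* (:- c) :+ r :* :0) refl _ _ _ (q^ 2) ⟩
      1ₛ + q^ 1 * - up (q^ e) + q^ 2 * 0ₛ
        ≈⟨ sym (+-cong (+-cong up-1ₛ (*-congˡ (up-⊟ _))) (*-congˡ up-0ₛ)) ⟩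
      triple 1ₛ (- q^ e) 0ₛ ∎)

    factor₂ : ∀ e → Comps (1ₛ + - q^ (3 ℕ.* e ℕ.+ 2)) 1ₛ 0ₛ (- q^ e)
    factor₂ e = Comps-≈ (begin
      1ₛ + - q^ (3 ℕ.* e ℕ.+ 2)
        ≈⟨ +-congˡ (-‿cong (trans (q-split 2 (3 ℕ.* e) (ℕₚ.+-comm _ 2)) (*-congˡ (sym (up-q e))))) ⟩
      1ₛ + - (q^ 2 * up (q^ e))
        ≈⟨ solve 4 (λ o q c r → o :+ :- (q :* c) := o :+ r :* :0 :+ q :* (:- c)) refl _ _ _ (q^ 1) ⟩
      1ₛ + q^ 1 * 0ₛ + q^ 2 * - up (q^ e)
        ≈⟨ sym (+-cong (+-cong up-1ₛ (*-congˡ up-0ₛ)) (*-congˡ (up-⊟ _))) ⟩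
      triple 1ₛ 0ₛ (- q^ e) ∎)

    factor₀ : ∀ e → Comps (1ₛ + - q^ (3 ℕ.* e)) (1ₛ + - q^ e) 0ₛ 0ₛ
    factor₀ e = Comps-≈ (begin
      1ₛ + - q^ (3 ℕ.* e)
        ≈⟨ +-cong (sym up-1ₛ) (trans (-‿cong (sym (up-q e))) (sym (up-⊟ _))) ⟩
      up 1ₛ + up (- q^ e)
        ≈⟨ trans (sym (up-⊞ _ _)) (solve 3 (λ a q r → a := a :+ q :* :0 :+ r :* :0) refl _ (q^ 1) (q^ 2)) ⟩
      up (1ₛ + - q^ e) + q^ 1 * 0ₛ + q^ 2 * 0ₛ
        ≈⟨ sym (+-cong (+-congˡ (*-congˡ up-0ₛ)) (*-congˡ up-0ₛ)) ⟩
      triple (1ₛ + - q^ e) 0ₛ 0ₛ ∎)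

  -- Multiplicativity of the norm is proved only against factors 1 - q^k, where it is a polynomial
  -- identity in the components. For 3 not dividing k the conjugates of 1 - q^(k/3) multiply to 1 -
  -- q^k.
  norm-factor₁ : ∀ f e → norm (f * (1ₛ + - q^ (3 ℕ.* e ℕ.+ 1))) ≈ norm f * (1ₛ + - q^ (3 ℕ.* e ℕ.+ 1))
  norm-factor₁ f e = begin
    norm (f * (1ₛ + - q^ (3 ℕ.* e ℕ.+ 1)))
      ≈⟨ norm-Comps (Comps-* (Comps-refl f) (factor₁ e)) ⟩
    _ ≈⟨ solve 5 (λ x y z c q →
           let X = x :* :1 :+ q :* (y :* :0 :+ z :* (:- c)) ; Y = x :* (:- c) :+ y :* :1 :+ q :* (z :* :0) ; Z = x :* :0 :+ y :* (:- c) :+ z :* :1 in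
           X :* (X :* X) :+ q :* (Y :* (Y :* Y)) :+ (q :* q) :* (Z :* (Z :* Z)) :+ :- ((:1 :+ :1 :+ :1) :* (q :* (X :* (Y :* Z))))
           := (x :* (x :* x) :+ q :* (y :* (y :* y)) :+ (q :* q) :* (z :* (z :* z)) :+ :- ((:1 :+ :1 :+ :1) :* (q :* (x :* (y :* z)))))
              :* (:1 :+ :- (q :* (c :* (c :* c))))) refl (comp 0 f) (comp 1 f) (comp 2 f) (q^ e) (q^ 1) ⟩
    norm f * (1ₛ + - (q^ 1 * (q^ e * (q^ e * q^ e))))
      ≈⟨ *-congˡ (+-congˡ (-‿cong (sym (trans (q-split 1 (e ℕ.+ (e ℕ.+ e)) (idx e)) (*-congˡ (trans (q-+ e _) (*-congˡ (q-+ e e)))))))) ⟩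
    norm f * (1ₛ + - q^ (3 ℕ.* e ℕ.+ 1)) ∎
    where
    idx : ∀ e → 3 ℕ.* e ℕ.+ 1 ≡ 1 ℕ.+ (e ℕ.+ (e ℕ.+ e))
    idx = solve-∀

  norm-factor₂ : ∀ f e → norm (f * (1ₛ + - q^ (3 ℕ.* e ℕ.+ 2))) ≈ norm f * (1ₛ + - q^ (3 ℕ.* e ℕ.+ 2))
  norm-factor₂ f e = begin
    norm (f * (1ₛ + - q^ (3 ℕ.* e ℕ.+ 2)))
      ≈⟨ norm-Comps (Comps-* (Comps-refl f) (factor₂ e)) ⟩
    _ ≈⟨ solve 5 (λ x y z c q →
           let X = x :* :1 :+ q :* (y :* (:- c) :+ z :* :0) ; Y = x :* :0 :+ y :* :1 :+ q :* (z :* (:- c)) ; Z = x :* (:- c) :+ y :* :0 :+ z :* :1 in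
           X :* (X :* X) :+ q :* (Y :* (Y :* Y)) :+ (q :* q) :* (Z :* (Z :* Z)) :+ :- ((:1 :+ :1 :+ :1) :* (q :* (X :* (Y :* Z))))
           := (x :* (x :* x) :+ q :* (y :* (y :* y)) :+ (q :* q) :* (z :* (z :* z)) :+ :- ((:1 :+ :1 :+ :1) :* (q :* (x :* (y :* z)))))
              :* (:1 :+ :- ((q :* q) :* (c :* (c :* c))))) refl (comp 0 f) (comp 1 f) (comp 2 f) (q^ e) (q^ 1) ⟩
    norm f * (1ₛ + - ((q^ 1 * q^ 1) * (q^ e * (q^ e * q^ e))))
      ≈⟨ *-congˡ (+-congˡ (-‿cong (sym (trans (q-split 2 (e ℕ.+ (e ℕ.+ e)) (idx e)) (*-cong (q-+ 1 1) (trans (q-+ e _) (*-congˡ (q-+ e e)))))))) ⟩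
    norm f * (1ₛ + - q^ (3 ℕ.* e ℕ.+ 2)) ∎
    where
    idx : ∀ e → 3 ℕ.* e ℕ.+ 2 ≡ 2 ℕ.+ (e ℕ.+ (e ℕ.+ e))
    idx = solve-∀

  -- Here the factor is a series in q³, equal to all its conjugates, so its cube appears.
  norm-factor₀ : ∀ f e → norm (f * (1ₛ + - q^ (3 ℕ.* e))) ≈ norm f * cube (1ₛ + - q^ e)
  norm-factor₀ f e = trans (norm-Comps (Comps-* (Comps-refl f) (factor₀ e)))
    (solve 5 (λ x y z c q →
           let X = x :* c :+ q :* (y :* :0 :+ z :* :0) ; Y = x :* :0 :+ y :* c :+ q :* (z :* :0) ; Z = x :* :0 :+ y :* :0 :+ z :* c in
           X :* (X :* X) :+ q :* (Y :* (Y :* Y)) :+ (q :* q) :* (Z :* (Z :* Z)) :+ :- ((:1 :+ :1 :+ :1) :* (q :* (X :* (Y :* Z))))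
           := (x :* (x :* x) :+ q :* (y :* (y :* y)) :+ (q :* q) :* (z :* (z :* z)) :+ :- ((:1 :+ :1 :+ :1) :* (q :* (x :* (y :* z)))))
              :* (c :* (c :* c))) refl (comp 0 f) (comp 1 f) (comp 2 f) (1ₛ + - q^ e) (q^ 1))

  private
    F : ℕ → PS
    F e = 1ₛ + - q^ e

    factor₁′ : ∀ f {k} e → k ≡ 3 ℕ.* e ℕ.+ 1 → norm (f * F k) ≈ norm f * F k
    factor₁′ f e ≡.refl = norm-factor₁ f e
    factor₂′ : ∀ f {k} e → k ≡ 3 ℕ.* e ℕ.+ 2 → norm (f * F k) ≈ norm f * F k
    factor₂′ f e ≡.refl = norm-factor₂ f e
    factor₀′ : ∀ f {k} e → k ≡ 3 ℕ.* e → norm (f * F k) ≈ norm f * cube (F e)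
    factor₀′ f e ≡.refl = norm-factor₀ f e

    -- Of three consecutive factors 1 - q^(bn), with b prime to 3, one has an exponent divisible by
    -- 3. It contributes a cube in place of itself, and these factors, which form `poch c c K`, are
    -- kept on the left to avoid a quotient. For b = 1 and b = 2 the other two residues come in
    -- opposite order, so their treatment is a hypothesis.
    norm-poch : ∀ b c → (∀ f K → norm (f * F (b ℕ.+ b ℕ.* (K ℕ.* 3))) ≈ norm f * F (b ℕ.+ b ℕ.* (K ℕ.* 3))) →
      (∀ f K → norm (f * F (b ℕ.+ b ℕ.* (1 ℕ.+ K ℕ.* 3))) ≈ norm f * F (b ℕ.+ b ℕ.* (1 ℕ.+ K ℕ.* 3))) → c ≡ 3 ℕ.* b →
      ∀ f K → norm (f * poch b b (K ℕ.* 3)) * poch c c K ≈ norm f * poch b b (K ℕ.* 3) * cube (poch b b K)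
    norm-poch b c h₁ h₂ c≡ f zero = begin
      norm (f * poch b b 0) * poch c c 0
        ≈⟨ *-cong (norm-cong∞ (trans (*-congˡ (≡⇒≈ (poch-0 b b))) (*-identityʳ f))) (≡⇒≈ (poch-0 c c)) ⟩
      norm f * 1ₛ
        ≈⟨ solve 1 (λ n → n :* :1 := n :* :1 :* (:1 :* (:1 :* :1))) refl _ ⟩
      norm f * 1ₛ * cube 1ₛ
        ≈⟨ sym (*-cong (*-congˡ p0) (*-cong p0 (*-cong p0 p0))) ⟩
      norm f * poch b b 0 * cube (poch b b 0) ∎
      where
      p0 : poch b b 0 ≈ 1ₛ
      p0 = ≡⇒≈ (poch-0 b b)
    norm-poch b c h₁ h₂ c≡ f (suc K) = begin
      norm (f * poch b b (3 ℕ.+ K ℕ.* 3)) * poch c c (suc K)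
        ≈⟨ *-cong (norm-cong∞ (trans (*-congˡ P-expand) (solve 5 (λ f p a b c → f :* (((p :* a) :* b) :* c) := ((f :* p) :* a) :* b :* c) refl _ _ _ _ _)))
             (≡⇒≈ (poch-suc c c K)) ⟩
      norm (((f * P) * A₁ * A₂) * A₃) * (poch c c K * F (c ℕ.+ c ℕ.* K))
        ≈⟨ *-cong (trans (factor₀′ _ (b ℕ.+ b ℕ.* K) (e₃ b K)) (*-congʳ (trans (h₂ _ K) (*-congʳ (h₁ _ K))))) (*-congˡ (≡⇒≈ (≡.cong F e₄))) ⟩
      (norm (f * P) * A₁ * A₂ * cube G) * (poch c c K * A₃)
        ≈⟨ solve 6 (λ n a b g p d → (n :* a :* b :* g) :* (p :* d) := (n :* p) :* (a :* b :* g :* d)) refl _ _ _ _ _ _ ⟩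
      (norm (f * P) * poch c c K) * (A₁ * A₂ * cube G * A₃)
        ≈⟨ *-congʳ (norm-poch b c h₁ h₂ c≡ f K) ⟩
      (norm f * P * cube p) * (A₁ * A₂ * cube G * A₃)
        ≈⟨ solve 7 (λ n P p a b g d → (n :* P :* (p :* (p :* p))) :* (a :* b :* (g :* (g :* g)) :* d)
             := n :* (((P :* a) :* b) :* d) :* ((p :* g) :* ((p :* g) :* (p :* g)))) refl _ _ _ _ _ _ _ ⟩
      norm f * (((P * A₁) * A₂) * A₃) * cube (p * G)
        ≈⟨ sym (*-cong (*-congˡ P-expand) (*-cong p-expand (*-cong p-expand p-expand))) ⟩
      norm f * poch b b (3 ℕ.+ K ℕ.* 3) * cube (poch b b (suc K)) ∎
      where
      P = poch b b (K ℕ.* 3)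
      p = poch b b K
      G = F (b ℕ.+ b ℕ.* K)
      A₁ = F (b ℕ.+ b ℕ.* (K ℕ.* 3))
      A₂ = F (b ℕ.+ b ℕ.* (1 ℕ.+ K ℕ.* 3))
      A₃ = F (b ℕ.+ b ℕ.* (2 ℕ.+ K ℕ.* 3))
      P-expand : poch b b (3 ℕ.+ K ℕ.* 3) ≈ ((P * A₁) * A₂) * A₃
      P-expand = trans (≡⇒≈ (poch-suc b b _)) (*-congʳ (trans (≡⇒≈ (poch-suc b b _)) (*-congʳ (≡⇒≈ (poch-suc b b _)))))
      p-expand : poch b b (suc K) ≈ p * G
      p-expand = ≡⇒≈ (poch-suc b b K)
      e₃ : ∀ b K → b ℕ.+ b ℕ.* (2 ℕ.+ K ℕ.* 3) ≡ 3 ℕ.* (b ℕ.+ b ℕ.* K)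
      e₃ = solve-∀
      e₅ : ∀ b K → 3 ℕ.* b ℕ.+ 3 ℕ.* b ℕ.* K ≡ b ℕ.+ b ℕ.* (2 ℕ.+ K ℕ.* 3)
      e₅ = solve-∀
      e₄ : c ℕ.+ c ℕ.* K ≡ b ℕ.+ b ℕ.* (2 ℕ.+ K ℕ.* 3)
      e₄ = ≡.trans (≡.cong (λ c → c ℕ.+ c ℕ.* K) c≡) (e₅ b K)

    norm-poch-1 : ∀ f K → norm (f * poch 1 1 (K ℕ.* 3)) * poch 3 3 K ≈ norm f * poch 1 1 (K ℕ.* 3) * cube (poch 1 1 K)
    norm-poch-1 = norm-poch 1 3 (λ f K → factor₁′ f K (e₁ K)) (λ f K → factor₂′ f K (e₂ K)) ≡.refl
      where
      e₁ : ∀ K → 1 ℕ.+ 1 ℕ.* (K ℕ.* 3) ≡ 3 ℕ.* K ℕ.+ 1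
      e₁ = solve-∀
      e₂ : ∀ K → 1 ℕ.+ 1 ℕ.* (1 ℕ.+ K ℕ.* 3) ≡ 3 ℕ.* K ℕ.+ 2
      e₂ = solve-∀

    norm-poch-2 : ∀ f K → norm (f * poch 2 2 (K ℕ.* 3)) * poch 6 6 K ≈ norm f * poch 2 2 (K ℕ.* 3) * cube (poch 2 2 K)
    norm-poch-2 = norm-poch 2 6 (λ f K → factor₂′ f (2 ℕ.* K) (e₁ K)) (λ f K → factor₁′ f (1 ℕ.+ 2 ℕ.* K) (e₂ K)) ≡.refl
      where
      e₁ : ∀ K → 2 ℕ.+ 2 ℕ.* (K ℕ.* 3) ≡ 3 ℕ.* (2 ℕ.* K) ℕ.+ 2
      e₁ = solve-∀
      e₂ : ∀ K → 2 ℕ.+ 2 ℕ.* (1 ℕ.+ K ℕ.* 3) ≡ 3 ℕ.* (1 ℕ.+ 2 ℕ.* K) ℕ.+ 1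
      e₂ = solve-∀

    norm-limit : ∀ b c f → (∀ K → norm (f * poch (suc b) (suc b) (K ℕ.* 3)) * poch (suc c) (suc c) K
                                ≈ norm f * poch (suc b) (suc b) (K ℕ.* 3) * cube (poch (suc b) (suc b) K)) →
                 norm (f * Jm (suc b)) * Jm (suc c) ≈ norm f * Jm (suc b) * cube (Jm (suc b))
    norm-limit b c f h = limit λ N →
      let module K = Mod N ; module K3 = Mod (3 ℕ.* N)
          1≤ : ∀ {n} → 1 ≤ suc n
          1≤ = s≤s z≤n
          big : ∀ M {m} → M ≤ m → Jm (suc b) ≈[ fin M ] poch (suc b) (suc b) m
          big M = pochInf≈ M (suc b) (suc b) 1≤ 1≤
      in K.trans (K.*-cong (norm-cong (K3.*-congˡ (big (3 ℕ.* N) (ℕₚ.≤-reflexive (ℕₚ.*-comm 3 N))))) (pochInf≈ N (suc c) (suc c) 1≤ 1≤ ℕₚ.≤-refl))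
         (K.trans (exact (fin N) (h N)) (K.sym (K.*-cong (K.*-congˡ (big N (ℕₚ.m≤m*n N 3)))
            (K.*-cong (big N ℕₚ.≤-refl) (K.*-cong (big N ℕₚ.≤-refl) (big N ℕₚ.≤-refl))))))

  -- In quotient form: a factor `Jm 1` multiplies the norm by J_1^4 / J_3.
  norm-Jm-1 : ∀ f → norm (f * Jm 1) * Jm 3 ≈ norm f * Jm 1 * (Jm 1 * (Jm 1 * Jm 1))
  norm-Jm-1 f = norm-limit 0 2 f (norm-poch-1 f)

  norm-Jm-2 : ∀ f → norm (f * Jm 2) * Jm 6 ≈ norm f * Jm 2 * (Jm 2 * (Jm 2 * Jm 2))
  norm-Jm-2 f = norm-limit 1 5 f (norm-poch-2 f)

  1-comps : Comps 1ₛ 1ₛ 0ₛ 0ₛ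
  1-comps = Comps-≈ (trans (sym up-1ₛ) (trans (solve 3 (λ o q r → o := o :+ q :* :0 :+ r :* :0) refl _ (q^ 1) (q^ 2))
      (sym (+-cong (+-congˡ (*-congˡ up-0ₛ)) (*-congˡ up-0ₛ)))))

  norm-1 : norm 1ₛ ≈ 1ₛ
  norm-1 = trans (norm-Comps 1-comps)
    (solve 1 (λ q → :1 :* (:1 :* :1) :+ q :* (:0 :* (:0 :* :0)) :+ (q :* q) :* (:0 :* (:0 :* :0)) :+ :- ((:1 :+ :1 :+ :1) :* (q :* (:1 :* (:0 :* :0)))) := :1) refl (q^ 1))

-- Theta products and the generating function of all overpartitions

module OverpartitionSeries where
  open PowerSeries
  open Inverses
  open TripleProducts
  open RankSeries
  open RankResidues
  open Trisection

  private
    1≤ : ∀ {n} → 1 ≤ suc n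
    1≤ = s≤s z≤n

  open Series ∞

  private
    poch-×2 : ∀ b c → c ≡ b ℕ.+ b → ∀ K → poch b c K * poch c c K ≈ poch b b (K ℕ.* 2)
    poch-×2 b c e zero    = trans (*-cong (≡⇒≈ (poch-0 b c)) (≡⇒≈ (poch-0 c c))) (trans (*-identityˡ _) (sym (≡⇒≈ (poch-0 b b))))
    poch-×2 b c e (suc K) = begin
      poch b c (suc K) * poch c c (suc K)
        ≈⟨ *-cong (≡⇒≈ (poch-suc b c K)) (≡⇒≈ (poch-suc c c K)) ⟩
      (poch b c K * (1ₛ + - q^ (b ℕ.+ c ℕ.* K))) * (poch c c K * (1ₛ + - q^ (c ℕ.+ c ℕ.* K)))
        ≈⟨ solve 4 (λ p x r y → (p :* x) :* (r :* y) := ((p :* r) :* x) :* y) refl _ _ _ _ ⟩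
      ((poch b c K * poch c c K) * (1ₛ + - q^ (b ℕ.+ c ℕ.* K))) * (1ₛ + - q^ (c ℕ.+ c ℕ.* K))
        ≈⟨ *-cong (*-cong (poch-×2 b c e K) (+-congˡ (-‿cong (q-cong e₁)))) (+-congˡ (-‿cong (q-cong e₂))) ⟩
      (poch b b (K ℕ.* 2) * (1ₛ + - q^ (b ℕ.+ b ℕ.* (K ℕ.* 2)))) * (1ₛ + - q^ (b ℕ.+ b ℕ.* (1 ℕ.+ K ℕ.* 2)))
        ≈⟨ sym (trans (≡⇒≈ (poch-suc b b (1 ℕ.+ K ℕ.* 2))) (*-congʳ (≡⇒≈ (poch-suc b b (K ℕ.* 2))))) ⟩
      poch b b (2 ℕ.+ K ℕ.* 2) ∎
      where
      l₁ : ∀ b K → b ℕ.+ (b ℕ.+ b) ℕ.* K ≡ b ℕ.+ b ℕ.* (K ℕ.* 2)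
      l₁ = solve-∀
      l₂ : ∀ b K → (b ℕ.+ b) ℕ.+ (b ℕ.+ b) ℕ.* K ≡ b ℕ.+ b ℕ.* (1 ℕ.+ K ℕ.* 2)
      l₂ = solve-∀
      e₁ : b ℕ.+ c ℕ.* K ≡ b ℕ.+ b ℕ.* (K ℕ.* 2)
      e₁ = ≡.trans (≡.cong (λ c → b ℕ.+ c ℕ.* K) e) (l₁ b K)
      e₂ : c ℕ.+ c ℕ.* K ≡ b ℕ.+ b ℕ.* (1 ℕ.+ K ℕ.* 2)
      e₂ = ≡.trans (≡.cong (λ c → c ℕ.+ c ℕ.* K) e) (l₂ b K)

    poch-×3 : ∀ a K → poch a 6 K * poch (2 ℕ.+ a) 6 K * poch (4 ℕ.+ a) 6 K ≈ poch a 2 (K ℕ.* 3)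
    poch-×3 a zero    = trans (*-cong (*-cong (≡⇒≈ (poch-0 a 6)) (≡⇒≈ (poch-0 (2 ℕ.+ a) 6))) (≡⇒≈ (poch-0 (4 ℕ.+ a) 6)))
      (trans (solve 0 (:1 :* :1 :* :1 := :1) refl) (sym (≡⇒≈ (poch-0 a 2))))
    poch-×3 a (suc K) = begin
      poch a 6 (suc K) * poch (2 ℕ.+ a) 6 (suc K) * poch (4 ℕ.+ a) 6 (suc K)
        ≈⟨ *-cong (*-cong (≡⇒≈ (poch-suc a 6 K)) (≡⇒≈ (poch-suc (2 ℕ.+ a) 6 K))) (≡⇒≈ (poch-suc (4 ℕ.+ a) 6 K)) ⟩
      (poch a 6 K * F (a ℕ.+ 6 ℕ.* K)) * (poch (2 ℕ.+ a) 6 K * F (2 ℕ.+ a ℕ.+ 6 ℕ.* K)) * (poch (4 ℕ.+ a) 6 K * F (4 ℕ.+ a ℕ.+ 6 ℕ.* K))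
        ≈⟨ solve 6 (λ p q r x y z → (p :* x) :* (q :* y) :* (r :* z) := (((p :* q :* r) :* x) :* y) :* z) refl
             (poch a 6 K) (poch (2 ℕ.+ a) 6 K) (poch (4 ℕ.+ a) 6 K) (F (a ℕ.+ 6 ℕ.* K)) (F (2 ℕ.+ a ℕ.+ 6 ℕ.* K)) (F (4 ℕ.+ a ℕ.+ 6 ℕ.* K)) ⟩
      (((poch a 6 K * poch (2 ℕ.+ a) 6 K * poch (4 ℕ.+ a) 6 K) * F (a ℕ.+ 6 ℕ.* K)) * F (2 ℕ.+ a ℕ.+ 6 ℕ.* K)) * F (4 ℕ.+ a ℕ.+ 6 ℕ.* K)
        ≈⟨ *-cong (*-cong (*-cong (poch-×3 a K) (F≈ (e₁ a K))) (F≈ (e₂ a K))) (F≈ (e₃ a K)) ⟩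
      ((poch a 2 (K ℕ.* 3) * F (a ℕ.+ 2 ℕ.* (K ℕ.* 3))) * F (a ℕ.+ 2 ℕ.* (1 ℕ.+ K ℕ.* 3))) * F (a ℕ.+ 2 ℕ.* (2 ℕ.+ K ℕ.* 3))
        ≈⟨ sym (trans (≡⇒≈ (poch-suc a 2 (2 ℕ.+ K ℕ.* 3))) (*-congʳ (trans (≡⇒≈ (poch-suc a 2 (1 ℕ.+ K ℕ.* 3))) (*-congʳ (≡⇒≈ (poch-suc a 2 (K ℕ.* 3))))))) ⟩
      poch a 2 (3 ℕ.+ K ℕ.* 3) ∎
      where
      F : ℕ → PS
      F e = 1ₛ + - q^ e
      F≈ : ∀ {a b} → a ≡ b → F a ≈ F b
      F≈ e = +-congˡ (-‿cong (q-cong e))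
      e₁ : ∀ a K → a ℕ.+ 6 ℕ.* K ≡ a ℕ.+ 2 ℕ.* (K ℕ.* 3)
      e₁ = solve-∀
      e₂ : ∀ a K → 2 ℕ.+ a ℕ.+ 6 ℕ.* K ≡ a ℕ.+ 2 ℕ.* (1 ℕ.+ K ℕ.* 3)
      e₂ = solve-∀
      e₃ : ∀ a K → 4 ℕ.+ a ℕ.+ 6 ℕ.* K ≡ a ℕ.+ 2 ℕ.* (2 ℕ.+ K ℕ.* 3)
      e₃ = solve-∀

  pochInf-×2 : ∀ b → pochInf (suc b) (suc b ℕ.+ suc b) * pochInf (suc b ℕ.+ suc b) (suc b ℕ.+ suc b) ≈ Jm (suc b)
  pochInf-×2 b = limit λ N → let module K = Mod N in
    K.trans (K.*-cong (pochInf≈ N _ _ 1≤ 1≤ ℕₚ.≤-refl) (pochInf≈ N _ _ 1≤ 1≤ ℕₚ.≤-refl))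
    (K.trans (exact (fin N) (poch-×2 (suc b) _ ≡.refl N)) (K.sym (pochInf≈ N _ _ 1≤ 1≤ (ℕₚ.m≤m*n N 2))))

  pochInf-×3 : ∀ a → pochInf (suc a) 6 * pochInf (3 ℕ.+ a) 6 * pochInf (5 ℕ.+ a) 6 ≈ pochInf (suc a) 2
  pochInf-×3 a = limit λ N → let module K = Mod N in
    K.trans (K.*-cong (K.*-cong (pochInf≈ N (suc a) 6 1≤ 1≤ ℕₚ.≤-refl) (pochInf≈ N (3 ℕ.+ a) 6 1≤ 1≤ ℕₚ.≤-refl)) (pochInf≈ N (5 ℕ.+ a) 6 1≤ 1≤ ℕₚ.≤-refl))
    (K.trans (exact (fin N) (poch-×3 (suc a) N)) (K.sym (pochInf≈ N (suc a) 2 1≤ 1≤ (ℕₚ.m≤m*n N 3))))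

  module T₁₁ = TripleProduct 1 0 0 ≡.refl
  module T₅₁ = TripleProduct 5 4 0 ≡.refl
  module T₄₂ = TripleProduct 5 3 1 ≡.refl

  -- φ is the sum of (-1)^n q^(n²) over all integers n, and B is J_(1,6).
  φ B : PS
  φ = Σ∞ T₁₁.η
  B = Σ∞ T₅₁.η

  φ-product : φ * Jm 2 ≈ Jm 1 * Jm 1
  φ-product = trans (*-congʳ T₁₁.triple-product) (trans
    (solve 2 (λ a b → (a :* a :* b) :* b := (a :* b) :* (a :* b)) refl (pochInf 1 2) (pochInf 2 2))
    (*-cong (pochInf-×2 0) (pochInf-×2 0)))

  -- The exponents congruent to 2, 4 and 6 mod 6 are together all the even ones.
  T₄₂-product : Σ∞ T₄₂.η ≈ Jm 2
  T₄₂-product = trans T₄₂.triple-product (trans (*-congʳ (*-comm (pochInf 4 6) (pochInf 2 6))) (pochInf-×3 1))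

  -- Iterating the recurrence for Z_{2k} expands 1/P̄ as a theta series.
  φ*P̄ : φ * P̄ ≈ 1ₛ
  φ*P̄ = limit go
    where
    go : ∀ N → φ ⊠ P̄ ≈[ fin N ] 1ₛ
    go N = product
      where
      module K = Mod N
      open K using () renaming (_≈_ to _≈ₙ_)
      module R = ResidueSums N
      t : ℕ → PS
      t = θ 2 1
      y : ℕ → PS
      y k = t k ⊠ Zz (+ (2 ℕ.* k))
      step : ∀ k → y (suc k) ≈ₙ t (suc k) ⊠ Zz (+ (2 ℕ.+ 2 ℕ.* k))
      step k = K.*-congˡ (K.≡⇒≈ (≡.cong (λ x → Zz (+ x)) (ℕₚ.*-suc 2 k)))
      e : ℕ → PS
      e zero    = 1ₛ
      e (suc _) = 0ₛ
      Zeven : ∀ k → Zz (+ (2 ℕ.* k)) ≈ₙ e k ⊞ q^ (2 ℕ.* k ℕ.+ 1) ⊠ (R.2P̄ ⊞ ⊟ Zz (+ (2 ℕ.+ 2 ℕ.* k)))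
      Zeven zero    = R.Zz-rec-0
      Zeven (suc k) = K.trans (R.Zz-rec (k ℕ.+ suc (k ℕ.+ 0))) (K.trans (K.*-congʳ (K.q-cong (≡.cong suc (ℕₚ.+-comm 1 _)))) (K.sym (K.+-identityˡ _)))
      ty : ∀ k → t k ⊠ e k ≈ₙ e k
      ty zero    = K.*-identityˡ _
      ty (suc k) = K.zeroʳ _
      -- By t_(k+1) = -q^(2k+1) t_k the weight absorbs the power of q in the recurrence for Z_(2k).
      yrec : ∀ k → y k ≈ₙ e k ⊞ (y (suc k) ⊞ ⊟ (R.2P̄ ⊠ t (suc k)))
      yrec k = K.trans (K.*-congˡ (Zeven k)) (K.trans
        (K.solve 5 (λ t e x p z → t K.:* (e K.:+ x K.:* (p K.:+ K.:- z)) K.:= t K.:* e K.:+ ((K.:- (x K.:* t)) K.:* z K.:+ K.:- (p K.:* (K.:- (x K.:* t))))) K.refl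
          (t k) (e k) (q^ (2 ℕ.* k ℕ.+ 1)) R.2P̄ (Zz (+ (2 ℕ.+ 2 ℕ.* k))))
        (K.+-cong (ty k) (K.+-congʳ (K.sym (step k)))))
      unroll : ∀ M → P̄ ≈ₙ (1ₛ ⊞ (y (suc M) ⊞ ⊟ (R.2P̄ ⊠ K.∑ (suc M) (λ k → t (suc k)))))
      unroll zero = K.trans (K.sym R.Zz-0) (K.trans (K.trans (K.sym (K.*-identityˡ _)) (yrec 0)) (K.+-congˡ (K.+-congˡ (K.-‿cong (K.*-congˡ (K.sym (K.+-identityˡ _)))))))
      unroll (suc M) = K.trans (unroll M) (K.trans (K.+-congˡ (K.+-congʳ (K.trans (yrec (suc M)) (K.+-identityˡ _))))
        (K.solve 5 (λ o y p s t → o K.:+ ((y K.:+ K.:- (p K.:* t)) K.:+ K.:- (p K.:* s)) K.:= o K.:+ (y K.:+ K.:- (p K.:* (s K.:+ t)))) K.refl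
          1ₛ (y (suc (suc M))) R.2P̄ (K.∑ (suc M) (λ k → t (suc k))) (t (suc (suc M)))))
      y-small : y (suc N) ≈ₙ 0ₛ
      y-small = K.trans (K.*-congʳ (coarsen (ℕₚ.n≤1+n N) (θ-vanish 2 1≤ (suc N)))) (K.zeroˡ _)
      φ≈ : φ ≈ₙ 1ₛ ⊞ (K.∑ (suc N) (λ k → t (suc k)) ⊞ K.∑ (suc N) (λ k → t (suc k)))
      φ≈ = K.trans (Σ∞≈∑ N (suc N) (ℕₚ.n≤1+n N) T₁₁.η-vanishing) (K.trans (K.∑-+ (suc N) t (λ k → t (suc k)))
        (K.trans (K.+-congʳ (K.trans (K.trans (K.sym (K.trans (K.+-congˡ (coarsen (ℕₚ.n≤1+n N) (θ-vanish 2 1≤ (suc N)))) (K.+-identityʳ _))) (K.∑-head (suc N) t)) K.refl)) (K.+-assoc _ _ _)))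
      product : φ ⊠ P̄ ≈ₙ 1ₛ
      product = K.trans (K.*-congʳ φ≈) (K.trans
        (K.solve 2 (λ s p → (K.:1 K.:+ (s K.:+ s)) K.:* p K.:= p K.:+ (p K.:+ p) K.:* s) K.refl (K.∑ (suc N) (λ k → t (suc k))) P̄)
        (K.trans (K.+-congʳ (K.trans (unroll N) (K.+-congˡ (K.+-congʳ y-small))))
          (K.solve 2 (λ p s → (K.:1 K.:+ (K.:0 K.:+ K.:- (p K.:* s))) K.:+ p K.:* s K.:= K.:1) K.refl R.2P̄ (K.∑ (suc N) (λ k → t (suc k))))))

  -- The sum is cut modulo q^(3N), since extracting a residue class divides the precision by three.
  comp-Σ∞ : ∀ {i} → i < 3 → ∀ {F G} → Vanishing F → Vanishing G → (∀ k → comp i (F k) ≈ G k) → comp i (Σ∞ F) ≈ Σ∞ G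
  comp-Σ∞ {i} i<3 {F} {G} v v′ e = limit λ N → let module K = Mod N in
    K.trans (comp-cong i<3 (Σ∞≈∑′ N)) (K.trans (K.pointwise λ n → helper N n)
    (K.trans (K.∑-cong′ (3 ℕ.* N) (λ k → exact (fin N) (e k))) (K.sym (Σ∞≈∑ N (3 ℕ.* N) (ℕₚ.m≤m+n N _) v′))))
    where
    Σ∞≈∑′ : ∀ N → Σ∞ F ≈[ fin (3 ℕ.* N) ] Mod.∑ (3 ℕ.* N) (3 ℕ.* N) F
    Σ∞≈∑′ N = Σ∞≈∑ (3 ℕ.* N) (3 ℕ.* N) ℕₚ.≤-refl v
    helper : ∀ N n → comp i (Mod.∑ (3 ℕ.* N) (3 ℕ.* N) F) n ≡ Mod.∑ N (3 ℕ.* N) (λ k → comp i (F k)) n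
    helper N n = go (3 ℕ.* N)
      where
      go : ∀ M → comp i (Mod.∑ (3 ℕ.* N) M F) n ≡ Mod.∑ N M (λ k → comp i (F k)) n
      go zero    = comp-0ₛ i n
      go (suc M) = ≡.trans (comp-⊞ i _ _ n) (≡.trans (⊞-at _ _ n) (≡.trans (≡.cong (ℚ._+ comp i (F M) n) (go M)) (≡.sym (⊞-at _ _ n))))

-- The series of overpartitions of 3n + 2 as a product

module OverpartitionTrisection where
  open PowerSeries
  open Inverses
  open TripleProducts
  open RankSeries
  open RankResidues
  open RankDifferences using (module Bilaterals)
  open Trisection
  open CubicNorm
  open OverpartitionSeries

  open Series ∞
  open Units ∞
  open θ-Properties ∞ using (θ-explicit)

  private
    1≤ : ∀ {n} → 1 ≤ suc n
    1≤ = s≤s z≤n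

  Σ∞-⊟ : ∀ {F} → Vanishing F → Σ∞ (λ k → ⊟ F k) ≈ - Σ∞ F
  Σ∞-⊟ {F} v = limit λ N → let module K = Mod N in
    K.trans (Σ∞≈∑ N N ℕₚ.≤-refl (λ k → let module L = Mod k in L.trans (L.-‿cong (v k)) L.-0#≈0#))
    (K.trans (K.∑-neg N F) (K.-‿cong (K.sym (Σ∞≈∑ N N ℕₚ.≤-refl v))))

  Σ∞-⊞ : ∀ {F G} → Vanishing F → Vanishing G → Σ∞ (λ k → F k ⊞ G k) ≈ Σ∞ F + Σ∞ G
  Σ∞-⊞ {F} {G} v v′ = limit λ N → let module K = Mod N in
    K.trans (Σ∞≈∑ N N ℕₚ.≤-refl (λ k → let module L = Mod k in L.trans (L.+-cong (v k) (v′ k)) (L.+-identityˡ _)))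
    (K.trans (K.∑-+ N F G) (K.sym (K.+-cong (Σ∞≈∑ N N ℕₚ.≤-refl v) (Σ∞≈∑ N N ℕₚ.≤-refl v′))))

  Σ∞-0 : ∀ {F} → (∀ k → F k ≈ 0ₛ) → Σ∞ F ≈ 0ₛ
  Σ∞-0 {F} e = limit λ N → let module K = Mod N in
    K.trans (Σ∞≈∑ N N ℕₚ.≤-refl (λ k → exact (fin k) (e k))) (K.∑-0 N (λ k _ → exact (fin N) (e k)))

  sg-3 : ∀ a → sg (a ℕ.* 3) ≈ sg a
  sg-3 zero    = refl
  sg-3 (suc a) = trans (-‿cong (-‿involutive _)) (-‿cong (sg-3 a))

  up-sg : ∀ a → up (sg a) ≈ sg a
  up-sg zero    = up-1ₛ
  up-sg (suc a) = trans (up-⊟ (sg a)) (-‿cong (up-sg a))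

  up-sg-q : ∀ a e → up (sg a * q^ e) ≈ sg a * q^ (3 ℕ.* e)
  up-sg-q a e = trans (up-⊠ _ _) (*-cong (up-sg a) (up-q e))

  private
    t : ℕ → PS
    t = θ 2 1

    t-explicit : ∀ k → t k ≈ sg k * q^ (k ℕ.* k)
    t-explicit = θ-explicit (λ k → k ℕ.* k) ≡.refl e
      where
      e : ∀ k → (1 ℕ.+ k) ℕ.* (1 ℕ.+ k) ≡ (2 ℕ.* k ℕ.+ 1) ℕ.+ k ℕ.* k
      e = solve-∀

    -- Blocks of three squares with residues 1, 1, 0 mod 3. Starting at 1 keeps the constant term of
    -- φ, which occurs once and not twice, apart.
    G : ℕ → PS
    G a = t (1 ℕ.+ a ℕ.* 3) + t (2 ℕ.+ a ℕ.* 3) + t (3 ℕ.+ a ℕ.* 3)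

    G-vanishing : Vanishing G
    G-vanishing a = K.trans (K.+-cong (K.trans (K.+-cong (v 1) (v 2)) (K.+-identityˡ _)) (v 3)) (K.+-identityˡ _)
      where
      module K = Mod a
      v : ∀ j → t (j ℕ.+ a ℕ.* 3) ≈[ fin a ] 0ₛ
      v j = coarsen (ℕₚ.≤-trans (ℕₚ.m≤m*n a 3) (ℕₚ.m≤n+m _ j)) (θ-vanish 2 1≤ (j ℕ.+ a ℕ.* 3))

    φ≈G : φ ≈ 1ₛ + (Σ∞ G + Σ∞ G)
    φ≈G = limit λ N → let module K = Mod N in
      let M = N ℕ.* 3
          N≤M = ℕₚ.m≤m*n N 3
          S = K.∑ M (λ k → t (suc k))
          S≈ : S ≈[ fin N ] Σ∞ G
          S≈ = K.trans (K.∑-3 N (λ k → t (suc k))) (K.sym (Σ∞≈∑ N N ℕₚ.≤-refl G-vanishing))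
      in K.trans (Σ∞≈∑ N M N≤M T₁₁.η-vanishing) (K.trans (K.∑-+ M t (λ k → t (suc k)))
        (K.trans (K.+-congʳ (K.trans (K.sym (K.trans (K.+-congˡ (coarsen N≤M (θ-vanish 2 1≤ M))) (K.+-identityʳ _))) (K.∑-head M t)))
        (K.trans (K.+-assoc _ _ _) (K.+-congˡ (K.+-cong S≈ S≈)))))

    G-comps : ∀ a → Comps (G a) (sg (suc a) * q^ (3 ℕ.* (suc a ℕ.* suc a))) (- T₅₁.η a) 0ₛ
    G-comps a = Comps-≈ (begin
      t (1 ℕ.+ a ℕ.* 3) + t (2 ℕ.+ a ℕ.* 3) + t (3 ℕ.+ a ℕ.* 3)
        ≈⟨ +-cong (+-cong first second) third ⟩
      q^ 1 * up (- θ 6 5 a) + q^ 1 * up (- θ 6 1 (suc a)) + up (sg (suc a) * q^ (3 ℕ.* (suc a ℕ.* suc a)))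
        ≈⟨ trans (+-congʳ (trans (sym (distribˡ _ _ _)) (*-congˡ (trans (sym (up-⊞ _ _)) (up-cong (-+-comm _ _))))))
             (trans (solve 3 (λ a b r → a :+ b := b :+ a :+ r :* :0) refl _ _ (q^ 2)) (+-congˡ (*-congˡ (sym up-0ₛ)))) ⟩
      triple (sg (suc a) * q^ (3 ℕ.* (suc a ℕ.* suc a))) (- T₅₁.η a) 0ₛ ∎)
      where
      θ₅ : θ 6 5 a ≈ sg a * q^ (3 ℕ.* a ℕ.* a ℕ.+ 2 ℕ.* a)
      θ₅ = θ-explicit (λ a → 3 ℕ.* a ℕ.* a ℕ.+ 2 ℕ.* a) ≡.refl e a
        where
        e : ∀ a → 3 ℕ.* (1 ℕ.+ a) ℕ.* (1 ℕ.+ a) ℕ.+ 2 ℕ.* (1 ℕ.+ a) ≡ (6 ℕ.* a ℕ.+ 5) ℕ.+ (3 ℕ.* a ℕ.* a ℕ.+ 2 ℕ.* a)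
        e = solve-∀
      θ₁ : ∀ k → θ 6 1 k ≈ sg k * q^ (θ-exponent 6 1 k)
      θ₁ = θ-explicit (θ-exponent 6 1) ≡.refl (λ _ → ≡.refl)
      θ₁-exp : ∀ a → θ-exponent 6 1 (suc a) ≡ 3 ℕ.* a ℕ.* a ℕ.+ 4 ℕ.* a ℕ.+ 1
      θ₁-exp zero    = ≡.refl
      θ₁-exp (suc a) = ≡.trans (≡.cong (6 ℕ.* suc a ℕ.+ 1 ℕ.+_) (θ₁-exp a)) (e a)
        where
        e : ∀ a → 6 ℕ.* (1 ℕ.+ a) ℕ.+ 1 ℕ.+ (3 ℕ.* a ℕ.* a ℕ.+ 4 ℕ.* a ℕ.+ 1) ≡ 3 ℕ.* (1 ℕ.+ a) ℕ.* (1 ℕ.+ a) ℕ.+ 4 ℕ.* (1 ℕ.+ a) ℕ.+ 1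
        e = solve-∀
      lift : ∀ e k s → t k ≈ s * q^ (k ℕ.* k) → ∀ j → k ℕ.* k ≡ j ℕ.+ 3 ℕ.* e → t k ≈ q^ j * (s * q^ (3 ℕ.* e))
      lift e k s h j eq = trans h (trans (*-congˡ (q-split j (3 ℕ.* e) eq)) (solve 3 (λ s a b → s :* (a :* b) := a :* (s :* b)) refl _ _ _))
      first : t (1 ℕ.+ a ℕ.* 3) ≈ q^ 1 * up (- θ 6 5 a)
      first = trans (lift (3 ℕ.* a ℕ.* a ℕ.+ 2 ℕ.* a) (1 ℕ.+ a ℕ.* 3) _ (t-explicit (1 ℕ.+ a ℕ.* 3)) 1 (e a)) (*-congˡ (trans (*-congʳ (-‿cong (sg-3 a)))
        (trans (-‿distribˡ-*′ _ _) (trans (-‿cong (sym (up-sg-q a _))) (trans (sym (up-⊟ _)) (up-cong (-‿cong (sym θ₅))))))))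
        where
        e : ∀ a → (1 ℕ.+ a ℕ.* 3) ℕ.* (1 ℕ.+ a ℕ.* 3) ≡ 1 ℕ.+ 3 ℕ.* (3 ℕ.* a ℕ.* a ℕ.+ 2 ℕ.* a)
        e = solve-∀
        -‿distribˡ-*′ : ∀ a b → - a * b ≈ - (a * b)
        -‿distribˡ-*′ a b = sym (-‿distribˡ-* a b)
      second : t (2 ℕ.+ a ℕ.* 3) ≈ q^ 1 * up (- θ 6 1 (suc a))
      second = trans (lift (3 ℕ.* a ℕ.* a ℕ.+ 4 ℕ.* a ℕ.+ 1) (2 ℕ.+ a ℕ.* 3) _ (t-explicit (2 ℕ.+ a ℕ.* 3)) 1 (e a)) (*-congˡ (trans (*-congʳ (trans (-‿involutive _) (sg-3 a)))
        (trans (sym (up-sg-q a _)) (up-cong (trans (solve 2 (λ s x → s :* x := :- ((:- s) :* x)) refl _ _)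
          (-‿cong (trans (*-congˡ (q-cong (≡.sym (θ₁-exp a)))) (sym (θ₁ (suc a))))))))))
        where
        e : ∀ a → (2 ℕ.+ a ℕ.* 3) ℕ.* (2 ℕ.+ a ℕ.* 3) ≡ 1 ℕ.+ 3 ℕ.* (3 ℕ.* a ℕ.* a ℕ.+ 4 ℕ.* a ℕ.+ 1)
        e = solve-∀
      third : t (3 ℕ.+ a ℕ.* 3) ≈ up (sg (suc a) * q^ (3 ℕ.* (suc a ℕ.* suc a)))
      third = trans (t-explicit (3 ℕ.+ a ℕ.* 3)) (trans (*-cong (trans (-‿cong (-‿involutive _)) (-‿cong (sg-3 a))) (q-cong (e a))) (sym (up-sg-q (suc a) _)))
        where
        e : ∀ a → (3 ℕ.+ a ℕ.* 3) ℕ.* (3 ℕ.+ a ℕ.* 3) ≡ 3 ℕ.* (3 ℕ.* ((1 ℕ.+ a) ℕ.* (1 ℕ.+ a)))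
        e = solve-∀

  private
    -- No square is 2 mod 3, so the last component is zero; this makes the elimination in `P̄₂*norm`
    -- short.
    φ-comps : Comps φ (comp 0 φ) (- (B + B)) 0ₛ
    φ-comps = comps refl
      (trans (comp-cong∞ φ≈G) (trans (pointwise (comp-⊞ 1 _ _)) (trans (+-cong (Comps.c₁ 1-comps)
        (trans (pointwise (comp-⊞ 1 _ _)) (+-cong c₁ c₁))) (solve 1 (λ b → :0 :+ ((:- b) :+ (:- b)) := :- (b :+ b)) refl B))))
      (trans (comp-cong∞ φ≈G) (trans (pointwise (comp-⊞ 2 _ _)) (trans (+-cong (Comps.c₂ 1-comps)
        (trans (pointwise (comp-⊞ 2 _ _)) (+-cong c₂ c₂))) (solve 0 (:0 :+ (:0 :+ :0) := :0) refl))))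
      where
      c₁ : comp 1 (Σ∞ G) ≈ - B
      c₁ = trans (comp-Σ∞ (s≤s (s≤s z≤n)) G-vanishing (λ k → let module L = Mod k in L.trans (L.-‿cong (T₅₁.η-vanishing k)) L.-0#≈0#)
        (λ a → Comps.c₁ (G-comps a))) (Σ∞-⊟ T₅₁.η-vanishing)
      c₂ : comp 2 (Σ∞ G) ≈ 0ₛ
      c₂ = trans (comp-Σ∞ (s≤s (s≤s (s≤s z≤n))) G-vanishing (λ k → Mod.refl k) (λ a → Comps.c₂ (G-comps a))) (Σ∞-0 (λ _ → refl))

    four : PS → PS
    four x = x + x + x + x

  -- The components of φ P̄ = 1 are three linear equations for those of P̄ with determinant
  -- `norm φ`. The multipliers A², -Ab, b² are the cofactors that isolate the last unknown, leaving
  -- b² = 4B².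
  P̄₂*norm : comp 2 P̄ * norm φ ≈ four (B * B)
  P̄₂*norm = begin
    x₂ * norm φ
      ≈⟨ *-congˡ (norm-Comps φ-comps) ⟩
    x₂ * N3 A b 0ₛ
      ≈⟨ solve 6 (λ A b x₀ x₁ x₂ q →
           x₂ :* (A :* (A :* A) :+ q :* (b :* (b :* b)) :+ (q :* q) :* (:0 :* (:0 :* :0)) :+ :- ((:1 :+ :1 :+ :1) :* (q :* (A :* (b :* :0)))))
           := (A :* A) :* (A :* x₂ :+ b :* x₁ :+ :0 :* x₀) :+ :- ((A :* b) :* (A :* x₁ :+ b :* x₀ :+ q :* (:0 :* x₂)))
              :+ (b :* b) :* (A :* x₀ :+ q :* (b :* x₂ :+ :0 :* x₁))) refl A b x₀ x₁ x₂ (q^ 1) ⟩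
    (A * A) * (A * x₂ + b * x₁ + 0ₛ * x₀) + - ((A * b) * (A * x₁ + b * x₀ + q^ 1 * (0ₛ * x₂))) + (b * b) * (A * x₀ + q^ 1 * (b * x₂ + 0ₛ * x₁))
      ≈⟨ +-cong (+-cong (*-congˡ e₂) (-‿cong (*-congˡ e₁))) (*-congˡ e₀) ⟩
    (A * A) * 0ₛ + - ((A * b) * 0ₛ) + (b * b) * 1ₛ
      ≈⟨ solve 2 (λ A B → (A :* A) :* :0 :+ :- ((A :* (:- (B :+ B))) :* :0) :+ ((:- (B :+ B)) :* (:- (B :+ B))) :* :1
           := B :* B :+ B :* B :+ B :* B :+ B :* B) refl A B ⟩
    four (B * B) ∎
    where
    A = comp 0 φ ; b = - (B + B)
    x₀ = comp 0 P̄ ; x₁ = comp 1 P̄ ; x₂ = comp 2 P̄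
    prod : Comps (φ * P̄) _ _ _
    prod = Comps-* φ-comps (Comps-refl P̄)
    e₀ : A * x₀ + q^ 1 * (b * x₂ + 0ₛ * x₁) ≈ 1ₛ
    e₀ = trans (sym (Comps.c₀ prod)) (trans (comp-cong∞ φ*P̄) (Comps.c₀ 1-comps))
    e₁ : A * x₁ + b * x₀ + q^ 1 * (0ₛ * x₂) ≈ 0ₛ
    e₁ = trans (sym (Comps.c₁ prod)) (trans (comp-cong∞ φ*P̄) (Comps.c₁ 1-comps))
    e₂ : A * x₂ + b * x₁ + 0ₛ * x₀ ≈ 0ₛ
    e₂ = trans (sym (Comps.c₂ prod)) (trans (comp-cong∞ φ*P̄) (Comps.c₂ 1-comps))

  -- Write φ as J_1² / J_2; the norm of each J_b is J_b^4 / J_(3b). All denominators are multiplied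
  -- out.
  norm-φ : norm φ * (Jm 2 ^ₛ 4) * (Jm 3 * Jm 3) ≈ Jm 6 * (Jm 1 ^ₛ 8)
  norm-φ = begin
    norm φ * (J₂ ^ₛ 4) * (J₃ * J₃)
      ≈⟨ solve 3 (λ n a b → n :* pw 4 a :* (b :* b) := (n :* a :* (a :* (a :* a))) :* (b :* b)) refl (norm φ) J₂ J₃ ⟩
    (norm φ * J₂ * (J₂ * (J₂ * J₂))) * (J₃ * J₃)
      ≈⟨ *-congʳ (sym (norm-Jm-2 φ)) ⟩
    (norm (φ * J₂) * J₆) * (J₃ * J₃)
      ≈⟨ *-congʳ (*-congʳ (norm-cong∞ φ-product)) ⟩
    (norm (J₁ * J₁) * J₆) * (J₃ * J₃)
      ≈⟨ solve 3 (λ n a b → (n :* a) :* (b :* b) := a :* (n :* b) :* b) refl _ _ _ ⟩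
    J₆ * (norm (J₁ * J₁) * J₃) * J₃
      ≈⟨ *-congʳ (*-congˡ (norm-Jm-1 J₁)) ⟩
    J₆ * (norm J₁ * J₁ * (J₁ * (J₁ * J₁))) * J₃
      ≈⟨ solve 4 (λ s n a b → s :* (n :* a :* (a :* (a :* a))) :* b := s :* ((n :* b) :* (a :* (a :* (a :* a))))) refl J₆ (norm J₁) J₁ J₃ ⟩
    J₆ * ((norm J₁ * J₃) * (J₁ * (J₁ * (J₁ * J₁))))
      ≈⟨ *-congˡ (*-congʳ (trans (*-congʳ (norm-cong∞ (sym (*-identityˡ J₁)))) (trans (norm-Jm-1 1ₛ) (*-congʳ (*-congʳ norm-1))))) ⟩
    J₆ * ((1ₛ * J₁ * (J₁ * (J₁ * J₁))) * (J₁ * (J₁ * (J₁ * J₁))))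
      ≈⟨ solve 2 (λ s a → s :* ((:1 :* a :* (a :* (a :* a))) :* (a :* (a :* (a :* a)))) := s :* pw 8 a) refl J₆ J₁ ⟩
    J₆ * (J₁ ^ₛ 8) ∎
    where
    J₁ = Jm 1 ; J₂ = Jm 2 ; J₃ = Jm 3 ; J₆ = Jm 6

  private
    p : ℕ → PS
    p a = pochInf a 6

    J₁₆ J₃₆ : PS
    J₁₆ = p 1 * p 5 * p 6
    J₃₆ = p 3 * p 3 * p 6

    B≈J₁₆ : B ≈ J₁₆
    B≈J₁₆ = trans T₅₁.triple-product (*-congʳ (*-comm _ _))

    J₁₆-product : J₁₆ * Jm 2 * Jm 3 ≈ Jm 1 * (Jm 6 * Jm 6)
    J₁₆-product = begin
      (p 1 * p 5 * p 6) * Jm 2 * Jm 3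
        ≈⟨ *-congˡ (sym (pochInf-×2 2)) ⟩
      (p 1 * p 5 * p 6) * Jm 2 * (p 3 * p 6)
        ≈⟨ solve 5 (λ a b c d e → (a :* b :* c) :* d :* (e :* c) := ((a :* e :* b) :* d) :* (c :* c)) refl (p 1) (p 5) (p 6) (Jm 2) (p 3) ⟩
      ((p 1 * p 3 * p 5) * Jm 2) * (p 6 * p 6)
        ≈⟨ *-congʳ (trans (*-congʳ (pochInf-×3 0)) (pochInf-×2 0)) ⟩
      Jm 1 * (Jm 6 * Jm 6) ∎

    J₃₆-product : J₃₆ * Jm 6 ≈ Jm 3 * Jm 3
    J₃₆-product = trans (solve 2 (λ a b → (a :* a :* b) :* b := (a :* b) :* (a :* b)) refl (p 3) (p 6))
      (*-cong (pochInf-×2 2) (pochInf-×2 2))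

    power-cong : ∀ {f g} k → f ≈ g → f ^ₛ k ≈ g ^ₛ k
    power-cong zero    e = refl
    power-cong (suc k) e = *-cong e (power-cong k e)

    power-* : ∀ f g k → (f * g) ^ₛ k ≈ f ^ₛ k * g ^ₛ k
    power-* f g zero    = sym (*-identityˡ 1ₛ)
    power-* f g (suc k) = trans (*-congˡ (power-* f g k)) (solve 4 (λ a b c d → (a :* b) :* (c :* d) := (a :* c) :* (b :* d)) refl _ _ _ _)

    power-unit : ∀ {f} k → f 0 ≡ 1ℚ → (f ^ₛ k) 0 ≡ 1ℚ
    power-unit zero    e = 1-0
    power-unit {f} (suc k) e = unit-⊠ {f} {f ^ₛ k} e (power-unit k e)

  -- Both sides are multiplied by the unit U = J_6³ (J_6 J_1^8): the bracket allows `norm-φ` to be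
  -- applied, and J_6³ completes J_(3,6)³ to (J_3²)³. Then J_(1,6) J_2 J_3 = J_1 J_6² in the eighth
  -- power removes everything but J_6.
  P̄₂-product : comp 2 P̄ * (J₁₆ ^ₛ 6 * Jm 2 ^ₛ 4 * J₃₆ ^ₛ 3) ≈ four (Jm 6 ^ₛ 12)
  P̄₂-product = cancel-unit U U-unit (begin
    U * (x₂ * (b ^ₛ 6 * J₂ ^ₛ 4 * a ^ₛ 3))
      ≈⟨ solve 6 (λ s A x B C D → (pw 3 s :* (s :* A)) :* (x :* (B :* C :* pw 3 D)) := (x :* (s :* A)) :* (B :* C :* pw 3 (D :* s)))
           refl J₆ (J₁ ^ₛ 8) x₂ (b ^ₛ 6) (J₂ ^ₛ 4) a ⟩
    (x₂ * (J₆ * J₁ ^ₛ 8)) * (b ^ₛ 6 * J₂ ^ₛ 4 * (a * J₆) ^ₛ 3)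
      ≈⟨ *-cong (*-congˡ (sym norm-φ)) (*-congˡ (power-cong 3 J₃₆-product)) ⟩
    (x₂ * (norm φ * J₂ ^ₛ 4 * (J₃ * J₃))) * (b ^ₛ 6 * J₂ ^ₛ 4 * (J₃ * J₃) ^ₛ 3)
      ≈⟨ solve 5 (λ x n A J B → (x :* (n :* A :* (J :* J))) :* (B :* A :* pw 3 (J :* J)) := (x :* n) :* ((A :* (J :* J)) :* (B :* A :* pw 3 (J :* J))))
           refl x₂ (norm φ) (J₂ ^ₛ 4) J₃ (b ^ₛ 6) ⟩
    (x₂ * norm φ) * ((J₂ ^ₛ 4 * (J₃ * J₃)) * (b ^ₛ 6 * J₂ ^ₛ 4 * (J₃ * J₃) ^ₛ 3))
      ≈⟨ *-congʳ (trans P̄₂*norm (+-cong (+-cong (+-cong BB BB) BB) BB)) ⟩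
    four (b * b) * ((J₂ ^ₛ 4 * (J₃ * J₃)) * (b ^ₛ 6 * J₂ ^ₛ 4 * (J₃ * J₃) ^ₛ 3))
      ≈⟨ solve 3 (λ b c d → (b :* b :+ b :* b :+ b :* b :+ b :* b) :* ((pw 4 c :* (d :* d)) :* (pw 6 b :* pw 4 c :* pw 3 (d :* d)))
           := (:1 :+ :1 :+ :1 :+ :1) :* (pw 8 b :* pw 8 c :* pw 8 d)) refl b J₂ J₃ ⟩
    (1ₛ + 1ₛ + 1ₛ + 1ₛ) * (b ^ₛ 8 * J₂ ^ₛ 8 * J₃ ^ₛ 8)
      ≈⟨ *-congˡ (trans (sym (trans (power-* (b * J₂) J₃ 8) (*-congʳ (power-* b J₂ 8)))) (trans (power-cong 8 J₁₆-product) (power-* J₁ (J₆ * J₆) 8))) ⟩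
    (1ₛ + 1ₛ + 1ₛ + 1ₛ) * (J₁ ^ₛ 8 * (J₆ * J₆) ^ₛ 8)
      ≈⟨ solve 2 (λ A s → (:1 :+ :1 :+ :1 :+ :1) :* (A :* pw 8 (s :* s)) := (pw 3 s :* (s :* A)) :* (pw 12 s :+ pw 12 s :+ pw 12 s :+ pw 12 s)) refl (J₁ ^ₛ 8) J₆ ⟩
    U * four (J₆ ^ₛ 12) ∎)
    where
    J₁ = Jm 1 ; J₂ = Jm 2 ; J₃ = Jm 3 ; J₆ = Jm 6
    x₂ = comp 2 P̄ ; b = J₁₆ ; a = J₃₆
    U = J₆ ^ₛ 3 * (J₆ * J₁ ^ₛ 8)
    U-unit : U 0 ≡ 1ℚ
    U-unit = unit-⊠ {J₆ ^ₛ 3} {J₆ * J₁ ^ₛ 8} (power-unit {J₆} 3 (pochInf-unit 5 6)) (unit-⊠ {J₆} {J₁ ^ₛ 8} (pochInf-unit 5 6) (power-unit {J₁} 8 (pochInf-unit 0 1)))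
    BB : B * B ≈ b * b
    BB = *-cong B≈J₁₆ B≈J₁₆

  M-quotient : PS
  M-quotient = Jm 6 ^^ 12 ⊛ inv (J 1 6 ^^ 6 ⊛ Jm 2 ^^ 4 ⊛ J 3 6 ^^ 3)

  P̄₂≈M : comp 2 P̄ ≈ four M-quotient
  P̄₂≈M = trans (inv-unique (J₁₆ ^ₛ 6 * Jm 2 ^ₛ 4 * J₃₆ ^ₛ 3) D-unit (trans (*-comm _ _) P̄₂-product))
    (trans (solve 2 (λ x y → (x :+ x :+ x :+ x) :* y := x :* y :+ x :* y :+ x :* y :+ x :* y) refl _ _)
      (+-cong (+-cong (+-cong e e) e) e))
    where
    D-unit : (J₁₆ ^ₛ 6 * Jm 2 ^ₛ 4 * J₃₆ ^ₛ 3) 0 ≡ 1ℚ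
    D-unit = unit-⊠ {J₁₆ ^ₛ 6 * Jm 2 ^ₛ 4} {J₃₆ ^ₛ 3} (unit-⊠ {J₁₆ ^ₛ 6} {Jm 2 ^ₛ 4}
        (power-unit {J₁₆} 6 (unit-⊠ {p 1 * p 5} {p 6} (unit-⊠ {p 1} {p 5} (pochInf-unit 0 6) (pochInf-unit 4 6)) (pochInf-unit 5 6)))
        (power-unit {Jm 2} 4 (pochInf-unit 1 2)))
      (power-unit {J₃₆} 3 (unit-⊠ {p 3 * p 3} {p 6} (unit-⊠ {p 3} {p 3} (pochInf-unit 2 6) (pochInf-unit 2 6)) (pochInf-unit 5 6)))
    J-def : ∀ a → J a 6 ≡ pochInf a 6 ⊠ pochInf (6 ∸ a) 6 ⊠ pochInf 6 6
    J-def a = ≡.trans (⊠-def _ _) (≡.cong (_⊠ pochInf 6 6) (⊠-def _ _))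
    e : Jm 6 ^ₛ 12 * inv (J₁₆ ^ₛ 6 * Jm 2 ^ₛ 4 * J₃₆ ^ₛ 3) ≈ M-quotient
    e = sym (≡⇒≈ (≡.trans (⊠-def _ _) (≡.cong₂ (λ x y → x ⊠ inv y) (^^-def _ 12)
      (≡.trans (⊠-def _ _) (≡.cong₂ _⊠_ (≡.trans (⊠-def _ _) (≡.cong₂ _⊠_
        (≡.trans (^^-def _ 6) (≡.cong (_^ₛ 6) (J-def 1))) (^^-def _ 4))) (≡.trans (^^-def _ 3) (≡.cong (_^ₛ 3) (J-def 3))))))))

  rb-total : P̄ ≈ rb 0 + rb 1 + rb 1 + rb 2 + rb 2 + rb 3
  rb-total = limit λ N → let open Mod N using () renaming (trans to transₙ; +-cong to +-congₙ; refl to reflₙ; pointwise to pointwiseₙ; solve to solveₙ; _:+_ to _:+ₙ_; _:=_ to _:=ₙ_) in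
    transₙ (pointwiseₙ split) (transₙ (+-congₙ (+-congₙ reflₙ (Bilaterals.rb-4 N)) (Bilaterals.rb-5 N))
      (solveₙ 4 (λ a b c d → a :+ₙ b :+ₙ c :+ₙ d :+ₙ c :+ₙ b :=ₙ a :+ₙ b :+ₙ b :+ₙ c :+ₙ c :+ₙ d) reflₙ (rb 0) (rb 1) (rb 2) (rb 3)))
    where
    one : ∀ {r} → r < 6 → 1ℚ ≡ δ r 0 ℚ.+ δ r 1 ℚ.+ δ r 2 ℚ.+ δ r 3 ℚ.+ δ r 4 ℚ.+ δ r 5
    one = toWitness {a? = ℕₚ.allUpTo? (λ r → 1ℚ ℚ.≟ δ r 0 ℚ.+ δ r 1 ℚ.+ δ r 2 ℚ.+ δ r 3 ℚ.+ δ r 4 ℚ.+ δ r 5) 6} tt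
    W : ℕ → Weight
    W s p k = δ ((+ p ℤ.- + k) %ℕ 6) s
    V : ℕ → Weight
    V zero    = W 0
    V (suc s) = λ p k → V s p k ℚ.+ W (suc s) p k
    total : ℕ → PS
    total zero    = rb 0
    total (suc s) = total s ⊞ rb (suc s)
    V-total : ∀ s n → RF (V s) n ≡ total s n
    V-total zero    n = ≡.sym (rb≡RF 0 n)
    V-total (suc s) n = ≡.trans (RF-+ (V s) (W (suc s)) n)
      (≡.trans (≡.cong₂ ℚ._+_ (V-total s n) (≡.sym (rb≡RF (suc s) n))) (≡.sym (⊞-at (total s) (rb (suc s)) n)))
    split : ∀ n → P̄ n ≡ (rb 0 ⊞ rb 1 ⊞ rb 2 ⊞ rb 3 ⊞ rb 4 ⊞ rb 5) n
    split n = ≡.trans (RF-ext {λ _ _ → 1ℚ} {V 5} (λ p k → one (ℤ÷.n%ℕd<d (+ p ℤ.- + k) 6)) n) (V-total 5 n)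

-- Exchange of divisors in the Lambert series for ρ

module LambertIdentity where
  open PowerSeries
  open Inverses
  open TripleProducts
  open MockTheta

  e₁ e₂ : ℕ → ℕ
  e₁ l = 3 ℕ.* l ℕ.* l ℕ.+ 5 ℕ.* l
  e₂ l = 3 ℕ.* l ℕ.* l ℕ.+ 7 ℕ.* l ℕ.+ 3

  -- Half of what the exponents 3n + 2 of `s₀ l` and `s₂ l` contribute, with q³ replaced by q.
  a b : ℕ → PS
  a l = sg l ⊠ (q^ (e₁ l) ⊠ inv (1ₛ ⊞ ⊟ q^ suc (6 ℕ.* l)))
  b l = sg l ⊠ (q^ (e₂ l) ⊠ inv (1ₛ ⊞ ⊟ q^ suc (4 ℕ.+ 6 ℕ.* l)))

  private
    l≤e₁ : ∀ l → l ≤ e₁ l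
    l≤e₁ l = ℕₚ.≤-trans (ℕₚ.m≤m+n l _) (ℕₚ.m≤n+m _ (3 ℕ.* l ℕ.* l))
    l≤e₂ : ∀ l → l ≤ e₂ l
    l≤e₂ l = ℕₚ.≤-trans (ℕₚ.≤-trans (ℕₚ.m≤m+n l _) (ℕₚ.m≤n+m _ (3 ℕ.* l ℕ.* l))) (ℕₚ.m≤m+n _ 3)

  a-vanishing : Vanishing a
  a-vanishing = Vanishing-*ˡ sg (Vanishing-*ʳ (λ l → inv (1ₛ ⊞ ⊟ q^ suc (6 ℕ.* l))) (Vanishing-q e₁ l≤e₁))

  b-vanishing : Vanishing b
  b-vanishing = Vanishing-*ˡ sg (Vanishing-*ʳ (λ l → inv (1ₛ ⊞ ⊟ q^ suc (4 ℕ.+ 6 ℕ.* l))) (Vanishing-q e₂ l≤e₂))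

  module _ (N : ℕ) where
    open Mod N
    open LambertKernels (fin N)

    private
      row : (ℕ → ℕ) → (ℕ → ℕ) → ℕ → PS
      row e d l = q^ (e l) * inv (1ₛ + - q^ suc (d l))

      row-sum : ∀ e d l → row e d l ≈ ∑ N (λ r → q^ (e l ℕ.+ suc (d l) ℕ.* r))
      row-sum e d l = trans (*-congˡ (inv-geometric N (d l))) (trans (sym (∑-*ˡ N _ _)) (∑-cong′ N (λ r → sym (q-+ (e l) _))))

      sg-even : ∀ α → sg (α ℕ.* 2) ≈ 1ₛ
      sg-even zero    = refl
      sg-even (suc α) = trans (-‿involutive _) (sg-even α)

      alternate : ∀ e d → (∀ l → l ≤ e l) → ∑ N (λ l → sg l * row e d l)
                ≈ ∑ N (λ α → row e d (α ℕ.* 2)) + - ∑ N (λ α → row e d (1 ℕ.+ α ℕ.* 2))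
      alternate e d big = begin
        ∑ N (λ l → sg l * row e d l)
          ≈⟨ ∑-extend _ (ℕₚ.m≤m*n N 2) (λ l h → trans (*-congˡ (q-big-* _ (ℕₚ.≤-trans h (big l)))) (zeroʳ _)) ⟨
        ∑ (N ℕ.* 2) (λ l → sg l * row e d l)
          ≈⟨ ∑-2 N _ ⟩
        ∑ N (λ α → sg (α ℕ.* 2) * row e d (α ℕ.* 2) + - sg (α ℕ.* 2) * row e d (1 ℕ.+ α ℕ.* 2))
          ≈⟨ ∑-cong′ N (λ α → +-cong (trans (*-congʳ (sg-even α)) (*-identityˡ _))
               (trans (*-congʳ (-‿cong (sg-even α))) (solve 1 (λ x → (:- :1) :* x := :- x) refl _))) ⟩
        ∑ N (λ α → row e d (α ℕ.* 2) + - row e d (1 ℕ.+ α ℕ.* 2))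
          ≈⟨ trans (∑-+ N _ _) (+-congˡ (∑-neg N _)) ⟩
        _ ∎

      -- U and D are the parts of the quadrant Full on and above, and below, the diagonal.
      U D Full : (ℕ → ℕ → ℕ) → PS
      U E    = ∑ N (λ x → ∑ N (λ r → q^ (E x (x ℕ.+ r))))
      D E    = ∑ N (λ y → ∑ N (λ t → q^ (E (suc y ℕ.+ t) y)))
      Full E = ∑ N (λ x → ∑ N (λ y → q^ (E x y)))

      diagonal : ∀ E → (∀ x y → x ≤ E x y) → (∀ x y → y ≤ E x y) → Full E ≈ U E + D E
      diagonal E h₁ h₂ = ∑-diagonal N (λ x y → q^ (E x y)) (λ x y h → q-big (ℕₚ.≤-trans h (h₁ x y))) (λ x y h → q-big (ℕₚ.≤-trans h (h₂ x y)))

      transpose : ∀ E → Full E ≈ Full (λ x y → E y x)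
      transpose E = ∑-swap N N _

      -- Parity of l removes the sign. Once the geometric series is expanded, the row l = 2α or 2α +
      -- 1 runs along one side of a diagonal in a quadrant, with r as the distance from it.
      series : ∀ e d → (∀ l → l ≤ e l) → (E E′ : ℕ → PS) →
               (∀ α → ∑ N (λ r → q^ (e (α ℕ.* 2) ℕ.+ suc (d (α ℕ.* 2)) ℕ.* r)) ≈ E α) →
               (∀ α → ∑ N (λ r → q^ (e (1 ℕ.+ α ℕ.* 2) ℕ.+ suc (d (1 ℕ.+ α ℕ.* 2)) ℕ.* r)) ≈ E′ α) →
               ∑ N (λ l → sg l * row e d l) ≈ ∑ N E + - ∑ N E′
      series e d big E E′ h h′ = trans (alternate e d big) (+-cong
        (∑-cong′ N (λ α → trans (row-sum e d _) (h α)))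
        (-‿cong (∑-cong′ N (λ α → trans (row-sum e d _) (h′ α)))))

      along : ∀ {f g : ℕ → ℕ} → (∀ r → f r ≡ g r) → ∑ N (λ r → q^ (f r)) ≈ ∑ N (λ r → q^ (g r))
      along h = ∑-cong′ N (λ r → q-cong (h r))

      -- 4E + 3 factors as (12x+1)(4y+3), (12x+5)(4y+3), (4x+1)(12y+7), (4x+1)(12y+11), (12x+3)(4y+1), (12x+9)(4y+3).
      E₁₃ E₅₃ E₁₇ E₁ₑ E₃₁ E₃₃ : ℕ → ℕ → ℕ
      E₁₃ x y = 12 ℕ.* x ℕ.* y ℕ.+ 9 ℕ.* x ℕ.+ y
      E₅₃ x y = 12 ℕ.* x ℕ.* y ℕ.+ 9 ℕ.* x ℕ.+ 5 ℕ.* y ℕ.+ 3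
      E₁₇ x y = 12 ℕ.* x ℕ.* y ℕ.+ 7 ℕ.* x ℕ.+ 3 ℕ.* y ℕ.+ 1
      E₁ₑ x y = 12 ℕ.* x ℕ.* y ℕ.+ 11 ℕ.* x ℕ.+ 3 ℕ.* y ℕ.+ 2
      E₃₁ x y = 12 ℕ.* x ℕ.* y ℕ.+ 3 ℕ.* x ℕ.+ 3 ℕ.* y
      E₃₃ x y = 12 ℕ.* x ℕ.* y ℕ.+ 9 ℕ.* x ℕ.+ 9 ℕ.* y ℕ.+ 6

      A-sum : ∑ N (λ l → sg l * row e₁ (λ l → 6 ℕ.* l) l) ≈ U E₁₃ + - D E₁₇
      A-sum = series e₁ _ l≤e₁ _ _ (λ α → along (h α)) (λ α → along (h′ α))
        where
        h : ∀ α r → 3 ℕ.* (α ℕ.* 2) ℕ.* (α ℕ.* 2) ℕ.+ 5 ℕ.* (α ℕ.* 2) ℕ.+ (1 ℕ.+ 6 ℕ.* (α ℕ.* 2)) ℕ.* r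
            ≡ 12 ℕ.* α ℕ.* (α ℕ.+ r) ℕ.+ 9 ℕ.* α ℕ.+ (α ℕ.+ r)
        h = solve-∀
        h′ : ∀ α r → 3 ℕ.* (1 ℕ.+ α ℕ.* 2) ℕ.* (1 ℕ.+ α ℕ.* 2) ℕ.+ 5 ℕ.* (1 ℕ.+ α ℕ.* 2) ℕ.+ (1 ℕ.+ 6 ℕ.* (1 ℕ.+ α ℕ.* 2)) ℕ.* r
            ≡ 12 ℕ.* (1 ℕ.+ α ℕ.+ r) ℕ.* α ℕ.+ 7 ℕ.* (1 ℕ.+ α ℕ.+ r) ℕ.+ 3 ℕ.* α ℕ.+ 1
        h′ = solve-∀

      B-sum : ∑ N (λ l → sg l * row e₂ (λ l → 4 ℕ.+ 6 ℕ.* l) l) ≈ U E₅₃ + - D E₁ₑ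
      B-sum = series e₂ _ l≤e₂ _ _ (λ α → along (h α)) (λ α → along (h′ α))
        where
        h : ∀ α r → 3 ℕ.* (α ℕ.* 2) ℕ.* (α ℕ.* 2) ℕ.+ 7 ℕ.* (α ℕ.* 2) ℕ.+ 3 ℕ.+ (1 ℕ.+ (4 ℕ.+ 6 ℕ.* (α ℕ.* 2))) ℕ.* r
            ≡ 12 ℕ.* α ℕ.* (α ℕ.+ r) ℕ.+ 9 ℕ.* α ℕ.+ 5 ℕ.* (α ℕ.+ r) ℕ.+ 3
        h = solve-∀
        h′ : ∀ α r → 3 ℕ.* (1 ℕ.+ α ℕ.* 2) ℕ.* (1 ℕ.+ α ℕ.* 2) ℕ.+ 7 ℕ.* (1 ℕ.+ α ℕ.* 2) ℕ.+ 3 ℕ.+ (1 ℕ.+ (4 ℕ.+ 6 ℕ.* (1 ℕ.+ α ℕ.* 2))) ℕ.* r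
            ≡ 12 ℕ.* (1 ℕ.+ α ℕ.+ r) ℕ.* α ℕ.+ 11 ℕ.* (1 ℕ.+ α ℕ.+ r) ℕ.+ 3 ℕ.* α ℕ.+ 2
        h′ = solve-∀

      -- The exponents of `θ 6 6 l` times 1, u, u², u³; `suc (d₃ l)` is the exponent of u³.
      c₀ c₁ c₂ c₃ d₃ : ℕ → ℕ
      c₀ l = 3 ℕ.* (l ℕ.* l ℕ.+ l)
      c₁ l = c₀ l ℕ.+ (1 ℕ.+ 2 ℕ.* l)
      c₂ l = c₁ l ℕ.+ (1 ℕ.+ 2 ℕ.* l)
      c₃ l = c₂ l ℕ.+ (1 ℕ.+ 2 ℕ.* l)
      d₃ l = 2 ℕ.+ 6 ℕ.* l

      l≤c₀ : ∀ l → l ≤ c₀ l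
      l≤c₀ l = ℕₚ.≤-trans (ℕₚ.m≤n+m l (l ℕ.* l)) (ℕₚ.m≤m+n _ _)

      C₀-sum : ∑ N (λ l → sg l * row c₀ d₃ l) ≈ U E₃₁ + - U E₃₃
      C₀-sum = series c₀ d₃ l≤c₀ _ _ (λ α → along (h α)) (λ α → along (h′ α))
        where
        h : ∀ α r → 3 ℕ.* ((α ℕ.* 2) ℕ.* (α ℕ.* 2) ℕ.+ (α ℕ.* 2)) ℕ.+ (3 ℕ.+ 6 ℕ.* (α ℕ.* 2)) ℕ.* r
            ≡ 12 ℕ.* α ℕ.* (α ℕ.+ r) ℕ.+ 3 ℕ.* α ℕ.+ 3 ℕ.* (α ℕ.+ r)
        h = solve-∀
        h′ : ∀ α r → 3 ℕ.* ((1 ℕ.+ α ℕ.* 2) ℕ.* (1 ℕ.+ α ℕ.* 2) ℕ.+ (1 ℕ.+ α ℕ.* 2)) ℕ.+ (3 ℕ.+ 6 ℕ.* (1 ℕ.+ α ℕ.* 2)) ℕ.* r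
            ≡ 12 ℕ.* α ℕ.* (α ℕ.+ r) ℕ.+ 9 ℕ.* α ℕ.+ 9 ℕ.* (α ℕ.+ r) ℕ.+ 6
        h′ = solve-∀

      C₁-sum : ∑ N (λ l → sg l * row c₁ d₃ l) ≈ U E₁₇ + - D E₁₃
      C₁-sum = series c₁ d₃ (λ l → ℕₚ.≤-trans (l≤c₀ l) (ℕₚ.m≤m+n _ _)) _ _ (λ α → along (h α)) (λ α → along (h′ α))
        where
        h : ∀ α r → 3 ℕ.* ((α ℕ.* 2) ℕ.* (α ℕ.* 2) ℕ.+ (α ℕ.* 2)) ℕ.+ (1 ℕ.+ 2 ℕ.* (α ℕ.* 2)) ℕ.+ (3 ℕ.+ 6 ℕ.* (α ℕ.* 2)) ℕ.* r
            ≡ 12 ℕ.* α ℕ.* (α ℕ.+ r) ℕ.+ 7 ℕ.* α ℕ.+ 3 ℕ.* (α ℕ.+ r) ℕ.+ 1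
        h = solve-∀
        h′ : ∀ α r → 3 ℕ.* ((1 ℕ.+ α ℕ.* 2) ℕ.* (1 ℕ.+ α ℕ.* 2) ℕ.+ (1 ℕ.+ α ℕ.* 2)) ℕ.+ (1 ℕ.+ 2 ℕ.* (1 ℕ.+ α ℕ.* 2)) ℕ.+ (3 ℕ.+ 6 ℕ.* (1 ℕ.+ α ℕ.* 2)) ℕ.* r
            ≡ 12 ℕ.* (1 ℕ.+ α ℕ.+ r) ℕ.* α ℕ.+ 9 ℕ.* (1 ℕ.+ α ℕ.+ r) ℕ.+ α
        h′ = solve-∀

      C₂-sum : ∑ N (λ l → sg l * row c₂ d₃ l) ≈ U E₁ₑ + - D E₅₃
      C₂-sum = series c₂ d₃ (λ l → ℕₚ.≤-trans (l≤c₀ l) (ℕₚ.≤-trans (ℕₚ.m≤m+n _ _) (ℕₚ.m≤m+n _ _))) _ _ (λ α → along (h α)) (λ α → along (h′ α))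
        where
        h : ∀ α r → 3 ℕ.* ((α ℕ.* 2) ℕ.* (α ℕ.* 2) ℕ.+ (α ℕ.* 2)) ℕ.+ (1 ℕ.+ 2 ℕ.* (α ℕ.* 2)) ℕ.+ (1 ℕ.+ 2 ℕ.* (α ℕ.* 2)) ℕ.+ (3 ℕ.+ 6 ℕ.* (α ℕ.* 2)) ℕ.* r
            ≡ 12 ℕ.* α ℕ.* (α ℕ.+ r) ℕ.+ 11 ℕ.* α ℕ.+ 3 ℕ.* (α ℕ.+ r) ℕ.+ 2
        h = solve-∀
        h′ : ∀ α r → 3 ℕ.* ((1 ℕ.+ α ℕ.* 2) ℕ.* (1 ℕ.+ α ℕ.* 2) ℕ.+ (1 ℕ.+ α ℕ.* 2)) ℕ.+ (1 ℕ.+ 2 ℕ.* (1 ℕ.+ α ℕ.* 2)) ℕ.+ (1 ℕ.+ 2 ℕ.* (1 ℕ.+ α ℕ.* 2)) ℕ.+ (3 ℕ.+ 6 ℕ.* (1 ℕ.+ α ℕ.* 2)) ℕ.* r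
            ≡ 12 ℕ.* (1 ℕ.+ α ℕ.+ r) ℕ.* α ℕ.+ 9 ℕ.* (1 ℕ.+ α ℕ.+ r) ℕ.+ 5 ℕ.* α ℕ.+ 3
        h′ = solve-∀

      C₃-sum : ∑ N (λ l → sg l * row c₃ d₃ l) ≈ D E₃₁ + - D E₃₃
      C₃-sum = series c₃ d₃ (λ l → ℕₚ.≤-trans (l≤c₀ l) (ℕₚ.≤-trans (ℕₚ.m≤m+n _ _) (ℕₚ.≤-trans (ℕₚ.m≤m+n _ _) (ℕₚ.m≤m+n _ _)))) _ _ (λ α → along (h α)) (λ α → along (h′ α))
        where
        h : ∀ α r → 3 ℕ.* ((α ℕ.* 2) ℕ.* (α ℕ.* 2) ℕ.+ (α ℕ.* 2)) ℕ.+ (1 ℕ.+ 2 ℕ.* (α ℕ.* 2)) ℕ.+ (1 ℕ.+ 2 ℕ.* (α ℕ.* 2)) ℕ.+ (1 ℕ.+ 2 ℕ.* (α ℕ.* 2)) ℕ.+ (3 ℕ.+ 6 ℕ.* (α ℕ.* 2)) ℕ.* r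
            ≡ 12 ℕ.* (1 ℕ.+ α ℕ.+ r) ℕ.* α ℕ.+ 3 ℕ.* (1 ℕ.+ α ℕ.+ r) ℕ.+ 3 ℕ.* α
        h = solve-∀
        h′ : ∀ α r → 3 ℕ.* ((1 ℕ.+ α ℕ.* 2) ℕ.* (1 ℕ.+ α ℕ.* 2) ℕ.+ (1 ℕ.+ α ℕ.* 2)) ℕ.+ (1 ℕ.+ 2 ℕ.* (1 ℕ.+ α ℕ.* 2)) ℕ.+ (1 ℕ.+ 2 ℕ.* (1 ℕ.+ α ℕ.* 2)) ℕ.+ (1 ℕ.+ 2 ℕ.* (1 ℕ.+ α ℕ.* 2)) ℕ.+ (3 ℕ.+ 6 ℕ.* (1 ℕ.+ α ℕ.* 2)) ℕ.* r
            ≡ 12 ℕ.* (1 ℕ.+ α ℕ.+ r) ℕ.* α ℕ.+ 9 ℕ.* (1 ℕ.+ α ℕ.+ r) ℕ.+ 9 ℕ.* α ℕ.+ 6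
        h′ = solve-∀

      -- Both sides run over the products de with d ≡ 1, e ≡ 3 mod 4; the left splits d mod 12, the right splits e.
      exchange : Full E₁₃ + Full E₅₃ + Full E₃₃ ≈ Full E₃₁ + Full E₁₇ + Full E₁ₑ
      exchange = trans (sym (mod-3 (λ x y → 4 ℕ.* x ℕ.* y ℕ.+ 3 ℕ.* x ℕ.+ y) big₁ E₁₃ E₅₃ E₃₃ f₀ f₁ f₂))
        (trans (trans (transpose _) (∑-cong′ N (λ x → ∑-cong′ N (λ y → q-cong (sw x y)))))
        (trans (mod-3 (λ x y → 4 ℕ.* x ℕ.* y ℕ.+ x ℕ.+ 3 ℕ.* y) big₂ E₃₁ (λ x y → E₁₇ y x) (λ x y → E₁ₑ y x) g₀ g₁ g₂)
          (+-cong (+-congˡ (transpose (λ x y → E₁₇ y x))) (transpose (λ x y → E₁ₑ y x)))))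
        where
        sw : ∀ x y → 4 ℕ.* y ℕ.* x ℕ.+ 3 ℕ.* y ℕ.+ x ≡ 4 ℕ.* x ℕ.* y ℕ.+ x ℕ.+ 3 ℕ.* y
        sw = solve-∀
        mod-3 : ∀ E → (∀ x y → x ≤ E x y) → ∀ F G H → (∀ x y → E (x ℕ.* 3) y ≡ F x y) → (∀ x y → E (1 ℕ.+ x ℕ.* 3) y ≡ G x y) → (∀ x y → E (2 ℕ.+ x ℕ.* 3) y ≡ H x y) →
                Full E ≈ Full F + Full G + Full H
        mod-3 E big F G H f g h = begin
          Full E
            ≈⟨ ∑-extend _ (ℕₚ.m≤m*n N 3) (λ x N≤x → ∑-0 N (λ y _ → q-big (ℕₚ.≤-trans N≤x (big x y)))) ⟨
          ∑ (N ℕ.* 3) (λ x → ∑ N (λ y → q^ (E x y)))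
            ≈⟨ trans (∑-3 N _) (trans (∑-+ N _ _) (+-congʳ (∑-+ N _ _))) ⟩
          _ ≈⟨ +-cong (+-cong (∑-cong′ N (λ x → along (f x))) (∑-cong′ N (λ x → along (g x)))) (∑-cong′ N (λ x → along (h x))) ⟩
          Full F + Full G + Full H ∎
        big₁ : ∀ x y → x ≤ 4 ℕ.* x ℕ.* y ℕ.+ 3 ℕ.* x ℕ.+ y
        big₁ x y = ℕₚ.≤-trans (ℕₚ.m≤m+n x _) (ℕₚ.≤-trans (ℕₚ.m≤n+m (3 ℕ.* x) (4 ℕ.* x ℕ.* y)) (ℕₚ.m≤m+n _ y))
        big₂ : ∀ x y → x ≤ 4 ℕ.* x ℕ.* y ℕ.+ x ℕ.+ 3 ℕ.* y
        big₂ x y = ℕₚ.≤-trans (ℕₚ.m≤n+m x (4 ℕ.* x ℕ.* y)) (ℕₚ.m≤m+n _ _)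
        f₀ : ∀ x y → 4 ℕ.* (x ℕ.* 3) ℕ.* y ℕ.+ 3 ℕ.* (x ℕ.* 3) ℕ.+ y ≡ 12 ℕ.* x ℕ.* y ℕ.+ 9 ℕ.* x ℕ.+ y
        f₀ = solve-∀
        f₁ : ∀ x y → 4 ℕ.* (1 ℕ.+ x ℕ.* 3) ℕ.* y ℕ.+ 3 ℕ.* (1 ℕ.+ x ℕ.* 3) ℕ.+ y ≡ 12 ℕ.* x ℕ.* y ℕ.+ 9 ℕ.* x ℕ.+ 5 ℕ.* y ℕ.+ 3
        f₁ = solve-∀
        f₂ : ∀ x y → 4 ℕ.* (2 ℕ.+ x ℕ.* 3) ℕ.* y ℕ.+ 3 ℕ.* (2 ℕ.+ x ℕ.* 3) ℕ.+ y ≡ 12 ℕ.* x ℕ.* y ℕ.+ 9 ℕ.* x ℕ.+ 9 ℕ.* y ℕ.+ 6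
        f₂ = solve-∀
        g₀ : ∀ x y → 4 ℕ.* (x ℕ.* 3) ℕ.* y ℕ.+ (x ℕ.* 3) ℕ.+ 3 ℕ.* y ≡ 12 ℕ.* x ℕ.* y ℕ.+ 3 ℕ.* x ℕ.+ 3 ℕ.* y
        g₀ = solve-∀
        g₁ : ∀ x y → 4 ℕ.* (1 ℕ.+ x ℕ.* 3) ℕ.* y ℕ.+ (1 ℕ.+ x ℕ.* 3) ℕ.+ 3 ℕ.* y ≡ 12 ℕ.* y ℕ.* x ℕ.+ 7 ℕ.* y ℕ.+ 3 ℕ.* x ℕ.+ 1
        g₁ = solve-∀
        g₂ : ∀ x y → 4 ℕ.* (2 ℕ.+ x ℕ.* 3) ℕ.* y ℕ.+ (2 ℕ.+ x ℕ.* 3) ℕ.+ 3 ℕ.* y ≡ 12 ℕ.* y ℕ.* x ℕ.+ 11 ℕ.* y ℕ.+ 3 ℕ.* x ℕ.+ 2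
        g₂ = solve-∀

      -- Moving every negative part to the other side completes six full quadrants, and the claim
      -- becomes `exchange`.
      quadrants : (U E₁₃ + - D E₁₇) + (U E₅₃ + - D E₁ₑ) ≈
                  (U E₃₁ + - U E₃₃) + (U E₁₇ + - D E₁₃) + (U E₁ₑ + - D E₅₃) + (D E₃₁ + - D E₃₃)
      quadrants = begin
        (U E₁₃ + - D E₁₇) + (U E₅₃ + - D E₁ₑ)
          ≈⟨ solve 6 (λ a b c d e f → (a :+ :- b) :+ (c :+ :- d) := ((a :+ e) :+ (c :+ f)) :+ :- b :+ :- d :+ :- e :+ :- f) refl (U E₁₃) (D E₁₇) (U E₅₃) (D E₁ₑ) (D E₁₃) (D E₅₃) ⟩
        ((U E₁₃ + D E₁₃) + (U E₅₃ + D E₅₃)) + - D E₁₇ + - D E₁ₑ + - D E₁₃ + - D E₅₃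
          ≈⟨ +-congʳ (+-congʳ (+-congʳ (+-congʳ (trans (+-cong (sym d₁₃) (sym d₅₃))
               (trans (solve 3 (λ a b c → a :+ b := (a :+ b :+ c) :+ :- c) refl _ _ (Full E₃₃)) (+-cong exchange (-‿cong d₃₃))))))) ⟩
        (Full E₃₁ + Full E₁₇ + Full E₁ₑ + - (U E₃₃ + D E₃₃)) + - D E₁₇ + - D E₁ₑ + - D E₁₃ + - D E₅₃
          ≈⟨ +-congʳ (+-congʳ (+-congʳ (+-congʳ (+-congʳ (+-cong (+-cong d₃₁ d₁₇) d₁ₑ))))) ⟩
        ((U E₃₁ + D E₃₁) + (U E₁₇ + D E₁₇) + (U E₁ₑ + D E₁ₑ) + - (U E₃₃ + D E₃₃)) + - D E₁₇ + - D E₁ₑ + - D E₁₃ + - D E₅₃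
          ≈⟨ solve 10 (λ a a′ b b′ c c′ d d′ e f → ((a :+ a′) :+ (b :+ b′) :+ (c :+ c′) :+ :- (d :+ d′)) :+ :- b′ :+ :- c′ :+ :- e :+ :- f
               := (a :+ :- d) :+ (b :+ :- e) :+ (c :+ :- f) :+ (a′ :+ :- d′)) refl
               (U E₃₁) (D E₃₁) (U E₁₇) (D E₁₇) (U E₁ₑ) (D E₁ₑ) (U E₃₃) (D E₃₃) (D E₁₃) (D E₅₃) ⟩
        (U E₃₁ + - U E₃₃) + (U E₁₇ + - D E₁₃) + (U E₁ₑ + - D E₅₃) + (D E₃₁ + - D E₃₃) ∎
        where
        left : ∀ k (x y z : ℕ) → x ≤ 12 ℕ.* x ℕ.* y ℕ.+ suc k ℕ.* x ℕ.+ z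
        left k x y z = ℕₚ.≤-trans (ℕₚ.m≤m+n x _) (ℕₚ.≤-trans (ℕₚ.m≤n+m (suc k ℕ.* x) (12 ℕ.* x ℕ.* y)) (ℕₚ.m≤m+n _ z))
        right : ∀ k (x y z : ℕ) → y ≤ z ℕ.+ suc k ℕ.* y
        right k x y z = ℕₚ.≤-trans (ℕₚ.m≤m+n y _) (ℕₚ.m≤n+m (suc k ℕ.* y) z)
        d₁₃ = diagonal E₁₃ (λ x y → left 8 x y y) (λ x y → ℕₚ.m≤n+m y _)
        d₅₃ = diagonal E₅₃ (λ x y → ℕₚ.≤-trans (left 8 x y _) (ℕₚ.m≤m+n _ 3)) (λ x y → ℕₚ.≤-trans (right 4 x y (12 ℕ.* x ℕ.* y ℕ.+ 9 ℕ.* x)) (ℕₚ.m≤m+n _ 3))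
        d₁₇ = diagonal E₁₇ (λ x y → ℕₚ.≤-trans (left 6 x y _) (ℕₚ.m≤m+n _ 1)) (λ x y → ℕₚ.≤-trans (right 2 x y (12 ℕ.* x ℕ.* y ℕ.+ 7 ℕ.* x)) (ℕₚ.m≤m+n _ 1))
        d₁ₑ = diagonal E₁ₑ (λ x y → ℕₚ.≤-trans (left 10 x y _) (ℕₚ.m≤m+n _ 2)) (λ x y → ℕₚ.≤-trans (right 2 x y (12 ℕ.* x ℕ.* y ℕ.+ 11 ℕ.* x)) (ℕₚ.m≤m+n _ 2))
        d₃₁ = diagonal E₃₁ (λ x y → left 2 x y _) (λ x y → right 2 x y (12 ℕ.* x ℕ.* y ℕ.+ 3 ℕ.* x))
        d₃₃ = diagonal E₃₃ (λ x y → ℕₚ.≤-trans (left 8 x y _) (ℕₚ.m≤m+n _ 6)) (λ x y → ℕₚ.≤-trans (right 8 x y (12 ℕ.* x ℕ.* y ℕ.+ 9 ℕ.* x)) (ℕₚ.m≤m+n _ 6))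

    -- The kernel on the right is neither that of ω nor that of ρ, but three times it is the ρ
    -- kernel plus twice the ω kernel; `rho-relation` makes use of this.
    kernel-sum : ∑ N a + ∑ N b ≈ ∑ N (λ l → θ 6 6 l * ((1ₛ + u l + u l * u l + u l * (u l * u l)) * 1/1-u³ l))
    kernel-sum = begin
      ∑ N a + ∑ N b ≈⟨ +-cong A-sum B-sum ⟩
      (U E₁₃ + - D E₁₇) + (U E₅₃ + - D E₁ₑ) ≈⟨ quadrants ⟩
      (U E₃₁ + - U E₃₃) + (U E₁₇ + - D E₁₃) + (U E₁ₑ + - D E₅₃) + (D E₃₁ + - D E₃₃)
        ≈⟨ sym (+-cong (+-cong (+-cong C₀-sum C₁-sum) C₂-sum) C₃-sum) ⟩
      ∑ N (r c₀) + ∑ N (r c₁) + ∑ N (r c₂) + ∑ N (r c₃)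
        ≈⟨ sym (trans (∑-+ N _ _) (+-congʳ (trans (∑-+ N _ _) (+-congʳ (∑-+ N _ _))))) ⟩
      ∑ N (λ l → r c₀ l + r c₁ l + r c₂ l + r c₃ l)
        ≈⟨ ∑-cong′ N (λ l → sym (begin
             θ 6 6 l * ((1ₛ + u l + u l * u l + u l * (u l * u l)) * 1/1-u³ l)
               ≈⟨ *-congʳ (θ-Properties.θ-explicit (fin N) c₀ ≡.refl s₆ l) ⟩
             (sg l * q^ c₀ l) * ((1ₛ + u l + u l * u l + u l * (u l * u l)) * 1/1-u³ l)
               ≈⟨ solve 4 (λ s c u w → (s :* c) :* ((:1 :+ u :+ u :* u :+ u :* (u :* u)) :* w)
                    := s :* (c :* w) :+ s :* ((c :* u) :* w) :+ s :* (((c :* u) :* u) :* w) :+ s :* ((((c :* u) :* u) :* u) :* w)) refl _ _ _ _ ⟩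
             _ ≈⟨ +-cong (+-cong (+-congˡ (*-congˡ (*-congʳ (sym (x₁ l))))) (*-congˡ (*-congʳ (sym (x₂ l))))) (*-congˡ (*-congʳ (sym (x₃ l)))) ⟩
             r c₀ l + r c₁ l + r c₂ l + r c₃ l ∎)) ⟩
      ∑ N (λ l → θ 6 6 l * ((1ₛ + u l + u l * u l + u l * (u l * u l)) * 1/1-u³ l)) ∎
      where
      r : (ℕ → ℕ) → ℕ → PS
      r c l = sg l * row c d₃ l
      x₁ : ∀ l → q^ c₁ l ≈ q^ c₀ l * u l
      x₁ l = q-+ (c₀ l) _
      x₂ : ∀ l → q^ c₂ l ≈ (q^ c₀ l * u l) * u l
      x₂ l = trans (q-+ (c₁ l) _) (*-congʳ (x₁ l))
      x₃ : ∀ l → q^ c₃ l ≈ ((q^ c₀ l * u l) * u l) * u l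
      x₃ l = trans (q-+ (c₂ l) _) (*-congʳ (x₂ l))
      s₆ : ∀ r → 3 ℕ.* ((1 ℕ.+ r) ℕ.* (1 ℕ.+ r) ℕ.+ (1 ℕ.+ r)) ≡ (6 ℕ.* r ℕ.+ 6) ℕ.+ 3 ℕ.* (r ℕ.* r ℕ.+ r)
      s₆ = solve-∀

-- The three linear relations and the theorem

module RankRelations where
  open PowerSeries
  open Inverses
  open TripleProducts
  open MockTheta
  open RankResidues using (rb)
  open ThetaSums using (w)
  open RankDifferences
  open Trisection
  open CubicNorm
  open OverpartitionSeries
  open OverpartitionTrisection
  open LambertIdentity

  open Series ∞
  open Units ∞
  open θ-Properties ∞ using (θ-explicit)

  up-inv : ∀ {f} → f 0 ≡ 1ℚ → up (inv f) ≈ inv (up f)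
  up-inv {f} f0 = trans (inv-unique (up f) f0 (trans (sym (up-⊠ f (inv f))) (trans (up-cong (inv-r f0)) up-1ₛ))) (*-identityˡ _)

  up-1-q : ∀ e → up (1ₛ + - q^ e) ≈ 1ₛ + - q^ (3 ℕ.* e)
  up-1-q e = trans (up-⊞ _ _) (+-cong up-1ₛ (trans (up-⊟ _) (-‿cong (up-q e))))

  inv-1-q : ∀ {k} d → k ≡ 3 ℕ.* suc d → inv (1ₛ + - q^ k) ≈ up (inv (1ₛ + - q^ suc d))
  inv-1-q d ≡.refl = sym (trans (up-inv (unit-1-q d)) (inv-cong (≡.trans (unit-1-q d) ≡.refl) (unit-1-q (d ℕ.+ (suc d ℕ.+ (suc d ℕ.+ 0)))) (up-1-q (suc d))))

  q≈up : ∀ {k} e → k ≡ 3 ℕ.* e → q^ k ≈ up (q^ e)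
  q≈up e ≡.refl = sym (up-q e)

  w-explicit : ∀ k → w k ≈ sg k * q^ (k ℕ.* k ℕ.+ k)
  w-explicit = θ-explicit (λ k → k ℕ.* k ℕ.+ k) ≡.refl e
    where
    e : ∀ k → (1 ℕ.+ k) ℕ.* (1 ℕ.+ k) ℕ.+ (1 ℕ.+ k) ≡ (2 ℕ.* k ℕ.+ 2) ℕ.+ (k ℕ.* k ℕ.+ k)
    e = solve-∀

  w≈ : ∀ k s l j e → sg k ≈ s * sg l → k ℕ.* k ℕ.+ k ≡ j ℕ.+ 3 ℕ.* e → w k ≈ s * (q^ j * up (sg l * q^ e))
  w≈ k s l j e h eq = trans (w-explicit k) (trans (*-cong h (q-split j (3 ℕ.* e) eq))
    (trans (solve 4 (λ s g a b → (s :* g) :* (a :* b) := s :* (a :* (g :* b))) refl _ _ _ _) (*-congˡ (*-congˡ (sym (up-sg-q l e))))))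

  private
    sg₀ : ∀ l → sg (l ℕ.* 3) ≈ 1ₛ * sg l
    sg₀ l = trans (sg-3 l) (sym (*-identityˡ _))
    sg₁ : ∀ l → sg (1 ℕ.+ l ℕ.* 3) ≈ - 1ₛ * sg l
    sg₁ l = trans (-‿cong (sg-3 l)) (solve 1 (λ x → :- x := (:- :1) :* x) refl _)
    sg₂ : ∀ l → sg (2 ℕ.+ l ℕ.* 3) ≈ 1ₛ * sg l
    sg₂ l = trans (-‿involutive _) (sg₀ l)

    sq₀ : ∀ l → (l ℕ.* 3) ℕ.* (l ℕ.* 3) ℕ.+ l ℕ.* 3 ≡ 0 ℕ.+ 3 ℕ.* (3 ℕ.* l ℕ.* l ℕ.+ l)
    sq₀ = solve-∀
    sq₁ : ∀ l → (1 ℕ.+ l ℕ.* 3) ℕ.* (1 ℕ.+ l ℕ.* 3) ℕ.+ (1 ℕ.+ l ℕ.* 3) ≡ 2 ℕ.+ 3 ℕ.* (3 ℕ.* (l ℕ.* l ℕ.+ l))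
    sq₁ = solve-∀
    sq₂ : ∀ l → (2 ℕ.+ l ℕ.* 3) ℕ.* (2 ℕ.+ l ℕ.* 3) ℕ.+ (2 ℕ.+ l ℕ.* 3) ≡ 0 ℕ.+ 3 ℕ.* (3 ℕ.* l ℕ.* l ℕ.+ 5 ℕ.* l ℕ.+ 2)
    sq₂ = solve-∀

    w₀ : ∀ l → w (l ℕ.* 3) ≈ up (sg l * q^ (3 ℕ.* l ℕ.* l ℕ.+ l))
    w₀ l = trans (w≈ (l ℕ.* 3) 1ₛ l 0 (3 ℕ.* l ℕ.* l ℕ.+ l) (sg₀ l) (sq₀ l)) (trans (*-identityˡ _) (trans (*-congʳ q-0) (*-identityˡ _)))
    w₂ : ∀ l → w (2 ℕ.+ l ℕ.* 3) ≈ up (sg l * q^ (3 ℕ.* l ℕ.* l ℕ.+ 5 ℕ.* l ℕ.+ 2))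
    w₂ l = trans (w≈ (2 ℕ.+ l ℕ.* 3) 1ₛ l 0 (3 ℕ.* l ℕ.* l ℕ.+ 5 ℕ.* l ℕ.+ 2) (sg₂ l) (sq₂ l)) (trans (*-identityˡ _) (trans (*-congʳ q-0) (*-identityˡ _)))

  T-comps : ∀ l → Comps (T l) (T₄₂.η l) 0ₛ 0ₛ
  T-comps l = Comps-≈ (trans (trans (+-cong (w₀ l) (-‿cong (w₂ l))) (trans (+-congˡ (sym (up-⊟ _))) (trans (sym (up-⊞ _ _)) (up-cong (+-cong (sym θ₄) θ₂)))))
    (trans (solve 3 (λ a q r → a := a :+ q :* :0 :+ r :* :0) refl _ (q^ 1) (q^ 2)) (sym (+-cong (+-congˡ (*-congˡ up-0ₛ)) (*-congˡ up-0ₛ)))))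
    where
    θ₄ : θ 6 4 l ≈ sg l * q^ (3 ℕ.* l ℕ.* l ℕ.+ l)
    θ₄ = θ-explicit (λ l → 3 ℕ.* l ℕ.* l ℕ.+ l) ≡.refl e l
      where
      e : ∀ a → 3 ℕ.* (1 ℕ.+ a) ℕ.* (1 ℕ.+ a) ℕ.+ (1 ℕ.+ a) ≡ (6 ℕ.* a ℕ.+ 4) ℕ.+ (3 ℕ.* a ℕ.* a ℕ.+ a)
      e = solve-∀
    exp₂ : ∀ a → θ-exponent 6 2 (suc a) ≡ 3 ℕ.* a ℕ.* a ℕ.+ 5 ℕ.* a ℕ.+ 2
    exp₂ zero    = ≡.refl
    exp₂ (suc a) = ≡.trans (≡.cong (6 ℕ.* suc a ℕ.+ 2 ℕ.+_) (exp₂ a)) (e a)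
      where
      e : ∀ a → 6 ℕ.* (1 ℕ.+ a) ℕ.+ 2 ℕ.+ (3 ℕ.* a ℕ.* a ℕ.+ 5 ℕ.* a ℕ.+ 2) ≡ 3 ℕ.* (1 ℕ.+ a) ℕ.* (1 ℕ.+ a) ℕ.+ 5 ℕ.* (1 ℕ.+ a) ℕ.+ 2
      e = solve-∀
    θ₂ : - (sg l * q^ (3 ℕ.* l ℕ.* l ℕ.+ 5 ℕ.* l ℕ.+ 2)) ≈ θ 6 2 (suc l)
    θ₂ = sym (trans (θ-explicit (θ-exponent 6 2) ≡.refl (λ _ → ≡.refl) (suc l)) (trans (*-congˡ (q-cong (exp₂ l)))
      (solve 2 (λ s x → (:- s) :* x := :- (s :* x)) refl _ _)))

  -- The exponents of w_(3a) and w_(3a+2) are divisible by 3 and give Euler's pentagonal series.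
  -- Being a series in q³, the prefactor passes through `comp 2`.
  T-sum : Σ∞ T ≈ up (Jm 2)
  T-sum = trans (from-Comps (comps
      (trans (comp-Σ∞ (s≤s z≤n) T-vanishing T₄₂.η-vanishing (λ l → Comps.c₀ (T-comps l))) T₄₂-product)
      (trans (comp-Σ∞ (s≤s (s≤s z≤n)) {T} {λ _ → 0ₛ} T-vanishing (λ k → Mod.refl k) (λ l → Comps.c₁ (T-comps l))) (Σ∞-0 (λ _ → refl)))
      (trans (comp-Σ∞ (s≤s (s≤s (s≤s z≤n))) {T} {λ _ → 0ₛ} T-vanishing (λ k → Mod.refl k) (λ l → Comps.c₂ (T-comps l))) (Σ∞-0 (λ _ → refl)))))
    (trans (+-cong (+-congˡ (*-congˡ up-0ₛ)) (*-congˡ up-0ₛ)) (solve 3 (λ a q r → a :+ q :* :0 :+ r :* :0 := a) refl _ (q^ 1) (q^ 2)))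

  comp-T : ∀ R → comp 2 (Σ∞ T * R) ≈ Jm 2 * comp 2 R
  comp-T R = trans (comp-cong∞ (*-congʳ T-sum)) (pointwise (comp-up-⊠ third₂ (Jm 2) R))

  ωS : ℕ → PS
  ωS l = θ 6 6 l ⊠ K∞.ωKernel l

  private
    θ66 : ∀ l → θ 6 6 l ≈ sg l * q^ (3 ℕ.* (l ℕ.* l ℕ.+ l))
    θ66 = θ-explicit (λ r → 3 ℕ.* (r ℕ.* r ℕ.+ r)) ≡.refl e
      where
      e : ∀ r → 3 ℕ.* ((1 ℕ.+ r) ℕ.* (1 ℕ.+ r) ℕ.+ (1 ℕ.+ r)) ≡ (6 ℕ.* r ℕ.+ 6) ℕ.+ 3 ℕ.* (r ℕ.* r ℕ.+ r)
      e = solve-∀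

    pure₂ : ∀ {f z} → f ≈ q^ 2 * up z → comp 2 f ≈ z
    pure₂ {f} {z} e = Comps.c₂ (Comps-≈ {f} {0ₛ} {0ₛ} {z} (trans e (trans (solve 2 (λ q x → x := :0 :+ q :* :0 :+ x) refl (q^ 1) _)
      (+-congʳ (sym (+-cong up-0ₛ (*-congˡ up-0ₛ)))))))

  -- For k = 3l + 1 both k² + k - 2 and 2k + 1 are divisible by 3, so `s₁ l` lies entirely in
  -- residue 2 and is -q² times a term of the ω series in q³.
  comp-s₁ : ∀ l → comp 2 (s₁ l) ≈ - ωS l
  comp-s₁ l = pure₂ (begin
    w (1 ℕ.+ l ℕ.* 3) * ((1ₛ + q^ k) * inv (1ₛ + - q^ k))
      ≈⟨ *-cong (w≈ (1 ℕ.+ l ℕ.* 3) (- 1ₛ) l 2 (3 ℕ.* (l ℕ.* l ℕ.+ l)) (sg₁ l) (sq₁ l)) (*-cong (+-cong (sym up-1ₛ) (q≈up (1 ℕ.+ 2 ℕ.* l) (e l))) (inv-1-q (2 ℕ.* l) (e l))) ⟩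
    (- 1ₛ * (q^ 2 * up (sg l * q^ (3 ℕ.* (l ℕ.* l ℕ.+ l))))) * ((up 1ₛ + up (q^ (1 ℕ.+ 2 ℕ.* l))) * up (inv (1ₛ + - q^ (1 ℕ.+ 2 ℕ.* l))))
      ≈⟨ *-cong (*-congˡ (*-congˡ (up-cong (sym (θ66 l))))) (trans (*-congʳ (sym (up-⊞ _ _))) (sym (up-⊠ _ _))) ⟩
    (- 1ₛ * (q^ 2 * up (θ 6 6 l))) * up (K∞.ωKernel l)
      ≈⟨ solve 3 (λ q a b → ((:- :1) :* (q :* a)) :* b := q :* (:- (a :* b))) refl _ _ _ ⟩
    q^ 2 * - (up (θ 6 6 l) * up (K∞.ωKernel l))
      ≈⟨ *-congˡ (trans (-‿cong (sym (up-⊠ _ _))) (sym (up-⊟ _))) ⟩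
    q^ 2 * up (- ωS l) ∎)
    where
    k = 1 ℕ.+ 2 ℕ.* (1 ℕ.+ l ℕ.* 3)
    e : ∀ l → 1 ℕ.+ 2 ℕ.* (1 ℕ.+ l ℕ.* 3) ≡ 3 ℕ.* (1 ℕ.+ 2 ℕ.* l)
    e = solve-∀

  -- (1 + v)/(1 − v) = (1 + 2v + 2v² + v³)/(1 − v³) separates the residues mod 3 of the exponents
  kernel-3 : ∀ r → K∞.ωKernel r ≈ (1ₛ + (K∞.u r + K∞.u r) + (K∞.u r * K∞.u r + K∞.u r * K∞.u r) + q^ (3 ℕ.+ 6 ℕ.* r)) * K∞.1/1-u³ r
  kernel-3 r = trans (*-congˡ (K∞.1/1-u≈ r)) (trans
    (solve 2 (λ v w → (:1 :+ v) :* ((:1 :+ v :+ v :* v) :* w) := (:1 :+ (v :+ v) :+ (v :* v :+ v :* v) :+ v :* (v :* v)) :* w) refl (K∞.u r) _)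
    (*-congʳ (+-congˡ (sym (K∞.u³ r)))))

  private
    twice : PS → PS
    twice x = x + x

    collect₁ : ∀ X y y′ z W → up X * ((1ₛ + (q^ 1 * up y + q^ 1 * up y) + (q^ 2 * up y′ + q^ 2 * up y′) + up z) * up W)
                      ≈ triple ((X + X * z) * W) (twice (X * y * W)) (twice (X * y′ * W))
    collect₁ X y y′ z W = trans
      (solve 7 (λ X y y′ z W q r → X :* ((:1 :+ (q :* y :+ q :* y) :+ (r :* y′ :+ r :* y′) :+ z) :* W)
        := (X :+ X :* z) :* W :+ q :* (X :* y :* W :+ X :* y :* W) :+ r :* (X :* y′ :* W :+ X :* y′ :* W)) refl (up X) (up y) (up y′) (up z) (up W) (q^ 1) (q^ 2))
      (sym (+-cong (+-cong (trans (up-⊠ _ _) (*-congʳ (trans (up-⊞ _ _) (+-congˡ (up-⊠ _ _)))))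
        (*-congˡ (twice-up y))) (*-congˡ (twice-up y′))))
      where
      twice-up : ∀ y → up (twice (X * y * W)) ≈ up X * up y * up W + up X * up y * up W
      twice-up y = trans (up-⊞ _ _) (+-cong one one)
        where
        one : up (X * y * W) ≈ up X * up y * up W
        one = trans (up-⊠ _ _) (*-congʳ (up-⊠ _ _))

  -- Here u = q^(6l+1), so in `kernel-3` only the term 2u² has exponent 2 mod 3.
  comp-s₀ : ∀ l → comp 2 (s₀ l) ≈ a l + a l
  comp-s₀ l = trans (Comps.c₂ (Comps-≈ (trans (*-cong (w₀ l) (trans (kernel-3 (l ℕ.* 3))
      (*-cong (+-cong (+-cong (+-congˡ (+-cong v v)) (+-cong v² v²)) (q≈up (1 ℕ.+ 6 ℕ.* l) (k₃ l))) (inv-1-q (6 ℕ.* l) (k₃ l)))))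
      (collect₁ _ _ _ _ _)))) (+-cong fin-a fin-a)
    where
    k₁ : ∀ l → 1 ℕ.+ 2 ℕ.* (l ℕ.* 3) ≡ 1 ℕ.+ 3 ℕ.* (2 ℕ.* l)
    k₁ = solve-∀
    k₂ : ∀ l → (1 ℕ.+ 2 ℕ.* (l ℕ.* 3)) ℕ.+ (1 ℕ.+ 2 ℕ.* (l ℕ.* 3)) ≡ 2 ℕ.+ 3 ℕ.* (4 ℕ.* l)
    k₂ = solve-∀
    k₃ : ∀ l → 3 ℕ.+ 6 ℕ.* (l ℕ.* 3) ≡ 3 ℕ.* (1 ℕ.+ 6 ℕ.* l)
    k₃ = solve-∀
    v : K∞.u (l ℕ.* 3) ≈ q^ 1 * up (q^ (2 ℕ.* l))
    v = trans (q-split 1 _ (k₁ l)) (*-congˡ (sym (up-q _)))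
    v² : K∞.u (l ℕ.* 3) * K∞.u (l ℕ.* 3) ≈ q^ 2 * up (q^ (4 ℕ.* l))
    v² = trans (sym (q-+ _ _)) (trans (q-split 2 _ (k₂ l)) (*-congˡ (sym (up-q _))))
    k₄ : ∀ l → 3 ℕ.* l ℕ.* l ℕ.+ 5 ℕ.* l ≡ (3 ℕ.* l ℕ.* l ℕ.+ l) ℕ.+ 4 ℕ.* l
    k₄ = solve-∀
    fin-a : sg l * q^ (3 ℕ.* l ℕ.* l ℕ.+ l) * q^ (4 ℕ.* l) * inv (1ₛ + - q^ suc (6 ℕ.* l)) ≈ a l
    fin-a = trans (solve 4 (λ s x y i → s :* x :* y :* i := s :* ((x :* y) :* i)) refl _ _ _ _) (*-congˡ (*-congʳ (sym (q-split _ _ (k₄ l)))))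

  -- Here u = q^(6l+5), so the term 2u is selected and 2u² falls into residue 1; the two are swapped
  -- before `collect₁` applies.
  comp-s₂ : ∀ l → comp 2 (s₂ l) ≈ b l + b l
  comp-s₂ l = trans (Comps.c₂ (Comps-≈ (trans (*-cong (w₂ l) (trans (kernel-3 (2 ℕ.+ l ℕ.* 3))
      (*-cong (+-cong (trans (+-cong (+-congˡ (+-cong v v)) (+-cong v² v²)) (solve 3 (λ o x y → o :+ (x :+ x) :+ (y :+ y) := o :+ (y :+ y) :+ (x :+ x)) refl _ _ _))
         (q≈up (5 ℕ.+ 6 ℕ.* l) (k₃ l))) (inv-1-q (4 ℕ.+ 6 ℕ.* l) (k₃ l)))))
      (collect₁ _ _ _ _ _)))) (+-cong fin-b fin-b)
    where
    k₁ : ∀ l → 1 ℕ.+ 2 ℕ.* (2 ℕ.+ l ℕ.* 3) ≡ 2 ℕ.+ 3 ℕ.* (1 ℕ.+ 2 ℕ.* l)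
    k₁ = solve-∀
    k₂ : ∀ l → (1 ℕ.+ 2 ℕ.* (2 ℕ.+ l ℕ.* 3)) ℕ.+ (1 ℕ.+ 2 ℕ.* (2 ℕ.+ l ℕ.* 3)) ≡ 1 ℕ.+ 3 ℕ.* (3 ℕ.+ 4 ℕ.* l)
    k₂ = solve-∀
    k₃ : ∀ l → 3 ℕ.+ 6 ℕ.* (2 ℕ.+ l ℕ.* 3) ≡ 3 ℕ.* (5 ℕ.+ 6 ℕ.* l)
    k₃ = solve-∀
    v : K∞.u (2 ℕ.+ l ℕ.* 3) ≈ q^ 2 * up (q^ (1 ℕ.+ 2 ℕ.* l))
    v = trans (q-split 2 _ (k₁ l)) (*-congˡ (sym (up-q _)))
    v² : K∞.u (2 ℕ.+ l ℕ.* 3) * K∞.u (2 ℕ.+ l ℕ.* 3) ≈ q^ 1 * up (q^ (3 ℕ.+ 4 ℕ.* l))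
    v² = trans (sym (q-+ _ _)) (trans (q-split 1 _ (k₂ l)) (*-congˡ (sym (up-q _))))
    k₄ : ∀ l → 3 ℕ.* l ℕ.* l ℕ.+ 7 ℕ.* l ℕ.+ 3 ≡ (3 ℕ.* l ℕ.* l ℕ.+ 5 ℕ.* l ℕ.+ 2) ℕ.+ (1 ℕ.+ 2 ℕ.* l)
    k₄ = solve-∀
    fin-b : sg l * q^ (3 ℕ.* l ℕ.* l ℕ.+ 5 ℕ.* l ℕ.+ 2) * q^ (1 ℕ.+ 2 ℕ.* l) * inv (1ₛ + - q^ suc (4 ℕ.+ 6 ℕ.* l)) ≈ b l
    fin-b = trans (solve 4 (λ s x y i → s :* x :* y :* i := s :* ((x :* y) :* i)) refl _ _ _ _) (*-congˡ (*-congʳ (sym (q-split _ _ (k₄ l)))))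

  private
    ωS-vanishing : Vanishing ωS
    ωS-vanishing = Vanishing-*ʳ K∞.ωKernel (θ-vanish 6 (s≤s z≤n))

    double-vanishing : ∀ {F} → Vanishing F → Vanishing (λ k → F k ⊞ F k)
    double-vanishing v k = K.trans (K.+-cong (v k) (v k)) (K.+-identityˡ _)
      where module K = Mod k

    2<3 : 2 < 3
    2<3 = s≤s (s≤s (s≤s z≤n))

    comp-⊞≈ : ∀ f g → comp 2 (f ⊞ g) ≈ comp 2 f + comp 2 g
    comp-⊞≈ f g = pointwise (comp-⊞ 2 f g)

    comp-⊟≈ : ∀ f → comp 2 (⊟ f) ≈ - comp 2 f
    comp-⊟≈ f = pointwise (comp-⊟ 2 f)

    r : ℕ → PS
    r s = comp 2 (rb s)

  omega-relation : r 3 + - r 1 ≈ - (omega + omega)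
  omega-relation = cancel-unit (Jm 2) (pochInf-unit 1 2) (begin
    Jm 2 * (r 3 + - r 1)
      ≈⟨ *-congˡ (sym (trans (comp-⊞≈ _ _) (+-congˡ (comp-⊟≈ _)))) ⟩
    Jm 2 * comp 2 (rb 3 ⊞ ⊟ rb 1)
      ≈⟨ sym (comp-T _) ⟩
    comp 2 (Σ∞ T * (rb 3 ⊞ ⊟ rb 1))
      ≈⟨ trans (comp-cong∞ rank-1-3) (trans (comp-⊞≈ _ _) (+-cong e e)) ⟩
    - (omega * Jm 2) + - (omega * Jm 2)
      ≈⟨ solve 2 (λ o j → :- (o :* j) :+ :- (o :* j) := j :* (:- (o :+ o))) refl _ _ ⟩
    Jm 2 * - (omega + omega) ∎)
    where
    e : comp 2 (Σ∞ s₁) ≈ - (omega * Jm 2)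
    e = trans (comp-Σ∞ 2<3 s₁-vanishing (λ k → let module K = Mod k in K.trans (K.-‿cong (ωS-vanishing k)) K.-0#≈0#) comp-s₁)
      (trans (Σ∞-⊟ ωS-vanishing) (-‿cong (sym omega-lambert)))

  rho-relation : (1ₛ + 1ₛ + 1ₛ) * (r 0 + r 1 + - r 2 + - r 3) ≈ rho + rho + (omega + omega + omega + omega)
  rho-relation = cancel-unit (Jm 2) (pochInf-unit 1 2) (begin
    Jm 2 * ((1ₛ + 1ₛ + 1ₛ) * (r 0 + r 1 + - r 2 + - r 3))
      ≈⟨ solve 3 (λ j t x → j :* (t :* x) := t :* (j :* x)) refl _ _ _ ⟩
    (1ₛ + 1ₛ + 1ₛ) * (Jm 2 * (r 0 + r 1 + - r 2 + - r 3))
      ≈⟨ *-congˡ (*-congˡ (sym (trans (comp-⊞≈ _ _) (+-cong (trans (comp-⊞≈ _ _) (+-cong (comp-⊞≈ _ _) (comp-⊟≈ _))) (comp-⊟≈ _))))) ⟩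
    (1ₛ + 1ₛ + 1ₛ) * (Jm 2 * comp 2 (rb 0 ⊞ rb 1 ⊞ ⊟ rb 2 ⊞ ⊟ rb 3))
      ≈⟨ *-congˡ (trans (sym (comp-T _)) (trans (comp-cong∞ rank-0123) (trans (comp-⊞≈ _ _) (+-cong e₀ e₂′)))) ⟩
    (1ₛ + 1ₛ + 1ₛ) * ((Σ∞ a + Σ∞ a) + (Σ∞ b + Σ∞ b))
      ≈⟨ solve 2 (λ a b → (:1 :+ :1 :+ :1) :* ((a :+ a) :+ (b :+ b)) := (:1 :+ :1) :* ((:1 :+ :1 :+ :1) :* (a :+ b))) refl _ _ ⟩
    (1ₛ + 1ₛ) * ((1ₛ + 1ₛ + 1ₛ) * (Σ∞ a + Σ∞ b))
      ≈⟨ *-congˡ (limit combine) ⟩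
    (1ₛ + 1ₛ) * (rho * Jm 2 + (omega * Jm 2 + omega * Jm 2))
      ≈⟨ solve 3 (λ p o j → (:1 :+ :1) :* (p :* j :+ (o :* j :+ o :* j)) := j :* (p :+ p :+ (o :+ o :+ o :+ o))) refl _ _ _ ⟩
    Jm 2 * (rho + rho + (omega + omega + omega + omega)) ∎)
    where
    e₀ : comp 2 (Σ∞ s₀) ≈ Σ∞ a + Σ∞ a
    e₀ = trans (comp-Σ∞ 2<3 s₀-vanishing (double-vanishing a-vanishing) comp-s₀) (Σ∞-⊞ a-vanishing a-vanishing)
    e₂′ : comp 2 (Σ∞ s₂) ≈ Σ∞ b + Σ∞ b
    e₂′ = trans (comp-Σ∞ 2<3 s₂-vanishing (double-vanishing b-vanishing) comp-s₂) (Σ∞-⊞ b-vanishing b-vanishing)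
    combine : ∀ N → (1ₛ ⊞ 1ₛ ⊞ 1ₛ) ⊠ (Σ∞ a ⊞ Σ∞ b) ≈[ fin N ] rho ⊠ Jm 2 ⊞ (omega ⊠ Jm 2 ⊞ omega ⊠ Jm 2)
    combine N = K.trans (K.*-congˡ (K.trans (K.+-cong (Σ∞≈∑ N N ℕₚ.≤-refl a-vanishing) (Σ∞≈∑ N N ℕₚ.≤-refl b-vanishing)) (kernel-sum N)))
      (K.trans (K.sym (K.∑-*ˡ N _ _)) (K.trans (K.∑-cong′ N termwise) (K.trans (K.∑-+ N _ _) (K.+-cong
        (K.sym (K.trans (rho-lambert-mod N) (Σ∞≈∑ N N ℕₚ.≤-refl (Vanishing-*ʳ L.ρKernel (θ-vanish 6 (s≤s z≤n))))))
        (K.trans (K.∑-+ N _ _) (K.+-cong om om))))))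
      where
      module K = Mod N
      module L = LambertKernels (fin N)
      om : K.∑ N (λ l → θ 6 6 l ⊠ L.ωKernel l) K.≈ omega ⊠ Jm 2
      om = K.sym (K.trans (omega-lambert-mod N) (Σ∞≈∑ N N ℕₚ.≤-refl (Vanishing-*ʳ L.ωKernel (θ-vanish 6 (s≤s z≤n)))))
      -- The ω kernel over the denominator 1 - u³ has numerator (1 + u)(1 + u + u²); twice that plus
      -- the ρ numerator is 3(1 + u + u² + u³). This is why the relation carries a factor 3.
      termwise : ∀ l → (1ₛ ⊞ 1ₛ ⊞ 1ₛ) ⊠ (θ 6 6 l ⊠ ((1ₛ ⊞ L.u l ⊞ L.u l ⊠ L.u l ⊞ L.u l ⊠ (L.u l ⊠ L.u l)) ⊠ L.1/1-u³ l))
                 K.≈ θ 6 6 l ⊠ L.ρKernel l ⊞ (θ 6 6 l ⊠ L.ωKernel l ⊞ θ 6 6 l ⊠ L.ωKernel l)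
      termwise l = K.trans
        (K.solve 3 (λ t v w → (K.:1 K.:+ K.:1 K.:+ K.:1) K.:* (t K.:* ((K.:1 K.:+ v K.:+ v K.:* v K.:+ v K.:* (v K.:* v)) K.:* w))
          K.:= t K.:* ((K.:1 K.:+ K.:- v K.:+ K.:- (v K.:* v) K.:+ v K.:* (v K.:* v)) K.:* w)
            K.:+ (t K.:* ((K.:1 K.:+ v) K.:* ((K.:1 K.:+ v K.:+ v K.:* v) K.:* w)) K.:+ t K.:* ((K.:1 K.:+ v) K.:* ((K.:1 K.:+ v K.:+ v K.:* v) K.:* w))))
          K.refl (θ 6 6 l) (L.u l) (L.1/1-u³ l))
        (K.+-congˡ (K.+-cong k k))
        where
        k = K.*-congˡ {x = θ 6 6 l} (K.*-congˡ {x = 1ₛ ⊞ L.u l} (K.sym (L.1/1-u≈ l)))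

  total-relation : r 0 + r 1 + r 1 + r 2 + r 2 + r 3 ≈ M-quotient + M-quotient + M-quotient + M-quotient
  total-relation = trans (sym (trans (comp-cong∞ rb-total) (trans (comp-⊞≈ _ _) (+-congʳ (trans (comp-⊞≈ _ _) (+-congʳ (trans (comp-⊞≈ _ _)
    (+-congʳ (trans (comp-⊞≈ _ _) (+-congʳ (comp-⊞≈ _ _)))))))))) ) P̄₂≈M

  module _ (n : ℕ) where
    private
      R : ℕ → ℚ
      R s = rbar s 2 n

      R≡ : ∀ s → r s n ≡ R s
      R≡ s = ≡.sym (comp-at 2 (rb s) n)

      plus : ∀ {f g x y} → f n ≡ x → g n ≡ y → (f ⊞ g) n ≡ x ℚ.+ y
      plus {f} {g} e e′ = ≡.trans (⊞-at f g n) (≡.cong₂ ℚ._+_ e e′)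

      minus : ∀ {f x} → f n ≡ x → (⊟ f) n ≡ ℚ.- x
      minus {f} e = ≡.trans (⊟-at f n) (≡.cong ℚ.-_ e)

      o p y : ℚ
      o = omega n
      p = rho n
      y = M-quotient n

      rel₁ : R 3 ℚ.+ ℚ.- R 1 ≡ ℚ.- (o ℚ.+ o)
      rel₁ = ≡.trans (≡.sym (plus (R≡ 3) (minus (R≡ 1)))) (≡.trans (at omega-relation n tt) (minus (plus ≡.refl ≡.refl)))

      X = R 0 ℚ.+ R 1 ℚ.+ ℚ.- R 2 ℚ.+ ℚ.- R 3

      rel₂ : X ℚ.+ X ℚ.+ X ≡ p ℚ.+ p ℚ.+ (o ℚ.+ o ℚ.+ o ℚ.+ o)
      rel₂ = ≡.trans (≡.sym (plus (plus x x) x)) (≡.trans (at (trans (solve 1 (λ x → x :+ x :+ x := (:1 :+ :1 :+ :1) :* x) refl _) rho-relation) n tt)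
        (plus (plus ≡.refl ≡.refl) (plus (plus (plus ≡.refl ≡.refl) ≡.refl) ≡.refl)))
        where
        x = plus (plus (plus (R≡ 0) (R≡ 1)) (minus (R≡ 2))) (minus (R≡ 3))

      rel₃ : R 0 ℚ.+ R 1 ℚ.+ R 1 ℚ.+ R 2 ℚ.+ R 2 ℚ.+ R 3 ≡ y ℚ.+ y ℚ.+ y ℚ.+ y
      rel₃ = ≡.trans (≡.sym (plus (plus (plus (plus (plus (R≡ 0) (R≡ 1)) (R≡ 1)) (R≡ 2)) (R≡ 2)) (R≡ 3)))
        (≡.trans (at total-relation n tt) (plus (plus (plus ≡.refl ≡.refl) ≡.refl) ≡.refl))

      open ℚS.+-*-Solver using () renaming (solve to solveℚ; _:+_ to _⊕ᵖ_; _:*_ to _⊗ᵖ_; :-_ to ⊝ᵖ_; _:=_ to _≐_; con to conᵖ)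

      vanish : ∀ {x y} → x ≡ y → x ℚ.+ ℚ.- y ≡ 0ℚ
      vanish {x} ≡.refl = ℚₚ.+-inverseʳ x

      absorb : ∀ t c₁ c₂ c₃ {x y z} → x ≡ 0ℚ → y ≡ 0ℚ → z ≡ 0ℚ → t ℚ.+ c₁ ℚ.* x ℚ.+ c₂ ℚ.* y ℚ.+ c₃ ℚ.* z ≡ t
      absorb t c₁ c₂ c₃ ≡.refl ≡.refl ≡.refl = solveℚ 4 (λ t c₁ c₂ c₃ → t ⊕ᵖ c₁ ⊗ᵖ conᵖ 0ℚ ⊕ᵖ c₂ ⊗ᵖ conᵖ 0ℚ ⊕ᵖ c₃ ⊗ᵖ conᵖ 0ℚ ≐ t) ≡.refl t c₁ c₂ c₃

    first : (rbar 0 2 ⊕ rbar 3 2) n ≡ ((+ 4 / 9) · rho ⊕ (-[1+ 15 ] / 9) · omega ⊕ Mq) n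
    first = ≡.trans (combination (R 0) (R 1) (R 2) (R 3) p o y)
      -- With X = R 0 + R 1 - R 2 - R 3, the coefficients solve R 0 + R 3 = 1/3 (R 0 + 2 R 1 + 2 R 2
      -- + R 3) + 2/9 (3X) + 4/3 (R 3 - R 1); in them -16/9 = 8/9 - 8/3.
      (absorb ((+ 4 / 9) ℚ.* p ℚ.+ (-[1+ 15 ] / 9) ℚ.* o ℚ.+ (+ 4 / 3) ℚ.* y) (+ 1 / 3) (+ 2 / 9) (+ 4 / 3) (vanish rel₃) (vanish rel₂) (vanish rel₁))
      where
      combination : ∀ r0 r1 r2 r3 p o y → let X = r0 ℚ.+ r1 ℚ.+ ℚ.- r2 ℚ.+ ℚ.- r3 in
        r0 ℚ.+ r3 ≡ ((+ 4 / 9) ℚ.* p ℚ.+ (-[1+ 15 ] / 9) ℚ.* o ℚ.+ (+ 4 / 3) ℚ.* y)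
          ℚ.+ (+ 1 / 3) ℚ.* (r0 ℚ.+ r1 ℚ.+ r1 ℚ.+ r2 ℚ.+ r2 ℚ.+ r3 ℚ.+ ℚ.- (y ℚ.+ y ℚ.+ y ℚ.+ y))
          ℚ.+ (+ 2 / 9) ℚ.* (X ℚ.+ X ℚ.+ X ℚ.+ ℚ.- (p ℚ.+ p ℚ.+ (o ℚ.+ o ℚ.+ o ℚ.+ o)))
          ℚ.+ (+ 4 / 3) ℚ.* (r3 ℚ.+ ℚ.- r1 ℚ.+ ℚ.- (ℚ.- (o ℚ.+ o)))
      combination = solveℚ 7 (λ r0 r1 r2 r3 p o y → let X = r0 ⊕ᵖ r1 ⊕ᵖ ⊝ᵖ r2 ⊕ᵖ ⊝ᵖ r3 in
        r0 ⊕ᵖ r3 ≐ (conᵖ (+ 4 / 9) ⊗ᵖ p ⊕ᵖ conᵖ (-[1+ 15 ] / 9) ⊗ᵖ o ⊕ᵖ conᵖ (+ 4 / 3) ⊗ᵖ y)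
          ⊕ᵖ conᵖ (+ 1 / 3) ⊗ᵖ (r0 ⊕ᵖ r1 ⊕ᵖ r1 ⊕ᵖ r2 ⊕ᵖ r2 ⊕ᵖ r3 ⊕ᵖ ⊝ᵖ (y ⊕ᵖ y ⊕ᵖ y ⊕ᵖ y))
          ⊕ᵖ conᵖ (+ 2 / 9) ⊗ᵖ (X ⊕ᵖ X ⊕ᵖ X ⊕ᵖ ⊝ᵖ (p ⊕ᵖ p ⊕ᵖ (o ⊕ᵖ o ⊕ᵖ o ⊕ᵖ o)))
          ⊕ᵖ conᵖ (+ 4 / 3) ⊗ᵖ (r3 ⊕ᵖ ⊝ᵖ r1 ⊕ᵖ ⊝ᵖ (⊝ᵖ (o ⊕ᵖ o)))) ≡.refl

    second : (rbar 1 2 ⊖ rbar 3 2) n ≡ ((+ 2 / 1) · omega) n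
    second = ≡.trans (combination (R 1) (R 3) o) (≡.trans (≡.cong (λ t → (+ 2 / 1) ℚ.* o ℚ.+ ℚ.- t) (vanish rel₁)) (ℚₚ.+-identityʳ _))
      where
      combination : ∀ r1 r3 o → r1 ℚ.+ ℚ.- r3 ≡ (+ 2 / 1) ℚ.* o ℚ.+ ℚ.- (r3 ℚ.+ ℚ.- r1 ℚ.+ ℚ.- (ℚ.- (o ℚ.+ o)))
      combination = solveℚ 3 (λ r1 r3 o → r1 ⊕ᵖ ⊝ᵖ r3 ≐ conᵖ (+ 2 / 1) ⊗ᵖ o ⊕ᵖ ⊝ᵖ (r3 ⊕ᵖ ⊝ᵖ r1 ⊕ᵖ ⊝ᵖ (⊝ᵖ (o ⊕ᵖ o)))) ≡.refl

    third : (rbar 2 2 ⊕ rbar 3 2) n ≡ ((-[1+ 1 ] / 9) · rho ⊕ (-[1+ 9 ] / 9) · omega ⊕ Mq) n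
    third = ≡.trans (combination (R 0) (R 1) (R 2) (R 3) p o y)
      -- The same system solved for R 2 + R 3 gives the coefficients 1/3, -1/9, 1/3; in them -10/9 =
      -- -4/9 - 2/3.
      (absorb ((-[1+ 1 ] / 9) ℚ.* p ℚ.+ (-[1+ 9 ] / 9) ℚ.* o ℚ.+ (+ 4 / 3) ℚ.* y) (+ 1 / 3) (-[1+ 0 ] / 9) (+ 1 / 3) (vanish rel₃) (vanish rel₂) (vanish rel₁))
      where
      combination : ∀ r0 r1 r2 r3 p o y → let X = r0 ℚ.+ r1 ℚ.+ ℚ.- r2 ℚ.+ ℚ.- r3 in
        r2 ℚ.+ r3 ≡ ((-[1+ 1 ] / 9) ℚ.* p ℚ.+ (-[1+ 9 ] / 9) ℚ.* o ℚ.+ (+ 4 / 3) ℚ.* y)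
          ℚ.+ (+ 1 / 3) ℚ.* (r0 ℚ.+ r1 ℚ.+ r1 ℚ.+ r2 ℚ.+ r2 ℚ.+ r3 ℚ.+ ℚ.- (y ℚ.+ y ℚ.+ y ℚ.+ y))
          ℚ.+ (-[1+ 0 ] / 9) ℚ.* (X ℚ.+ X ℚ.+ X ℚ.+ ℚ.- (p ℚ.+ p ℚ.+ (o ℚ.+ o ℚ.+ o ℚ.+ o)))
          ℚ.+ (+ 1 / 3) ℚ.* (r3 ℚ.+ ℚ.- r1 ℚ.+ ℚ.- (ℚ.- (o ℚ.+ o)))
      combination = solveℚ 7 (λ r0 r1 r2 r3 p o y → let X = r0 ⊕ᵖ r1 ⊕ᵖ ⊝ᵖ r2 ⊕ᵖ ⊝ᵖ r3 in
        r2 ⊕ᵖ r3 ≐ (conᵖ (-[1+ 1 ] / 9) ⊗ᵖ p ⊕ᵖ conᵖ (-[1+ 9 ] / 9) ⊗ᵖ o ⊕ᵖ conᵖ (+ 4 / 3) ⊗ᵖ y)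
          ⊕ᵖ conᵖ (+ 1 / 3) ⊗ᵖ (r0 ⊕ᵖ r1 ⊕ᵖ r1 ⊕ᵖ r2 ⊕ᵖ r2 ⊕ᵖ r3 ⊕ᵖ ⊝ᵖ (y ⊕ᵖ y ⊕ᵖ y ⊕ᵖ y))
          ⊕ᵖ conᵖ (-[1+ 0 ] / 9) ⊗ᵖ (X ⊕ᵖ X ⊕ᵖ X ⊕ᵖ ⊝ᵖ (p ⊕ᵖ p ⊕ᵖ (o ⊕ᵖ o ⊕ᵖ o ⊕ᵖ o)))
          ⊕ᵖ conᵖ (+ 1 / 3) ⊗ᵖ (r3 ⊕ᵖ ⊝ᵖ r1 ⊕ᵖ ⊝ᵖ (⊝ᵖ (o ⊕ᵖ o)))) ≡.refl

open RankRelations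

theorem1p4 : (n : ℕ) →
    ((rbar 0 2 ⊕ rbar 3 2) n ≡ ((+ 4 / 9) · rho ⊕ (-[1+ 15 ] / 9) · omega ⊕ Mq) n)
    × ((rbar 1 2 ⊖ rbar 3 2) n ≡ ((+ 2 / 1) · omega) n)
    × ((rbar 2 2 ⊕ rbar 3 2) n ≡ ((-[1+ 1 ] / 9) · rho ⊕ (-[1+ 9 ] / 9) · omega ⊕ Mq) n)
theorem1p4 n = first n , second n , third n
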